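{- If $A$ is a purely infinite, simple, unital C*-algebra then $K_1(A)$ is in $A^{\mathrm{eq}}$. In particular, if $A\prec B$ then $K_1(A)$ is an elementary submodel of $K_1(B)$.
   Context: Continuous logic for C*-algebras: a unital C*-algebra $A$ is a metric structure whose sorts are the balls $\{a:\|a\|\le n\}$, $n\in\mathbb N$, with metric $\|x-y\|$, and functions the restrictions of $+,\cdot,{}^*$, scalar multiplications, the constants $0,1$, and inclusions between balls; formulas are built from distances between *-polynomial terms by applying continuous functions $\mathbb R^n\to\mathbb R$ and $\sup_x,\inf_x$ over the sorts; $\varphi^A(\bar a)$ is the value. $A\prec B$ ($A$ is an elementary submodel of $B$) if $A\subseteq B$ and $\varphi^A(\bar a)=\varphi^B(\bar a)$ for all formulas $\varphi$ and $\bar a$ in $A$. A definable predicate relative to a theory is a limit of formulas uniform over all models of the theory; a definable set is a uniform assignment $A\mapsto X(A)$ of closed subsets of a finite product of sorts such that for every formula $\psi(\bar x,\bar y)$, $\sup_{\bar x\in X(A)}\psi$ and $\inf_{\bar x\in X(A)}\psi$ are definable predicates. $A^{\mathrm{eq}}$ is the structure obtained from $A$ by iteratively adding as new (imaginary) sorts: countable products of sorts with their projections; definable sets; and quotients of sorts (or finite products of sorts) by definable pseudometrics (with the quotient maps). A structure is in $A^{\mathrm{eq}}$ if its universe is such a sort and its operations and relations are definable. $A$ is purely infinite and simple if $\dim A>1$ and for all nonzero positive $a,b$ there are $x_n$ with $\|x_nax_n^*-b\|\to0$. $K_1(A)$ is the usual $K_1$-group, considered as a discrete group; "elementary submodel"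 for groups is the usual first-order notion, via the map induced by $A\subseteq B$. -}

module Defs where

open import Algebra.Bundles using (CommutativeRing; Ring; RawGroup)
import Algebra.Properties.Semiring.Exp as Exp
open import Algebra.Module.Structures using (IsLeftModule)
open import Algebra.Morphism.Structures using (module RingMorphisms)
import Algebra.Properties.Ring as RingProperties
import Algebra.Properties.Semiring.Mult as Mult
import Algebra.Properties.Semiring.Sum as SemiringSum
import Algebra.Solver.Ring.NaturalCoefficients.Default as NaturalCoefficients
open import Axiom.ExcludedMiddle using (ExcludedMiddle)
open import Data.Empty using (⊥)
open import Data.Empty.Polymorphic using () renaming (⊥ to ⊥ₚ)
open import Data.Fin.Base using (Fin; zero; suc; splitAt; _↑ˡ_; _↑ʳ_)
open import Data.Fin.Properties using (splitAt-↑ˡ; splitAt-↑ʳ)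
open import Data.List.Base using (List; []; _∷_; _++_; map)
open import Data.List.Membership.Propositional using (_∈_)
open import Data.List.Relation.Unary.All using (All; []; _∷_; lookup)
import Data.List.Relation.Unary.All as All
import Data.List.Relation.Unary.All.Properties as Allₚ
open import Data.Nat.Base as ℕ using (ℕ)
open import Data.Product using (Σ; ∃; ∃₂; _×_; _,_; proj₁; proj₂)
open import Data.Sum.Base using (_⊎_; inj₁; inj₂; [_,_]′)
open import Data.Vec.Functional as Vector using (Vector)
open import Function.Base using (_∘_)
open import Function.Bundles using (_⇔_)
open import Level using (Level; 0ℓ; _⊔_) renaming (suc to lsuc)
open import Relation.Binary.Core using (Rel)
open import Relation.Binary.PropositionalEquality as ≡ using (_≡_; subst)
open import Relation.Binary.Structures using (IsTotalOrder)
open import Relation.Nullary using (¬_; yes; no; contradiction)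

module RingIdentities (R : CommutativeRing 0ℓ 0ℓ) where

  open CommutativeRing R
  open RingProperties ring using (-1*x≈-x; -‿distribˡ-*; -‿distribʳ-*; -‿involutive; -0#≈0#)

  private
    open NaturalCoefficients commutativeSemiring using (solve; _:+_; _:*_; _:=_)

    -- In the next four lemmas n stands for - 1#.
    re-*-assoc′ : ∀ n a b c d e f → (a * c + n * (b * d)) * e + n * ((a * d + b * c) * f) ≈
                                    a * (c * e + n * (d * f)) + n * (b * (c * f + d * e))
    re-*-assoc′ = solve 7 (λ n a b c d e f →
      (a :* c :+ n :* (b :* d)) :* e :+ n :* ((a :* d :+ b :* c) :* f) :=
      a :* (c :* e :+ n :* (d :* f)) :+ n :* (b :* (c :* f :+ d :* e))) refl

    im-*-assoc′ : ∀ n a b c d e f → (a * c + n * (b * d)) * f + (a * d + b * c) * e ≈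
                                    a * (c * f + d * e) + b * (c * e + n * (d * f))
    im-*-assoc′ = solve 7 (λ n a b c d e f →
      (a :* c :+ n :* (b :* d)) :* f :+ (a :* d :+ b :* c) :* e :=
      a :* (c :* f :+ d :* e) :+ b :* (c :* e :+ n :* (d :* f))) refl

    re-distribˡ′ : ∀ n a b c d e f → a * (c + e) + n * (b * (d + f)) ≈
                                     (a * c + n * (b * d)) + (a * e + n * (b * f))
    re-distribˡ′ = solve 7 (λ n a b c d e f →
      a :* (c :+ e) :+ n :* (b :* (d :+ f)) :=
      (a :* c :+ n :* (b :* d)) :+ (a :* e :+ n :* (b :* f))) refl

    re-distribʳ′ : ∀ n a b c d e f → (c + e) * a + n * ((d + f) * b) ≈
                                     (c * a + n * (d * b)) + (e * a + n * (f * b))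
    re-distribʳ′ = solve 7 (λ n a b c d e f →
      (c :+ e) :* a :+ n :* ((d :+ f) :* b) :=
      (c :* a :+ n :* (d :* b)) :+ (e :* a :+ n :* (f :* b))) refl

    im-distribˡ′ : ∀ a b c d e f → a * (d + f) + b * (c + e) ≈ (a * d + b * c) + (a * f + b * e)
    im-distribˡ′ = solve 6 (λ a b c d e f →
      a :* (d :+ f) :+ b :* (c :+ e) :=
      (a :* d :+ b :* c) :+ (a :* f :+ b :* e)) refl

    im-distribʳ′ : ∀ a b c d e f → (c + e) * b + (d + f) * a ≈ (c * b + d * a) + (e * b + f * a)
    im-distribʳ′ = solve 6 (λ a b c d e f →
      (c :+ e) :* b :+ (d :+ f) :* a :=
      (c :* b :+ d :* a) :+ (e :* b :+ f :* a)) refl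

    square-sum′ : ∀ y d → (y + d) * (y + d) ≈ (d * d + (y * d + y * d)) + y * y
    square-sum′ = solve 2 (λ y d →
      (y :+ d) :* (y :+ d) :=
      (d :* d :+ (y :* d :+ y :* d)) :+ y :* y) refl

  private
    n : Carrier
    n = - 1#

    sub : ∀ {a b} → a - b ≈ a + n * b
    sub = +-congˡ (sym (-1*x≈-x _))

  square-neg : ∀ x → (- x) * (- x) ≈ x * x
  square-neg x = trans (sym (-‿distribˡ-* x (- x)))
    (trans (-‿cong (sym (-‿distribʳ-* x x))) (-‿involutive (x * x)))

  square-sum : ∀ y d → (y + d) * (y + d) ≈ (d * d + (y * d + y * d)) + y * y
  square-sum = square-sum′

  re-*-assoc : ∀ a b c d e f → (a * c - b * d) * e - (a * d + b * c) * f ≈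
                               a * (c * e - d * f) - b * (c * f + d * e)
  re-*-assoc a b c d e f = trans (trans sub (+-congʳ (*-congʳ sub)))
    (trans (re-*-assoc′ n a b c d e f) (sym (trans sub (+-congʳ (*-congˡ sub)))))

  im-*-assoc : ∀ a b c d e f → (a * c - b * d) * f + (a * d + b * c) * e ≈
                               a * (c * f + d * e) + b * (c * e - d * f)
  im-*-assoc a b c d e f = trans (+-congʳ (*-congʳ sub))
    (trans (im-*-assoc′ n a b c d e f) (sym (+-congˡ (*-congˡ sub))))

  re-distribˡ : ∀ a b c d e f → a * (c + e) - b * (d + f) ≈ (a * c - b * d) + (a * e - b * f)
  re-distribˡ a b c d e f = trans sub
    (trans (re-distribˡ′ n a b c d e f) (sym (+-cong sub sub)))

  re-distribʳ : ∀ a b c d e f → (c + e) * a - (d + f) * b ≈ (c * a - d * b) + (e * a - f * b)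
  re-distribʳ a b c d e f = trans sub
    (trans (re-distribʳ′ n a b c d e f) (sym (+-cong sub sub)))

  im-distribˡ : ∀ a b c d e f → a * (d + f) + b * (c + e) ≈ (a * d + b * c) + (a * f + b * e)
  im-distribˡ = im-distribˡ′

  im-distribʳ : ∀ a b c d e f → (c + e) * b + (d + f) * a ≈ (c * b + d * a) + (e * b + f * a)
  im-distribʳ = im-distribʳ′

  re-*-comm : ∀ a b c d → a * c - b * d ≈ c * a - d * b
  re-*-comm a b c d = +-cong (*-comm a c) (-‿cong (*-comm b d))

  im-*-comm : ∀ a b c d → a * d + b * c ≈ c * b + d * a
  im-*-comm a b c d = trans (+-comm _ _) (+-cong (*-comm b c) (*-comm a d))

  re-*-identityˡ : ∀ a b → 1# * a - 0# * b ≈ a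
  re-*-identityˡ a b = trans (+-cong (*-identityˡ a) (-‿cong (zeroˡ b)))
    (trans (+-congˡ -0#≈0#) (+-identityʳ a))

  im-*-identityˡ : ∀ a b → 1# * b + 0# * a ≈ b
  im-*-identityˡ a b = trans (+-cong (*-identityˡ b) (zeroˡ a)) (+-identityʳ b)

-- Dedekind-complete ordered fields: classically there is exactly one up to
-- isomorphism, the field of real numbers.

record CompleteOrderedField : Set₁ where
  infix 4 _≤_ _<_
  infix 8 _⁻¹
  field
    commutativeRing : CommutativeRing 0ℓ 0ℓ
  open CommutativeRing commutativeRing public
  field
    _≤_          : Rel Carrier 0ℓ
    isTotalOrder : IsTotalOrder _≈_ _≤_
    +-monoʳ-≤    : ∀ z {x y} → x ≤ y → z + x ≤ z + y
    *-nonneg     : ∀ {x y} → 0# ≤ x → 0# ≤ y → 0# ≤ x * y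
    1≉0          : ¬ 1# ≈ 0#
    _⁻¹          : Carrier → Carrier
    *-inverseʳ   : ∀ {x} → ¬ x ≈ 0# → x * x ⁻¹ ≈ 1#
    supremum     : (P : Carrier → Set) → ∃ P → (∃ λ b → ∀ x → P x → x ≤ b) →
                   ∃ λ s → (∀ x → P x → x ≤ s) ×
                           (∀ b → (∀ x → P x → x ≤ b) → s ≤ b)

  open IsTotalOrder isTotalOrder public
    using (total; antisym; ≤-respˡ-≈; ≤-respʳ-≈)
    renaming (refl to ≤-refl; reflexive to ≤-reflexive; trans to ≤-trans)

  _<_ : Rel Carrier 0ℓ
  x < y = x ≤ y × ¬ x ≈ y

  _⊔ᵣ_ _⊓ᵣ_ : Carrier → Carrier → Carrier
  x ⊔ᵣ y = [ (λ _ → y) , (λ _ → x) ]′ (total x y)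
  x ⊓ᵣ y = [ (λ _ → x) , (λ _ → y) ]′ (total x y)

  fromℕ : ℕ → Carrier
  fromℕ n = Mult._×_ semiring n 1#

  _^_ : Carrier → ℕ → Carrier
  _^_ = Exp._^_ semiring

  -- ∣ x - y ∣ ≤ ε
  Within : Carrier → Carrier → Carrier → Set
  Within ε x y = x ≤ y + ε × y ≤ x + ε

  open RingIdentities commutativeRing using (square-neg; square-sum)

  +-mono-≤ : ∀ {a b c d} → a ≤ b → c ≤ d → a + c ≤ b + d
  +-mono-≤ {a} {b} {c} {d} p q =
    ≤-trans (+-monoʳ-≤ a q)
      (≤-respˡ-≈ (+-comm d a) (≤-respʳ-≈ (+-comm d b) (+-monoʳ-≤ d p)))

  x≤y⇒0≤y-x : ∀ {x y} → x ≤ y → 0# ≤ y + - x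
  x≤y⇒0≤y-x {x} {y} p =
    ≤-respˡ-≈ (-‿inverseˡ x) (≤-respʳ-≈ (+-comm (- x) y) (+-monoʳ-≤ (- x) p))

  0≤y-x⇒x≤y : ∀ {x y} → 0# ≤ y + - x → x ≤ y
  0≤y-x⇒x≤y {x} {y} p =
    ≤-respˡ-≈ (+-identityʳ x) (≤-respʳ-≈ cancel (+-monoʳ-≤ x p))
    where
    cancel : x + (y + - x) ≈ y
    cancel = trans (+-comm x _) (trans (+-assoc y (- x) x)
               (trans (+-congˡ (-‿inverseˡ x)) (+-identityʳ y)))

  *-monoʳ-≤ : ∀ {x y z} → 0# ≤ z → x ≤ y → z * x ≤ z * y
  *-monoʳ-≤ {x} {y} {z} 0≤z x≤y =
    0≤y-x⇒x≤y (≤-respʳ-≈ eq (*-nonneg 0≤z (x≤y⇒0≤y-x x≤y)))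
    where
    open RingProperties ring using (-‿distribʳ-*)
    eq : z * (y + - x) ≈ z * y + - (z * x)
    eq = trans (distribˡ z y (- x)) (+-congˡ (sym (-‿distribʳ-* z x)))

  *-mono-≤ : ∀ {a b c d} → 0# ≤ a → 0# ≤ d → a ≤ b → c ≤ d → a * c ≤ b * d
  *-mono-≤ {a} {b} {c} {d} 0≤a 0≤d a≤b c≤d =
    ≤-trans (*-monoʳ-≤ 0≤a c≤d)
      (≤-respˡ-≈ (*-comm d a) (≤-respʳ-≈ (*-comm d b) (*-monoʳ-≤ 0≤d a≤b)))

  0≤1 : 0# ≤ 1#
  0≤1 with total 0# 1#
  ... | inj₁ p = p
  ... | inj₂ p = ≤-respʳ-≈ (trans (square-neg 1#) (*-identityˡ 1#)) (*-nonneg 0≤-1 0≤-1)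
    where
    0≤-1 : 0# ≤ - 1#
    0≤-1 = ≤-respʳ-≈ (+-identityˡ (- 1#)) (x≤y⇒0≤y-x p)

  0≤square : ∀ x → 0# ≤ x * x
  0≤square x with total 0# x
  ... | inj₁ p = *-nonneg p p
  ... | inj₂ p = ≤-respʳ-≈ (square-neg x) (*-nonneg 0≤-x 0≤-x)
    where
    0≤-x : 0# ≤ - x
    0≤-x = ≤-respʳ-≈ (+-identityˡ (- x)) (x≤y⇒0≤y-x p)

  square-nonzero : ∀ {x} → ¬ x ≈ 0# → ¬ x * x ≈ 0#
  square-nonzero {x} x≉0 xx≈0 = x≉0 (begin
    x                ≈⟨ *-identityʳ x ⟨
    x * 1#           ≈⟨ *-congˡ (*-inverseʳ x≉0) ⟨
    x * (x * x ⁻¹)   ≈⟨ *-assoc x x (x ⁻¹) ⟨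
    (x * x) * x ⁻¹   ≈⟨ *-congʳ xx≈0 ⟩
    0# * x ⁻¹        ≈⟨ zeroˡ (x ⁻¹) ⟩
    0#               ∎)
    where open import Relation.Binary.Reasoning.Setoid setoid

  squares-≤⇒¬¬≈ : ∀ {x y} → 0# ≤ y → y ≤ x → x * x ≤ y * y → ¬ ¬ x ≈ y
  squares-≤⇒¬¬≈ {x} {y} 0≤y y≤x xx≤yy x≉y = square-nonzero d≉0 (antisym dd≤0 (0≤square d))
    where
    d : Carrier
    d = x + - y
    d≉0 : ¬ d ≈ 0#
    d≉0 d≈0 = x≉y (trans (sym (+-identityʳ x)) (trans (+-congˡ (sym (-‿inverseˡ y)))
                (trans (sym (+-assoc x (- y) y)) (trans (+-congʳ d≈0) (+-identityˡ y)))))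
    0≤yd : 0# ≤ y * d
    0≤yd = *-nonneg 0≤y (x≤y⇒0≤y-x y≤x)
    0≤yd+yd : 0# ≤ y * d + y * d
    0≤yd+yd = ≤-respˡ-≈ (+-identityˡ 0#) (+-mono-≤ 0≤yd 0≤yd)
    y+d≈x : y + d ≈ x
    y+d≈x = trans (+-comm y d) (trans (+-assoc x (- y) y)
              (trans (+-congˡ (-‿inverseˡ y)) (+-identityʳ x)))
    dd≤dd+2yd : d * d ≤ d * d + (y * d + y * d)
    dd≤dd+2yd = ≤-respˡ-≈ (+-identityʳ (d * d)) (+-monoʳ-≤ (d * d) 0≤yd+yd)
    yy+dd≤yy : y * y + d * d ≤ y * y
    yy+dd≤yy = ≤-trans (+-monoʳ-≤ (y * y) dd≤dd+2yd)
      (≤-respˡ-≈ (trans (*-cong (sym y+d≈x) (sym y+d≈x))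
                   (trans (square-sum y d) (+-comm _ (y * y)))) xx≤yy)
    dd≤0 : d * d ≤ 0#
    dd≤0 = ≤-respˡ-≈ (cancel (d * d)) (≤-respʳ-≈ (-‿inverseˡ (y * y))
             (+-monoʳ-≤ (- (y * y)) yy+dd≤yy))
      where
      cancel : ∀ z → - (y * y) + (y * y + z) ≈ z
      cancel z = trans (sym (+-assoc _ _ z)) (trans (+-congʳ (-‿inverseˡ (y * y))) (+-identityˡ z))

  1≤x⇒x≉0 : ∀ {x} → 1# ≤ x → ¬ x ≈ 0#
  1≤x⇒x≉0 1≤x x≈0 = 1≉0 (antisym (≤-respʳ-≈ x≈0 1≤x) 0≤1)

  idempotent⇒≤1 : ∀ {x} → x ≈ x * x → x ≤ 1#
  idempotent⇒≤1 {x} x≈xx with total x 1#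
  ... | inj₁ p = p
  ... | inj₂ p = ≤-reflexive (begin
      x                ≈⟨ *-identityʳ x ⟨
      x * 1#           ≈⟨ *-congˡ (*-inverseʳ x≉0) ⟨
      x * (x * x ⁻¹)   ≈⟨ *-assoc x x (x ⁻¹) ⟨
      (x * x) * x ⁻¹   ≈⟨ *-congʳ x≈xx ⟨
      x * x ⁻¹         ≈⟨ *-inverseʳ x≉0 ⟩
      1#               ∎)
    where
    open import Relation.Binary.Reasoning.Setoid setoid
    x≉0 : ¬ x ≈ 0#
    x≉0 = 1≤x⇒x≉0 p

  fromℕ-nonneg : ∀ n → 0# ≤ fromℕ n
  fromℕ-nonneg ℕ.zero    = ≤-refl
  fromℕ-nonneg (ℕ.suc n) = ≤-respˡ-≈ (+-identityˡ 0#) (+-mono-≤ 0≤1 (fromℕ-nonneg n))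

  fromℕ-mono : ∀ {m n} → m ℕ.≤ n → fromℕ m ≤ fromℕ n
  fromℕ-mono {n = n} ℕ.z≤n = fromℕ-nonneg n
  fromℕ-mono (ℕ.s≤s p)     = +-monoʳ-≤ 1# (fromℕ-mono p)

  fromℕ-+ : ∀ m n → fromℕ (m ℕ.+ n) ≈ fromℕ m + fromℕ n
  fromℕ-+ m n = Mult.×-homo-+ semiring 1# m n

  fromℕ-* : ∀ m n → fromℕ (m ℕ.* n) ≈ fromℕ m * fromℕ n
  fromℕ-* = Mult.×1-homo-* semiring

  fromℕ-1 : fromℕ 1 ≈ 1#
  fromℕ-1 = +-identityʳ 1#

data GroupTerm (n : ℕ) : Set where
  var : Fin n → GroupTerm n
  _∙_ : GroupTerm n → GroupTerm n → GroupTerm n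
  ε   : GroupTerm n
  _⁻¹ : GroupTerm n → GroupTerm n

data GroupFormula (n : ℕ) : Set where
  _≐_         : GroupTerm n → GroupTerm n → GroupFormula n
  ⊥′          : GroupFormula n
  _∧_ _∨_ _⇒_ : GroupFormula n → GroupFormula n → GroupFormula n
  ∀′ ∃′       : GroupFormula (ℕ.suc n) → GroupFormula n

module _ {c ℓ} (G : RawGroup c ℓ) where
  private module G = RawGroup G

  ⟦_⟧ᵍ : ∀ {n} → GroupTerm n → Vector G.Carrier n → G.Carrier
  ⟦ var i ⟧ᵍ ρ = ρ i
  ⟦ s ∙ t ⟧ᵍ ρ = ⟦ s ⟧ᵍ ρ G.∙ ⟦ t ⟧ᵍ ρ
  ⟦ ε     ⟧ᵍ ρ = G.ε
  ⟦ t ⁻¹  ⟧ᵍ ρ = ⟦ t ⟧ᵍ ρ G.⁻¹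

  Satisfies : ∀ {n} → GroupFormula n → Vector G.Carrier n → Set (c ⊔ ℓ)
  Satisfies (s ≐ t) ρ = Level.Lift c (⟦ s ⟧ᵍ ρ G.≈ ⟦ t ⟧ᵍ ρ)
  Satisfies ⊥′      ρ = ⊥ₚ
  Satisfies (φ ∧ ψ) ρ = Satisfies φ ρ × Satisfies ψ ρ
  Satisfies (φ ∨ ψ) ρ = Satisfies φ ρ ⊎ Satisfies ψ ρ
  Satisfies (φ ⇒ ψ) ρ = Satisfies φ ρ → Satisfies ψ ρ
  Satisfies (∀′ φ)  ρ = ∀ x → Satisfies φ (x Vector.∷ ρ)
  Satisfies (∃′ φ)  ρ = ∃ λ x → Satisfies φ (x Vector.∷ ρ)

IsElementaryGroupEmbedding : ∀ {c ℓ c′ ℓ′} (G : RawGroup c ℓ) (H : RawGroup c′ ℓ′) →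
  (RawGroup.Carrier G → RawGroup.Carrier H) → Set (c ⊔ ℓ ⊔ c′ ⊔ ℓ′)
IsElementaryGroupEmbedding G H f =
  ∀ {n} (φ : GroupFormula n) ρ → Satisfies G φ ρ ⇔ Satisfies H φ (f ∘ ρ)

-- A language of metric structures without relation symbols: the metrics of the
-- sorts are part of every structure and give all atomic formulas.

record Language : Set₁ where
  field
    Sort : Set
    Fun  : List Sort → Sort → Set

module _ (L : Language) where
  open Language L

  data Term (Γ : List Sort) : Sort → Set where
    var : ∀ {s} → s ∈ Γ → Term Γ s
    app : ∀ {Δ s} → Fun Δ s → All (Term Γ) Δ → Term Γ s

-- Excluded middle is a parameter because suprema and infima of arbitrary bounded
-- families, hence values of formulas, exist only classically.

module Setting (em : ∀ {ℓ} → ExcludedMiddle ℓ) (R : CompleteOrderedField) where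

  module ℝ = CompleteOrderedField R

  ℝ : Set
  ℝ = ℝ.Carrier

  private
    square-cancel-≤ : ∀ {x y} → ℝ.0# ℝ.≤ y → x ℝ.* x ℝ.≤ y ℝ.* y → x ℝ.≤ y
    square-cancel-≤ {x} {y} 0≤y xx≤yy with ℝ.total x y | em {P = x ℝ.≈ y}
    ... | inj₁ p   | _       = p
    ... | inj₂ _   | yes x≈y = ℝ.≤-reflexive x≈y
    ... | inj₂ y≤x | no x≉y  = contradiction x≉y (ℝ.squares-≤⇒¬¬≈ 0≤y y≤x xx≤yy)

  module _ {ℓ} {X : Set ℓ} (f : X → ℝ) where

    IsSup IsInf : ℝ → Set ℓ
    IsSup s = (∀ x → f x ℝ.≤ s) × (∀ b → (∀ x → f x ℝ.≤ b) → s ℝ.≤ b)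
    IsInf s = (∀ x → s ℝ.≤ f x) × (∀ b → (∀ x → b ℝ.≤ f x) → b ℝ.≤ s)

    -- The default value 0 is irrelevant: below, all families are bounded and
    -- indexed by nonempty types, so that the supremum and infimum exist.
    sup inf : ℝ
    sup with em {P = ∃ IsSup}
    ... | yes (s , _) = s
    ... | no  _       = ℝ.0#
    inf with em {P = ∃ IsInf}
    ... | yes (s , _) = s
    ... | no  _       = ℝ.0#

  record ContinuousFunction (n : ℕ) : Set where
    field
      apply      : Vector ℝ n → ℝ
      continuous : ∀ x ε → ℝ.0# ℝ.< ε → ∃ λ δ → ℝ.0# ℝ.< δ ×
                   (∀ y → (∀ i → ℝ.Within δ (x i) (y i)) → ℝ.Within ε (apply x) (apply y))

  record Structure (L : Language) (ℓ : Level) : Set (lsuc ℓ) where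
    open Language L
    field
      Dom  : Sort → Set ℓ
      dist : ∀ {s} → Dom s → Dom s → ℝ
      fun  : ∀ {Γ s} → Fun Γ s → All Dom Γ → Dom s

    Env : List Sort → Set ℓ
    Env = All Dom

    distEnv : ∀ {Γ} → Env Γ → Env Γ → ℝ
    distEnv []       []       = ℝ.0#
    distEnv (x ∷ xs) (y ∷ ys) = dist x y ℝ.⊔ᵣ distEnv xs ys

  module _ (L : Language) where
    open Language L

    data Formula (Γ : List Sort) : Set where
      dist′     : ∀ {s} → Term L Γ s → Term L Γ s → Formula Γ
      conn      : ∀ {n} → ContinuousFunction n → Vector (Formula Γ) n → Formula Γ
      sup′ inf′ : ∀ s → Formula (s ∷ Γ) → Formula Γ

  module _ {L : Language} {ℓ} (𝓐 : Structure L ℓ) where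
    open Structure 𝓐

    evalTerm  : ∀ {Γ s} → Term L Γ s → Env Γ → Dom s
    evalTerms : ∀ {Γ Δ} → All (Term L Γ) Δ → Env Γ → Env Δ
    evalTerm (var i)    ρ = lookup ρ i
    evalTerm (app f ts) ρ = fun f (evalTerms ts ρ)
    evalTerms []       ρ = []
    evalTerms (t ∷ ts) ρ = evalTerm t ρ ∷ evalTerms ts ρ

    eval : ∀ {Γ} → Formula L Γ → Env Γ → ℝ
    eval (dist′ s t) ρ = dist (evalTerm s ρ) (evalTerm t ρ)
    eval (conn f φ)  ρ = ContinuousFunction.apply f (λ i → eval (φ i) ρ)
    eval (sup′ s φ)  ρ = sup (λ (x : Dom s) → eval φ (x ∷ ρ))
    eval (inf′ s φ)  ρ = inf (λ (x : Dom s) → eval φ (x ∷ ρ))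

  -- 𝓜 indexes the class of models relative to which definability is meant.
  module _ {ℓ} (𝓜 : Set (lsuc ℓ)) where

    record Expansion : Set (lsuc ℓ) where
      field
        language  : Language
        structure : 𝓜 → Structure language ℓ

      open Language language public
      module Model (M : 𝓜) = Structure (structure M)

      Predicate : List Sort → Set (lsuc ℓ)
      Predicate Γ = ∀ M → Model.Env M Γ → ℝ

      value : ∀ {Γ} → Formula language Γ → Predicate Γ
      value φ M = eval (structure M) φ

      IsDefinable : ∀ {Γ} → Predicate Γ → Set (lsuc ℓ)
      IsDefinable {Γ} P = ∀ ε → ℝ.0# ℝ.< ε → ∃ λ (φ : Formula language Γ) →
        ∀ M x → ℝ.Within ε (P M x) (value φ M x)

    module _ (E : Expansion) where
      open Expansion E

      record DefinableSet (Γ : List Sort) : Set (lsuc ℓ) where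
        field
          Member   : ∀ M → Model.Env M Γ → Set ℓ
          nonempty : ∀ M → ∃ (Member M)
          closed   : ∀ M x →
            (∀ ε → ℝ.0# ℝ.< ε → ∃ λ y → Member M y × Model.distEnv M x y ℝ.≤ ε) →
            Member M x
          sup-definable : ∀ {Δ} (ψ : Formula language (Γ ++ Δ)) → IsDefinable {Δ} λ M y →
            sup (λ ((x , _) : ∃ (Member M)) → value ψ M (Allₚ.++⁺ x y))
          inf-definable : ∀ {Δ} (ψ : Formula language (Γ ++ Δ)) → IsDefinable {Δ} λ M y →
            inf (λ ((x , _) : ∃ (Member M)) → value ψ M (Allₚ.++⁺ x y))

      record DefinablePseudometric (Γ : List Sort) : Set (lsuc ℓ) where
        field
          δ         : ∀ M → Model.Env M Γ → Model.Env M Γ → ℝ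
          nonneg    : ∀ M x y → ℝ.0# ℝ.≤ δ M x y
          reflexive : ∀ M x → δ M x x ℝ.≈ ℝ.0#
          symmetric : ∀ M x y → δ M x y ℝ.≈ δ M y x
          triangle  : ∀ M x y z → δ M x z ℝ.≤ δ M x y ℝ.+ δ M y z
          definable : IsDefinable {Γ ++ Γ} λ M xy → δ M (Allₚ.++⁻ˡ Γ xy) (Allₚ.++⁻ʳ Γ xy)

      data NewSort : Set (lsuc ℓ) where
        product  : (ℕ → Sort) → NewSort
        subset   : ∀ Γ → DefinableSet Γ → NewSort
        quotient : ∀ Γ → DefinablePseudometric Γ → NewSort

      NewDom : NewSort → 𝓜 → Set ℓ
      NewDom (product s)    M = ∀ n → Model.Dom M (s n)
      NewDom (subset Γ X)   M = ∃ (DefinableSet.Member X M)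
      NewDom (quotient Γ _) M = Model.Env M Γ

      -- The metric on a countable product is supₙ 2⁻ⁿ min(1, dₙ).  As elements
      -- at distance 0 are identified throughout, a quotient by a pseudometric
      -- only changes the metric.
      newDist : ∀ c M → NewDom c M → NewDom c M → ℝ
      newDist (product s)    M x y = sup λ n →
        ((ℝ.1# ℝ.+ ℝ.1#) ℝ.⁻¹) ℝ.^ n ℝ.* (ℝ.1# ℝ.⊓ᵣ Model.dist M (x n) (y n))
      newDist (subset Γ X)   M (x , _) (y , _) = Model.distEnv M x y
      newDist (quotient Γ d) M x y = DefinablePseudometric.δ d M x y

      -- Function symbols from and to a new sort: the projections of a product,
      -- the coordinates of the inclusion of a definable set, quotient maps.
      FunFrom : NewSort → Sort → Set
      FunFrom (product s)    t = ∃ λ n → s n ≡ t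
      FunFrom (subset Γ _)   t = t ∈ Γ
      FunFrom (quotient _ _) t = ⊥

      FunTo : NewSort → List Sort → Set
      FunTo (quotient Γ _) Δ = Γ ≡ Δ
      FunTo _              Δ = ⊥

      funFrom : ∀ c {t} M → FunFrom c t → NewDom c M → Model.Dom M t
      funFrom (product s)  M (n , ≡.refl) x       = x n
      funFrom (subset _ _) M i          (x , _) = lookup x i

      funTo : ∀ c {Δ} M → FunTo c Δ → Model.Env M Δ → NewDom c M
      funTo (quotient _ _) M ≡.refl x = x

      module _ {J : Set} (new : J → NewSort) where

        data ExtendedFun : List (Sort ⊎ J) → Sort ⊎ J → Set where
          old  : ∀ {Γ t} → Fun Γ t → ExtendedFun (map inj₁ Γ) (inj₁ t)
          from : ∀ j {t} → FunFrom (new j) t → ExtendedFun (inj₂ j ∷ []) (inj₁ t)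
          to   : ∀ j {Γ} → FunTo (new j) Γ → ExtendedFun (map inj₁ Γ) (inj₂ j)

        extendedLanguage : Language
        extendedLanguage = record { Sort = Sort ⊎ J ; Fun = ExtendedFun }

        module _ (M : 𝓜) where

          ExtendedDom : Sort ⊎ J → Set ℓ
          ExtendedDom (inj₁ s) = Model.Dom M s
          ExtendedDom (inj₂ j) = NewDom (new j) M

          extendedDist : ∀ s → ExtendedDom s → ExtendedDom s → ℝ
          extendedDist (inj₁ s) = Model.dist M
          extendedDist (inj₂ j) = newDist (new j) M

          extendedFun : ∀ {Γ s} → ExtendedFun Γ s → All ExtendedDom Γ → ExtendedDom s
          extendedFun (old f)    xs       = Model.fun M f (Allₚ.map⁻ xs)
          extendedFun (from j p) (x ∷ []) = funFrom (new j) M p x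
          extendedFun (to j p)   xs       = funTo (new j) M p (Allₚ.map⁻ xs)

        extend : Expansion
        extend = record
          { language  = extendedLanguage
          ; structure = λ M → record
            { Dom  = ExtendedDom M
            ; dist = λ {s} → extendedDist M s
            ; fun  = extendedFun M
            }
          }

    -- The stages in the iterative construction of the imaginary sorts over E₀;
    -- a step adjoins an arbitrary family of new sorts simultaneously.
    data Imaginary (E₀ : Expansion) : Expansion → Set (lsuc ℓ) where
      base : Imaginary E₀ E₀
      step : ∀ {E J} → Imaginary E₀ E → (new : J → NewSort E) → Imaginary E₀ (extend E new)

  ℂ : Set
  ℂ = ℝ × ℝ

  open RingIdentities ℝ.commutativeRing

  ℂ-commutativeRing : CommutativeRing 0ℓ 0ℓ
  ℂ-commutativeRing = record
    { Carrier = ℂ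
    ; _≈_ = λ (a , b) (c , d) → a ℝ.≈ c × b ℝ.≈ d
    ; _+_ = λ (a , b) (c , d) → a ℝ.+ c , b ℝ.+ d
    ; _*_ = λ (a , b) (c , d) → a ℝ.* c ℝ.+ ℝ.- (b ℝ.* d) , a ℝ.* d ℝ.+ b ℝ.* c
    ; -_  = λ (a , b) → ℝ.- a , ℝ.- b
    ; 0#  = ℝ.0# , ℝ.0#
    ; 1#  = ℝ.1# , ℝ.0#
    ; isCommutativeRing = record
      { isRing = record
        { +-isAbelianGroup = record
          { isGroup = record
            { isMonoid = record
              { isSemigroup = record
                { isMagma = record
                  { isEquivalence = record
                    { refl  = ℝ.refl , ℝ.refl
                    ; sym   = λ (p , q) → ℝ.sym p , ℝ.sym q
                    ; trans = λ (p , q) (p′ , q′) → ℝ.trans p p′ , ℝ.trans q q′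
                    }
                  ; ∙-cong = λ (p , q) (p′ , q′) → ℝ.+-cong p p′ , ℝ.+-cong q q′
                  }
                ; assoc = λ _ _ _ → ℝ.+-assoc _ _ _ , ℝ.+-assoc _ _ _
                }
              ; identity = (λ _ → ℝ.+-identityˡ _ , ℝ.+-identityˡ _) ,
                           (λ _ → ℝ.+-identityʳ _ , ℝ.+-identityʳ _)
              }
            ; inverse = (λ _ → ℝ.-‿inverseˡ _ , ℝ.-‿inverseˡ _) ,
                        (λ _ → ℝ.-‿inverseʳ _ , ℝ.-‿inverseʳ _)
            ; ⁻¹-cong = λ (p , q) → ℝ.-‿cong p , ℝ.-‿cong q
            }
          ; comm = λ _ _ → ℝ.+-comm _ _ , ℝ.+-comm _ _
          }
        ; *-cong = λ (p , q) (p′ , q′) →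
            ℝ.+-cong (ℝ.*-cong p p′) (ℝ.-‿cong (ℝ.*-cong q q′)) ,
            ℝ.+-cong (ℝ.*-cong p q′) (ℝ.*-cong q p′)
        ; *-assoc = λ (a , b) (c , d) (e , f) →
            re-*-assoc a b c d e f , im-*-assoc a b c d e f
        ; *-identity = (λ (a , b) → re-*-identityˡ a b , im-*-identityˡ a b) ,
                       (λ (a , b) →
                          ℝ.trans (re-*-comm a b ℝ.1# ℝ.0#) (re-*-identityˡ a b) ,
                          ℝ.trans (im-*-comm a b ℝ.1# ℝ.0#) (im-*-identityˡ a b))
        ; distrib = (λ (a , b) (c , d) (e , f) →
                       re-distribˡ a b c d e f , im-distribˡ a b c d e f) ,
                    (λ (a , b) (c , d) (e , f) →
                       re-distribʳ a b c d e f , im-distribʳ a b c d e f)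
        }
      ; *-comm = λ (a , b) (c , d) → re-*-comm a b c d , im-*-comm a b c d
      }
    }

  module ℂ = CommutativeRing ℂ-commutativeRing

  conj : ℂ → ℂ
  conj (a , b) = a , ℝ.- b

  -- ∣ z ∣²
  normSq : ℂ → ℝ
  normSq (a , b) = a ℝ.* a ℝ.+ b ℝ.* b

  record CStarAlgebra (ℓ : Level) : Set (lsuc ℓ) where
    infixr 7 _·_
    infix  8 _⋆
    field
      ring : Ring ℓ ℓ
    open Ring ring public
    field
      _·_          : ℂ → Carrier → Carrier
      isLeftModule : IsLeftModule ℂ.ring _≈_ _+_ 0# -_ _·_
      ·-*-assocˡ   : ∀ z a b → z · (a * b) ≈ (z · a) * b
      ·-*-assocʳ   : ∀ z a b → z · (a * b) ≈ a * (z · b)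

      _⋆           : Carrier → Carrier
      ⋆-cong       : ∀ {a b} → a ≈ b → a ⋆ ≈ b ⋆
      ⋆-involutive : ∀ a → a ⋆ ⋆ ≈ a
      ⋆-+          : ∀ a b → (a + b) ⋆ ≈ a ⋆ + b ⋆
      ⋆-*          : ∀ a b → (a * b) ⋆ ≈ b ⋆ * a ⋆
      ⋆-·          : ∀ z a → (z · a) ⋆ ≈ conj z · a ⋆

      ‖_‖          : Carrier → ℝ
      ‖‖-cong      : ∀ {a b} → a ≈ b → ‖ a ‖ ℝ.≈ ‖ b ‖
      ‖‖-nonneg    : ∀ a → ℝ.0# ℝ.≤ ‖ a ‖
      ‖‖-definite  : ∀ {a} → ‖ a ‖ ℝ.≈ ℝ.0# → a ≈ 0#
      ‖‖-+         : ∀ a b → ‖ a + b ‖ ℝ.≤ ‖ a ‖ ℝ.+ ‖ b ‖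
      -- The square of ‖ z · a ‖ = ∣ z ∣ ‖ a ‖.
      ‖‖-·         : ∀ z a → ‖ z · a ‖ ℝ.* ‖ z · a ‖ ℝ.≈ normSq z ℝ.* (‖ a ‖ ℝ.* ‖ a ‖)
      ‖‖-*         : ∀ a b → ‖ a * b ‖ ℝ.≤ ‖ a ‖ ℝ.* ‖ b ‖
      ‖‖-⋆         : ∀ a → ‖ a ⋆ ‖ ℝ.≈ ‖ a ‖
      C*-identity  : ∀ a → ‖ a ⋆ * a ‖ ℝ.≈ ‖ a ‖ ℝ.* ‖ a ‖

    ConvergesTo : (ℕ → Carrier) → Carrier → Set
    ConvergesTo u a = ∀ ε → ℝ.0# ℝ.< ε → ∃ λ N → ∀ n → N ℕ.≤ n → ‖ u n - a ‖ ℝ.≤ ε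

    IsCauchy : (ℕ → Carrier) → Set
    IsCauchy u = ∀ ε → ℝ.0# ℝ.< ε → ∃ λ N → ∀ m n → N ℕ.≤ m → N ℕ.≤ n → ‖ u m - u n ‖ ℝ.≤ ε

    field
      complete : ∀ u → IsCauchy u → ∃ (ConvergesTo u)

    Positive : Carrier → Set ℓ
    Positive a = ∃ λ b → a ≈ b ⋆ * b

    0⋆≈0 : 0# ⋆ ≈ 0#
    0⋆≈0 = +-cancelˡ (0# ⋆) (0# ⋆) 0#
      (trans (sym (⋆-+ 0# 0#)) (trans (⋆-cong (+-identityˡ 0#)) (sym (+-identityʳ (0# ⋆)))))
      where open RingProperties ring using (+-cancelˡ)

    1⋆≈1 : 1# ⋆ ≈ 1#
    1⋆≈1 = begin
      1# ⋆             ≈⟨ *-identityʳ (1# ⋆) ⟨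
      1# ⋆ * 1#        ≈⟨ *-congˡ (⋆-involutive 1#) ⟨
      1# ⋆ * 1# ⋆ ⋆    ≈⟨ ⋆-* (1# ⋆) 1# ⟨
      (1# ⋆ * 1#) ⋆    ≈⟨ ⋆-cong (*-identityʳ (1# ⋆)) ⟩
      1# ⋆ ⋆           ≈⟨ ⋆-involutive 1# ⟩
      1#               ∎
      where open import Relation.Binary.Reasoning.Setoid setoid

    ‖0‖≈0 : ‖ 0# ‖ ℝ.≈ ℝ.0#
    ‖0‖≈0 = ℝ.antisym (ℝ.≤-respʳ-≈ ‖0‖*0 bound) (‖‖-nonneg 0#)
      where
      ‖0‖*0 : ‖ 0# ‖ ℝ.* ‖ 0# ‖ ℝ.≈ ℝ.0#
      ‖0‖*0 = ℝ.trans (ℝ.*-cong (‖‖-cong (sym 0·0)) (‖‖-cong (sym 0·0)))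
                (ℝ.trans (‖‖-· ℂ.0# 0#) (ℝ.trans (ℝ.*-congʳ normSq0) (ℝ.zeroˡ _)))
        where
        0·0 : ℂ.0# · 0# ≈ 0#
        0·0 = IsLeftModule.*ₗ-zeroˡ isLeftModule 0#
        normSq0 : normSq ℂ.0# ℝ.≈ ℝ.0#
        normSq0 = ℝ.trans (ℝ.+-cong (ℝ.zeroˡ _) (ℝ.zeroˡ _)) (ℝ.+-identityˡ ℝ.0#)
      bound : ‖ 0# ‖ ℝ.≤ ‖ 0# ‖ ℝ.* ‖ 0# ‖
      bound = ℝ.≤-respˡ-≈ (‖‖-cong (zeroˡ 0#)) (‖‖-* 0# 0#)

    ‖1‖≤1 : ‖ 1# ‖ ℝ.≤ ℝ.1#
    ‖1‖≤1 = ℝ.idempotent⇒≤1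
      (ℝ.trans (‖‖-cong (sym (trans (*-identityʳ (1# ⋆)) 1⋆≈1))) (C*-identity 1#))

  -- dim A > 1 is the existence of two linearly independent elements.
  record PurelyInfiniteSimple {ℓ} (A : CStarAlgebra ℓ) : Set ℓ where
    open CStarAlgebra A
    field
      dim>1 : ∃₂ λ a b → ∀ z w → z · a + w · b ≈ 0# → z ℂ.≈ ℂ.0# × w ℂ.≈ ℂ.0#
      purelyInfinite : ∀ a b → Positive a → ¬ a ≈ 0# → Positive b → ¬ b ≈ 0# →
        ∃ λ (x : ℕ → Carrier) → ConvergesTo (λ n → x n * a * x n ⋆) b

  record Embedding {ℓ ℓ′} (A : CStarAlgebra ℓ) (B : CStarAlgebra ℓ′) : Set (ℓ ⊔ ℓ′) where
    private
      module A = CStarAlgebra A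
      module B = CStarAlgebra B
    open RingMorphisms A.rawRing B.rawRing using (IsRingHomomorphism)
    field
      ⟦_⟧                : A.Carrier → B.Carrier
      isRingHomomorphism : IsRingHomomorphism ⟦_⟧
      ·-homo             : ∀ z a → ⟦ z A.· a ⟧ B.≈ z B.· ⟦ a ⟧
      ⋆-homo             : ∀ a → ⟦ a A.⋆ ⟧ B.≈ ⟦ a ⟧ B.⋆
      isometric          : ∀ a → B.‖ ⟦ a ⟧ ‖ ℝ.≈ A.‖ a ‖
    open IsRingHomomorphism isRingHomomorphism public

  -- The sort n is the ball of radius n.
  data CStarFun : List ℕ → ℕ → Set where
    zero′ : CStarFun [] 0
    one′  : CStarFun [] 1
    plus  : ∀ m n → CStarFun (m ∷ n ∷ []) (m ℕ.+ n)
    times : ∀ m n → CStarFun (m ∷ n ∷ []) (m ℕ.* n)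
    star  : ∀ n → CStarFun (n ∷ []) n
    -- The side condition is ∣ z ∣ m ≤ n.
    scale : ∀ z m n → normSq z ℝ.* (ℝ.fromℕ m ℝ.* ℝ.fromℕ m) ℝ.≤ ℝ.fromℕ n ℝ.* ℝ.fromℕ n →
            CStarFun (m ∷ []) n
    incl  : ∀ {m n} → m ℕ.≤ n → CStarFun (m ∷ []) n

  CStarLanguage : Language
  CStarLanguage = record { Sort = ℕ ; Fun = CStarFun }

  module _ {ℓ} (A : CStarAlgebra ℓ) where
    open CStarAlgebra A

    Ball : ℕ → Set ℓ
    Ball n = ∃ λ a → ‖ a ‖ ℝ.≤ ℝ.fromℕ n

    cstarFun : ∀ {Γ n} → CStarFun Γ n → All Ball Γ → Ball n
    cstarFun zero′ [] = 0# , ℝ.≤-reflexive ‖0‖≈0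
    cstarFun one′ [] = 1# , ℝ.≤-respʳ-≈ (ℝ.sym ℝ.fromℕ-1) ‖1‖≤1
    cstarFun (plus m n) ((a , p) ∷ (b , q) ∷ []) = a + b ,
      ℝ.≤-respʳ-≈ (ℝ.sym (ℝ.fromℕ-+ m n)) (ℝ.≤-trans (‖‖-+ a b) (ℝ.+-mono-≤ p q))
    cstarFun (times m n) ((a , p) ∷ (b , q) ∷ []) = a * b ,
      ℝ.≤-respʳ-≈ (ℝ.sym (ℝ.fromℕ-* m n))
        (ℝ.≤-trans (‖‖-* a b) (ℝ.*-mono-≤ (‖‖-nonneg a) (ℝ.fromℕ-nonneg n) p q))
    cstarFun (star n) ((a , p) ∷ []) = a ⋆ , ℝ.≤-respˡ-≈ (ℝ.sym (‖‖-⋆ a)) p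
    cstarFun (scale z m n z*m≤n) ((a , p) ∷ []) = z · a ,
      square-cancel-≤ (ℝ.fromℕ-nonneg n)
        (ℝ.≤-respˡ-≈ (ℝ.sym (‖‖-· z a)) (ℝ.≤-trans
          (ℝ.*-monoʳ-≤ normSq-nonneg
            (ℝ.*-mono-≤ (‖‖-nonneg a) (ℝ.fromℕ-nonneg m) p p))
          z*m≤n))
      where
      normSq-nonneg : ℝ.0# ℝ.≤ normSq z
      normSq-nonneg = ℝ.≤-respˡ-≈ (ℝ.+-identityˡ ℝ.0#)
        (ℝ.+-mono-≤ (ℝ.0≤square (proj₁ z)) (ℝ.0≤square (proj₂ z)))
    cstarFun (incl m≤n) ((a , p) ∷ []) = a , ℝ.≤-trans p (ℝ.fromℕ-mono m≤n)

    cstarStructure : Structure CStarLanguage ℓ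
    cstarStructure = record
      { Dom  = Ball
      ; dist = λ (a , _) (b , _) → ‖ a - b ‖
      ; fun  = cstarFun
      }

  module _ {ℓ ℓ′} {A : CStarAlgebra ℓ} {B : CStarAlgebra ℓ′} (ι : Embedding A B) where
    open Embedding ι

    Ball-map : ∀ {n} → Ball A n → Ball B n
    Ball-map (a , p) = ⟦ a ⟧ , ℝ.≤-respˡ-≈ (ℝ.sym (isometric a)) p

    IsElementary : Set ℓ
    IsElementary = ∀ {Γ} (φ : Formula CStarLanguage Γ) (a : All (Ball A) Γ) →
      eval (cstarStructure A) φ a ℝ.≈ eval (cstarStructure B) φ (All.map (λ {n} → Ball-map {n}) a)

  -- The models of the complete theory of A.
  Models : ∀ {ℓ} → CStarAlgebra ℓ → Set (lsuc ℓ)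
  Models {ℓ} A = Σ (CStarAlgebra ℓ) λ M → ∀ (φ : Formula CStarLanguage []) →
    eval (cstarStructure M) φ [] ℝ.≈ eval (cstarStructure A) φ []

  module _ {ℓ} (A : CStarAlgebra ℓ) where

    itself : Models A
    itself = A , λ _ → ℝ.refl

    cstarExpansion : Expansion (Models A)
    cstarExpansion = record
      { language  = CStarLanguage
      ; structure = λ (M , _) → cstarStructure M
      }

    -- G, with the discrete metric, is (isomorphic to) a structure whose
    -- universe is a sort of the structure of imaginaries over A and whose
    -- operations are definable; an operation f is definable when the
    -- predicate d(f(x), z) is.
    record InEq {c ℓ′} (G : RawGroup c ℓ′) : Set (lsuc ℓ ⊔ c ⊔ ℓ′) where
      private module G = RawGroup G

      IsDiscreteDistance : G.Carrier → G.Carrier → ℝ → Set ℓ′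
      IsDiscreteDistance g h r = (g G.≈ h → r ℝ.≈ ℝ.0#) × (¬ g G.≈ h → r ℝ.≈ ℝ.1#)

      field
        expansion : Expansion (Models A)
        imaginary : Imaginary (Models A) cstarExpansion expansion
      open Expansion expansion
      open Model itself using (Dom; dist)
      field
        sort       : Sort
        toGroup    : Dom sort → G.Carrier
        surjective : ∀ g → ∃ λ x → toGroup x G.≈ g
        isometric  : ∀ x y → IsDiscreteDistance (toGroup x) (toGroup y) (dist x y)

        ∙-graph     : Predicate (sort ∷ sort ∷ sort ∷ [])
        ∙-definable : IsDefinable ∙-graph
        ∙-isGraph   : ∀ x y z → IsDiscreteDistance (toGroup x G.∙ toGroup y) (toGroup z)
                                  (∙-graph itself (x ∷ y ∷ z ∷ []))

        ε-graph     : Predicate (sort ∷ [])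
        ε-definable : IsDefinable ε-graph
        ε-isGraph   : ∀ z → IsDiscreteDistance G.ε (toGroup z) (ε-graph itself (z ∷ []))

        ⁻¹-graph     : Predicate (sort ∷ sort ∷ [])
        ⁻¹-definable : IsDefinable ⁻¹-graph
        ⁻¹-isGraph   : ∀ x z → IsDiscreteDistance (toGroup x G.⁻¹) (toGroup z)
                                 (⁻¹-graph itself (x ∷ z ∷ []))

  𝕀 : Set
  𝕀 = Σ ℝ λ t → ℝ.0# ℝ.≤ t × t ℝ.≤ ℝ.1#

  0ᴵ 1ᴵ : 𝕀
  0ᴵ = ℝ.0# , ℝ.≤-refl , ℝ.0≤1
  1ᴵ = ℝ.1# , ℝ.0≤1 , ℝ.≤-refl

  module Matrices {ℓ} (A : CStarAlgebra ℓ) where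
    open CStarAlgebra A hiding (zero)
    open SemiringSum semiring using (sum; *-distribˡ-sum; *-distribʳ-sum) renaming (sum-cong-≋ to sum-cong)
    open import Relation.Binary.Reasoning.Setoid setoid

    Matrix : ℕ → Set ℓ
    Matrix n = Fin n → Fin n → Carrier

    _≈ᴹ_ : ∀ {n} → Rel (Matrix n) ℓ
    x ≈ᴹ y = ∀ i j → x i j ≈ y i j

    _*ᴹ_ : ∀ {n} → Matrix n → Matrix n → Matrix n
    (x *ᴹ y) i j = sum λ k → x i k * y k j

    _⋆ᴹ : ∀ {n} → Matrix n → Matrix n
    (x ⋆ᴹ) i j = x j i ⋆

    1ᴹ : ∀ {n} → Matrix n
    1ᴹ zero    zero    = 1#
    1ᴹ zero    (suc j) = 0#
    1ᴹ (suc i) zero    = 0#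
    1ᴹ (suc i) (suc j) = 1ᴹ i j

    block : ∀ {m n} → Matrix m → Matrix n → Fin m ⊎ Fin n → Fin m ⊎ Fin n → Carrier
    block x y (inj₁ i) (inj₁ j) = x i j
    block x y (inj₁ i) (inj₂ j) = 0#
    block x y (inj₂ i) (inj₁ j) = 0#
    block x y (inj₂ i) (inj₂ j) = y i j

    _⊕ᴹ_ : ∀ {m n} → Matrix m → Matrix n → Matrix (m ℕ.+ n)
    _⊕ᴹ_ {m} x y i j = block x y (splitAt m i) (splitAt m j)

    IsUnitary : ∀ {n} → Matrix n → Set ℓ
    IsUnitary u = ((u ⋆ᴹ) *ᴹ u) ≈ᴹ 1ᴹ × (u *ᴹ (u ⋆ᴹ)) ≈ᴹ 1ᴹ

    sum-zeroˡ : ∀ {n} (f : Vector Carrier n) → sum (λ k → 0# * f k) ≈ 0#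
    sum-zeroˡ f = trans (sym (*-distribˡ-sum 0# f)) (zeroˡ (sum f))

    sum-zeroʳ : ∀ {n} (f : Vector Carrier n) → sum (λ k → f k * 0#) ≈ 0#
    sum-zeroʳ f = trans (sym (*-distribʳ-sum 0# f)) (zeroʳ (sum f))

    sum-split : ∀ m {n} (f : Vector Carrier (m ℕ.+ n)) →
                sum f ≈ sum (λ i → f (i ↑ˡ n)) + sum (λ i → f (m ↑ʳ i))
    sum-split ℕ.zero    f = sym (+-identityˡ (sum f))
    sum-split (ℕ.suc m) f = trans (+-congˡ (sum-split m (f ∘ suc))) (sym (+-assoc _ _ _))

    1ᴹ-⋆ : ∀ {n} → ((1ᴹ {n}) ⋆ᴹ) ≈ᴹ 1ᴹ
    1ᴹ-⋆ zero    zero    = 1⋆≈1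
    1ᴹ-⋆ zero    (suc j) = 0⋆≈0
    1ᴹ-⋆ (suc i) zero    = 0⋆≈0
    1ᴹ-⋆ (suc i) (suc j) = 1ᴹ-⋆ i j

    *ᴹ-identityˡ : ∀ {n} (x : Fin n → Carrier) i → sum (λ k → 1ᴹ i k * x k) ≈ x i
    *ᴹ-identityˡ x zero    = trans
      (+-cong (*-identityˡ _) (sum-zeroˡ (x ∘ suc))) (+-identityʳ _)
    *ᴹ-identityˡ x (suc i) = trans
      (+-cong (zeroˡ _) (*ᴹ-identityˡ (x ∘ suc) i)) (+-identityˡ _)

    1ᴹ-isUnitary : ∀ {n} → IsUnitary (1ᴹ {n})
    1ᴹ-isUnitary =
      (λ i j → trans (sum-cong λ k → *-congʳ (1ᴹ-⋆ i k)) (*ᴹ-identityˡ (λ k → 1ᴹ k j) i)) ,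
      (λ i j → trans (*ᴹ-identityˡ (λ k → 1ᴹ j k ⋆) i) (1ᴹ-⋆ i j))

    block-cong : ∀ {m n} {x x′ : Matrix m} {y y′ : Matrix n} → x ≈ᴹ x′ → y ≈ᴹ y′ →
                 ∀ s t → block x y s t ≈ block x′ y′ s t
    block-cong p q (inj₁ i) (inj₁ j) = p i j
    block-cong p q (inj₁ i) (inj₂ j) = refl
    block-cong p q (inj₂ i) (inj₁ j) = refl
    block-cong p q (inj₂ i) (inj₂ j) = q i j

    block-⋆ : ∀ {m n} (x : Matrix m) (y : Matrix n) s t →
              block x y t s ⋆ ≈ block (x ⋆ᴹ) (y ⋆ᴹ) s t
    block-⋆ x y (inj₁ i) (inj₁ j) = refl
    block-⋆ x y (inj₁ i) (inj₂ j) = 0⋆≈0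
    block-⋆ x y (inj₂ i) (inj₁ j) = 0⋆≈0
    block-⋆ x y (inj₂ i) (inj₂ j) = refl

    block-* : ∀ {m n} (x x′ : Matrix m) (y y′ : Matrix n) s t →
              sum (λ k → block x y s (inj₁ k) * block x′ y′ (inj₁ k) t) +
              sum (λ k → block x y s (inj₂ k) * block x′ y′ (inj₂ k) t) ≈
              block (x *ᴹ x′) (y *ᴹ y′) s t
    block-* {n = n} x x′ y y′ (inj₁ i) (inj₁ j) =
      trans (+-congˡ (sum-zeroˡ {n} λ _ → 0#)) (+-identityʳ _)
    block-* x x′ y y′ (inj₁ i) (inj₂ j) =
      trans (+-cong (sum-zeroʳ (x i)) (sum-zeroˡ λ k → y′ k j)) (+-identityʳ _)
    block-* x x′ y y′ (inj₂ i) (inj₁ j) =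
      trans (+-cong (sum-zeroˡ λ k → x′ k j) (sum-zeroʳ (y i))) (+-identityʳ _)
    block-* {m} x x′ y y′ (inj₂ i) (inj₂ j) =
      trans (+-congʳ (sum-zeroˡ {m} λ _ → 0#)) (+-identityˡ _)

    ⊕ᴹ-* : ∀ {m n} (x x′ : Matrix m) (y y′ : Matrix n) →
           ((x ⊕ᴹ y) *ᴹ (x′ ⊕ᴹ y′)) ≈ᴹ ((x *ᴹ x′) ⊕ᴹ (y *ᴹ y′))
    ⊕ᴹ-* {m} {n} x x′ y y′ i j = trans (sum-split m _) (trans
      (+-cong (sum-cong λ k → reflexive (≡.cong (λ s → block x y (splitAt m i) s *
                                                       block x′ y′ s (splitAt m j))
                                                (splitAt-↑ˡ m k n)))
              (sum-cong λ k → reflexive (≡.cong (λ s → block x y (splitAt m i) s *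
                                                       block x′ y′ s (splitAt m j))
                                                (splitAt-↑ʳ m n k))))
      (block-* x x′ y y′ (splitAt m i) (splitAt m j)))

    ⊕ᴹ-1 : ∀ m {n} → (1ᴹ {m} ⊕ᴹ 1ᴹ {n}) ≈ᴹ 1ᴹ
    ⊕ᴹ-1 ℕ.zero    i       j       = refl
    ⊕ᴹ-1 (ℕ.suc m) zero    zero    = refl
    ⊕ᴹ-1 (ℕ.suc m) zero    (suc j) with splitAt m j
    ... | inj₁ _ = refl
    ... | inj₂ _ = refl
    ⊕ᴹ-1 (ℕ.suc m) (suc i) zero    with splitAt m i
    ... | inj₁ _ = refl
    ... | inj₂ _ = refl
    ⊕ᴹ-1 (ℕ.suc m) (suc i) (suc j) with splitAt m i | splitAt m j | ⊕ᴹ-1 m i j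
    ... | inj₁ _ | inj₁ _ | p = p
    ... | inj₁ _ | inj₂ _ | p = p
    ... | inj₂ _ | inj₁ _ | p = p
    ... | inj₂ _ | inj₂ _ | p = p

    ⊕ᴹ-isUnitary : ∀ {m n} {u : Matrix m} {v : Matrix n} →
                   IsUnitary u → IsUnitary v → IsUnitary (u ⊕ᴹ v)
    ⊕ᴹ-isUnitary {m} {n} {u} {v} (p , p′) (q , q′) =
      (λ i j → begin
        (((u ⊕ᴹ v) ⋆ᴹ) *ᴹ (u ⊕ᴹ v)) i j                ≈⟨ sum-cong (λ k → *-congʳ (⊕-⋆ i k)) ⟩
        (((u ⋆ᴹ) ⊕ᴹ (v ⋆ᴹ)) *ᴹ (u ⊕ᴹ v)) i j           ≈⟨ ⊕ᴹ-* (u ⋆ᴹ) u (v ⋆ᴹ) v i j ⟩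
        (((u ⋆ᴹ) *ᴹ u) ⊕ᴹ ((v ⋆ᴹ) *ᴹ v)) i j           ≈⟨ ⊕-cong p q i j ⟩
        (1ᴹ {m} ⊕ᴹ 1ᴹ {n}) i j                         ≈⟨ ⊕ᴹ-1 m i j ⟩
        1ᴹ i j                                         ∎) ,
      (λ i j → begin
        ((u ⊕ᴹ v) *ᴹ ((u ⊕ᴹ v) ⋆ᴹ)) i j                ≈⟨ sum-cong (λ k → *-congˡ (⊕-⋆ k j)) ⟩
        ((u ⊕ᴹ v) *ᴹ ((u ⋆ᴹ) ⊕ᴹ (v ⋆ᴹ))) i j           ≈⟨ ⊕ᴹ-* u (u ⋆ᴹ) v (v ⋆ᴹ) i j ⟩
        ((u *ᴹ (u ⋆ᴹ)) ⊕ᴹ (v *ᴹ (v ⋆ᴹ))) i j           ≈⟨ ⊕-cong p′ q′ i j ⟩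
        (1ᴹ {m} ⊕ᴹ 1ᴹ {n}) i j                         ≈⟨ ⊕ᴹ-1 m i j ⟩
        1ᴹ i j                                         ∎)
      where
      ⊕-⋆ : ((u ⊕ᴹ v) ⋆ᴹ) ≈ᴹ ((u ⋆ᴹ) ⊕ᴹ (v ⋆ᴹ))
      ⊕-⋆ i j = block-⋆ u v (splitAt m i) (splitAt m j)
      ⊕-cong : ∀ {x x′ : Matrix m} {y y′ : Matrix n} → x ≈ᴹ x′ → y ≈ᴹ y′ → (x ⊕ᴹ y) ≈ᴹ (x′ ⊕ᴹ y′)
      ⊕-cong r r′ i j = block-cong r r′ (splitAt m i) (splitAt m j)

    Unitary : ℕ → Set ℓ
    Unitary n = ∃ (IsUnitary {n})

    1ᵁ : ∀ n → Unitary n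
    1ᵁ n = 1ᴹ , 1ᴹ-isUnitary

    _⊕ᵁ_ : ∀ {m n} → Unitary m → Unitary n → Unitary (m ℕ.+ n)
    (u , p) ⊕ᵁ (v , q) = u ⊕ᴹ v , ⊕ᴹ-isUnitary p q

    _⋆ᵁ : ∀ {n} → Unitary n → Unitary n
    (u , p , q) ⋆ᵁ = u ⋆ᴹ ,
      (λ i j → trans (sum-cong λ k → *-congʳ (⋆-involutive (u i k))) (q i j)) ,
      (λ i j → trans (sum-cong λ k → *-congˡ (⋆-involutive (u k j))) (p i j))

    -- Entrywise convergence is convergence in the C*-norm of Mₙ(A), so that
    -- norm-continuous paths may be described entrywise.
    record Homotopic {n} (u v : Unitary n) : Set ℓ where
      field
        path       : 𝕀 → Unitary n
        continuous : ∀ t ε → ℝ.0# ℝ.< ε → ∃ λ δ → ℝ.0# ℝ.< δ ×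
                     (∀ s → ℝ.Within δ (proj₁ t) (proj₁ s) →
                      ∀ i j → ‖ proj₁ (path t) i j - proj₁ (path s) i j ‖ ℝ.≤ ε)
        path-0     : proj₁ (path 0ᴵ) ≈ᴹ proj₁ u
        path-1     : proj₁ (path 1ᴵ) ≈ᴹ proj₁ v

    -- The unitaries of all Mₙ(A), identified when they become homotopic after
    -- adding identity matrices; the operation is the block sum.
    K₁ : RawGroup ℓ ℓ
    K₁ = record
      { Carrier = ∃ Unitary
      ; _≈_     = λ (m , u) (n , v) → ∃₂ λ k l → Σ (m ℕ.+ k ≡ n ℕ.+ l) λ eq →
                    Homotopic (subst Unitary eq (u ⊕ᵁ 1ᵁ k)) (v ⊕ᵁ 1ᵁ l)
      ; _∙_     = λ (m , u) (n , v) → m ℕ.+ n , u ⊕ᵁ v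
      ; ε       = 0 , 1ᵁ 0
      ; _⁻¹     = λ (n , u) → n , u ⋆ᵁ
      }

  open Matrices public using (K₁)

  module _ {ℓ ℓ′} {A : CStarAlgebra ℓ} {B : CStarAlgebra ℓ′} (ι : Embedding A B) where
    private
      module A = CStarAlgebra A
      module B = CStarAlgebra B
      module Mᴬ = Matrices A
      module Mᴮ = Matrices B
      module ∑ᴬ = SemiringSum A.semiring
      module ∑ᴮ = SemiringSum B.semiring
    open Embedding ι

    private
      sum-homo : ∀ {n} (f : Vector A.Carrier n) → ⟦ ∑ᴬ.sum f ⟧ B.≈ ∑ᴮ.sum (⟦_⟧ ∘ f)
      sum-homo {ℕ.zero}  f = 0#-homo
      sum-homo {ℕ.suc n} f = B.trans (+-homo _ _) (B.+-congˡ (sum-homo (f ∘ suc)))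

      1ᴹ-homo : ∀ {n} (i j : Fin n) → ⟦ Mᴬ.1ᴹ i j ⟧ B.≈ Mᴮ.1ᴹ i j
      1ᴹ-homo zero    zero    = 1#-homo
      1ᴹ-homo zero    (suc j) = 0#-homo
      1ᴹ-homo (suc i) zero    = 0#-homo
      1ᴹ-homo (suc i) (suc j) = 1ᴹ-homo i j

      product-homo : ∀ {n} (x y : Mᴬ.Matrix n) i j →
        ⟦ (x Mᴬ.*ᴹ y) i j ⟧ B.≈ ∑ᴮ.sum (λ k → ⟦ x i k ⟧ B.* ⟦ y k j ⟧)
      product-homo x y i j = B.trans (sum-homo λ k → x i k A.* y k j) (∑ᴮ.sum-cong-≋ λ k → *-homo (x i k) (y k j))

    Unitary-map : ∀ {n} → Mᴬ.Unitary n → Mᴮ.Unitary n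
    Unitary-map (u , p , q) = (λ i j → ⟦ u i j ⟧) ,
      (λ i j → B.trans (∑ᴮ.sum-cong-≋ λ k → B.*-congʳ (B.sym (⋆-homo (u k i))))
               (B.trans (B.sym (product-homo (u Mᴬ.⋆ᴹ) u i j))
               (B.trans (⟦⟧-cong (p i j)) (1ᴹ-homo i j)))) ,
      (λ i j → B.trans (∑ᴮ.sum-cong-≋ λ k → B.*-congˡ (B.sym (⋆-homo (u j k))))
               (B.trans (B.sym (product-homo u (u Mᴬ.⋆ᴹ) i j))
               (B.trans (⟦⟧-cong (q i j)) (1ᴹ-homo i j))))

    K₁-map : RawGroup.Carrier (K₁ A) → RawGroup.Carrier (K₁ B)
    K₁-map (n , u) = n , Unitary-map u

{-# OPTIONS --safe #-}
module Submission where

-- A purely infinite simple algebra A contains isometries s, t with s* t = 0.  The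
-- isometries tⁱ s place all matrices over A in corners of A, so that every class in K₁
-- is represented by a unitary of A, and the classes of a and b agree if and only if
-- s a s* + 1 - s s* and s b s* + 1 - s s* are homotopic.
--
-- Homotopy is expressed by formulas as follows.  Write α p a = p a p* + 1 - p p*.  If a
-- path from a to b is cut into small steps a = a₀, …, aₙ = b, then a ⊕ (a₁ ⊕ … ⊕ aₙ₋₁) is
-- close to a permutation of b ⊕ (a₁ ⊕ … ⊕ aₙ₋₁), whence v (α p a) d ≈ (α p b) d v for
-- an isometry p and unitaries v, d, up to any prescribed error.  Conversely an error ¼
-- implies that a and b have the same class, because close unitaries are homotopic and
-- commutators vanish in K₁.  The infimum of the error over p, v, d is therefore a
-- definable predicate with a gap, uniformly over all models, and equality in K₁ is given
-- by a formula with values 0 and 1.  Since approximate unitaries are close to unitaries,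
-- the unitaries are a definable set, and K₁(A) is its quotient by this predicate.  With
-- quantifiers over the unitaries, all first-order formulas in K₁(A) become formulas in A.

open import Algebra.Bundles using (Ring; RawGroup)
import Algebra.Properties.Ring as RingProperties
import Algebra.Properties.Semiring.Sum as SemiringSum
open import Algebra.Module.Structures using (IsLeftModule)
open import Axiom.ExcludedMiddle using (ExcludedMiddle)
open import Data.Bool.Base as Bool using (Bool; true; false; if_then_else_; T)
open import Data.Empty using (⊥; ⊥-elim)
import Data.Fin.Properties as Finₚ
open import Data.Fin.Base using (Fin; zero; suc; _↑ˡ_; _↑ʳ_)
open import Data.List.Base as List using (List; []; _∷_; _++_; length)
open import Data.List.Membership.Propositional using (_∈_)
open import Data.List.Relation.Unary.All as All using (All; []; _∷_; lookup)
import Data.List.Relation.Unary.All.Properties as Allₚ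
open import Data.List.Relation.Unary.Any using (here; there)
open import Data.Nat.Base as ℕ using (ℕ)
import Data.Nat.Properties as ℕₚ
open import Data.Product using (Σ; ∃; ∃₂; _×_; _,_; proj₁; proj₂)
open import Data.Sum.Base using (_⊎_; inj₁; inj₂)
open import Data.Unit.Base using (⊤; tt)
open import Data.Vec.Functional as Vector using (Vector)
open import Function.Base using (_∘_)
open import Function.Bundles using (mk⇔)
open import Level using (Level; 0ℓ; _⊔_; Lift; lift; lower) renaming (suc to lsuc)
open import Relation.Binary.PropositionalEquality as ≡ using (_≡_; subst)
open import Relation.Nullary using (¬_; Dec; yes; no; contradiction)
open import Defs

-- Homotopy is not visibly first-order: the number of steps in a path is unbounded, and a formula
-- that counted steps would depend on that number. The certificate makes all steps at once. The
-- errors of the steps lie in orthogonal corners, where the norm of a sum is the maximum of the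
-- norms and not their sum, so one inequality with the error of a single step replaces the path. Of
-- the other models only the theory is known. They inherit s and t because value 0 of one sentence
-- provides approximate pairs, which can be corrected. In A the pair comes from pure infiniteness as
-- soon as there are nonzero b, c with b* c = 0; otherwise every element of A would be a scalar,
-- against dim A > 1. Functional calculus is avoided: square roots are taken only of elements near
-- 1, by Newton's iteration, and paths of unitaries come from Cayley transforms. Most steps thereby
-- become identities in *-rings under a few relations, which rewriting decides.

record StarRing c ℓ : Set (lsuc (c ⊔ ℓ)) where
  field
    ring : Ring c ℓ
  open Ring ring public
  field
    _⋆           : Carrier → Carrier
    ⋆-cong       : ∀ {a b} → a ≈ b → a ⋆ ≈ b ⋆
    ⋆-involutive : ∀ a → (a ⋆) ⋆ ≈ a
    ⋆-+          : ∀ a b → (a + b) ⋆ ≈ (a ⋆) + (b ⋆)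
    ⋆-*          : ∀ a b → (a * b) ⋆ ≈ (b ⋆) * (a ⋆)

-- A decision procedure for identities of *-rings modulo rewriting rules: an
-- element is expanded to a signed sum of words in the generators, and each
-- word is reduced by the rules.

infixl 6 _:+_ _:-_
infixl 7 _:*_
infix  8 :-_ _:⋆
infix  5 _⟶_ _⊜_

data Expr : Set where
  var       : ℕ → Expr
  _:+_ _:*_ : Expr → Expr → Expr
  :-_ _:⋆   : Expr → Expr
  :0 :1     : Expr

_:-_ : Expr → Expr → Expr
x :- y = x :+ (:- y)

data Rule : Set where
  _⟶_ : Expr → Expr → Rule

Letter Word Poly : Set
Letter = ℕ × Bool
Word   = List Letter
Poly   = List (Bool × Word)

data Equation : Set where
  _⊜_ : Expr → Expr → Equation

private
  infixr 6 _&_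
  _&_ : Bool → Bool → Bool
  true  & b = b
  false & b = false

  eqᵇ : Bool → Bool → Bool
  eqᵇ true  b = b
  eqᵇ false b = Bool.not b

  eqˡ : Letter → Letter → Bool
  eqˡ (m , a) (n , b) = (m ℕ.≡ᵇ n) & eqᵇ a b

  eqʷ : Word → Word → Bool
  eqʷ []      []      = true
  eqʷ (x ∷ v) (y ∷ w) = eqˡ x y & eqʷ v w
  eqʷ _       _       = false

  signed : Bool → Poly → Poly
  signed s = List.map λ (t , w) → eqᵇ s t , w

  _>>=_ : Poly → (Word → Poly) → Poly
  []            >>= f = []
  ((s , w) ∷ p) >>= f = signed s (f w) ++ (p >>= f)

  _⊗_ : Poly → Poly → Poly
  p ⊗ q = p >>= λ v → q >>= λ w → (true , v ++ w) ∷ []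

  flip : Letter → Letter
  flip (n , b) = n , Bool.not b

  starʷ : Word → Word
  starʷ []      = []
  starʷ (x ∷ w) = starʷ w ++ flip x ∷ []

  poly : Expr → Poly
  poly (var n)  = (true , (n , false) ∷ []) ∷ []
  poly (e :+ f) = poly e ++ poly f
  poly (e :* f) = poly e ⊗ poly f
  poly (:- e)   = signed false (poly e)
  poly (e :⋆)   = poly e >>= λ w → (true , starʷ w) ∷ []
  poly :0       = []
  poly :1       = (true , []) ∷ []

  -- The first generators, k in number, are central and are moved to the front.
  swaps : ℕ → Letter → Letter → Bool
  swaps k (m , a) (n , b) =
    Bool.not b & (n ℕ.<ᵇ k) & Bool.not (Bool.not a & (m ℕ.<ᵇ ℕ.suc n))

  stripPrefix : Word → Word → Bool × Word
  stripPrefix []      w       = true , w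
  stripPrefix (_ ∷ _) []      = false , []
  stripPrefix (x ∷ v) (y ∷ w) = if eqˡ x y then stripPrefix v w else (false , [])

  CompiledRule : Set
  CompiledRule = Word × Poly

  -- A left side can be matched only if it expands to one word with positive sign. Dropping every
  -- other rule weakens the procedure but keeps it sound.
  compile : List Rule → List CompiledRule
  compile [] = []
  compile ((l ⟶ r) ∷ rs) with poly l
  ... | (true , w) ∷ [] = (w , poly r) ∷ compile rs
  ... | _               = compile rs

  module Reduce (k : ℕ) (rules : List CompiledRule) where
    -- Letters are inserted from the right into a tail that has been reduced before, so rules are
    -- tried at the front of a word only.
    insert : ℕ → Letter → Word → Poly
    try    : ℕ → List CompiledRule → Word → Poly
    tryᵇ   : ℕ → List CompiledRule → Word → Poly → Bool × Word → Poly
    prepend : ℕ → Word → Word → Poly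
    swapped : ℕ → Letter → Word → Poly

    insert ℕ.zero    x w = (true , x ∷ w) ∷ []
    insert (ℕ.suc n) x w = swapped n x w

    swapped n x []      = try n rules (x ∷ [])
    swapped n x (y ∷ w) = if swaps k x y
      then (insert n x w >>= insert n y)
      else try n rules (x ∷ y ∷ w)

    try n []             w = (true , w) ∷ []
    try n ((l , r) ∷ rs) w = tryᵇ n rs w r (stripPrefix l w)

    tryᵇ n rs w r (true  , v) = r >>= λ u → prepend n u v
    tryᵇ n rs w r (false , _) = try n rs w

    prepend n []      w = (true , w) ∷ []
    prepend n (x ∷ v) w = prepend n v w >>= insert n x

    -- Every value is sound, because a word left unreduced keeps its value. The number only limits
    -- the depth of nested rewriting.
    fuel : ℕ
    fuel = 60

    reduce : Poly → Poly
    reduce p = p >>= λ w → prepend fuel w []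

  remove : Bool → Word → Poly → Bool × Poly
  remove s w [] = false , []
  remove s w ((t , v) ∷ p) =
    if Bool.not (eqᵇ s t) & eqʷ w v then (true , p) else
      (proj₁ (remove s w p) , (t , v) ∷ proj₂ (remove s w p))

  isZero : ℕ → Poly → Bool
  isZero _         []            = true
  isZero ℕ.zero    (_ ∷ _)       = false
  isZero (ℕ.suc n) ((s , w) ∷ p) = proj₁ (remove s w p) & isZero n (proj₂ (remove s w p))

check : ℕ → List Rule → Equation → Bool
check k rs (l ⊜ r) = isZero (length q) q
  where q = Reduce.reduce k (compile rs) (poly (l :- r))

-- Lets an identity be written with bound names for its generators; the names are instantiated by
-- consecutive variables.
Curried : ℕ → Set → Set
Curried ℕ.zero    B = B
Curried (ℕ.suc n) B = Expr → Curried n B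

applyFrom : ∀ {B} m n → Curried n B → B
applyFrom m ℕ.zero    f = f
applyFrom m (ℕ.suc n) f = applyFrom (ℕ.suc m) n (f (var m))

-- Soundness of the decision procedure.

module Solver {c ℓ} (S : StarRing c ℓ) where
  open StarRing S
  open RingProperties ring
  open import Relation.Binary.Reasoning.Setoid setoid

  ⋆-0 : 0# ⋆ ≈ 0#
  ⋆-0 = +-cancelˡ (0# ⋆) _ _
    (trans (sym (⋆-+ 0# 0#)) (trans (⋆-cong (+-identityˡ 0#)) (sym (+-identityʳ _))))

  ⋆-1 : 1# ⋆ ≈ 1#
  ⋆-1 = begin
    1# ⋆               ≈⟨ *-identityʳ _ ⟨
    1# ⋆ * 1#          ≈⟨ *-congˡ (⋆-involutive 1#) ⟨
    1# ⋆ * (1# ⋆) ⋆    ≈⟨ ⋆-* _ _ ⟨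
    (1# ⋆ * 1#) ⋆      ≈⟨ ⋆-cong (*-identityʳ _) ⟩
    (1# ⋆) ⋆           ≈⟨ ⋆-involutive _ ⟩
    1#                 ∎

  ⋆-neg : ∀ a → (- a) ⋆ ≈ - (a ⋆)
  ⋆-neg a = sym (+-cancelˡ (a ⋆) _ _ (trans (-‿inverseʳ _) (sym
    (trans (sym (⋆-+ a (- a))) (trans (⋆-cong (-‿inverseʳ a)) ⋆-0)))))

  at : List Carrier → ℕ → Carrier
  at []      _         = 0#
  at (x ∷ _) ℕ.zero    = x
  at (_ ∷ ρ) (ℕ.suc n) = at ρ n

  ⟦_⟧ : Expr → List Carrier → Carrier
  ⟦ var n  ⟧ ρ = at ρ n
  ⟦ e :+ f ⟧ ρ = ⟦ e ⟧ ρ + ⟦ f ⟧ ρ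
  ⟦ e :* f ⟧ ρ = ⟦ e ⟧ ρ * ⟦ f ⟧ ρ
  ⟦ :- e   ⟧ ρ = - ⟦ e ⟧ ρ
  ⟦ e :⋆   ⟧ ρ = ⟦ e ⟧ ρ ⋆
  ⟦ :0     ⟧ ρ = 0#
  ⟦ :1     ⟧ ρ = 1#

  Holds : List Carrier → Rule → Set ℓ
  Holds ρ (l ⟶ r) = ⟦ l ⟧ ρ ≈ ⟦ r ⟧ ρ

  Central : Carrier → Set (c ⊔ ℓ)
  Central z = ∀ x → x * z ≈ z * x

  private
    module Correct (cs : List Carrier) (central : All Central cs) (vs : List Carrier) where

      ρ : List Carrier
      ρ = cs ++ vs

      lv : Letter → Carrier
      lv (n , false) = at ρ n
      lv (n , true)  = at ρ n ⋆

      wv : Word → Carrier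
      wv []      = 1#
      wv (x ∷ w) = lv x * wv w

      sv : Bool → Carrier → Carrier
      sv true  a = a
      sv false a = - a

      pv : Poly → Carrier
      pv []            = 0#
      pv ((s , w) ∷ p) = sv s (wv w) + pv p

      sv-cong : ∀ s {a b} → a ≈ b → sv s a ≈ sv s b
      sv-cong true  p = p
      sv-cong false p = -‿cong p

      sv-+ : ∀ s a b → sv s (a + b) ≈ sv s a + sv s b
      sv-+ true  a b = refl
      sv-+ false a b = sym (-‿+-comm a b)

      sv-0 : ∀ s → sv s 0# ≈ 0#
      sv-0 true  = refl
      sv-0 false = -0#≈0#

      sv-*ʳ : ∀ s a b → sv s a * b ≈ sv s (a * b)
      sv-*ʳ true  a b = refl
      sv-*ʳ false a b = sym (-‿distribˡ-* a b)

      sv-*ˡ : ∀ s a b → a * sv s b ≈ sv s (a * b)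
      sv-*ˡ true  a b = refl
      sv-*ˡ false a b = sym (-‿distribʳ-* a b)

      sv-sv : ∀ s t a → sv (eqᵇ s t) a ≈ sv s (sv t a)
      sv-sv true  t     a = refl
      sv-sv false true  a = refl
      sv-sv false false a = sym (-‿involutive a)

      sv-⋆ : ∀ s a → sv s a ⋆ ≈ sv s (a ⋆)
      sv-⋆ true  a = refl
      sv-⋆ false a = ⋆-neg a

      pv-++ : ∀ p q → pv (p ++ q) ≈ pv p + pv q
      pv-++ []            q = sym (+-identityˡ _)
      pv-++ ((s , w) ∷ p) q = trans (+-congˡ (pv-++ p q)) (sym (+-assoc _ _ _))

      pv-signed : ∀ s p → pv (signed s p) ≈ sv s (pv p)
      pv-signed s []            = sym (sv-0 s)
      pv-signed s ((t , w) ∷ p) =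
        trans (+-cong (sv-sv s t _) (pv-signed s p)) (sym (sv-+ s _ _))

      -- One induction for all uses of bind: `F` is an additive map, namely multiplication on one
      -- side, the involution, or the identity.
      pv->>= : ∀ (F : Carrier → Carrier) → (∀ {a b} → a ≈ b → F a ≈ F b) → F 0# ≈ 0# →
               (∀ s a b → F (sv s a + b) ≈ sv s (F a) + F b) →
               ∀ p f → (∀ w → pv (f w) ≈ F (wv w)) → pv (p >>= f) ≈ F (pv p)
      pv->>= F F-cong F0 F+ []            f h = sym F0
      pv->>= F F-cong F0 F+ ((s , w) ∷ p) f h = begin
        pv (signed s (f w) ++ (p >>= f))     ≈⟨ pv-++ (signed s (f w)) _ ⟩
        pv (signed s (f w)) + pv (p >>= f)   ≈⟨ +-cong (trans (pv-signed s (f w)) (sv-cong s (h w)))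
                                                       (pv->>= F F-cong F0 F+ p f h) ⟩
        sv s (F (wv w)) + F (pv p)           ≈⟨ F+ s _ _ ⟨
        F (sv s (wv w) + pv p)               ∎

      pv->>=ʳ : ∀ b p f → (∀ w → pv (f w) ≈ wv w * b) → pv (p >>= f) ≈ pv p * b
      pv->>=ʳ b = pv->>= (_* b) *-congʳ (zeroˡ b)
        λ s x y → trans (distribʳ b _ _) (+-congʳ (sv-*ʳ s x b))

      pv->>=ˡ : ∀ a p f → (∀ w → pv (f w) ≈ a * wv w) → pv (p >>= f) ≈ a * pv p
      pv->>=ˡ a = pv->>= (a *_) *-congˡ (zeroʳ a)
        λ s x y → trans (distribˡ a _ _) (+-congʳ (sv-*ˡ s a x))

      pv->>=id : ∀ p f → (∀ w → pv (f w) ≈ wv w) → pv (p >>= f) ≈ pv p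
      pv->>=id = pv->>= (λ a → a) (λ p → p) refl λ _ _ _ → refl

      pv-word : ∀ w → pv ((true , w) ∷ []) ≈ wv w
      pv-word w = +-identityʳ _

      wv-++ : ∀ v w → wv (v ++ w) ≈ wv v * wv w
      wv-++ []      w = sym (*-identityˡ _)
      wv-++ (x ∷ v) w = trans (*-congˡ (wv-++ v w)) (sym (*-assoc _ _ _))

      pv-⊗ : ∀ p q → pv (p ⊗ q) ≈ pv p * pv q
      pv-⊗ p q = pv->>=ʳ (pv q) p _ λ v → pv->>=ˡ (wv v) q _ λ w → trans (pv-word (v ++ w)) (wv-++ v w)

      lv-flip : ∀ x → lv (flip x) ≈ lv x ⋆
      lv-flip (n , false) = refl
      lv-flip (n , true)  = sym (⋆-involutive _)

      wv-star : ∀ w → wv (starʷ w) ≈ wv w ⋆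
      wv-star []      = sym ⋆-1
      wv-star (x ∷ w) = begin
        wv (starʷ w ++ flip x ∷ [])       ≈⟨ wv-++ (starʷ w) _ ⟩
        wv (starʷ w) * (lv (flip x) * 1#) ≈⟨ *-cong (wv-star w) (trans (*-identityʳ _) (lv-flip x)) ⟩
        wv w ⋆ * lv x ⋆                   ≈⟨ ⋆-* _ _ ⟨
        (lv x * wv w) ⋆                   ∎

      pv-poly : ∀ e → pv (poly e) ≈ ⟦ e ⟧ ρ
      pv-poly (var n)  = trans (+-identityʳ _) (*-identityʳ _)
      pv-poly (e :+ f) = trans (pv-++ (poly e) _) (+-cong (pv-poly e) (pv-poly f))
      pv-poly (e :* f) = trans (pv-⊗ (poly e) (poly f)) (*-cong (pv-poly e) (pv-poly f))
      pv-poly (:- e)   = trans (pv-signed false (poly e)) (-‿cong (pv-poly e))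
      pv-poly (e :⋆)   = trans
        (pv->>= _⋆ ⋆-cong ⋆-0 (λ s a b → trans (⋆-+ _ _) (+-congʳ (sv-⋆ s a)))
                (poly e) _ λ w → trans (pv-word (starʷ w)) (wv-star w))
        (⋆-cong (pv-poly e))
      pv-poly :0       = refl
      pv-poly :1       = +-identityʳ _

      &-T : ∀ a {b} → T (a & b) → T a × T b
      &-T true t = tt , t

      eqᵇ-T : ∀ a b → T (eqᵇ a b) → a ≡ b
      eqᵇ-T true  true  _ = ≡.refl
      eqᵇ-T false false _ = ≡.refl

      eqˡ-T : ∀ x y → T (eqˡ x y) → x ≡ y
      eqˡ-T (m , a) (n , b) t =
        ≡.cong₂ _,_ (ℕₚ.≡ᵇ⇒≡ m n (proj₁ (&-T _ t))) (eqᵇ-T a b (proj₂ (&-T (m ℕ.≡ᵇ n) t)))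

      eqʷ-T : ∀ v w → T (eqʷ v w) → v ≡ w
      eqʷ-T []      []      _ = ≡.refl
      eqʷ-T (x ∷ v) (y ∷ w) t =
        ≡.cong₂ _∷_ (eqˡ-T x y (proj₁ (&-T _ t))) (eqʷ-T v w (proj₂ (&-T (eqˡ x y) t)))

      at-central : ∀ n → T (n ℕ.<ᵇ length cs) → Central (at ρ n)
      at-central n = go cs central n
        where
        go : ∀ ds → All Central ds → ∀ n → T (n ℕ.<ᵇ length ds) → Central (at (ds ++ vs) n)
        go (_ ∷ _)  (p ∷ _)  ℕ.zero    _ = p
        go (_ ∷ ds) (_ ∷ ps) (ℕ.suc n) t = go ds ps n t

      swaps-T : ∀ x y → T (swaps (length cs) x y) → lv x * lv y ≈ lv y * lv x
      swaps-T x (n , false) t = at-central n (proj₁ (&-T (n ℕ.<ᵇ length cs) t)) (lv x)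

      stripPrefix-T : ∀ v w → T (proj₁ (stripPrefix v w)) → w ≡ v ++ proj₂ (stripPrefix v w)
      stripPrefix-T []      w       _ = ≡.refl
      stripPrefix-T (x ∷ v) (y ∷ w) t with eqˡ x y | eqˡ-T x y
      ... | true | eq = ≡.cong₂ _∷_ (≡.sym (eq tt)) (stripPrefix-T v w t)

      Valid : CompiledRule → Set ℓ
      Valid (l , r) = wv l ≈ pv r

      compile-valid : ∀ rs → All (Holds ρ) rs → All Valid (compile rs)
      compile-valid [] [] = []
      compile-valid ((l ⟶ r) ∷ rs) (h ∷ hs) with poly l | pv-poly l
      ... | []                  | _ = compile-valid rs hs
      ... | (true , w) ∷ []     | p =
        trans (trans (sym (pv-word w)) p) (trans h (sym (pv-poly r))) ∷ compile-valid rs hs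
      ... | (true , _) ∷ _ ∷ _  | _ = compile-valid rs hs
      ... | (false , _) ∷ _     | _ = compile-valid rs hs

      module _ (rules : List CompiledRule) (valid : All Valid rules) where
        open Reduce (length cs) rules

        insert-correct  : ∀ n x w → pv (insert n x w) ≈ lv x * wv w
        swapped-correct : ∀ n x w → pv (swapped n x w) ≈ lv x * wv w
        try-correct     : ∀ n rs → All Valid rs → ∀ w → pv (try n rs w) ≈ wv w
        tryᵇ-correct    : ∀ n rs → All Valid rs → ∀ w r b,v →
                          (T (proj₁ b,v) → wv w ≈ pv r * wv (proj₂ b,v)) → pv (tryᵇ n rs w r b,v) ≈ wv w
        prepend-correct : ∀ n v w → pv (prepend n v w) ≈ wv v * wv w

        insert-correct ℕ.zero    x w = pv-word (x ∷ w)
        insert-correct (ℕ.suc n) x w = swapped-correct n x w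

        swapped-correct n x []      = try-correct n rules valid _
        swapped-correct n x (y ∷ w) with swaps (length cs) x y | swaps-T x y
        ... | false | _ = try-correct n rules valid _
        ... | true  | h = begin
          pv (insert n x w >>= insert n y)  ≈⟨ pv->>=ˡ (lv y) (insert n x w) _ (insert-correct n y) ⟩
          lv y * pv (insert n x w)          ≈⟨ *-congˡ (insert-correct n x w) ⟩
          lv y * (lv x * wv w)              ≈⟨ *-assoc _ _ _ ⟨
          (lv y * lv x) * wv w              ≈⟨ *-congʳ (h tt) ⟨
          (lv x * lv y) * wv w              ≈⟨ *-assoc _ _ _ ⟩
          lv x * (lv y * wv w)              ∎

        try-correct n []             []       w = pv-word w
        try-correct n ((l , r) ∷ rs) (h ∷ hs) w = tryᵇ-correct n rs hs w r (stripPrefix l w) λ t →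
          trans (trans (reflexive (≡.cong wv (stripPrefix-T l w t))) (wv-++ l _)) (*-congʳ h)

        tryᵇ-correct n rs hs w r (true  , v) h =
          trans (pv->>=ʳ (wv v) r _ λ u → prepend-correct n u v) (sym (h tt))
        tryᵇ-correct n rs hs w r (false , _) h = try-correct n rs hs w

        prepend-correct n []      w = trans (pv-word w) (sym (*-identityˡ _))
        prepend-correct n (x ∷ v) w = begin
          pv (prepend n v w >>= insert n x)  ≈⟨ pv->>=ˡ (lv x) (prepend n v w) _ (insert-correct n x) ⟩
          lv x * pv (prepend n v w)          ≈⟨ *-congˡ (prepend-correct n v w) ⟩
          lv x * (wv v * wv w)               ≈⟨ *-assoc _ _ _ ⟨
          (lv x * wv v) * wv w               ∎

        reduce-correct : ∀ p → pv (reduce p) ≈ pv p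
        reduce-correct p = pv->>=id p _ λ w → trans (prepend-correct fuel w []) (*-identityʳ _)

      sv-opposite : ∀ s t a → T (Bool.not (eqᵇ s t)) → sv s a + sv t a ≈ 0#
      sv-opposite true  false a _ = -‿inverseʳ a
      sv-opposite false true  a _ = -‿inverseˡ a

      remove-correct : ∀ s w p → T (proj₁ (remove s w p)) →
                       sv s (wv w) + pv p ≈ pv (proj₂ (remove s w p))
      remove-correct s w ((t , v) ∷ p) h
        with Bool.not (eqᵇ s t) & eqʷ w v | &-T (Bool.not (eqᵇ s t)) {eqʷ w v}
      ... | true | q = begin
          sv s (wv w) + (sv t (wv v) + pv p)  ≈⟨ +-assoc _ _ _ ⟨
          (sv s (wv w) + sv t (wv v)) + pv p
            ≈⟨ +-congʳ (trans (+-congˡ (reflexive (≡.cong (sv t ∘ wv) (≡.sym (eqʷ-T w v (proj₂ (q tt)))))))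
                              (sv-opposite s t (wv w) (proj₁ (q tt)))) ⟩
          0# + pv p                           ≈⟨ +-identityˡ _ ⟩
          pv p                                ∎
      ... | false | _ = begin
          sv s (wv w) + (sv t (wv v) + pv p)  ≈⟨ +-assoc _ _ _ ⟨
          (sv s (wv w) + sv t (wv v)) + pv p  ≈⟨ +-congʳ (+-comm _ _) ⟩
          (sv t (wv v) + sv s (wv w)) + pv p  ≈⟨ +-assoc _ _ _ ⟩
          sv t (wv v) + (sv s (wv w) + pv p)  ≈⟨ +-congˡ (remove-correct s w p h) ⟩
          sv t (wv v) + pv (proj₂ (remove s w p)) ∎

      isZero-correct : ∀ n p → T (isZero n p) → pv p ≈ 0#
      isZero-correct _         []            _ = refl
      isZero-correct (ℕ.suc n) ((s , w) ∷ p) h =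
        trans (remove-correct s w p (proj₁ (&-T (proj₁ (remove s w p)) h)))
          (isZero-correct n (proj₂ (remove s w p)) (proj₂ (&-T (proj₁ (remove s w p)) h)))

      check-correct : ∀ rs l r → All (Holds ρ) rs → T (check (length cs) rs (l ⊜ r)) →
                      ⟦ l ⟧ ρ ≈ ⟦ r ⟧ ρ
      check-correct rs l r hs t = x∙y⁻¹≈ε⇒x≈y _ _ (begin
        ⟦ l :- r ⟧ ρ              ≈⟨ pv-poly (l :- r) ⟨
        pv (poly (l :- r))        ≈⟨ reduce-correct (compile rs) (compile-valid rs hs) (poly (l :- r)) ⟨
        pv reduced                ≈⟨ isZero-correct (length reduced) reduced t ⟩
        0#                        ∎)
        where
        reduced : Poly
        reduced = Reduce.reduce (length cs) (compile rs) (poly (l :- r))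

  Valid : List Carrier → Equation → Set ℓ
  Valid ρ (l ⊜ r) = ⟦ l ⟧ ρ ≈ ⟦ r ⟧ ρ

  private
    check-valid : ∀ cs → All Central cs → ∀ vs rs eq → All (Holds (cs ++ vs)) rs →
                  T (check (length cs) rs eq) → Valid (cs ++ vs) eq
    check-valid cs zs vs rs (l ⊜ r) = Correct.check-correct cs zs vs rs l r

  Problem : List Carrier → List Carrier → Set
  Problem cs vs = Curried (length (cs ++ vs)) (List Rule × Equation)

  problem : ∀ cs vs → Problem cs vs → List Rule × Equation
  problem cs vs = applyFrom 0 (length (cs ++ vs))

  -- Proof by reflection: the implicit argument is inferred because its type computes to `⊤` when
  -- the check succeeds.
  solveᶜ : ∀ cs → All Central cs → ∀ vs (f : Problem cs vs) →
           All (Holds (cs ++ vs)) (proj₁ (problem cs vs f)) →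
           {_ : T (check (length cs) (proj₁ (problem cs vs f)) (proj₂ (problem cs vs f)))} →
           Valid (cs ++ vs) (proj₂ (problem cs vs f))
  solveᶜ cs zs vs f hs {t} = check-valid cs zs vs _ (proj₂ (problem cs vs f)) hs t

  solve : ∀ vs (f : Problem [] vs) → All (Holds vs) (proj₁ (problem [] vs f)) →
          {_ : T (check 0 (proj₁ (problem [] vs f)) (proj₂ (problem [] vs f)))} →
          Valid vs (proj₂ (problem [] vs f))
  solve = solveᶜ [] []

-- Real numbers: order, suprema, compactness of boxes.

module Reals (em : ∀ {ℓ} → ExcludedMiddle ℓ) (R : CompleteOrderedField) where
  open Setting em R using (sup; IsSup; inf; IsInf; ContinuousFunction)
  open CompleteOrderedField R hiding (zero) renaming (_⁻¹ to infix 8 _⁻¹ʳ)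

  -- With the trivial involution, and all generators declared central, the same procedure decides
  -- polynomial identities of real numbers.
  ℝ-starRing : StarRing 0ℓ 0ℓ
  ℝ-starRing = record
    { ring = ring ; _⋆ = λ a → a ; ⋆-cong = λ p → p ; ⋆-involutive = λ _ → refl
    ; ⋆-+ = λ _ _ → refl ; ⋆-* = *-comm }

  private module S = Solver ℝ-starRing

  solveᴿ : ∀ cs (f : S.Problem cs []) →
           All (S.Holds (cs ++ [])) (proj₁ (S.problem cs [] f)) →
           {_ : T (check (length cs) (proj₁ (S.problem cs [] f)) (proj₂ (S.problem cs [] f)))} →
           S.Valid (cs ++ []) (proj₂ (S.problem cs [] f))
  solveᴿ cs f hs {t} = S.solveᶜ cs (All.universal (λ c x → *-comm x c) cs) [] f hs {t}

  -- The identity says y - x = r - l. A linear inequality is thus proved by adding up its hypotheses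
  -- to `l ≤ r` and leaving a ring identity to the solver.
  lin : ∀ {l r x y} → l ≤ r → x + r ≈ y + l → x ≤ y
  lin {l} {r} {x} {y} p q = 0≤y-x⇒x≤y (≤-respʳ-≈ (trans
    (solveᴿ (x ∷ y ∷ l ∷ r ∷ []) (λ x y l r → [] , r :- l ⊜ (y :- x) :+ ((x :+ r) :- (y :+ l))) [])
    (trans (+-congˡ (trans (+-congʳ q) (-‿inverseʳ _))) (+-identityʳ _))) (x≤y⇒0≤y-x p))

  ≤-resp : ∀ {a b c d} → a ≈ b → c ≈ d → a ≤ c → b ≤ d
  ≤-resp p q r = ≤-respˡ-≈ p (≤-respʳ-≈ q r)

  <⇒≤ : ∀ {x y} → x < y → x ≤ y
  <⇒≤ = proj₁

  ≰⇒> : ∀ {x y} → ¬ x ≤ y → y < x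
  ≰⇒> {x} {y} p with total x y
  ... | inj₁ q = contradiction q p
  ... | inj₂ q = q , λ y≈x → p (≤-reflexive (sym y≈x))

  ≤⇒≯ : ∀ {x y} → x ≤ y → ¬ y < x
  ≤⇒≯ p (q , r) = r (antisym q p)

  <-≤-trans : ∀ {x y z} → x < y → y ≤ z → x < z
  <-≤-trans (p , q) r = ≤-trans p r , λ x≈z → q (antisym p (≤-trans r (≤-reflexive (sym x≈z))))

  ≤-<-trans : ∀ {x y z} → x ≤ y → y < z → x < z
  ≤-<-trans r (p , q) = ≤-trans r p , λ x≈z → q (antisym p (≤-trans (≤-reflexive (sym x≈z)) r))

  <-resp : ∀ {a b c d} → a ≈ b → c ≈ d → a < c → b < d
  <-resp p q (r , s) = ≤-resp p q r , λ b≈d → s (trans p (trans b≈d (sym q)))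

  0<1 : 0# < 1#
  0<1 = 0≤1 , λ p → 1≉0 (sym p)

  +-pos : ∀ {x y} → 0# < x → 0# ≤ y → 0# < x + y
  +-pos {x} p q = <-≤-trans p (≤-respˡ-≈ (+-identityʳ x) (+-monoʳ-≤ x q))

  *-zero-product : ∀ {x y} → ¬ x ≈ 0# → x * y ≈ 0# → y ≈ 0#
  *-zero-product {x} {y} p q = trans
    (solveᴿ (x ∷ x ⁻¹ʳ ∷ y ∷ []) (λ x i y → (x :* i ⟶ :1) ∷ [] , y ⊜ i :* (x :* y)) (*-inverseʳ p ∷ []))
    (trans (*-congˡ q) (zeroʳ _))

  *-pos : ∀ {x y} → 0# < x → 0# < y → 0# < x * y
  *-pos (p , p′) (q , q′) = *-nonneg p q , λ r →
    q′ (sym (*-zero-product (λ x≈0 → p′ (sym x≈0)) (sym r)))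

  pos⇒≉0 : ∀ {x} → 0# < x → ¬ x ≈ 0#
  pos⇒≉0 (_ , p) q = p (sym q)

  ⁻¹-pos : ∀ {x} → 0# < x → 0# < x ⁻¹ʳ
  ⁻¹-pos {x} p with total 0# (x ⁻¹ʳ)
  ... | inj₁ q = q , λ r → 1≉0 (trans (sym (*-inverseʳ (pos⇒≉0 p))) (trans (*-congˡ (sym r)) (zeroʳ x)))
  ... | inj₂ q = contradiction (antisym (≤-respˡ-≈ (*-inverseʳ (pos⇒≉0 p))
      (≤-respʳ-≈ (zeroʳ x) (*-monoʳ-≤ (<⇒≤ p) q))) 0≤1) 1≉0

  2# : Carrier
  2# = 1# + 1#

  0<2 : 0# < 2#
  0<2 = +-pos 0<1 0≤1

  ½ : Carrier
  ½ = 2# ⁻¹ʳ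

  0<½ : 0# < ½
  0<½ = ⁻¹-pos 0<2

  0≤½ : 0# ≤ ½
  0≤½ = <⇒≤ 0<½

  ½+½≈1 : ½ + ½ ≈ 1#
  ½+½≈1 = trans (solveᴿ (½ ∷ []) (λ h → [] , h :+ h ⊜ (:1 :+ :1) :* h) []) (*-inverseʳ (pos⇒≉0 0<2))

  half : Carrier → Carrier
  half x = ½ * x

  half+half : ∀ x → half x + half x ≈ x
  half+half x = trans (sym (distribʳ x ½ ½)) (trans (*-congʳ ½+½≈1) (*-identityˡ x))

  half-pos : ∀ {x} → 0# < x → 0# < half x
  half-pos = *-pos 0<½

  half-nonneg : ∀ {x} → 0# ≤ x → 0# ≤ half x
  half-nonneg = *-nonneg 0≤½

  half≤ : ∀ {x} → 0# ≤ x → half x ≤ x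
  half≤ {x} p = lin (half-nonneg p) (trans (half+half x) (sym (+-identityʳ x)))

  ½≤1 : ½ ≤ 1#
  ½≤1 = lin 0≤½ (trans ½+½≈1 (sym (+-identityʳ _)))

  *-monoˡ-≤ : ∀ {x y z} → 0# ≤ z → x ≤ y → x * z ≤ y * z
  *-monoˡ-≤ p q = ≤-resp (*-comm _ _) (*-comm _ _) (*-monoʳ-≤ p q)

  ≤-ε : ∀ {x y} → (∀ η → 0# < η → x ≤ y + η) → x ≤ y
  ≤-ε {x} {y} h with em {P = x ≤ y}
  ... | yes p = p
  ... | no  p = contradiction (half-pos 0<d) (≤⇒≯ (lin (h (half d) (half-pos 0<d))
                  (trans (solveᴿ (half d ∷ y ∷ x ∷ []) (λ e y x → [] , e :+ (y :+ e) ⊜ (e :+ e) :+ y) [])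
                    (trans (+-congʳ (half+half d))
                      (solveᴿ (y ∷ x ∷ []) (λ y x → [] , (x :- y) :+ y ⊜ :0 :+ x) [])))))
    where
    d = x - y
    0<d : 0# < d
    0<d with ≰⇒> p
    ... | q , r = x≤y⇒0≤y-x q , λ 0≈d → r (sym (trans
      (solveᴿ (x ∷ y ∷ []) (λ x y → [] , x ⊜ (x :- y) :+ y) []) (trans (+-congʳ (sym 0≈d)) (+-identityˡ y))))

  ≈-ε : ∀ {x y} → (∀ η → 0# < η → Within η x y) → x ≈ y
  ≈-ε h = antisym (≤-ε λ η p → proj₁ (h η p)) (≤-ε λ η p → proj₂ (h η p))

  nonneg-ε : ∀ {x} → 0# ≤ x → (∀ η → 0# < η → x ≤ η) → x ≈ 0#
  nonneg-ε p h = antisym (≤-ε λ η q → ≤-respʳ-≈ (sym (+-identityˡ η)) (h η q)) p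

  Bound : Carrier → Carrier → Set
  Bound b x = - b ≤ x × x ≤ b

  bound-mono : ∀ {b c x} → b ≤ c → Bound b x → Bound c x
  bound-mono {b} {c} p (q , r) = ≤-trans (lin p (solveᴿ (b ∷ c ∷ []) (λ b c → [] ,
    (:- c) :+ c ⊜ (:- b) :+ b) [])) q , ≤-trans r p

  common : ∀ {a b} → 0# < a → 0# < b → ∃ λ c → 0# < c × c ≤ a × c ≤ b
  common {a} {b} p q with total a b
  ... | inj₁ r = a , p , ≤-refl , r
  ... | inj₂ r = b , q , r , ≤-refl

  upper : ∀ a b → ∃ λ c → a ≤ c × b ≤ c
  upper a b with total a b
  ... | inj₁ r = b , r , ≤-refl
  ... | inj₂ r = a , ≤-refl , r

  -- The choice δ = η / (b + 1) covers b = 0 as well.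
  shrink : ∀ b → 0# ≤ b → ∀ η → 0# < η → ∃ λ δ → 0# < δ × b * δ ≤ η
  shrink b p η q = η * c , *-pos q (⁻¹-pos 0<b+1) , lin (*-nonneg (<⇒≤ q) (<⇒≤ (⁻¹-pos 0<b+1)))
    (solveᴿ (η ∷ b ∷ c ∷ []) (λ η b c → (b :* c ⟶ :1 :- c) ∷ [] ,
      b :* (η :* c) :+ η :* c ⊜ η :+ :0) (
      trans (solveᴿ (b ∷ c ∷ []) (λ b c → [] , b :* c ⊜ (b :+ :1) :* c :- c) [])
            (+-congʳ (*-inverseʳ (pos⇒≉0 0<b+1))) ∷ []))
    where
    0<b+1 : 0# < b + 1#
    0<b+1 = <-resp refl (+-comm _ _) (+-pos 0<1 p)
    c = (b + 1#) ⁻¹ʳ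

  Within-refl : ∀ {η x} → 0# ≤ η → Within η x x
  Within-refl {η} {x} p = q , q
    where
    q : x ≤ x + η
    q = ≤-respˡ-≈ (+-identityʳ x) (+-monoʳ-≤ x p)

  Within-sym : ∀ {η x y} → Within η x y → Within η y x
  Within-sym (p , q) = q , p

  Within-mono : ∀ {η δ x y} → η ≤ δ → Within η x y → Within δ x y
  Within-mono p (q , r) = ≤-trans q (+-monoʳ-≤ _ p) , ≤-trans r (+-monoʳ-≤ _ p)

  Within-trans : ∀ {η δ x y z} → Within η x y → Within δ y z → Within (η + δ) x z
  Within-trans {η} {δ} {x} {y} {z} (p , p′) (q , q′) =
    lin (+-mono-≤ p q) (solveᴿ (x ∷ y ∷ z ∷ η ∷ δ ∷ []) (λ x y z e d → [] ,
      x :+ ((y :+ e) :+ (z :+ d)) ⊜ (z :+ (e :+ d)) :+ (x :+ y)) []) ,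
    lin (+-mono-≤ p′ q′) (solveᴿ (x ∷ y ∷ z ∷ η ∷ δ ∷ []) (λ x y z e d → [] ,
      z :+ ((x :+ e) :+ (y :+ d)) ⊜ (x :+ (e :+ d)) :+ (y :+ z)) [])

  Within-half : ∀ {η x y z} → Within (half η) x y → Within (half η) y z → Within η x z
  Within-half {η} p q = Within-mono (≤-reflexive (half+half η)) (Within-trans p q)

  Within-resp : ∀ {η x y x′ y′} → x ≈ x′ → y ≈ y′ → Within η x y → Within η x′ y′
  Within-resp p q (r , s) = ≤-resp p (+-congʳ q) r , ≤-resp q (+-congʳ p) s

  Within-reflexive : ∀ {η x y} → 0# ≤ η → x ≈ y → Within η x y
  Within-reflexive p q = Within-resp refl q (Within-refl p)

  square-cancel : ∀ {x y} → 0# ≤ y → x * x ≤ y * y → x ≤ y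
  square-cancel {x} {y} 0≤y xx≤yy with em {P = x ≤ y}
  ... | yes p = p
  ... | no ¬p with ≰⇒> ¬p
  ...   | y≤x , y≉x with em {P = x ≈ y}
  ...     | yes x≈y = ≤-reflexive x≈y
  ...     | no  x≉y = contradiction x≉y (squares-≤⇒¬¬≈ 0≤y y≤x xx≤yy)

  square-mono : ∀ {x y} → 0# ≤ x → x ≤ y → x * x ≤ y * y
  square-mono p q = *-mono-≤ p (≤-trans p q) q q

  -- Lowers a predicate to the level required by the supremum axiom.
  private
    ⌊_⌋ : ∀ {p} → Set p → Set
    ⌊ P ⌋ with em {P = P}
    ... | yes _ = ⊤
    ... | no  _ = ⊥

    lowerP : ∀ {p} {P : Set p} → P → ⌊ P ⌋
    lowerP {P = P} x with em {P = P}
    ... | yes _ = tt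
    ... | no ¬x = ¬x x

    raiseP : ∀ {p} {P : Set p} → ⌊ P ⌋ → P
    raiseP {P = P} t with em {P = P}
    ... | yes x = x

  lub : ∀ {p} (P : Carrier → Set p) → ∃ P → (∃ λ b → ∀ x → P x → x ≤ b) →
        ∃ λ s → (∀ x → P x → x ≤ s) × (∀ b → (∀ x → P x → x ≤ b) → s ≤ b)
  lub P (x , Px) (b , h) with supremum (λ x → ⌊ P x ⌋) (x , lowerP Px) (b , λ x q → h x (raiseP q))
  ... | s , up , least = s , (λ x q → up x (lowerP q)) , λ b h → least b λ x q → h x (raiseP q)

  module _ {ℓ} {X : Set ℓ} (f : X → Carrier) (x₀ : X) where

    sup-isSup : ∀ b → (∀ x → f x ≤ b) → IsSup f (sup f)
    sup-isSup b h with em {P = ∃ (IsSup f)}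
    ... | yes (_ , p) = p
    ... | no  ¬p with lub (λ r → ∃ λ x → r ≈ f x) (f x₀ , x₀ , refl)
                       (b , λ r (x , r≈fx) → ≤-respˡ-≈ (sym r≈fx) (h x))
    ...   | s , up , least = contradiction (s , (λ x → up (f x) (x , refl)) ,
              λ c q → least c λ r (x , r≈fx) → ≤-respˡ-≈ (sym r≈fx) (q x)) ¬p

    inf-isInf : ∀ b → (∀ x → b ≤ f x) → IsInf f (inf f)
    inf-isInf b h with em {P = ∃ (IsInf f)}
    ... | yes (_ , p) = p
    ... | no  ¬p with lub (λ r → ∀ x → r ≤ f x) (b , h) (f x₀ , λ r q → q x₀)
    ...   | s , up , least = contradiction (s , (λ x → least (f x) λ r q → q x) , up) ¬p

  module _ {ℓ} {X : Set ℓ} {f g : X → Carrier} (f≈g : ∀ x → f x ≈ g x) where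

    private
      to-sup : ∀ {s} → IsSup f s → IsSup g s
      to-sup (a , b) = (λ x → ≤-respˡ-≈ (f≈g x) (a x)) , λ c h → b c λ x → ≤-respˡ-≈ (sym (f≈g x)) (h x)
      from-sup : ∀ {s} → IsSup g s → IsSup f s
      from-sup (a , b) = (λ x → ≤-respˡ-≈ (sym (f≈g x)) (a x)) , λ c h → b c λ x → ≤-respˡ-≈ (f≈g x) (h x)
      to-inf : ∀ {s} → IsInf f s → IsInf g s
      to-inf (a , b) = (λ x → ≤-respʳ-≈ (f≈g x) (a x)) , λ c h → b c λ x → ≤-respʳ-≈ (sym (f≈g x)) (h x)
      from-inf : ∀ {s} → IsInf g s → IsInf f s
      from-inf (a , b) = (λ x → ≤-respʳ-≈ (sym (f≈g x)) (a x)) , λ c h → b c λ x → ≤-respʳ-≈ (f≈g x) (h x)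

    sup-cong : sup f ≈ sup g
    sup-cong with em {P = ∃ (IsSup f)} | em {P = ∃ (IsSup g)}
    ... | yes (s , p) | yes (t , q) = antisym (proj₂ p _ (proj₁ (from-sup q))) (proj₂ q _ (proj₁ (to-sup p)))
    ... | yes (s , p) | no ¬q = contradiction (s , to-sup p) ¬q
    ... | no ¬p | yes (t , q) = contradiction (t , from-sup q) ¬p
    ... | no _  | no _        = refl

    inf-cong : inf f ≈ inf g
    inf-cong with em {P = ∃ (IsInf f)} | em {P = ∃ (IsInf g)}
    ... | yes (s , p) | yes (t , q) = antisym (proj₂ q _ (proj₁ (to-inf p))) (proj₂ p _ (proj₁ (from-inf q)))
    ... | yes (s , p) | no ¬q = contradiction (s , to-inf p) ¬q
    ... | no ¬p | yes (t , q) = contradiction (t , from-inf q) ¬p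
    ... | no _  | no _        = refl

  archimedes : ∀ x → ∃ λ n → x ≤ fromℕ n
  archimedes x with em {P = ∃ λ n → x ≤ fromℕ n}
  ... | yes p = p
  ... | no ¬p with lub (λ r → ∃ λ n → r ≈ fromℕ n) (0# , 0 , refl)
                   (x , λ r (n , q) → ≤-respˡ-≈ (sym q) (<⇒≤ (≰⇒> λ h → ¬p (n , h))))
  ...   | s , up , least = contradiction 0<1 (≤⇒≯ (lin
            (least (s - 1#) λ r (n , q) → lin (up (1# + fromℕ n) (ℕ.suc n , refl))
              (trans (+-congʳ q) (solveᴿ (fromℕ n ∷ s ∷ []) (λ n s → [] ,
                n :+ s ⊜ (s :- :1) :+ (:1 :+ n)) [])))
            (solveᴿ (s ∷ []) (λ s → [] , :1 :+ (s :- :1) ⊜ :0 :+ s) [])))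

  infix 9 ½^_
  ½^_ : ℕ → Carrier
  ½^ ℕ.zero    = 1#
  ½^ (ℕ.suc n) = half (½^ n)

  ½^-pos : ∀ n → 0# < ½^ n
  ½^-pos ℕ.zero    = 0<1
  ½^-pos (ℕ.suc n) = half-pos (½^-pos n)

  private
    n½^n≤1 : ∀ n → (1# + fromℕ n) * ½^ n ≤ 1#
    n½^n≤1 ℕ.zero = ≤-reflexive (trans (*-identityʳ _) (+-identityʳ _))
    n½^n≤1 (ℕ.suc n) = ≤-trans (*-monoˡ-≤ (<⇒≤ (½^-pos n)) le) (n½^n≤1 n)
      ⟨by⟩ solveᴿ (½ ∷ ½^ n ∷ fromℕ n ∷ []) (λ h p n → [] ,
        (:1 :+ (:1 :+ n)) :* h :* p ⊜ (:1 :+ (:1 :+ n)) :* (h :* p)) []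
      where
      infixl 5 _⟨by⟩_
      _⟨by⟩_ : ∀ {a b c} → a ≤ b → a ≈ c → c ≤ b
      p ⟨by⟩ q = ≤-respˡ-≈ q p
      le : (1# + fromℕ (ℕ.suc n)) * ½ ≤ 1# + fromℕ n
      le = lin (half-nonneg (fromℕ-nonneg n)) (trans
        (solveᴿ (½ ∷ fromℕ n ∷ []) (λ h n → [] ,
          (:1 :+ (:1 :+ n)) :* h :+ h :* n ⊜ (h :+ h) :+ (h :+ h) :* n) [])
        (trans (+-cong ½+½≈1 (trans (*-congʳ ½+½≈1) (*-identityˡ _))) (sym (+-identityʳ _))))

  ½^-small : ∀ b η → 0# < η → ∃ λ n → ½^ n * b ≤ η
  ½^-small b η 0<η with archimedes (b * η ⁻¹ʳ)
  ... | n , p = n , ≤-trans (*-monoʳ-≤ (<⇒≤ (½^-pos n)) b≤) (≤-trans (≤-reflexive (solveᴿ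
          (½^ n ∷ fromℕ n ∷ η ∷ []) (λ p n e → [] , p :* (n :* e) ⊜ (n :* p) :* e) []))
          (≤-trans (*-monoˡ-≤ (<⇒≤ 0<η) n½^≤1) (≤-reflexive (*-identityˡ η))))
    where
    b≤ : b ≤ fromℕ n * η
    b≤ = ≤-respˡ-≈ (solveᴿ (b ∷ η ∷ η ⁻¹ʳ ∷ []) (λ b e i → (e :* i ⟶ :1) ∷ [] , b :* i :* e ⊜ b)
      (*-inverseʳ (pos⇒≉0 0<η) ∷ [])) (*-monoˡ-≤ (<⇒≤ 0<η) p)
    n½^≤1 : fromℕ n * ½^ n ≤ 1#
    n½^≤1 = ≤-trans (*-monoˡ-≤ (<⇒≤ (½^-pos n)) (lin 0≤1 (trans (+-comm _ _) (sym (+-identityʳ _))))) (n½^n≤1 n)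

  ½^-mono : ∀ {m n} → m ℕ.≤ n → ½^ n ≤ ½^ m
  ½^-mono {n = ℕ.zero}  ℕ.z≤n = ≤-refl
  ½^-mono {n = ℕ.suc n} ℕ.z≤n = ≤-trans (half≤ (<⇒≤ (½^-pos n))) (½^-mono {n = n} ℕ.z≤n)
  ½^-mono (ℕ.s≤s p) = *-monoʳ-≤ 0≤½ (½^-mono p)

  -- Cousin's lemma.
  module _ {p} (P : Carrier → Carrier → Set p) {a b} (a≤b : a ≤ b)
           (additive : ∀ {c d e} → c ≤ d → d ≤ e → P c d → P d e → P c e)
           (local : ∀ x → a ≤ x → x ≤ b → ∃ λ δ → 0# < δ × (∀ c d → a ≤ c → c ≤ x → x ≤ d → d ≤ b →
                    x ≤ c + δ → d ≤ x + δ → P c d)) where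

    private
      Q : Carrier → Set p
      Q c = a ≤ c × c ≤ b × P a c

      Qa : Q a
      Qa with local a ≤-refl a≤b
      ... | δ , 0<δ , h = ≤-refl , a≤b , h a a ≤-refl ≤-refl ≤-refl a≤b a≤ a≤
        where
        a≤ : a ≤ a + δ
        a≤ = proj₁ (Within-refl (<⇒≤ 0<δ))

      module _ (s : Carrier) (up : ∀ c → Q c → c ≤ s) (least : ∀ c → (∀ d → Q d → d ≤ c) → s ≤ c) where
        a≤s : a ≤ s
        a≤s = up a Qa

        finish : P a b
        finish with local s a≤s (least b λ c q → proj₁ (proj₂ q))
        ... | δ , 0<δ , h with em {P = ∃ λ c → Q c × s ≤ c + δ}
        ...   | no ¬p = contradiction 0<δ (≤⇒≯ (lin
                  (least (s - δ) λ c q → lin (<⇒≤ (≰⇒> λ s≤ → ¬p (c , q , s≤)))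
                    (solveᴿ (c ∷ s ∷ δ ∷ []) (λ c s d → [] , c :+ s ⊜ (s :- d) :+ (c :+ d)) []))
                  (solveᴿ (s ∷ δ ∷ []) (λ s d → [] , d :+ (s :- d) ⊜ :0 :+ s) [])))
        ...   | yes (c , (a≤c , c≤b , Pac) , s≤c+δ) with total (s + δ) b
        ...     | inj₂ b≤ = additive a≤c c≤b Pac
                    (h c b a≤c (up c (a≤c , c≤b , Pac)) (least b λ c q → proj₁ (proj₂ q)) ≤-refl s≤c+δ b≤)
        ...     | inj₁ ≤b = contradiction s<s+δ
                    (≤⇒≯ (up (s + δ) (≤-trans a≤s (proj₁ s<s+δ) , ≤b ,
                      additive a≤c (≤-trans c≤s (proj₁ s<s+δ)) Pac
                        (h c (s + δ) a≤c c≤s (proj₁ s<s+δ) ≤b s≤c+δ ≤-refl))))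
          where
          c≤s : c ≤ s
          c≤s = up c (a≤c , c≤b , Pac)
          s<s+δ : s < s + δ
          s<s+δ = proj₁ (Within-refl (<⇒≤ 0<δ)) , λ s≈ → pos⇒≉0 0<δ
            (trans (solveᴿ (s ∷ δ ∷ []) (λ s d → [] , d ⊜ (s :+ d) :- s) [])
                   (trans (+-congʳ (sym s≈)) (-‿inverseʳ s)))

    cousin : P a b
    cousin with lub Q (a , Qa) (b , λ c q → proj₁ (proj₂ q))
    ... | s , up , least = finish s up least

  Box : ∀ {n} → Carrier → Vector Carrier n → Set
  Box b x = ∀ i → Bound b (x i)

  Near : ∀ {n} → Carrier → Vector Carrier n → Vector Carrier n → Set
  Near δ x y = ∀ i → Within δ (x i) (y i)

  -- The Heine–Borel theorem, by induction on the dimension.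
  heine : ∀ {n} (Q : (Vector Carrier n → Set) → Set) →
          (∀ {S T} → (∀ x → S x → T x) → Q T → Q S) →
          (∀ {S T} → Q S → Q T → Q (λ x → S x ⊎ T x)) →
          (∀ x → ∃ λ δ → 0# < δ × Q (Near δ x)) →
          ∀ b → 0# ≤ b → Q (Box b)
  heine {ℕ.zero} Q mono union local b 0≤b with local (λ ())
  ... | δ , _ , q = mono (λ _ _ ()) q
  heine {ℕ.suc n} Q mono union local b 0≤b = mono (λ x h → (h zero) , λ i → h (suc i))
    (cousin P (lin (+-mono-≤ 0≤b 0≤b) (solveᴿ (b ∷ []) (λ b → [] , (:- b) :+ (b :+ b) ⊜ b :+ (:0 :+ :0)) []))
      (λ {c} {d} {e} _ _ p q → mono (split c d e) (union p q)) tube)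
    where
    P : Carrier → Carrier → Set
    P c d = Q λ y → (c ≤ y zero × y zero ≤ d) × Box b (y ∘ suc)
    split : ∀ c d e y → (c ≤ y zero × y zero ≤ e) × Box b (y ∘ suc) →
      ((c ≤ y zero × y zero ≤ d) × Box b (y ∘ suc)) ⊎ ((d ≤ y zero × y zero ≤ e) × Box b (y ∘ suc))
    split c d e y ((p , q) , r) with total (y zero) d
    ... | inj₁ h = inj₁ ((p , h) , r)
    ... | inj₂ h = inj₂ ((h , q) , r)
    -- `Q′ x S` says that `Q` holds on some tube around the slice of `S` at first coordinate x. The
    -- induction hypothesis for `Q′ x` provides a tube around the whole slice of the box, and
    -- Cousin's lemma glues the tubes along the first coordinate.
    Q′ : Carrier → (Vector Carrier n → Set) → Set
    Q′ x S = ∃ λ δ → 0# < δ × Q λ y → Within δ x (y zero) × S (y ∘ suc)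
    union′ : ∀ x {S T} → Q′ x S → Q′ x T → Q′ x (λ x → S x ⊎ T x)
    union′ x {S} {T} (δ , p , q) (δ′ , p′ , q′) with common p p′
    ... | δ″ , p″ , l , l′ = δ″ , p″ , mono f (union q q′)
      where
      f : ∀ y → Within δ″ x (y zero) × (S (y ∘ suc) ⊎ T (y ∘ suc)) → _
      f y (w , inj₁ s) = inj₁ (Within-mono l w , s)
      f y (w , inj₂ t) = inj₂ (Within-mono l′ w , t)
    local′ : ∀ x y → ∃ λ δ → 0# < δ × Q′ x (Near δ y)
    local′ x y with local (x Vector.∷ y)
    ... | δ , p , q = δ , p , δ , p , mono (λ z (w , ws) → λ { zero → w ; (suc i) → ws i }) q
    tube : ∀ x → - b ≤ x → x ≤ b → ∃ λ δ → 0# < δ × (∀ c d → - b ≤ c → c ≤ x → x ≤ d → d ≤ b →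
           x ≤ c + δ → d ≤ x + δ → P c d)
    tube x _ _ with heine (Q′ x) (λ h (δ , p , q) → δ , p , mono (λ y (w , s) → w , h _ s) q)
                      (λ {S} {T} → union′ x {S} {T}) (local′ x) b 0≤b
    ... | δ , p , q = δ , p , λ c d _ _ _ _ x≤ ≤x → mono (λ y ((l , r) , s) →
            (≤-trans x≤ (+-mono-≤ l ≤-refl) , ≤-trans r ≤x) , s) q

  module _ {n} (f : ContinuousFunction n) where
    open ContinuousFunction f

    -- Connectives are not assumed to respect the equality of `ℝ`. Continuity forces it, since equal
    -- arguments are within every δ of each other.
    apply-cong : ∀ {x y} → (∀ i → x i ≈ y i) → apply x ≈ apply y
    apply-cong {x} {y} h = ≈-ε λ η p → close η (continuous x η p)
      where
      close : ∀ η → (∃ λ δ → 0# < δ × (∀ y → Near δ x y → Within η (apply x) (apply y))) →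
              Within η (apply x) (apply y)
      close η (δ , p , q) = q y λ i → Within-reflexive (<⇒≤ p) (h i)

    uniformly-continuous : ∀ b → 0# ≤ b → ∀ η → 0# < η → ∃ λ δ → 0# < δ ×
      (∀ x y → Box b x → Near δ x y → Within η (apply x) (apply y))
    uniformly-continuous b 0≤b η 0<η = heine Q
      (λ h (δ , p , q) → δ , p , λ x y s → q x y (h x s)) union local b 0≤b
      where
      Q : (Vector Carrier n → Set) → Set
      Q S = ∃ λ δ → 0# < δ × (∀ x y → S x → Near δ x y → Within η (apply x) (apply y))
      union : ∀ {S T} → Q S → Q T → Q (λ x → S x ⊎ T x)
      union (δ , p , q) (δ′ , p′ , q′) with common p p′
      ... | δ″ , p″ , l , l′ = δ″ , p″ , λ where
        x y (inj₁ s) h → q x y s λ i → Within-mono l (h i)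
        x y (inj₂ t) h → q′ x y t λ i → Within-mono l′ (h i)
      local : ∀ x → ∃ λ δ → 0# < δ × Q (Near δ x)
      local x with continuous x (half η) (half-pos 0<η)
      ... | δ , p , q = half δ , half-pos p , half δ , half-pos p , λ y z h h′ →
            Within-half (Within-sym (q y λ i → Within-mono (half≤ (<⇒≤ p)) (h i)))
              (q z λ i → Within-half (h i) (h′ i))

    bounded : ∀ b → 0# ≤ b → ∃ λ c → 0# ≤ c × (∀ x → Box b x → Bound c (apply x))
    bounded b 0≤b = heine Q (λ h (c , p , q) → c , p , λ x s → q x (h x s)) union local b 0≤b
      where
      Q : (Vector Carrier n → Set) → Set
      Q S = ∃ λ c → 0# ≤ c × (∀ x → S x → Bound c (apply x))
      union : ∀ {S T} → Q S → Q T → Q (λ x → S x ⊎ T x)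
      union (c , p , q) (d , p′ , q′) with upper c d
      ... | e , l , l′ = e , ≤-trans p l , λ where
        x (inj₁ s) → bound-mono l (q x s)
        x (inj₂ t) → bound-mono l′ (q′ x t)
      local : ∀ x → ∃ λ δ → 0# < δ × Q (Near δ x)
      local x with continuous x 1# 0<1 | upper (apply x) (- apply x)
      ... | δ , p , q | m , l , l′ = δ , p , m + 1# , ≤-trans 0≤m (proj₁ (Within-refl 0≤1)) , λ y h →
            lin (+-mono-≤ l′ (proj₁ (q y h))) (solveᴿ (m ∷ apply x ∷ apply y ∷ []) (λ m a b → [] ,
              (:- (m :+ :1)) :+ (m :+ (b :+ :1)) ⊜ b :+ ((:- a) :+ a)) []) ,
            ≤-trans (proj₂ (q y h)) (+-mono-≤ l ≤-refl)
        where
        0≤m : 0# ≤ m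
        0≤m = ≤-resp (zeroʳ ½) (trans (distribˡ ½ m m) (half+half m)) (*-monoʳ-≤ 0≤½
          (≤-respˡ-≈ (-‿inverseʳ _) (+-mono-≤ l l′)))

-- Norm estimates, scalars and limits in a C*-algebra.

module CStarBasics (em : ∀ {ℓ} → ExcludedMiddle ℓ) (R : CompleteOrderedField)
                   {ℓ} (A : Setting.CStarAlgebra em R ℓ) where
  open Setting em R
  open Reals em R
  open CStarAlgebra A
  open RingProperties ring using (-1*x≈-x; x∙y⁻¹≈ε⇒x≈y; +-cancelˡ)
  open IsLeftModule isLeftModule

  starRing : StarRing ℓ ℓ
  starRing = record
    { ring = ring ; _⋆ = _⋆ ; ⋆-cong = ⋆-cong ; ⋆-involutive = ⋆-involutive ; ⋆-+ = ⋆-+ ; ⋆-* = ⋆-* }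

  open Solver starRing public using (solve; solveᶜ; Central)

  -- Real scalars become central elements of the algebra, so that the solver can treat them as
  -- generators.
  ⌜_⌝ : ℝ → Carrier
  ⌜ r ⌝ = (r , ℝ.0#) · 1#

  scalar-central : ∀ z → Central (z · 1#)
  scalar-central z x = trans (sym (·-*-assocʳ z x 1#))
    (trans (*ₗ-cong ℂ.refl (trans (*-identityʳ x) (sym (*-identityˡ x)))) (·-*-assocˡ z 1# x))

  ⌜⌝-central : ∀ r → Central ⌜ r ⌝
  ⌜⌝-central r = scalar-central (r , ℝ.0#)

  ·-scalar : ∀ z a → z · a ≈ (z · 1#) * a
  ·-scalar z a = trans (*ₗ-cong ℂ.refl (sym (*-identityˡ a))) (·-*-assocˡ z 1# a)

  scalar-* : ∀ z w → (z ℂ.* w) · 1# ≈ (z · 1#) * (w · 1#)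
  scalar-* z w = trans (*ₗ-assoc z w 1#) (·-scalar z (w · 1#))

  ⌜⌝-cong : ∀ {r s} → r ℝ.≈ s → ⌜ r ⌝ ≈ ⌜ s ⌝
  ⌜⌝-cong p = *ₗ-cong (p , ℝ.refl) refl

  ⌜⌝-+ : ∀ r s → ⌜ r ℝ.+ s ⌝ ≈ ⌜ r ⌝ + ⌜ s ⌝
  ⌜⌝-+ r s = trans (*ₗ-cong (ℝ.refl , ℝ.sym (ℝ.+-identityˡ _)) refl) (*ₗ-distribʳ 1# (r , ℝ.0#) (s , ℝ.0#))

  ⌜⌝-* : ∀ r s → ⌜ r ℝ.* s ⌝ ≈ ⌜ r ⌝ * ⌜ s ⌝
  ⌜⌝-* r s = trans (*ₗ-cong (solveᴿ (r ∷ s ∷ []) (λ r s → [] , r :* s ⊜ r :* s :- :0 :* :0) [] ,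
    solveᴿ (r ∷ s ∷ []) (λ r s → [] , :0 ⊜ r :* :0 :+ :0 :* s) []) refl) (scalar-* (r , ℝ.0#) (s , ℝ.0#))

  ⌜1⌝ : ⌜ ℝ.1# ⌝ ≈ 1#
  ⌜1⌝ = *ₗ-identityˡ 1#

  ⌜0⌝ : ⌜ ℝ.0# ⌝ ≈ 0#
  ⌜0⌝ = *ₗ-zeroˡ 1#

  ⌜⌝-⋆ : ∀ r → ⌜ r ⌝ ⋆ ≈ ⌜ r ⌝
  ⌜⌝-⋆ r = trans (⋆-· _ _) (*ₗ-cong (ℝ.refl , solveᴿ [] ([] , :- :0 ⊜ :0) []) 1⋆≈1)

  𝐢 : Carrier
  𝐢 = (ℝ.0# , ℝ.1#) · 1#

  𝐢-central : Central 𝐢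
  𝐢-central = scalar-central (ℝ.0# , ℝ.1#)

  neg-scalar : ∀ z → (ℂ.- z) · 1# ≈ - (z · 1#)
  neg-scalar z = sym (+-cancelˡ (z · 1#) _ _ (trans (-‿inverseʳ _) (sym (trans (sym (*ₗ-distribʳ 1# z (ℂ.- z)))
    (trans (*ₗ-cong (ℂ.-‿inverseʳ z) refl) (*ₗ-zeroˡ 1#))))))

  ⌜⌝-neg : ∀ r → ⌜ ℝ.- r ⌝ ≈ - ⌜ r ⌝
  ⌜⌝-neg r = trans (*ₗ-cong (ℝ.refl , solveᴿ [] ([] , :0 ⊜ :- :0) []) refl) (neg-scalar (r , ℝ.0#))

  𝐢𝐢 : 𝐢 * 𝐢 ≈ - 1#
  𝐢𝐢 = trans (sym (scalar-* (ℝ.0# , ℝ.1#) (ℝ.0# , ℝ.1#))) (trans (*ₗ-cong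
    (solveᴿ [] ([] , :0 :* :0 :- :1 :* :1 ⊜ :- :1) [] , solveᴿ [] ([] , :0 :* :1 :+ :1 :* :0 ⊜ :0) []) refl)
    (trans (⌜⌝-neg ℝ.1#) (-‿cong ⌜1⌝)))

  𝐢⋆ : 𝐢 ⋆ ≈ - 𝐢
  𝐢⋆ = trans (⋆-· _ _) (trans (*ₗ-cong (solveᴿ [] ([] , :0 ⊜ :- :0) [] , ℝ.refl) 1⋆≈1)
    (neg-scalar (ℝ.0# , ℝ.1#)))

  -- The hypothesis on squares expresses that the absolute value of r is at most c, in the form in
  -- which the norm axiom for scalars is stated.
  ‖⌜⌝*‖ : ∀ r c a → ℝ.0# ℝ.≤ c → r ℝ.* r ℝ.≤ c ℝ.* c → ‖ ⌜ r ⌝ * a ‖ ℝ.≤ c ℝ.* ‖ a ‖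
  ‖⌜⌝*‖ r c a 0≤c rr≤cc = ℝ.≤-respˡ-≈ (‖‖-cong (·-scalar (r , ℝ.0#) a))
    (square-cancel (ℝ.*-nonneg 0≤c (‖‖-nonneg a)) (ℝ.≤-respˡ-≈ (ℝ.sym (‖‖-· _ a))
      (≤-resp (ℝ.*-congʳ (solveᴿ (r ∷ []) (λ r → [] , r :* r ⊜ r :* r :+ :0 :* :0) []))
        (solveᴿ (c ∷ ‖ a ‖ ∷ []) (λ c a → [] , c :* c :* (a :* a) ⊜ c :* a :* (c :* a)) [])
        (*-monoˡ-≤ (ℝ.*-nonneg (‖‖-nonneg a) (‖‖-nonneg a)) rr≤cc))))

  ‖⌜⌝*‖⁺ : ∀ {r} a → ℝ.0# ℝ.≤ r → ‖ ⌜ r ⌝ * a ‖ ℝ.≤ r ℝ.* ‖ a ‖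
  ‖⌜⌝*‖⁺ a p = ‖⌜⌝*‖ _ _ a p ℝ.≤-refl

  private
    ‖neg‖≤ : ∀ a → ‖ - a ‖ ℝ.≤ ‖ a ‖
    ‖neg‖≤ a = ≤-resp (‖‖-cong (trans (*-congʳ (trans (⌜⌝-neg ℝ.1#) (-‿cong ⌜1⌝))) (-1*x≈-x a)))
      (ℝ.*-identityˡ _) (‖⌜⌝*‖ (ℝ.- ℝ.1#) ℝ.1# a ℝ.0≤1 (ℝ.≤-reflexive
        (solveᴿ [] ([] , (:- :1) :* (:- :1) ⊜ :1 :* :1) [])))

  ‖‖-neg : ∀ a → ‖ - a ‖ ℝ.≈ ‖ a ‖
  ‖‖-neg a = ℝ.antisym (‖neg‖≤ a) (ℝ.≤-respˡ-≈ (‖‖-cong (solve (a ∷ []) (λ a → [] , :- :- a ⊜ a) [])) (‖neg‖≤ (- a)))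

  infixl 6 _⟨+⟩_ _⟨-⟩_
  infixl 7 _⟨*⟩_

  _⟨+⟩_ : ∀ {a b α β} → ‖ a ‖ ℝ.≤ α → ‖ b ‖ ℝ.≤ β → ‖ a + b ‖ ℝ.≤ α ℝ.+ β
  p ⟨+⟩ q = ℝ.≤-trans (‖‖-+ _ _) (ℝ.+-mono-≤ p q)

  ⟨neg⟩ : ∀ {a α} → ‖ a ‖ ℝ.≤ α → ‖ - a ‖ ℝ.≤ α
  ⟨neg⟩ = ℝ.≤-respˡ-≈ (ℝ.sym (‖‖-neg _))

  _⟨-⟩_ : ∀ {a b α β} → ‖ a ‖ ℝ.≤ α → ‖ b ‖ ℝ.≤ β → ‖ a - b ‖ ℝ.≤ α ℝ.+ β
  p ⟨-⟩ q = p ⟨+⟩ ⟨neg⟩ q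

  0≤bound : ∀ {a α} → ‖ a ‖ ℝ.≤ α → ℝ.0# ℝ.≤ α
  0≤bound = ℝ.≤-trans (‖‖-nonneg _)

  _⟨*⟩_ : ∀ {a b α β} → ‖ a ‖ ℝ.≤ α → ‖ b ‖ ℝ.≤ β → ‖ a * b ‖ ℝ.≤ α ℝ.* β
  p ⟨*⟩ q = ℝ.≤-trans (‖‖-* _ _) (ℝ.*-mono-≤ (‖‖-nonneg _) (0≤bound q) p q)

  ⟨⋆⟩ : ∀ {a α} → ‖ a ‖ ℝ.≤ α → ‖ a ⋆ ‖ ℝ.≤ α
  ⟨⋆⟩ = ℝ.≤-respˡ-≈ (ℝ.sym (‖‖-⋆ _))

  infixl 5 _⟨≈⟩_
  _⟨≈⟩_ : ∀ {a b α} → ‖ a ‖ ℝ.≤ α → a ≈ b → ‖ b ‖ ℝ.≤ α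
  p ⟨≈⟩ q = ℝ.≤-respˡ-≈ (‖‖-cong q) p

  _⟨1*⟩_ : ∀ {a b β} → ‖ a ‖ ℝ.≤ ℝ.1# → ‖ b ‖ ℝ.≤ β → ‖ a * b ‖ ℝ.≤ β
  p ⟨1*⟩ q = ℝ.≤-respʳ-≈ (ℝ.*-identityˡ _) (p ⟨*⟩ q)

  _⟨*1⟩_ : ∀ {a b α} → ‖ a ‖ ℝ.≤ α → ‖ b ‖ ℝ.≤ ℝ.1# → ‖ a * b ‖ ℝ.≤ α
  p ⟨*1⟩ q = ℝ.≤-respʳ-≈ (ℝ.*-identityʳ _) (p ⟨*⟩ q)

  ‖‖-comm : ∀ {a b α} → ‖ a - b ‖ ℝ.≤ α → ‖ b - a ‖ ℝ.≤ α
  ‖‖-comm {a} {b} p = ⟨neg⟩ p ⟨≈⟩ solve (a ∷ b ∷ []) (λ a b → [] , :- (a :- b) ⊜ b :- a) []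

  ‖‖-triangle : ∀ {a b c α β} → ‖ a - b ‖ ℝ.≤ α → ‖ b - c ‖ ℝ.≤ β → ‖ a - c ‖ ℝ.≤ α ℝ.+ β
  ‖‖-triangle {a} {b} {c} p q = (p ⟨+⟩ q) ⟨≈⟩
    solve (a ∷ b ∷ c ∷ []) (λ a b c → [] , (a :- b) :+ (b :- c) ⊜ a :- c) []

  ≈⇒‖-‖≤ : ∀ {a b α} → a ≈ b → ℝ.0# ℝ.≤ α → ‖ a - b ‖ ℝ.≤ α
  ≈⇒‖-‖≤ p = ℝ.≤-respˡ-≈ (ℝ.sym (ℝ.trans (‖‖-cong (trans (+-congʳ p) (-‿inverseʳ _))) ‖0‖≈0))

  norm-zero : ∀ {a} → ‖ a ‖ ℝ.≤ ℝ.0# → a ≈ 0#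
  norm-zero p = ‖‖-definite (ℝ.antisym p (‖‖-nonneg _))

  ≈-small : ∀ {a b} → (∀ η → ℝ.0# ℝ.< η → ‖ a - b ‖ ℝ.≤ η) → a ≈ b
  ≈-small h = x∙y⁻¹≈ε⇒x≈y _ _ (‖‖-definite (nonneg-ε (‖‖-nonneg _) h))

  ≈-small* : ∀ {a b} c → ℝ.0# ℝ.≤ c → (∀ η → ℝ.0# ℝ.< η → ‖ a - b ‖ ℝ.≤ c ℝ.* η) → a ≈ b
  ≈-small* c 0≤c h = ≈-small λ η p → via η (shrink c 0≤c η p)
    where
    via : ∀ η → (∃ λ δ → ℝ.0# ℝ.< δ × c ℝ.* δ ℝ.≤ η) → _
    via η (δ , p , q) = ℝ.≤-trans (h δ p) q

  IsIsometry : Carrier → Set ℓ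
  IsIsometry s = s ⋆ * s ≈ 1#

  IsUnitaryElement : Carrier → Set ℓ
  IsUnitaryElement u = u ⋆ * u ≈ 1# × u * u ⋆ ≈ 1#

  C*-≤ : ∀ {a α} → ℝ.0# ℝ.≤ α → ‖ a ⋆ * a ‖ ℝ.≤ α ℝ.* α → ‖ a ‖ ℝ.≤ α
  C*-≤ 0≤α p = square-cancel 0≤α (ℝ.≤-respˡ-≈ (C*-identity _) p)

  isometry-norm : ∀ {s} → IsIsometry s → ‖ s ‖ ℝ.≤ ℝ.1#
  isometry-norm p = C*-≤ ℝ.0≤1 (ℝ.≤-respʳ-≈ (ℝ.sym (ℝ.*-identityˡ _)) (‖1‖≤1 ⟨≈⟩ sym p))

  ‖‖-zero⇒ : ∀ {a} → a ⋆ * a ≈ 0# → a ≈ 0#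
  ‖‖-zero⇒ {a} p = norm-zero (C*-≤ ℝ.≤-refl (ℝ.≤-reflexive (ℝ.trans (‖‖-cong p) (ℝ.trans ‖0‖≈0 (ℝ.sym (ℝ.zeroˡ _))))))

  ‖‖-near : ∀ {a b α β} → ‖ a - b ‖ ℝ.≤ α → ‖ b ‖ ℝ.≤ β → ‖ a ‖ ℝ.≤ α ℝ.+ β
  ‖‖-near {a} {b} p q = (p ⟨+⟩ q) ⟨≈⟩ solve (a ∷ b ∷ []) (λ a b → [] , (a :- b) :+ b ⊜ a) []

  module Geometric (u : ℕ → Carrier) (c : ℝ) (steps : ∀ n → ‖ u (ℕ.suc n) - u n ‖ ℝ.≤ ½^ n ℝ.* c) where

    private
      tail : ∀ n k → ‖ u (k ℕ.+ n) - u n ‖ ℝ.+ ½^ (k ℕ.+ n) ℝ.* (c ℝ.+ c) ℝ.≤ ½^ n ℝ.* (c ℝ.+ c)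
      tail n ℕ.zero = ℝ.≤-reflexive (ℝ.trans (ℝ.+-congʳ (ℝ.trans (‖‖-cong (-‿inverseʳ _)) ‖0‖≈0)) (ℝ.+-identityˡ _))
      tail n (ℕ.suc k) = ℝ.≤-trans (lin (‖‖-triangle (steps (k ℕ.+ n)) ℝ.≤-refl)
        (ℝ.trans (ℝ.+-congʳ (ℝ.+-congˡ (ℝ.trans
            (solveᴿ (½ ∷ p ∷ c ∷ []) (λ h p c → [] , h :* p :* (c :+ c) ⊜ (h :+ h) :* (p :* c)) [])
            (ℝ.trans (ℝ.*-congʳ ½+½≈1) (ℝ.*-identityˡ _)))))
          (solveᴿ (p ∷ c ∷ x ∷ y ∷ []) (λ p c x y → [] ,
            (x :+ p :* c) :+ (p :* c :+ y) ⊜ (y :+ p :* (c :+ c)) :+ x) []))) (tail n k)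
        where
        p = ½^ (k ℕ.+ n)
        x = ‖ u (ℕ.suc k ℕ.+ n) - u n ‖
        y = ‖ u (k ℕ.+ n) - u n ‖

      0≤c : ℝ.0# ℝ.≤ c
      0≤c = ℝ.≤-respʳ-≈ (ℝ.*-identityˡ c) (0≤bound (steps 0))

      0≤2c : ℝ.0# ℝ.≤ c ℝ.+ c
      0≤2c = ℝ.≤-respˡ-≈ (ℝ.+-identityˡ _) (ℝ.+-mono-≤ 0≤c 0≤c)

      close : ∀ {m n} → n ℕ.≤ m → ‖ u m - u n ‖ ℝ.≤ ½^ n ℝ.* (c ℝ.+ c)
      close {m} {n} p = subst (λ k → ‖ u k - u n ‖ ℝ.≤ ½^ n ℝ.* (c ℝ.+ c)) (ℕₚ.m∸n+n≡m p)
        (lin (ℝ.+-mono-≤ (tail n (m ℕ.∸ n)) (ℝ.*-nonneg (<⇒≤ (½^-pos (m ℕ.∸ n ℕ.+ n))) 0≤2c))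
          (solveᴿ (x ∷ y ∷ z ∷ []) (λ x y z → [] , x :+ (y :+ z) ⊜ y :+ (x :+ z :+ :0)) []))
        where
        x = ‖ u (m ℕ.∸ n ℕ.+ n) - u n ‖
        y = ½^ n ℝ.* (c ℝ.+ c)
        z = ½^ (m ℕ.∸ n ℕ.+ n) ℝ.* (c ℝ.+ c)

      cauchy : IsCauchy u
      cauchy η p = via (½^-small (c ℝ.+ c) (half η) (half-pos p))
        where
        via : (∃ λ n → ½^ n ℝ.* (c ℝ.+ c) ℝ.≤ half η) → ∃ λ N → ∀ m n → N ℕ.≤ m → N ℕ.≤ n → ‖ u m - u n ‖ ℝ.≤ η
        via (N , q) = N , λ m n N≤m N≤n → ℝ.≤-respʳ-≈ (half+half η)
          (‖‖-triangle (ℝ.≤-trans (close N≤m) q) (‖‖-comm (ℝ.≤-trans (close N≤n) q)))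

    limit : Carrier
    limit = proj₁ (complete u cauchy)

    -- One index serves both estimates: the residual of the Newton iterates is bounded by a multiple
    -- of ½ⁿ, not by the distance to the limit.
    approximant : ∀ η → ℝ.0# ℝ.< η → ∃ λ n → ‖ u n - limit ‖ ℝ.≤ η × ½^ n ℝ.≤ η
    approximant η p = via (proj₂ (complete u cauchy) η p) (½^-small ℝ.1# η p)
      where
      via : (∃ λ N → ∀ n → N ℕ.≤ n → ‖ u n - limit ‖ ℝ.≤ η) → (∃ λ n → ½^ n ℝ.* ℝ.1# ℝ.≤ η) →
            ∃ λ n → ‖ u n - limit ‖ ℝ.≤ η × ½^ n ℝ.≤ η
      via (N , h) (M , q) = N ℕ.+ M , h _ (ℕₚ.m≤m+n N M) ,
        ℝ.≤-trans (½^-mono (ℕₚ.m≤n+m M N)) (ℝ.≤-respˡ-≈ (ℝ.*-identityʳ _) q)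

-- Newton's iteration g ↦ g (3 - y g²) / 2 for an inverse square root of y.

module NewtonIteration (em : ∀ {ℓ} → ExcludedMiddle ℓ) (R : CompleteOrderedField)
                       {ℓ} (A : Setting.CStarAlgebra em R ℓ) where
  open Setting em R
  open Reals em R
  open CStarAlgebra A
  open CStarBasics em R A

  ⌜½⌝+⌜½⌝ : ⌜ ½ ⌝ + ⌜ ½ ⌝ ≈ 1#
  ⌜½⌝+⌜½⌝ = trans (sym (⌜⌝-+ ½ ½)) (trans (⌜⌝-cong ½+½≈1) ⌜1⌝)

  ⌜½⌝*-+ : ∀ a → ⌜ ½ ⌝ * a + ⌜ ½ ⌝ * a ≈ a
  ⌜½⌝*-+ a = trans (sym (distribʳ a _ _)) (trans (*-congʳ ⌜½⌝+⌜½⌝) (*-identityˡ a))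

  ⌜½⌝-unique : ∀ {a b} → a + a ≈ b → ⌜ ½ ⌝ * b ≈ a
  ⌜½⌝-unique {a} p = trans (*-congˡ (sym p)) (trans (distribˡ _ a a) (⌜½⌝*-+ a))

  -- `commutes` places the root in the bicommutant of y. Together with `selfAdjoint` it supplies
  -- what functional calculus would be used for.
  record InverseRoot (y : Carrier) (r : ℝ) : Set ℓ where
    field
      root        : Carrier
      isRoot      : y * (root * root) ≈ 1#
      near-1      : ‖ root - 1# ‖ ℝ.≤ r ℝ.+ r
      commutes    : ∀ {c} → c * y ≈ y * c → c * root ≈ root * c
      selfAdjoint : y ⋆ ≈ y → root ⋆ ≈ root

  private
    module Iteration (y : Carrier) (r : ℝ) (‖1-y‖≤r : ‖ 1# - y ‖ ℝ.≤ r) (2r≤1 : r ℝ.+ r ℝ.≤ ℝ.1#) where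

      h : Carrier
      h = ⌜ ½ ⌝

      h-central : All Central (h ∷ [])
      h-central = ⌜⌝-central ½ ∷ []

      -- `d n` is half of the residual 1 - y g², so that g (1 + d) = g (3 - y g²) / 2 is the Newton
      -- step.
      g d : ℕ → Carrier
      g ℕ.zero    = 1#
      g (ℕ.suc n) = g n * (1# + d n)
      d n = h * (1# - y * (g n * g n))

      g-commutes : ∀ {c} → c * y ≈ y * c → ∀ n → c * g n ≈ g n * c
      g-commutes p ℕ.zero    = trans (*-identityʳ _) (sym (*-identityˡ _))
      g-commutes {c} p (ℕ.suc n) = solveᶜ (h ∷ []) h-central (c ∷ y ∷ g n ∷ []) (λ h c y g →
        (c :* y ⟶ y :* c) ∷ (c :* g ⟶ g :* c) ∷ [] ,
        c :* (g :* (:1 :+ h :* (:1 :- y :* (g :* g)))) ⊜ g :* (:1 :+ h :* (:1 :- y :* (g :* g))) :* c)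
        (p ∷ g-commutes p n ∷ [])

      yg : ∀ n → y * g n ≈ g n * y
      yg = g-commutes refl

      g-selfAdjoint : y ⋆ ≈ y → ∀ n → g n ⋆ ≈ g n
      g-selfAdjoint p ℕ.zero    = 1⋆≈1
      g-selfAdjoint p (ℕ.suc n) = solveᶜ (h ∷ []) h-central (y ∷ g n ∷ []) (λ h y g →
        (h :⋆ ⟶ h) ∷ (y :⋆ ⟶ y) ∷ (g :⋆ ⟶ g) ∷ (y :* g ⟶ g :* y) ∷ [] ,
        (g :* (:1 :+ h :* (:1 :- y :* (g :* g)))) :⋆ ⊜ g :* (:1 :+ h :* (:1 :- y :* (g :* g))))
        (⌜⌝-⋆ ½ ∷ p ∷ g-selfAdjoint p n ∷ yg n ∷ [])

      ygg : ∀ n → y * (g n * g n) ≈ 1# - d n - d n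
      ygg n = trans (solve (y ∷ g n ∷ []) (λ y g → [] , y :* (g :* g) ⊜ :1 :- (:1 :- y :* (g :* g))) [])
        (trans (+-congˡ (-‿cong (sym (⌜½⌝*-+ _)))) (solve (d n ∷ []) (λ d → [] , :1 :- (d :+ d) ⊜ :1 :- d :- d) []))

      gd : ∀ n → d n * g n ≈ g n * d n
      gd n = solveᶜ (h ∷ []) h-central (y ∷ g n ∷ []) (λ h y g → (y :* g ⟶ g :* y) ∷ [] ,
        h :* (:1 :- y :* (g :* g)) :* g ⊜ g :* (h :* (:1 :- y :* (g :* g)))) (yg n ∷ [])

      -- Since y g² = 1 - 2 d, the next residual is 1 - (1 - 2 d)(1 + d)² = 3 d² + 2 d³. Of this
      -- quadratic convergence only halving is used: if 4 ‖d‖ ≤ 1, then 3 d + 2 d² has norm at most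
      -- 1.
      d-step : ∀ n → d (ℕ.suc n) ≈ h * (d n * (d n + d n + d n + (d n + d n) * d n))
      d-step n = *-congˡ (solve (d n ∷ y ∷ g n ∷ []) (λ d y g →
        (d :* g ⟶ g :* d) ∷ (y :* g :* g ⟶ :1 :- d :- d) ∷ [] ,
        :1 :- y :* (g :* (:1 :+ d) :* (g :* (:1 :+ d))) ⊜ d :* (d :+ d :+ d :+ (d :+ d) :* d))
        (gd n ∷ trans (*-assoc _ _ _) (ygg n) ∷ []))

      0≤r : ℝ.0# ℝ.≤ r
      0≤r = 0≤bound ‖1-y‖≤r

      bound : ℕ → ℝ
      bound n = half (½^ n ℝ.* r)

      4bound≤1 : ∀ n → bound n ℝ.+ bound n ℝ.+ (bound n ℝ.+ bound n) ℝ.≤ ℝ.1#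
      4bound≤1 n = ℝ.≤-respˡ-≈ (ℝ.sym (ℝ.+-cong (half+half _) (half+half _)))
        (ℝ.≤-trans (ℝ.+-mono-≤ p p) 2r≤1)
        where
        p : ½^ n ℝ.* r ℝ.≤ r
        p = ℝ.≤-respʳ-≈ (ℝ.*-identityˡ r) (*-monoˡ-≤ 0≤r (½^-mono {0} {n} ℕ.z≤n))

      0≤bound-n : ∀ n → ℝ.0# ℝ.≤ bound n
      0≤bound-n n = half-nonneg (ℝ.*-nonneg (<⇒≤ (½^-pos n)) 0≤r)

      ‖d‖≤ : ∀ n → ‖ d n ‖ ℝ.≤ bound n
      ‖d‖≤ ℕ.zero = ℝ.≤-respʳ-≈ (ℝ.*-congˡ (ℝ.sym (ℝ.*-identityˡ r))) (ℝ.≤-trans (‖⌜⌝*‖⁺ _ 0≤½)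
        (ℝ.*-monoʳ-≤ 0≤½ (‖1-y‖≤r ⟨≈⟩ solve (y ∷ []) (λ y → [] , :1 :- y ⊜ :1 :- y :* (:1 :* :1)) [])))
      ‖d‖≤ (ℕ.suc n) = ℝ.≤-trans (‖⌜⌝*‖⁺ _ 0≤½ ⟨≈⟩ sym (d-step n)) (ℝ.*-monoʳ-≤ 0≤½
        (ℝ.≤-trans (‖d‖≤ n ⟨*⟩ q) (ℝ.≤-reflexive (solveᴿ (½ ∷ ½^ n ∷ r ∷ []) (λ h p r → [] ,
          h :* (p :* r) :* :1 ⊜ h :* p :* r) []))))
        where
        b = bound n
        2b≤1 : b ℝ.+ b ℝ.≤ ℝ.1#
        2b≤1 = ℝ.≤-trans (lin (ℝ.+-mono-≤ (0≤bound-n n) (0≤bound-n n)) (solveᴿ (b ∷ []) (λ b → [] ,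
          b :+ b :+ (b :+ b) ⊜ b :+ b :+ (b :+ b) :+ (:0 :+ :0)) [])) (4bound≤1 n)
        q : ‖ d n + d n + d n + (d n + d n) * d n ‖ ℝ.≤ ℝ.1#
        q = ℝ.≤-trans ((‖d‖≤ n ⟨+⟩ ‖d‖≤ n) ⟨+⟩ ‖d‖≤ n ⟨+⟩
              (ℝ.≤-respʳ-≈ (ℝ.*-identityˡ b) (ℝ.≤-trans (‖d‖≤ n ⟨+⟩ ‖d‖≤ n) 2b≤1 ⟨*⟩ ‖d‖≤ n)))
              (ℝ.≤-respˡ-≈ (solveᴿ (b ∷ []) (λ b → [] , b :+ b :+ (b :+ b) ⊜ b :+ b :+ b :+ b) []) (4bound≤1 n))

      ‖g-1‖≤ : ∀ n → ‖ g n - 1# ‖ ℝ.+ ½^ n ℝ.* (r ℝ.+ r) ℝ.≤ r ℝ.+ r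
      ‖g‖≤   : ∀ n → ‖ g n ‖ ℝ.≤ 2#
      g-step   : ∀ n → ‖ g (ℕ.suc n) - g n ‖ ℝ.≤ ½^ n ℝ.* r

      ‖g-1‖≤ ℕ.zero = ℝ.≤-reflexive (ℝ.trans (ℝ.+-cong (ℝ.trans (‖‖-cong (-‿inverseʳ 1#)) ‖0‖≈0)
        (ℝ.*-identityˡ _)) (ℝ.+-identityˡ _))
      ‖g-1‖≤ (ℕ.suc n) = ℝ.≤-trans (lin (‖‖-triangle (g-step n) ℝ.≤-refl) (ℝ.trans
        (ℝ.+-congʳ (ℝ.+-congˡ (ℝ.trans (solveᴿ (½ ∷ ½^ n ∷ r ∷ []) (λ h p r → [] ,
          h :* p :* (r :+ r) ⊜ h :* (p :* r) :+ h :* (p :* r)) []) (half+half _))))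
        (solveᴿ (½^ n ∷ r ∷ ‖ g n - 1# ‖ ∷ ‖ g (ℕ.suc n) - 1# ‖ ∷ []) (λ p r x y → [] ,
          y :+ p :* r :+ (p :* r :+ x) ⊜ x :+ p :* (r :+ r) :+ y) []))) (‖g-1‖≤ n)

      ‖g‖≤ n = ‖‖-near (ℝ.≤-trans (lin (ℝ.*-nonneg (<⇒≤ (½^-pos n)) (ℝ.≤-respˡ-≈ (ℝ.+-identityˡ _) (ℝ.+-mono-≤ 0≤r 0≤r)))
          (ℝ.trans (ℝ.+-comm _ _) (solveᴿ (‖ g n - 1# ‖ ∷ ½^ n ∷ r ∷ []) (λ x p r → [] ,
            p :* (r :+ r) :+ x ⊜ (x :+ p :* (r :+ r)) :+ :0) [])))
        (ℝ.≤-trans (‖g-1‖≤ n) 2r≤1)) ‖1‖≤1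

      g-step n = ℝ.≤-respʳ-≈ (ℝ.trans (solveᴿ (½ ∷ ½^ n ∷ r ∷ []) (λ h p r → [] ,
          (:1 :+ :1) :* (h :* (p :* r)) ⊜ h :* (p :* r) :+ h :* (p :* r)) []) (half+half _))
        ((‖g‖≤ n ⟨*⟩ ‖d‖≤ n) ⟨≈⟩ solve (g n ∷ d n ∷ []) (λ g d → [] , g :* d ⊜ g :* (:1 :+ d) :- g) [])

      open Geometric g r g-step renaming (limit to G)

      G-near-1 : ‖ G - 1# ‖ ℝ.≤ r ℝ.+ r
      G-near-1 = ≤-ε λ η p → via η (approximant η p)
        where
        via : ∀ η → (∃ λ n → ‖ g n - G ‖ ℝ.≤ η × ½^ n ℝ.≤ η) → ‖ G - 1# ‖ ℝ.≤ r ℝ.+ r ℝ.+ η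
        via η (n , p , _) = lin (ℝ.+-mono-≤ (‖‖-triangle (‖‖-comm p) ℝ.≤-refl)
            (ℝ.+-mono-≤ (‖g-1‖≤ n) (ℝ.*-nonneg (<⇒≤ (½^-pos n)) (ℝ.≤-respˡ-≈ (ℝ.+-identityˡ _) (ℝ.+-mono-≤ 0≤r 0≤r)))))
          (solveᴿ (‖ G - 1# ‖ ∷ ‖ g n - 1# ‖ ∷ ½^ n ∷ r ∷ η ∷ []) (λ G g p r e → [] ,
            G :+ ((e :+ g) :+ (r :+ r :+ p :* (r :+ r))) ⊜ r :+ r :+ e :+ (G :+ (g :+ p :* (r :+ r) :+ :0))) [])

      ‖G‖≤ : ‖ G ‖ ℝ.≤ 2#
      ‖G‖≤ = ‖‖-near (ℝ.≤-trans G-near-1 2r≤1) ‖1‖≤1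

      0≤2 : ℝ.0# ℝ.≤ 2#
      0≤2 = <⇒≤ 0<2

      isRoot : y * (G * G) ≈ 1#
      isRoot = ≈-small* c 0≤c λ η p → via η (approximant η p)
        where
        c = ‖ y ‖ ℝ.* 2# ℝ.+ ‖ y ‖ ℝ.* 2# ℝ.+ r
        0≤c : ℝ.0# ℝ.≤ c
        0≤c = ℝ.≤-respˡ-≈ (solveᴿ [] ([] , :0 :+ :0 :+ :0 ⊜ :0) []) (ℝ.+-mono-≤ (ℝ.+-mono-≤
          (ℝ.*-nonneg (‖‖-nonneg y) 0≤2) (ℝ.*-nonneg (‖‖-nonneg y) 0≤2)) 0≤r)
        via : ∀ η → (∃ λ n → ‖ g n - G ‖ ℝ.≤ η × ½^ n ℝ.≤ η) → ‖ y * (G * G) - 1# ‖ ℝ.≤ c ℝ.* η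
        via η (n , p , q) = ℝ.≤-respʳ-≈ (ℝ.trans (ℝ.+-congˡ (half+half _))
            (solveᴿ (‖ y ‖ ∷ r ∷ η ∷ []) (λ y r e → [] ,
              y :* e :* (:1 :+ :1) :+ y :* (:1 :+ :1) :* e :+ e :* r
              ⊜ (y :* (:1 :+ :1) :+ y :* (:1 :+ :1) :+ r) :* e) []))
          ((((ℝ.≤-refl ⟨*⟩ ‖‖-comm p) ⟨*⟩ ‖G‖≤) ⟨+⟩ ((ℝ.≤-refl ⟨*⟩ ‖g‖≤ n) ⟨*⟩ ‖‖-comm p) ⟨-⟩ (dn ⟨+⟩ dn)) ⟨≈⟩
          solve (d n ∷ y ∷ g n ∷ G ∷ []) (λ d y g G → (y :* g :* g ⟶ :1 :- d :- d) ∷ [] ,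
            y :* (G :- g) :* G :+ y :* g :* (G :- g) :- (d :+ d) ⊜ y :* (G :* G) :- :1)
            (trans (*-assoc _ _ _) (ygg n) ∷ []))
          where
          dn : ‖ d n ‖ ℝ.≤ half (η ℝ.* r)
          dn = ℝ.≤-trans (‖d‖≤ n) (ℝ.*-monoʳ-≤ 0≤½ (*-monoˡ-≤ 0≤r q))

      G-commutes : ∀ {c} → c * y ≈ y * c → c * G ≈ G * c
      G-commutes {c} comm = ≈-small* (‖ c ‖ ℝ.+ ‖ c ‖)
        (ℝ.≤-respˡ-≈ (ℝ.+-identityˡ _) (ℝ.+-mono-≤ (‖‖-nonneg c) (‖‖-nonneg c))) λ η p → via η (approximant η p)
        where
        via : ∀ η → (∃ λ n → ‖ g n - G ‖ ℝ.≤ η × ½^ n ℝ.≤ η) → ‖ c * G - G * c ‖ ℝ.≤ (‖ c ‖ ℝ.+ ‖ c ‖) ℝ.* η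
        via η (n , p , _) = ℝ.≤-respʳ-≈ (solveᴿ (‖ c ‖ ∷ η ∷ []) (λ c e → [] , c :* e :+ e :* c ⊜ (c :+ c) :* e) [])
          (((ℝ.≤-refl ⟨*⟩ ‖‖-comm p) ⟨-⟩ (‖‖-comm p ⟨*⟩ ℝ.≤-refl)) ⟨≈⟩
          solve (c ∷ g n ∷ G ∷ []) (λ c g G → (c :* g ⟶ g :* c) ∷ [] ,
            c :* (G :- g) :- (G :- g) :* c ⊜ c :* G :- G :* c) (g-commutes comm n ∷ []))

      G-selfAdjoint : y ⋆ ≈ y → G ⋆ ≈ G
      G-selfAdjoint sa = ≈-small* 2# 0≤2 λ η p → via η (approximant η p)
        where
        via : ∀ η → (∃ λ n → ‖ g n - G ‖ ℝ.≤ η × ½^ n ℝ.≤ η) → ‖ G ⋆ - G ‖ ℝ.≤ 2# ℝ.* η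
        via η (n , p , _) = ℝ.≤-respʳ-≈ (solveᴿ (η ∷ []) (λ e → [] , e :+ e ⊜ (:1 :+ :1) :* e) [])
          ((⟨⋆⟩ (‖‖-comm p) ⟨-⟩ ‖‖-comm p) ⟨≈⟩
          solve (g n ∷ G ∷ []) (λ g G → (g :⋆ ⟶ g) ∷ [] , (G :- g) :⋆ :- (G :- g) ⊜ G :⋆ :- G)
            (g-selfAdjoint sa n ∷ []))

  abstract
    inverseRoot : ∀ y {r} → ‖ 1# - y ‖ ℝ.≤ r → r ℝ.+ r ℝ.≤ ℝ.1# → InverseRoot y r
    inverseRoot y {r} p q = record
      { root = Geometric.limit g r g-step ; isRoot = isRoot ; near-1 = G-near-1
      ; commutes = G-commutes ; selfAdjoint = G-selfAdjoint }
      where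
      open Iteration y r p q

  ½-small : ½ ℝ.+ ½ ℝ.≤ ℝ.1#
  ½-small = ℝ.≤-reflexive ½+½≈1

  record NearInverse (y : Carrier) (r : ℝ) : Set ℓ where
    field
      inverse  : Carrier
      inverseˡ : inverse * y ≈ 1#
      inverseʳ : y * inverse ≈ 1#
      inverse-norm : ‖ inverse ‖ ℝ.≤ 2# ℝ.* 2#
      commutes : ∀ {c} → c * y ≈ y * c → c * inverse ≈ inverse * c

  abstract
    nearInverse : ∀ y {r} → ‖ 1# - y ‖ ℝ.≤ r → r ℝ.+ r ℝ.≤ ℝ.1# → NearInverse y r
    nearInverse y {r} p q = record
      { inverse  = g * g
      ; inverseˡ = trans (sym (comm refl)) isRoot
      ; inverseʳ = isRoot
      ; inverse-norm = ‖g‖ ⟨*⟩ ‖g‖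
      ; commutes = comm
      }
      where
      open InverseRoot (inverseRoot y p q) renaming (root to g)
      ‖g‖ : ‖ g ‖ ℝ.≤ 2#
      ‖g‖ = ‖‖-near (ℝ.≤-trans near-1 q) ‖1‖≤1
      comm : ∀ {c} → c * y ≈ y * c → c * (g * g) ≈ g * g * c
      comm {c} h = solve (c ∷ g ∷ []) (λ c g → (c :* g ⟶ g :* c) ∷ [] , c :* (g :* g) ⊜ g :* g :* c)
        (commutes h ∷ [])

  abstract
    -- Polar decomposition, with g the inverse square root of x* x.
    polar-isometry : ∀ x {r} → ‖ 1# - x ⋆ * x ‖ ℝ.≤ r → r ℝ.+ r ℝ.≤ ℝ.1# →
                     ∃ λ g → IsIsometry (x * g) × ‖ g - 1# ‖ ℝ.≤ r ℝ.+ r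
    polar-isometry x p q = g ,
      trans (solve (x ∷ g ∷ []) (λ x g → (g :⋆ ⟶ g) ∷ [] , (x :* g) :⋆ :* (x :* g) ⊜ g :* (x :⋆ :* x) :* g)
              (selfAdjoint sa ∷ []))
        (trans (*-congʳ (sym (commutes refl))) (trans (*-assoc _ _ _) isRoot)) ,
      near-1
      where
      open InverseRoot (inverseRoot (x ⋆ * x) p q) renaming (root to g)
      sa : (x ⋆ * x) ⋆ ≈ x ⋆ * x
      sa = solve (x ∷ []) (λ x → [] , (x :⋆ :* x) :⋆ ⊜ x :⋆ :* x) []

    -- Here x x* is invertible too. With g² the inverse of x* x, the range projection x g² x* of the
    -- isometry x g fixes x x*, and is therefore 1.
    polar-unitary : ∀ x {r} → ‖ 1# - x ⋆ * x ‖ ℝ.≤ r → ‖ 1# - x * x ⋆ ‖ ℝ.≤ r → r ℝ.+ r ℝ.≤ ℝ.1# →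
                    ∃ λ g → IsUnitaryElement (x * g) × ‖ g - 1# ‖ ℝ.≤ r ℝ.+ r
    polar-unitary x p p′ q = g , (isom , sym (trans (sym inverseʳ) (trans (solve (x ∷ g ∷ k ∷ [])
        (λ x g k → (g :⋆ ⟶ g) ∷ (g :* g :* x :⋆ :* x ⟶ :1) ∷ [] ,
          (x :* x :⋆) :* k ⊜ (x :* g) :* (x :* g) :⋆ :* (x :* x :⋆ :* k))
        (selfAdjoint sa ∷ trans (*-assoc _ _ _) ggy ∷ []))
        (trans (*-congˡ inverseʳ) (*-identityʳ _))))) , near-1
      where
      open InverseRoot (inverseRoot (x ⋆ * x) p q) renaming (root to g)
      open NearInverse (nearInverse (x * x ⋆) p′ q) using (inverseʳ) renaming (inverse to k)
      sa : (x ⋆ * x) ⋆ ≈ x ⋆ * x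
      sa = solve (x ∷ []) (λ x → [] , (x :⋆ :* x) :⋆ ⊜ x :⋆ :* x) []
      ggy : g * g * (x ⋆ * x) ≈ 1#
      ggy = trans (solve (x ⋆ * x ∷ g ∷ []) (λ y g → (y :* g ⟶ g :* y) ∷ [] , g :* g :* y ⊜ y :* (g :* g))
        (commutes refl ∷ [])) isRoot
      isom : IsIsometry (x * g)
      isom = trans (solve (x ∷ g ∷ []) (λ x g → (g :⋆ ⟶ g) ∷ [] , (x :* g) :⋆ :* (x :* g) ⊜ g :* (x :⋆ :* x) :* g)
              (selfAdjoint sa ∷ []))
        (trans (*-congʳ (sym (commutes refl))) (trans (*-assoc _ _ _) isRoot))

-- Two isometries with orthogonal ranges from pure infiniteness.

module Frames (em : ∀ {ℓ} → ExcludedMiddle ℓ) (R : CompleteOrderedField)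
              {ℓ} (A : Setting.CStarAlgebra em R ℓ) where
  open Setting em R
  open Reals em R
  open CStarAlgebra A
  open CStarBasics em R A
  open NewtonIteration em R A
  open RingProperties ring using (x∙y⁻¹≈ε⇒x≈y)

  record Frame : Set ℓ where
    field
      s t    : Carrier
      s⋆s    : s ⋆ * s ≈ 1#
      t⋆t    : t ⋆ * t ≈ 1#
      s⋆t    : s ⋆ * t ≈ 0#

    t⋆s : t ⋆ * s ≈ 0#
    t⋆s = trans (solve (s ∷ t ∷ []) (λ s t → [] , t :⋆ :* s ⊜ (s :⋆ :* t) :⋆) []) (trans (⋆-cong s⋆t) 0⋆≈0)

  module _ (pis : PurelyInfiniteSimple A) where
    open PurelyInfiniteSimple pis

    private
      1≉0ᴬ : ¬ 1# ≈ 0#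
      1≉0ᴬ 1≈0 = ℝ.1≉0 (proj₁ (proj₁ (proj₂ (proj₂ dim>1) ℂ.1# ℂ.1#
        (trans (sym (*-identityˡ _)) (trans (*-congʳ 1≈0) (zeroˡ _))))))

      -- Pure infiniteness gives x with x b* b x* close to 1. Then b x* is nearly isometric, and
      -- polar decomposition corrects it by a factor on the right.
      isometric-multiple : ∀ {b} → ¬ b ≈ 0# → ∃ λ x → IsIsometry (b * x)
      isometric-multiple {b} b≉0 = via (purelyInfinite (b ⋆ * b) 1# (b , refl) (λ p → b≉0 (‖‖-zero⇒ p))
                  (1# , sym (trans (*-identityʳ _) 1⋆≈1)) 1≉0ᴬ)
        where
        via : (∃ λ (x : ℕ → Carrier) → ConvergesTo (λ n → x n * (b ⋆ * b) * x n ⋆) 1#) → ∃ λ x → IsIsometry (b * x)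
        via (x , lim) = via′ (lim ½ 0<½)
          where
          via′ : (∃ λ N → ∀ n → N ℕ.≤ n → ‖ x n * (b ⋆ * b) * x n ⋆ - 1# ‖ ℝ.≤ ½) → ∃ λ x → IsIsometry (b * x)
          via′ (N , h) = via″ (polar-isometry (b * x N ⋆) (‖‖-comm (h N ℕₚ.≤-refl) ⟨≈⟩
              solve (b ∷ x N ∷ []) (λ b x → [] , :1 :- x :* (b :⋆ :* b) :* x :⋆ ⊜
                :1 :- (b :* x :⋆) :⋆ :* (b :* x :⋆)) []) ½-small)
            where
            via″ : (∃ λ g → IsIsometry (b * x N ⋆ * g) × _) → ∃ λ x → IsIsometry (b * x)
            via″ (g , p , _) = x N ⋆ * g , trans (*-cong (⋆-cong (sym (*-assoc _ _ _))) (sym (*-assoc _ _ _))) p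

      orthogonal⇒frame : ∀ {p q} → ¬ p ≈ 0# → ¬ q ≈ 0# → p ⋆ * q ≈ 0# → Frame
      orthogonal⇒frame {p} {q} p≉0 q≉0 pq = via (isometric-multiple p≉0) (isometric-multiple q≉0)
        where
        via : (∃ λ x → IsIsometry (p * x)) → (∃ λ x → IsIsometry (q * x)) → Frame
        via (x , h) (y , k) = record { s = p * x ; t = q * y ; s⋆s = h ; t⋆t = k ; s⋆t =
          solve (p ∷ q ∷ x ∷ y ∷ []) (λ p q x y → (p :⋆ :* q ⟶ :0) ∷ [] , (p :* x) :⋆ :* (q :* y) ⊜ :0) (pq ∷ []) }

      -- Without orthogonal nonzero elements A would be a division algebra; the set
      -- of real numbers μ for which h - μ is a square of a self-adjoint element
      -- would then be open and closed, for every self-adjoint h that is not a scalar.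
      module Division (noFrame : ¬ Frame) where

        -- Let u = b x be an isometry. If u were not unitary, 1 - u u* and u would be nonzero and
        -- orthogonal and would give a frame.
        rightInverse : ∀ {b} → ¬ b ≈ 0# → ∃ λ c → b * c ≈ 1#
        rightInverse {b} b≉0 = via (isometric-multiple b≉0)
          where
          via : (∃ λ x → IsIsometry (b * x)) → ∃ λ c → b * c ≈ 1#
          via (x , h) with em {P = 1# - (b * x) * (b * x) ⋆ ≈ 0#}
          ... | yes p = x * (b * x) ⋆ , trans (sym (*-assoc _ _ _)) (sym (x∙y⁻¹≈ε⇒x≈y _ _ p))
          ... | no ¬p = contradiction (orthogonal⇒frame ¬p u≉0 (solve (b * x ∷ []) (λ u →
                  (u :⋆ :* u ⟶ :1) ∷ [] , (:1 :- u :* u :⋆) :⋆ :* u ⊜ :0) (h ∷ []))) noFrame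
            where
            u≉0 : ¬ b * x ≈ 0#
            u≉0 p = 1≉0ᴬ (trans (sym h) (trans (*-congˡ p) (zeroʳ _)))

        inverse : ∀ {k} → k ⋆ ≈ k → ¬ k ≈ 0# → ∃ λ c → c ⋆ ≈ c × k * c ≈ 1# × c * k ≈ 1#
        inverse {k} sa k≉0 = via (rightInverse k≉0)
          where
          via : (∃ λ c → k * c ≈ 1#) → ∃ λ c → c ⋆ ≈ c × k * c ≈ 1# × c * k ≈ 1#
          via (c , kc) = c , c⋆≈c , kc , trans (*-congʳ (sym c⋆≈c)) c⋆k
            where
            c⋆k : c ⋆ * k ≈ 1#
            c⋆k = trans (*-congˡ (sym sa)) (trans (sym (⋆-* k c)) (trans (⋆-cong kc) 1⋆≈1))
            c⋆≈c : c ⋆ ≈ c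
            c⋆≈c = trans (solve (k ∷ c ⋆ ∷ c ∷ []) (λ k d c → (k :* c ⟶ :1) ∷ [] , d ⊜ d :* (k :* c)) (kc ∷ []))
              (trans (sym (*-assoc _ _ _)) (trans (*-congʳ c⋆k) (*-identityˡ c)))

        module _ (h : Carrier) (sa : h ⋆ ≈ h) (nonscalar : ∀ μ → ¬ h ≈ ⌜ μ ⌝) where

          IsSquare : ℝ → Set ℓ
          IsSquare μ = ∃ λ y → y ⋆ ≈ y × y * y ≈ h - ⌜ μ ⌝

          -- As h is no scalar, k = h - μ has an inverse c, and h - ν = k Y with Y = 1 - (ν - μ) c
          -- close to 1. Let g be the inverse root of Y. Everything in sight commutes, so a root y
          -- of h - μ yields the root y Y g of h - ν, and a root y of h - ν yields the root y g of h
          -- - μ.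
          local : ∀ μ → ∃ λ δ → ℝ.0# ℝ.< δ × (∀ ν → ℝ.Within δ μ ν →
                  (IsSquare μ → IsSquare ν) × (IsSquare ν → IsSquare μ))
          local μ = via (inverse k⋆ λ p → nonscalar μ (x∙y⁻¹≈ε⇒x≈y _ _ p))
            where
            Local : Set ℓ
            Local = ∃ λ δ → ℝ.0# ℝ.< δ × (∀ ν → ℝ.Within δ μ ν →
                    (IsSquare μ → IsSquare ν) × (IsSquare ν → IsSquare μ))
            k : Carrier
            k = h - ⌜ μ ⌝
            k⋆ : k ⋆ ≈ k
            k⋆ = solve (h ∷ ⌜ μ ⌝ ∷ []) (λ h m → (h :⋆ ⟶ h) ∷ (m :⋆ ⟶ m) ∷ [] , (h :- m) :⋆ ⊜ h :- m) (sa ∷ ⌜⌝-⋆ μ ∷ [])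
            via : (∃ λ c → c ⋆ ≈ c × k * c ≈ 1# × c * k ≈ 1#) → Local
            via (c , c⋆ , kc , ck) = via′ (shrink ‖ c ‖ (‖‖-nonneg c) ½ 0<½)
              where
              via′ : (∃ λ δ → ℝ.0# ℝ.< δ × ‖ c ‖ ℝ.* δ ℝ.≤ ½) → Local
              via′ (δ , 0<δ , small) = δ , 0<δ , go
                where
                go : ∀ ν → ℝ.Within δ μ ν → (IsSquare μ → IsSquare ν) × (IsSquare ν → IsSquare μ)
                go ν (p , p′) = forth , back
                  where
                  d : ℝ
                  d = ν ℝ.- μ
                  e : Carrier
                  e = ⌜ d ⌝
                  e-c : All Central (e ∷ [])
                  e-c = ⌜⌝-central d ∷ []
                  Y : Carrier
                  Y = 1# - e * c
                  dd≤δδ : d ℝ.* d ℝ.≤ δ ℝ.* δ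
                  dd≤δδ with ℝ.total ℝ.0# d
                  ... | inj₁ q = square-mono q (lin p′ (solveᴿ (ν ∷ μ ∷ δ ∷ []) (λ n m d → [] ,
                          n :- m :+ (m :+ d) ⊜ d :+ n) []))
                  ... | inj₂ q = ℝ.≤-respˡ-≈ (solveᴿ (d ∷ []) (λ d → [] , (:- d) :* (:- d) ⊜ d :* d) [])
                          (square-mono (lin q (solveᴿ (d ∷ []) (λ d → [] , :0 :+ :0 ⊜ (:- d) :+ d) []))
                          (lin p (solveᴿ (ν ∷ μ ∷ δ ∷ []) (λ n m d → [] , :- (n :- m) :+ (n :+ d) ⊜ d :+ m) [])))
                  ‖1-Y‖ : ‖ 1# - Y ‖ ℝ.≤ ½
                  ‖1-Y‖ = ℝ.≤-trans (‖⌜⌝*‖ d δ c (<⇒≤ 0<δ) dd≤δδ) (ℝ.≤-respˡ-≈ (ℝ.*-comm _ _) small)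
                    ⟨≈⟩ solve (e * c ∷ []) (λ x → [] , x ⊜ :1 :- (:1 :- x)) []
                  open InverseRoot (inverseRoot Y ‖1-Y‖ ½-small) renaming (root to g)
                  Y⋆ : Y ⋆ ≈ Y
                  Y⋆ = solveᶜ (e ∷ []) e-c (c ∷ []) (λ e c → (e :⋆ ⟶ e) ∷ (c :⋆ ⟶ c) ∷ [] ,
                    (:1 :- e :* c) :⋆ ⊜ :1 :- e :* c) (⌜⌝-⋆ d ∷ c⋆ ∷ [])
                  e≈ : e ≈ ⌜ ν ⌝ - ⌜ μ ⌝
                  e≈ = trans (⌜⌝-+ _ _) (+-congˡ (⌜⌝-neg μ))
                  kY : h - ⌜ ν ⌝ ≈ k * Y
                  kY = trans (solve (h ∷ ⌜ ν ⌝ ∷ ⌜ μ ⌝ ∷ []) (λ h n m → [] , h :- n ⊜ h :- m :- (n :- m)) [])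
                    (trans (+-congˡ (-‿cong (sym e≈))) (solveᶜ (e ∷ []) e-c (k ∷ c ∷ []) (λ e k c →
                      (k :* c ⟶ :1) ∷ [] , k :- e ⊜ k :* (:1 :- e :* c)) (kc ∷ [])))
                  k-c : ∀ {y} → y * k ≈ k * y → y * c ≈ c * y
                  k-c {y} q = trans (solve (y ∷ k ∷ c ∷ []) (λ y k c → (c :* k ⟶ :1) ∷ [] , y :* c ⊜ c :* (k :* y) :* c)
                    (ck ∷ [])) (trans (*-congʳ (*-congˡ (sym q))) (solve (y ∷ k ∷ c ∷ []) (λ y k c → (k :* c ⟶ :1) ∷ [] ,
                      c :* (y :* k) :* c ⊜ c :* y) (kc ∷ [])))
                  k-Y : ∀ {y} → y * k ≈ k * y → y * Y ≈ Y * y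
                  k-Y {y} q = solveᶜ (e ∷ []) e-c (y ∷ c ∷ []) (λ e y c → (y :* c ⟶ c :* y) ∷ [] ,
                    y :* (:1 :- e :* c) ⊜ (:1 :- e :* c) :* y) (k-c q ∷ [])
                  forth : IsSquare μ → IsSquare ν
                  forth (y , y⋆ , yy) = y * Y * g ,
                    solve (g ∷ Y ∷ y ∷ []) (λ g Y y → (y :⋆ ⟶ y) ∷ (Y :⋆ ⟶ Y) ∷ (g :⋆ ⟶ g) ∷ (y :* g ⟶ g :* y) ∷
                      (y :* Y ⟶ Y :* y) ∷ (Y :* g ⟶ g :* Y) ∷ [] , (y :* Y :* g) :⋆ ⊜ y :* Y :* g)
                      (y⋆ ∷ Y⋆ ∷ selfAdjoint Y⋆ ∷ commutes yY ∷ yY ∷ commutes refl ∷ []) ,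
                    trans (solve (g ∷ Y ∷ y ∷ []) (λ g Y y → (y :* g ⟶ g :* y) ∷ (y :* Y ⟶ Y :* y) ∷
                        (g :* Y ⟶ Y :* g) ∷ (Y :* g :* g ⟶ :1) ∷ [] , y :* Y :* g :* (y :* Y :* g) ⊜ (y :* y) :* Y)
                        (commutes yY ∷ yY ∷ sym (commutes refl) ∷ trans (*-assoc _ _ _) isRoot ∷ []))
                      (trans (*-congʳ yy) (sym kY))
                    where
                    yY : y * Y ≈ Y * y
                    yY = k-Y (trans (*-congˡ (sym yy)) (trans (sym (*-assoc _ _ _)) (*-congʳ yy)))
                  back : IsSquare ν → IsSquare μ
                  back (y , y⋆ , yy) = y * g ,
                    solve (g ∷ y ∷ []) (λ g y → (y :⋆ ⟶ y) ∷ (g :⋆ ⟶ g) ∷ (y :* g ⟶ g :* y) ∷ [] , (y :* g) :⋆ ⊜ y :* g)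
                      (y⋆ ∷ selfAdjoint Y⋆ ∷ commutes yY ∷ []) ,
                    trans (solve (g ∷ y ∷ []) (λ g y → (y :* g ⟶ g :* y) ∷ [] , y :* g :* (y :* g) ⊜ (y :* y) :* (g :* g))
                        (commutes yY ∷ []))
                      (trans (*-congʳ (trans yy kY)) (trans (*-assoc _ _ _) (trans (*-congˡ isRoot) (*-identityʳ k))))
                    where
                    yh-ν : y * (h - ⌜ ν ⌝) ≈ (h - ⌜ ν ⌝) * y
                    yh-ν = trans (*-congˡ (sym yy)) (trans (sym (*-assoc _ _ _)) (*-congʳ yy))
                    yk : y * k ≈ k * y
                    yk = trans (solveᶜ (⌜ ν ⌝ ∷ ⌜ μ ⌝ ∷ []) (⌜⌝-central ν ∷ ⌜⌝-central μ ∷ []) (y ∷ h ∷ []) (λ n m y h → [] ,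
                        y :* (h :- m) ⊜ y :* (h :- n) :+ (n :- m) :* y) []) (trans (+-congʳ yh-ν)
                      (solve (⌜ ν ⌝ ∷ ⌜ μ ⌝ ∷ y ∷ h ∷ []) (λ n m y h → [] ,
                        (h :- n) :* y :+ (n :- m) :* y ⊜ (h :- m) :* y) []))
                    yY : y * Y ≈ Y * y
                    yY = k-Y yk

          -- The ends of the interval are -m² and m². As m ≥ 1 and m ≥ 2 ‖h‖, the element h / m² has
          -- norm at most ½, so 1 ± h / m² has a root.
          m b : ℝ
          m = ‖ h ‖ ℝ.+ ‖ h ‖ ℝ.+ ℝ.1#
          b = m ℝ.* m

          1≤m : ℝ.1# ℝ.≤ m
          1≤m = lin (ℝ.+-mono-≤ (‖‖-nonneg h) (‖‖-nonneg h)) (solveᴿ (‖ h ‖ ∷ []) (λ h → [] ,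
            :1 :+ (h :+ h) ⊜ h :+ h :+ :1 :+ (:0 :+ :0)) [])

          0<m : ℝ.0# ℝ.< m
          0<m = <-≤-trans 0<1 1≤m

          i : ℝ
          i = m ℝ.⁻¹

          mi : m ℝ.* i ℝ.≈ ℝ.1#
          mi = ℝ.*-inverseʳ (pos⇒≉0 0<m)

          0≤ii : ℝ.0# ℝ.≤ i ℝ.* i
          0≤ii = ℝ.0≤square i

          ii‖h‖≤½ : i ℝ.* i ℝ.* ‖ h ‖ ℝ.≤ ½
          ii‖h‖≤½ = ≤-resp (ℝ.trans (solveᴿ (½ ∷ i ∷ ‖ h ‖ ∷ []) (λ p i h → [] ,
              p :* (i :* i :* (h :+ h)) ⊜ p :* (i :* i :* h) :+ p :* (i :* i :* h)) []) (half+half _))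
            (solveᴿ (½ ∷ m ∷ i ∷ []) (λ h m i → (m :* i ⟶ :1) ∷ [] , h :* (i :* i :* (m :* m)) ⊜ h) (mi ∷ []))
            (ℝ.*-monoʳ-≤ 0≤½ (ℝ.*-monoʳ-≤ 0≤ii (ℝ.≤-trans 2h≤m m≤mm)))
            where
            2h≤m : ‖ h ‖ ℝ.+ ‖ h ‖ ℝ.≤ m
            2h≤m = lin ℝ.0≤1 (solveᴿ (‖ h ‖ ∷ []) (λ h → [] , h :+ h :+ :1 ⊜ h :+ h :+ :1 :+ :0) [])
            m≤mm : m ℝ.≤ m ℝ.* m
            m≤mm = ℝ.≤-respˡ-≈ (ℝ.*-identityʳ m) (ℝ.*-monoʳ-≤ (<⇒≤ 0<m) 1≤m)

          M I : Carrier
          M = ⌜ m ⌝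
          I = ⌜ i ⌝

          MI : M * I ≈ 1#
          MI = trans (sym (⌜⌝-* m i)) (trans (⌜⌝-cong mi) ⌜1⌝)

          -- For c = ± m⁻² this makes `w` a self-adjoint root of m² ± h, because Y g is the square
          -- root of Y.
          module Root (c : ℝ) (cc≤ : c ℝ.* c ℝ.≤ i ℝ.* i ℝ.* (i ℝ.* i)) where
            e Y : Carrier
            e = ⌜ c ⌝
            Y = 1# + e * h
            open InverseRoot (inverseRoot Y (⟨neg⟩ (ℝ.≤-trans (‖⌜⌝*‖ c (i ℝ.* i) h 0≤ii cc≤) ii‖h‖≤½) ⟨≈⟩
              solve (e * h ∷ []) (λ x → [] , :- x ⊜ :1 :- (:1 :+ x)) []) ½-small) renaming (root to g) public
            w : Carrier
            w = M * (Y * g)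
            Y⋆ : Y ⋆ ≈ Y
            Y⋆ = solveᶜ (e ∷ []) (⌜⌝-central c ∷ []) (h ∷ []) (λ e h → (e :⋆ ⟶ e) ∷ (h :⋆ ⟶ h) ∷ [] ,
              (:1 :+ e :* h) :⋆ ⊜ :1 :+ e :* h) (⌜⌝-⋆ c ∷ sa ∷ [])
            h-Y : ∀ {y} → y * h ≈ h * y → y * Y ≈ Y * y
            h-Y {y} q = solveᶜ (e ∷ []) (⌜⌝-central c ∷ []) (y ∷ h ∷ []) (λ e y h → (y :* h ⟶ h :* y) ∷ [] ,
              y :* (:1 :+ e :* h) ⊜ (:1 :+ e :* h) :* y) (q ∷ [])
            w⋆ : w ⋆ ≈ w
            w⋆ = solveᶜ (M ∷ []) (⌜⌝-central m ∷ []) (g ∷ Y ∷ []) (λ M g Y → (M :⋆ ⟶ M) ∷ (g :⋆ ⟶ g) ∷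
              (Y :⋆ ⟶ Y) ∷ (Y :* g ⟶ g :* Y) ∷ [] , (M :* (Y :* g)) :⋆ ⊜ M :* (Y :* g))
              (⌜⌝-⋆ m ∷ selfAdjoint Y⋆ ∷ Y⋆ ∷ commutes refl ∷ [])
            ww : w * w ≈ M * M * Y
            ww = solveᶜ (M ∷ []) (⌜⌝-central m ∷ []) (g ∷ Y ∷ []) (λ M g Y →
              (g :* Y ⟶ Y :* g) ∷ (Y :* g :* g ⟶ :1) ∷ [] , M :* (Y :* g) :* (M :* (Y :* g)) ⊜ M :* M :* Y)
              (sym (commutes refl) ∷ trans (*-assoc _ _ _) isRoot ∷ [])
            w-commutes : ∀ {y} → y * h ≈ h * y → y * w ≈ w * y
            w-commutes {y} q = solveᶜ (M ∷ []) (⌜⌝-central m ∷ []) (y ∷ g ∷ Y ∷ []) (λ M y g Y →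
              (y :* Y ⟶ Y :* y) ∷ (y :* g ⟶ g :* y) ∷ [] , y :* (M :* (Y :* g)) ⊜ M :* (Y :* g) :* y)
              (h-Y q ∷ commutes (h-Y q) ∷ [])
            w≉0 : ¬ w ≈ 0#
            w≉0 p = 1≉0ᴬ (trans (sym isRoot) (trans (*-congʳ (trans (sym (trans (*-congˡ ww)
              (solveᶜ (M ∷ I ∷ []) (⌜⌝-central m ∷ ⌜⌝-central i ∷ []) (Y ∷ []) (λ M I Y → (M :* I ⟶ :1) ∷ [] ,
                I :* I :* (M :* M :* Y) ⊜ Y) (MI ∷ [])))) (trans (*-congˡ (trans (*-congʳ p) (zeroˡ w))) (zeroʳ _))))
              (zeroˡ _)))

          square-start : IsSquare (ℝ.- b)
          square-start = w , w⋆ , trans ww (trans (*-congˡ (+-congˡ (*-congʳ (⌜⌝-* i i))))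
            (trans (solveᶜ (M ∷ I ∷ []) (⌜⌝-central m ∷ ⌜⌝-central i ∷ []) (h ∷ []) (λ M I h → (M :* I ⟶ :1) ∷ [] ,
              M :* M :* (:1 :+ I :* I :* h) ⊜ h :+ M :* M) (MI ∷ []))
            (+-congˡ (trans (sym (⌜⌝-* m m)) (trans (⌜⌝-cong (solveᴿ (m ℝ.* m ∷ []) (λ b → [] , b ⊜ :- (:- b)) []))
              (⌜⌝-neg (ℝ.- b)))))))
            where
            open Root (i ℝ.* i) ℝ.≤-refl

          -- If y² = h - m², then the root w of m² - h commutes with y and y² + w² = 0. Hence (y - i
          -- w)* (y - i w) = 0 and y = i w. The left side is self-adjoint and the right side
          -- skew-adjoint, which forces w = 0; but w² is invertible.
          ¬square-end : ¬ IsSquare b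
          ¬square-end (y , y⋆ , yy) = w≉0 (trans (sym (⌜½⌝-unique refl)) (trans (*-congˡ 2w≈0) (zeroʳ _)))
            where
            open Root (ℝ.- (i ℝ.* i)) (ℝ.≤-reflexive (solveᴿ (i ∷ []) (λ i → [] ,
              (:- (i :* i)) :* (:- (i :* i)) ⊜ i :* i :* (i :* i)) []))
            bM : ⌜ b ⌝ ≈ M * M
            bM = ⌜⌝-* m m
            yh-b : y * (h - ⌜ b ⌝) ≈ (h - ⌜ b ⌝) * y
            yh-b = trans (*-congˡ (sym yy)) (trans (sym (*-assoc _ _ _)) (*-congʳ yy))
            yh : y * h ≈ h * y
            yh = trans (solveᶜ (⌜ b ⌝ ∷ []) (⌜⌝-central b ∷ []) (y ∷ h ∷ []) (λ n y h → [] ,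
              y :* h ⊜ y :* (h :- n) :+ n :* y) []) (trans (+-congʳ yh-b)
              (solve (⌜ b ⌝ ∷ y ∷ h ∷ []) (λ n y h → [] , (h :- n) :* y :+ n :* y ⊜ h :* y) []))
            yw : y * w ≈ w * y
            yw = w-commutes yh
            sum-zero : y * y + w * w ≈ 0#
            sum-zero = trans (+-cong (trans yy (+-congˡ (-‿cong bM))) (trans ww (*-congˡ (+-congˡ (*-congʳ
                (trans (⌜⌝-neg _) (-‿cong (⌜⌝-* i i))))))))
              (solveᶜ (M ∷ I ∷ []) (⌜⌝-central m ∷ ⌜⌝-central i ∷ []) (h ∷ []) (λ M I h → (M :* I ⟶ :1) ∷ [] ,
                h :- M :* M :+ M :* M :* (:1 :+ (:- (I :* I)) :* h) ⊜ :0) (MI ∷ []))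
            y≈𝐢w : y ≈ 𝐢 * w
            y≈𝐢w = x∙y⁻¹≈ε⇒x≈y _ _ (‖‖-zero⇒ (trans (solveᶜ (𝐢 ∷ []) (𝐢-central ∷ []) (y ∷ w ∷ []) (λ i y w →
              (i :⋆ ⟶ :- i) ∷ (y :⋆ ⟶ y) ∷ (w :⋆ ⟶ w) ∷ (i :* i ⟶ :- :1) ∷ (y :* w ⟶ w :* y) ∷ [] ,
              (y :- i :* w) :⋆ :* (y :- i :* w) ⊜ y :* y :+ w :* w) (𝐢⋆ ∷ y⋆ ∷ w⋆ ∷ 𝐢𝐢 ∷ yw ∷ [])) sum-zero))
            𝐢w≈-𝐢w : 𝐢 * w ≈ - (𝐢 * w)
            𝐢w≈-𝐢w = trans (sym y≈𝐢w) (trans (sym y⋆) (trans (⋆-cong y≈𝐢w)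
              (solveᶜ (𝐢 ∷ []) (𝐢-central ∷ []) (w ∷ []) (λ i w → (i :⋆ ⟶ :- i) ∷ (w :⋆ ⟶ w) ∷ [] ,
                (i :* w) :⋆ ⊜ :- (i :* w)) (𝐢⋆ ∷ w⋆ ∷ []))))
            2w≈0 : w + w ≈ 0#
            2w≈0 = trans (solveᶜ (𝐢 ∷ []) (𝐢-central ∷ []) (w ∷ []) (λ i w → (i :* i ⟶ :- :1) ∷ [] ,
              w :+ w ⊜ (:- i) :* (i :* w :+ i :* w)) (𝐢𝐢 ∷ []))
              (trans (*-congˡ (trans (+-congˡ 𝐢w≈-𝐢w) (-‿inverseʳ _))) (zeroʳ _))

          impossible : ⊥
          impossible = ¬square-end (cousin (λ μ ν → IsSquare μ → IsSquare ν)
            (lin (ℝ.+-mono-≤ 0≤b 0≤b) (solveᴿ (b ∷ []) (λ b → [] , (:- b) :+ (b :+ b) ⊜ b :+ (:0 :+ :0)) []))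
            (λ _ _ f g → g ∘ f) (λ μ _ _ → via μ (local μ)) square-start)
            where
            0≤b : ℝ.0# ℝ.≤ b
            0≤b = ℝ.0≤square m
            via : ∀ μ → (∃ λ δ → ℝ.0# ℝ.< δ × (∀ ν → ℝ.Within δ μ ν →
                  (IsSquare μ → IsSquare ν) × (IsSquare ν → IsSquare μ))) → _
            via μ (δ , p , f) = δ , p , λ c d _ c≤μ μ≤d _ μ≤c+δ d≤μ+δ sq →
              proj₁ (f d (ℝ.≤-trans μ≤d (proj₁ (Within-refl (<⇒≤ p))) , d≤μ+δ))
                (proj₂ (f c (μ≤c+δ , ℝ.≤-trans c≤μ (proj₁ (Within-refl (<⇒≤ p))))) sq)

        scalar : ∀ h → h ⋆ ≈ h → ∃ λ μ → h ≈ ⌜ μ ⌝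
        scalar h sa with em {P = ∃ λ μ → h ≈ ⌜ μ ⌝}
        ... | yes p = p
        ... | no ¬p = ⊥-elim (impossible h sa λ μ q → ¬p (μ , q))

        complex-scalar : ∀ a → ∃ λ z → a ≈ z · 1#
        complex-scalar a = via (scalar (a + a ⋆) (solve (a ∷ []) (λ a → [] , (a :+ a :⋆) :⋆ ⊜ a :+ a :⋆) []))
          (scalar (𝐢 * (a ⋆ - a)) (solveᶜ (𝐢 ∷ []) (𝐢-central ∷ []) (a ∷ []) (λ i a → (i :⋆ ⟶ :- i) ∷ [] ,
            (i :* (a :⋆ :- a)) :⋆ ⊜ i :* (a :⋆ :- a)) (𝐢⋆ ∷ [])))
          where
          h = ⌜ ½ ⌝
          via : (∃ λ μ → a + a ⋆ ≈ ⌜ μ ⌝) → (∃ λ ν → 𝐢 * (a ⋆ - a) ≈ ⌜ ν ⌝) → ∃ λ z → a ≈ z · 1#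
          via (μ , p) (ν , q) = (½ , ℝ.0#) ℂ.* ((μ , ℝ.0#) ℂ.+ (ℝ.0# , ℝ.1#) ℂ.* (ν , ℝ.0#)) ,
            sym (trans (scalar-* _ _) (trans (*-congˡ (trans (*ₗ-distribʳ 1# _ _) (+-congˡ (scalar-* _ _))))
              (trans (*-congˡ (+-cong (sym p) (*-congˡ (sym q))))
              (⌜½⌝-unique (solveᶜ (𝐢 ∷ []) (𝐢-central ∷ []) (a ∷ []) (λ i a → (i :* i ⟶ :- :1) ∷ [] ,
                a :+ a ⊜ a :+ a :⋆ :+ i :* (i :* (a :⋆ :- a))) (𝐢𝐢 ∷ []))))))
            where
            open IsLeftModule isLeftModule

        absurd : ⊥
        absurd = via dim>1
          where
          open IsLeftModule isLeftModule
          module ℂ′ = RingProperties ℂ.ring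
          via : (∃₂ λ a b → ∀ z w → z · a + w · b ≈ 0# → z ℂ.≈ ℂ.0# × w ℂ.≈ ℂ.0#) → ⊥
          via (a , b , independent) = via′ (complex-scalar a) (complex-scalar b)
            where
            via′ : (∃ λ z → a ≈ z · 1#) → (∃ λ z → b ≈ z · 1#) → ⊥
            via′ (z , a≈) (w , b≈) = ℝ.1≉0 (proj₁ (proj₁ (independent ℂ.1# ℂ.1# both-zero)))
              where
              dependent : w · a + (ℂ.- z) · b ≈ 0#
              dependent = trans (+-cong (trans (*ₗ-cong ℂ.refl a≈) (sym (*ₗ-assoc w z 1#)))
                  (trans (*ₗ-cong ℂ.refl b≈) (sym (*ₗ-assoc (ℂ.- z) w 1#))))
                (trans (sym (*ₗ-distribʳ 1# _ _)) (trans (*ₗ-cong (ℂ.trans (ℂ.+-cong (ℂ.*-comm w z)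
                  (ℂ.sym (ℂ′.-‿distribˡ-* z w))) (ℂ.-‿inverseʳ _)) refl) (*ₗ-zeroˡ 1#)))
              zeros = independent w (ℂ.- z) dependent
              z≈0 : z ℂ.≈ ℂ.0#
              z≈0 = ℂ.trans (ℂ.sym (ℂ′.-‿involutive z)) (ℂ.trans (ℂ.-‿cong (proj₂ zeros)) ℂ′.-0#≈0#)
              a≈0 : a ≈ 0#
              a≈0 = trans a≈ (trans (*ₗ-cong z≈0 refl) (*ₗ-zeroˡ 1#))
              b≈0 : b ≈ 0#
              b≈0 = trans b≈ (trans (*ₗ-cong (proj₁ zeros) refl) (*ₗ-zeroˡ 1#))
              both-zero : ℂ.1# · a + ℂ.1# · b ≈ 0#
              both-zero = trans (+-cong (trans (*ₗ-cong ℂ.refl a≈0) (*ₗ-zeroʳ _))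
                (trans (*ₗ-cong ℂ.refl b≈0) (*ₗ-zeroʳ _))) (+-identityˡ 0#)

    abstract
      frame : Frame
      frame with em {P = Frame}
      ... | yes f = f
      ... | no ¬f = ⊥-elim (Division.absurd ¬f)

-- Paths of unitaries: Cayley transforms, rotations and close unitaries.

module Paths (em : ∀ {ℓ} → ExcludedMiddle ℓ) (R : CompleteOrderedField)
             {ℓ} (A : Setting.CStarAlgebra em R ℓ) where
  open Setting em R
  open Reals em R
  open CStarAlgebra A
  open CStarBasics em R A
  open NewtonIteration em R A

  Continuous : (𝕀 → Carrier) → Set
  Continuous y = ∀ t η → ℝ.0# ℝ.< η → ∃ λ δ → ℝ.0# ℝ.< δ ×
                 (∀ s → ℝ.Within δ (proj₁ t) (proj₁ s) → ‖ y t - y s ‖ ℝ.≤ η)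

  unitary-norm : ∀ {u} → IsUnitaryElement u → ‖ u ‖ ℝ.≤ ℝ.1#
  unitary-norm (p , _) = isometry-norm p

  unitary-⋆ : ∀ {u} → IsUnitaryElement u → IsUnitaryElement (u ⋆)
  unitary-⋆ (p , q) = trans (*-congʳ (⋆-involutive _)) q , trans (*-congˡ (⋆-involutive _)) p

  unitary-* : ∀ {u v} → IsUnitaryElement u → IsUnitaryElement v → IsUnitaryElement (u * v)
  unitary-* {u} {v} (p , p′) (q , q′) =
    solve (u ∷ v ∷ []) (λ u v → (u :⋆ :* u ⟶ :1) ∷ (v :⋆ :* v ⟶ :1) ∷ [] , (u :* v) :⋆ :* (u :* v) ⊜ :1) (p ∷ q ∷ []) ,
    solve (u ∷ v ∷ []) (λ u v → (u :* u :⋆ ⟶ :1) ∷ (v :* v :⋆ ⟶ :1) ∷ [] , (u :* v) :* (u :* v) :⋆ ⊜ :1) (p′ ∷ q′ ∷ [])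

  unitary-cong : ∀ {u v} → u ≈ v → IsUnitaryElement u → IsUnitaryElement v
  unitary-cong p (q , q′) = trans (*-cong (⋆-cong (sym p)) (sym p)) q , trans (*-cong (sym p) (⋆-cong (sym p))) q′

  unitary-1 : IsUnitaryElement 1#
  unitary-1 = trans (*-identityʳ _) 1⋆≈1 , trans (*-identityˡ _) 1⋆≈1

  -- Commuting with `f` is the condition under which a path can be cut down to matrices: `f` will be
  -- the projection `range n`. With `f` equal to 1 it imposes nothing.
  record Path (f a b : Carrier) : Set ℓ where
    field
      path       : 𝕀 → Carrier
      unitary    : ∀ t → IsUnitaryElement (path t)
      commuting  : ∀ t → f * path t ≈ path t * f
      continuous : Continuous path
      start      : path 0ᴵ ≈ a
      end        : path 1ᴵ ≈ b

    start-unitary : IsUnitaryElement a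
    start-unitary = unitary-cong start (unitary 0ᴵ)

    end-unitary : IsUnitaryElement b
    end-unitary = unitary-cong end (unitary 1ᴵ)

    start-commuting : f * a ≈ a * f
    start-commuting = trans (*-congˡ (sym start)) (trans (commuting 0ᴵ) (*-congʳ start))

    end-commuting : f * b ≈ b * f
    end-commuting = trans (*-congˡ (sym end)) (trans (commuting 1ᴵ) (*-congʳ end))

  1-commutes : ∀ {a} → 1# * a ≈ a * 1#
  1-commutes = trans (*-identityˡ _) (sym (*-identityʳ _))

  path-const : ∀ {f a} → IsUnitaryElement a → f * a ≈ a * f → Path f a a
  path-const {f} {a} u c = record
    { path = λ _ → a ; unitary = λ _ → u ; commuting = λ _ → c
    ; continuous = λ t η p → η , p , λ s _ → ≈⇒‖-‖≤ refl (<⇒≤ p) ; start = refl ; end = refl }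

  path-cong : ∀ {f a b a′ b′} → a ≈ a′ → b ≈ b′ → Path f a b → Path f a′ b′
  path-cong p q P = record { Path P ; start = trans (Path.start P) p ; end = trans (Path.end P) q }

  path-* : ∀ {f a b c d} → Path f a b → Path f c d → Path f (a * c) (b * d)
  path-* {f} P Q = record
    { path = λ t → P.path t * Q.path t
    ; unitary = λ t → unitary-* (P.unitary t) (Q.unitary t)
    ; commuting = λ t → trans (sym (*-assoc _ _ _)) (trans (*-congʳ (P.commuting t))
        (trans (*-assoc _ _ _) (trans (*-congˡ (Q.commuting t)) (sym (*-assoc _ _ _)))))
    ; continuous = λ t η p → via t η (P.continuous t (half η) (half-pos p)) (Q.continuous t (half η) (half-pos p))
    ; start = *-cong P.start Q.start ; end = *-cong P.end Q.end }
    where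
    module P = Path P
    module Q = Path Q
    Near-at : (𝕀 → Carrier) → 𝕀 → ℝ → Set
    Near-at y t η = ∃ λ δ → ℝ.0# ℝ.< δ × (∀ s → ℝ.Within δ (proj₁ t) (proj₁ s) → ‖ y t - y s ‖ ℝ.≤ η)
    via : ∀ t η → Near-at P.path t (half η) → Near-at Q.path t (half η) → Near-at (λ t → P.path t * Q.path t) t η
    via t η (δ , p , h) (δ′ , p′ , h′) = via′ (common p p′)
      where
      via′ : (∃ λ c → ℝ.0# ℝ.< c × c ℝ.≤ δ × c ℝ.≤ δ′) → _
      via′ (c , q , l , l′) = c , q , λ s w → ℝ.≤-respʳ-≈ (half+half η)
        (((h s (Within-mono l w) ⟨*1⟩ unitary-norm (Q.unitary t)) ⟨+⟩
          (unitary-norm (P.unitary s) ⟨1*⟩ h′ s (Within-mono l′ w))) ⟨≈⟩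
        solve (P.path t ∷ P.path s ∷ Q.path t ∷ Q.path s ∷ []) (λ x y z w → [] ,
          (x :- y) :* z :+ y :* (z :- w) ⊜ x :* z :- y :* w) [])

  path-⋆ : ∀ {f a b} → f ⋆ ≈ f → Path f a b → Path f (a ⋆) (b ⋆)
  path-⋆ {f} f⋆ P = record
    { path = λ t → path t ⋆
    ; unitary = λ t → unitary-⋆ (unitary t)
    ; commuting = λ t → trans (*-congʳ (sym f⋆)) (trans (sym (⋆-* _ _)) (trans (⋆-cong (sym (commuting t)))
        (trans (⋆-* _ _) (*-congˡ f⋆))))
    ; continuous = λ t η p → proj₁ (continuous t η p) , proj₁ (proj₂ (continuous t η p)) , λ s w →
        ⟨⋆⟩ (proj₂ (proj₂ (continuous t η p)) s w) ⟨≈⟩ solve (path t ∷ path s ∷ []) (λ x y → [] ,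
          (x :- y) :⋆ ⊜ x :⋆ :- y :⋆) []
    ; start = ⋆-cong start ; end = ⋆-cong end }
    where
    open Path P

  -- For a path x(t), the product a x(t)* b runs from b to a, which spares reversing the parameter.
  path-sym : ∀ {f a b} → f ⋆ ≈ f → Path f a b → Path f b a
  path-sym {f} {a} {b} f⋆ P = path-cong
    (solve (a ∷ b ∷ []) (λ a b → (a :* a :⋆ ⟶ :1) ∷ [] , a :* a :⋆ :* b ⊜ b) (proj₂ start-unitary ∷ []))
    (solve (a ∷ b ∷ []) (λ a b → (b :⋆ :* b ⟶ :1) ∷ [] , a :* b :⋆ :* b ⊜ a) (proj₁ end-unitary ∷ []))
    (path-* (path-* (path-const start-unitary start-commuting) (path-⋆ f⋆ P)) (path-const end-unitary end-commuting))
    where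
    open Path P

  -- The pointwise product x(t) b* y(t) replaces concatenation, so no parameter is halved and no
  -- case distinction arises.
  path-trans : ∀ {f a b c} → f ⋆ ≈ f → Path f a b → Path f b c → Path f a c
  path-trans {f} {a} {b} {c} f⋆ P Q = path-cong
    (solve (a ∷ b ∷ []) (λ a b → (b :⋆ :* b ⟶ :1) ∷ [] , a :* b :⋆ :* b ⊜ a) (proj₁ Q.start-unitary ∷ []))
    (solve (b ∷ c ∷ []) (λ b c → (b :* b :⋆ ⟶ :1) ∷ [] , b :* b :⋆ :* c ⊜ c) (proj₂ Q.start-unitary ∷ []))
    (path-* (path-* P (path-⋆ f⋆ (path-const Q.start-unitary Q.start-commuting))) Q)
    where module Q = Path Q

  -- The unitary p a p* + (1 - p p*).
  α : Carrier → Carrier → Carrier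
  α p a = 1# + p * (a - 1#) * p ⋆

  α-cong : ∀ {p a b} → a ≈ b → α p a ≈ α p b
  α-cong h = +-congˡ (*-congʳ (*-congˡ (+-congʳ h)))

  α-* : ∀ {p} → IsIsometry p → ∀ a b → α p (a * b) ≈ α p a * α p b
  α-* {p} h a b = solve (p ∷ a ∷ b ∷ []) (λ p a b → (p :⋆ :* p ⟶ :1) ∷ [] ,
    :1 :+ p :* (a :* b :- :1) :* p :⋆ ⊜ (:1 :+ p :* (a :- :1) :* p :⋆) :* (:1 :+ p :* (b :- :1) :* p :⋆)) (h ∷ [])

  α-⋆ : ∀ p a → α p (a ⋆) ≈ α p a ⋆
  α-⋆ p a = solve (p ∷ a ∷ []) (λ p a → [] ,
    :1 :+ p :* (a :⋆ :- :1) :* p :⋆ ⊜ (:1 :+ p :* (a :- :1) :* p :⋆) :⋆) []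

  α-1 : ∀ p → α p 1# ≈ 1#
  α-1 p = solve (p ∷ []) (λ p → [] , :1 :+ p :* (:1 :- :1) :* p :⋆ ⊜ :1) []

  α-α : ∀ p q a → α p (α q a) ≈ α (p * q) a
  α-α p q a = solve (p ∷ q ∷ a ∷ []) (λ p q a → [] ,
    :1 :+ p :* (:1 :+ q :* (a :- :1) :* q :⋆ :- :1) :* p :⋆ ⊜ :1 :+ p :* q :* (a :- :1) :* (p :* q) :⋆) []

  α-unitary : ∀ {p a} → IsIsometry p → IsUnitaryElement a → IsUnitaryElement (α p a)
  α-unitary {p} {a} h (u , v) =
    trans (*-congʳ (sym (α-⋆ p a))) (trans (sym (α-* h _ _)) (trans (α-cong u) (α-1 p))) ,
    trans (*-congˡ (sym (α-⋆ p a))) (trans (sym (α-* h _ _)) (trans (α-cong v) (α-1 p)))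

  α-conj : ∀ {u} → IsUnitaryElement u → ∀ a → α u a ≈ u * a * u ⋆
  α-conj {u} (_ , p) a = solve (u ∷ a ∷ []) (λ u a → (u :* u :⋆ ⟶ :1) ∷ [] ,
    :1 :+ u :* (a :- :1) :* u :⋆ ⊜ u :* a :* u :⋆) (p ∷ [])

  isometry-* : ∀ {p q} → IsIsometry p → IsIsometry q → IsIsometry (p * q)
  isometry-* {p} {q} h k = solve (p ∷ q ∷ []) (λ p q → (p :⋆ :* p ⟶ :1) ∷ (q :⋆ :* q ⟶ :1) ∷ [] ,
    (p :* q) :⋆ :* (p :* q) ⊜ :1) (h ∷ k ∷ [])

  path-α : ∀ {f p a b} → f ⋆ ≈ f → f * p ≈ p → IsIsometry p → Path 1# a b → Path f (α p a) (α p b)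
  path-α {f} {p} f⋆ fp h P = record
    { path = λ t → α p (path t)
    ; unitary = λ t → α-unitary h (unitary t)
    ; commuting = λ t → solve (f ∷ p ∷ path t ∷ []) (λ f p a → (f :* p ⟶ p) ∷ (p :⋆ :* f ⟶ p :⋆) ∷ [] ,
        f :* (:1 :+ p :* (a :- :1) :* p :⋆) ⊜ (:1 :+ p :* (a :- :1) :* p :⋆) :* f) (fp ∷ p⋆f ∷ [])
    ; continuous = λ t η q → proj₁ (continuous t η q) , proj₁ (proj₂ (continuous t η q)) , λ s w →
        ((isometry-norm h ⟨1*⟩ proj₂ (proj₂ (continuous t η q)) s w) ⟨*1⟩ ⟨⋆⟩ (isometry-norm h)) ⟨≈⟩
        solve (p ∷ path t ∷ path s ∷ []) (λ p x y → [] , p :* (x :- y) :* p :⋆ ⊜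
          :1 :+ p :* (x :- :1) :* p :⋆ :- (:1 :+ p :* (y :- :1) :* p :⋆)) []
    ; start = α-cong start ; end = α-cong end }
    where
    open Path P
    p⋆f : p ⋆ * f ≈ p ⋆
    p⋆f = trans (*-congˡ (sym f⋆)) (trans (sym (⋆-* _ _)) (⋆-cong fp))

  -- The path of Cayley transforms (1 + τX)(1 - τX)⁻¹ = 2(1 - τX)⁻¹ - 1.
  module Cayley (f X : Carrier) (X⋆ : X ⋆ ≈ - X) (fX : f * X ≈ X * f) (c : 𝕀 → Carrier)
                (c-inverseˡ : ∀ t → c t * (1# - ⌜ proj₁ t ⌝ * X) ≈ 1#)
                (c-inverseʳ : ∀ t → (1# - ⌜ proj₁ t ⌝ * X) * c t ≈ 1#)
                (C : ℝ) (‖c‖≤ : ∀ t → ‖ c t ‖ ℝ.≤ C) where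

    private
      r : 𝕀 → Carrier
      r t = c t + c t - 1#

      module _ (t : 𝕀) where
        e E d : Carrier
        e = ⌜ proj₁ t ⌝
        E = e * X
        d = c t

        E⋆ : E ⋆ ≈ - E
        E⋆ = solveᶜ (e ∷ []) (⌜⌝-central (proj₁ t) ∷ []) (X ∷ []) (λ e X → (e :⋆ ⟶ e) ∷ (X :⋆ ⟶ :- X) ∷ [] ,
          (e :* X) :⋆ ⊜ :- (e :* X)) (⌜⌝-⋆ (proj₁ t) ∷ X⋆ ∷ [])

        Ed : E * d ≈ d - 1#
        Ed = trans (solve (E ∷ d ∷ []) (λ E d → [] , E :* d ⊜ d :- (:1 :- E) :* d) []) (+-congˡ (-‿cong (c-inverseʳ t)))

        dE : d * E ≈ d - 1#
        dE = trans (solve (E ∷ d ∷ []) (λ E d → [] , d :* E ⊜ d :- d :* (:1 :- E)) []) (+-congˡ (-‿cong (c-inverseˡ t)))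

        d⋆E : d ⋆ * E ≈ 1# - d ⋆
        d⋆E = trans (solve (E ∷ d ∷ []) (λ E d → (E :⋆ ⟶ :- E) ∷ [] , d :⋆ :* E ⊜ :- ((E :* d) :⋆)) (E⋆ ∷ []))
          (trans (-‿cong (⋆-cong Ed)) (solve (d ∷ []) (λ d → [] , :- ((d :- :1) :⋆) ⊜ :1 :- d :⋆) []))

        Ed⋆ : E * d ⋆ ≈ 1# - d ⋆
        Ed⋆ = trans (solve (E ∷ d ∷ []) (λ E d → (E :⋆ ⟶ :- E) ∷ [] , E :* d :⋆ ⊜ :- ((d :* E) :⋆)) (E⋆ ∷ []))
          (trans (-‿cong (⋆-cong dE)) (solve (d ∷ []) (λ d → [] , :- ((d :- :1) :⋆) ⊜ :1 :- d :⋆) []))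

        -- As d = (1 - E)⁻¹ and E is skew-adjoint, d* = (1 + E)⁻¹, and both sides equal 2 (1 -
        -- E²)⁻¹. This is the unitarity of 2 d - 1.
        d⋆d : d ⋆ * d + d ⋆ * d ≈ d ⋆ + d
        d⋆d = trans (solve (d ∷ E ∷ []) (λ d E → [] , d :⋆ :* d :+ d :⋆ :* d ⊜
            d :⋆ :* (d :- E :* d) :+ (d :⋆ :+ d :⋆ :* E) :* d) [])
          (trans (+-cong (*-congˡ (+-congˡ (-‿cong Ed))) (*-congʳ (+-congˡ d⋆E)))
          (solve (d ∷ []) (λ d → [] , d :⋆ :* (d :- (d :- :1)) :+ (d :⋆ :+ (:1 :- d :⋆)) :* d ⊜ d :⋆ :+ d) []))

        dd⋆ : d * d ⋆ + d * d ⋆ ≈ d ⋆ + d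
        dd⋆ = trans (solve (d ∷ E ∷ []) (λ d E → [] , d :* d :⋆ :+ d :* d :⋆ ⊜
            (d :- d :* E) :* d :⋆ :+ d :* (d :⋆ :+ E :* d :⋆)) [])
          (trans (+-cong (*-congʳ (+-congˡ (-‿cong dE))) (*-congˡ (+-congˡ Ed⋆)))
          (solve (d ∷ []) (λ d → [] , (d :- (d :- :1)) :* d :⋆ :+ d :* (d :⋆ :+ (:1 :- d :⋆)) ⊜ d :⋆ :+ d) []))

        r-unitary : IsUnitaryElement (r t)
        r-unitary =
          trans (solve (d ∷ []) (λ d → [] , (d :+ d :- :1) :⋆ :* (d :+ d :- :1) ⊜
              (d :⋆ :* d :+ d :⋆ :* d) :+ (d :⋆ :* d :+ d :⋆ :* d) :- (d :⋆ :+ d) :- (d :⋆ :+ d) :+ :1) [])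
            (trans (+-congʳ (+-congʳ (+-congʳ (+-cong d⋆d d⋆d)))) final) ,
          trans (solve (d ∷ []) (λ d → [] , (d :+ d :- :1) :* (d :+ d :- :1) :⋆ ⊜
              (d :* d :⋆ :+ d :* d :⋆) :+ (d :* d :⋆ :+ d :* d :⋆) :- (d :⋆ :+ d) :- (d :⋆ :+ d) :+ :1) [])
            (trans (+-congʳ (+-congʳ (+-congʳ (+-cong dd⋆ dd⋆)))) final)
          where
          final = solve (d ⋆ + d ∷ []) (λ x → [] , x :+ x :- x :- x :+ :1 ⊜ :1) []

        fd : f * d ≈ d * f
        fd = trans (trans (sym (*-identityˡ _)) (*-congʳ (sym (c-inverseˡ t))))
          (trans (solveᶜ (e ∷ []) (⌜⌝-central (proj₁ t) ∷ []) (f ∷ X ∷ d ∷ []) (λ e f X d → (f :* X ⟶ X :* f) ∷ [] ,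
            d :* (:1 :- e :* X) :* (f :* d) ⊜ d :* f :* ((:1 :- e :* X) :* d)) (fX ∷ []))
          (trans (*-congˡ (c-inverseʳ t)) (*-identityʳ _)))

        r-commuting : f * r t ≈ r t * f
        r-commuting = solve (f ∷ d ∷ []) (λ f d → (f :* d ⟶ d :* f) ∷ [] ,
          f :* (d :+ d :- :1) ⊜ (d :+ d :- :1) :* f) (fd ∷ [])

      0≤C : ℝ.0# ℝ.≤ C
      0≤C = 0≤bound (‖c‖≤ 0ᴵ)

      K : ℝ
      K = C ℝ.* ‖ X ‖ ℝ.* C ℝ.+ C ℝ.* ‖ X ‖ ℝ.* C

      0≤K : ℝ.0# ℝ.≤ K
      0≤K = ℝ.≤-respˡ-≈ (ℝ.+-identityˡ _) (ℝ.+-mono-≤ p p)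
        where p = ℝ.*-nonneg (ℝ.*-nonneg 0≤C (‖‖-nonneg X)) 0≤C

      -- By the resolvent identity, c t - c s = c t (τ - σ) X c s.
      r-lipschitz : ∀ t s δ → ℝ.0# ℝ.≤ δ → ℝ.Within δ (proj₁ t) (proj₁ s) → ‖ r t - r s ‖ ℝ.≤ K ℝ.* δ
      r-lipschitz t s δ 0≤δ (p , q) = ℝ.≤-respʳ-≈ (solveᴿ (C ∷ ‖ X ‖ ∷ δ ∷ []) (λ C X d → [] ,
          C :* (d :* X) :* C :+ C :* (d :* X) :* C ⊜ (C :* X :* C :+ C :* X :* C) :* d) [])
        (((bound ⟨+⟩ bound) ⟨≈⟩ eq))
        where
        τ σ : ℝ
        τ = proj₁ t
        σ = proj₁ s
        square≤ : (τ ℝ.- σ) ℝ.* (τ ℝ.- σ) ℝ.≤ δ ℝ.* δ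
        square≤ with ℝ.total ℝ.0# (τ ℝ.- σ)
        ... | inj₁ h = square-mono h (lin p (solveᴿ (τ ∷ σ ∷ δ ∷ []) (λ t s d → [] , t :- s :+ (s :+ d) ⊜ d :+ t) []))
        ... | inj₂ h = ℝ.≤-respˡ-≈ (solveᴿ (τ ∷ σ ∷ []) (λ t s → [] , (s :- t) :* (s :- t) ⊜ (t :- s) :* (t :- s)) [])
                (square-mono (lin h (solveᴿ (τ ∷ σ ∷ []) (λ t s → [] , :0 :+ :0 ⊜ (s :- t) :+ (t :- s)) []))
                  (lin q (solveᴿ (τ ∷ σ ∷ δ ∷ []) (λ t s d → [] , s :- t :+ (t :+ d) ⊜ d :+ s) [])))
        bound : ‖ c t * (⌜ τ ℝ.- σ ⌝ * X) * c s ‖ ℝ.≤ C ℝ.* (δ ℝ.* ‖ X ‖) ℝ.* C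
        bound = (‖c‖≤ t ⟨*⟩ ‖⌜⌝*‖ _ δ X 0≤δ square≤) ⟨*⟩ ‖c‖≤ s
        middle : ⌜ τ ℝ.- σ ⌝ ≈ ⌜ τ ⌝ - ⌜ σ ⌝
        middle = trans (⌜⌝-+ _ _) (+-congˡ (⌜⌝-neg σ))
        diff : c t * (⌜ τ ℝ.- σ ⌝ * X) * c s ≈ c t - c s
        diff = trans (*-congʳ (*-congˡ (*-congʳ middle)))
          (trans (solve (⌜ τ ⌝ ∷ ⌜ σ ⌝ ∷ X ∷ c t ∷ c s ∷ []) (λ τ σ X c d → [] , c :* ((τ :- σ) :* X) :* d ⊜
            c :* ((:1 :- σ :* X) :* d) :- (c :* (:1 :- τ :* X)) :* d) [])
          (trans (+-cong (*-congˡ (c-inverseʳ s)) (-‿cong (*-congʳ (c-inverseˡ t))))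
            (+-cong (*-identityʳ _) (-‿cong (*-identityˡ _)))))
        eq : c t * (⌜ τ ℝ.- σ ⌝ * X) * c s + c t * (⌜ τ ℝ.- σ ⌝ * X) * c s ≈ r t - r s
        eq = trans (+-cong diff diff) (solve (c t ∷ c s ∷ []) (λ c d → [] ,
          (c :- d) :+ (c :- d) ⊜ (c :+ c :- :1) :- (d :+ d :- :1)) [])

      c0≈1 : c 0ᴵ ≈ 1#
      c0≈1 = trans (sym (*-identityʳ _)) (trans (*-congˡ (sym (trans (+-congˡ (-‿cong
        (trans (*-congʳ ⌜0⌝) (zeroˡ X)))) (solve [] ([] , :1 :- :0 ⊜ :1) [])))) (c-inverseˡ 0ᴵ))

    cayley : Path f 1# (c 1ᴵ + c 1ᴵ - 1#)
    cayley = record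
      { path = r ; unitary = r-unitary ; commuting = r-commuting
      ; continuous = λ t η p → via t η (shrink K 0≤K η p)
      ; start = trans (+-congʳ (+-cong c0≈1 c0≈1)) (solve [] ([] , :1 :+ :1 :- :1 ⊜ :1) [])
      ; end = refl }
      where
      via : ∀ t η → (∃ λ δ → ℝ.0# ℝ.< δ × K ℝ.* δ ℝ.≤ η) → ∃ λ δ → ℝ.0# ℝ.< δ ×
            (∀ s → ℝ.Within δ (proj₁ t) (proj₁ s) → ‖ r t - r s ‖ ℝ.≤ η)
      via t η (δ , p , q) = δ , p , λ s w → ℝ.≤-trans (r-lipschitz t s δ (<⇒≤ p) w) q

  -- The Cayley transform W of z - z* exchanges the initial and the final space of z.
  module Rotation (f z : Carrier) (f⋆ : f ⋆ ≈ f) (fz : f * z ≈ z * f)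
                  (zz⋆z : z * (z ⋆ * z) ≈ z) (zz : z * z ≈ 0#) where

    private
      z⋆zz⋆ : z ⋆ * (z * z ⋆) ≈ z ⋆
      z⋆zz⋆ = trans (solve (z ∷ []) (λ z → [] , z :⋆ :* (z :* z :⋆) ⊜ (z :* (z :⋆ :* z)) :⋆) []) (⋆-cong zz⋆z)

      z⋆z⋆ : z ⋆ * z ⋆ ≈ 0#
      z⋆z⋆ = trans (sym (⋆-* z z)) (trans (⋆-cong zz) 0⋆≈0)

      X : Carrier
      X = z - z ⋆

      fz⋆ : f * z ⋆ ≈ z ⋆ * f
      fz⋆ = trans (*-congʳ (sym f⋆)) (trans (sym (⋆-* _ _)) (trans (⋆-cong (sym fz)) (trans (⋆-* _ _) (*-congˡ f⋆))))

      module _ (t : 𝕀) where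
        τ n b : ℝ
        τ = proj₁ t
        n = ℝ.1# ℝ.+ τ ℝ.* τ
        b = n ℝ.⁻¹

        0<n : ℝ.0# ℝ.< n
        0<n = +-pos 0<1 (ℝ.0≤square τ)

        nb : n ℝ.* b ℝ.≈ ℝ.1#
        nb = ℝ.*-inverseʳ (pos⇒≉0 0<n)

        b≤1 : b ℝ.≤ ℝ.1#
        b≤1 = lin (ℝ.*-nonneg (ℝ.0≤square τ) (<⇒≤ (⁻¹-pos 0<n))) (ℝ.trans
          (solveᴿ (b ∷ τ ∷ []) (λ b t → [] , b :+ t :* t :* b ⊜ (:1 :+ t :* t) :* b) []) (ℝ.trans nb
          (ℝ.sym (ℝ.+-identityʳ _))))

        b′ τ′ c : Carrier
        b′ = ⌜ b ⌝
        τ′ = ⌜ τ ⌝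
        -- With X = z - z* and e = z* z + z z* one has X² = - e and e X = X. Hence the inverse of 1
        -- - τ X is 1 - e + (e + τ X) / (1 + τ²).
        c = 1# - (z ⋆ * z + z * z ⋆) + b′ * (z ⋆ * z + z * z ⋆ + τ′ * (z - z ⋆))

        bττ : b′ * τ′ * τ′ ≈ 1# - b′
        bττ = trans (solveᶜ (b′ ∷ τ′ ∷ []) (⌜⌝-central b ∷ ⌜⌝-central τ ∷ []) [] (λ b t → [] ,
          b :* t :* t ⊜ (:1 :+ t :* t) :* b :- b) []) (+-congʳ (trans (*-congʳ (+-cong (sym ⌜1⌝) (sym (⌜⌝-* τ τ))))
            (trans (*-congʳ (sym (⌜⌝-+ _ _))) (trans (sym (⌜⌝-* _ _)) (trans (⌜⌝-cong nb) ⌜1⌝)))))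

        inverseˡ : c * (1# - τ′ * X) ≈ 1#
        inverseˡ = solveᶜ (b′ ∷ τ′ ∷ []) (⌜⌝-central b ∷ ⌜⌝-central τ ∷ []) (z ∷ []) (λ b t z →
          (b :* t :* t ⟶ :1 :- b) ∷ (z :* (z :⋆ :* z) ⟶ z) ∷ (z :⋆ :* (z :* z :⋆) ⟶ z :⋆) ∷ (z :* z ⟶ :0) ∷
          (z :⋆ :* z :⋆ ⟶ :0) ∷ [] ,
          (:1 :- (z :⋆ :* z :+ z :* z :⋆) :+ b :* (z :⋆ :* z :+ z :* z :⋆ :+ t :* (z :- z :⋆))) :*
            (:1 :- t :* (z :- z :⋆)) ⊜ :1) (bττ ∷ zz⋆z ∷ z⋆zz⋆ ∷ zz ∷ z⋆z⋆ ∷ [])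

        inverseʳ : (1# - τ′ * X) * c ≈ 1#
        inverseʳ = solveᶜ (b′ ∷ τ′ ∷ []) (⌜⌝-central b ∷ ⌜⌝-central τ ∷ []) (z ∷ []) (λ b t z →
          (b :* t :* t ⟶ :1 :- b) ∷ (z :* (z :⋆ :* z) ⟶ z) ∷ (z :⋆ :* (z :* z :⋆) ⟶ z :⋆) ∷ (z :* z ⟶ :0) ∷
          (z :⋆ :* z :⋆ ⟶ :0) ∷ [] ,
          (:1 :- t :* (z :- z :⋆)) :*
          (:1 :- (z :⋆ :* z :+ z :* z :⋆) :+ b :* (z :⋆ :* z :+ z :* z :⋆ :+ t :* (z :- z :⋆))) ⊜ :1)
          (bττ ∷ zz⋆z ∷ z⋆zz⋆ ∷ zz ∷ z⋆z⋆ ∷ [])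

        C-bound : ‖ c ‖ ℝ.≤ ‖ 1# - (z ⋆ * z + z * z ⋆) ‖ ℝ.+ (‖ z ⋆ * z + z * z ⋆ ‖ ℝ.+ ‖ X ‖)
        C-bound = ℝ.≤-refl ⟨+⟩ ℝ.≤-trans (‖⌜⌝*‖⁺ _ (<⇒≤ (⁻¹-pos 0<n))) (ℝ.≤-trans (*-monoˡ-≤ (‖‖-nonneg _) b≤1)
          (ℝ.≤-respˡ-≈ (ℝ.sym (ℝ.*-identityˡ _)) (ℝ.≤-refl ⟨+⟩ ℝ.≤-trans (‖⌜⌝*‖⁺ X (proj₁ (proj₂ t)))
            (ℝ.≤-respʳ-≈ (ℝ.*-identityˡ _) (*-monoˡ-≤ (‖‖-nonneg X) (proj₂ (proj₂ t)))))))

    W : Carrier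
    W = 1# - (z ⋆ * z + z * z ⋆) + (z - z ⋆)

    rotation : Path f 1# W
    rotation = path-cong refl c1 (Cayley.cayley f X
      (solve (z ∷ []) (λ z → [] , (z :- z :⋆) :⋆ ⊜ :- (z :- z :⋆)) [])
      (solve (f ∷ z ∷ []) (λ f z → (f :* z ⟶ z :* f) ∷ (f :* z :⋆ ⟶ z :⋆ :* f) ∷ [] , f :* (z :- z :⋆) ⊜ (z :- z :⋆) :* f)
        (fz ∷ fz⋆ ∷ []))
      c inverseˡ inverseʳ _ C-bound)
      where
      β : Carrier
      β = b′ 1ᴵ
      2β : β + β ≈ 1#
      2β = trans (sym (⌜⌝-+ _ _)) (trans (⌜⌝-cong (ℝ.trans (solveᴿ (b 1ᴵ ∷ []) (λ b → [] ,
        b :+ b ⊜ (:1 :+ :1 :* :1) :* b) []) (nb 1ᴵ))) ⌜1⌝)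
      c1 : c 1ᴵ + c 1ᴵ - 1# ≈ W
      c1 = trans (+-congʳ (+-cong (+-congˡ (*-congˡ (+-congˡ (*-congʳ ⌜1⌝)))) (+-congˡ (*-congˡ (+-congˡ (*-congʳ ⌜1⌝))))))
        (trans (solve (β ∷ z ∷ []) (λ b z → [] ,
          (:1 :- (z :⋆ :* z :+ z :* z :⋆) :+ b :* (z :⋆ :* z :+ z :* z :⋆ :+ :1 :* (z :- z :⋆))) :+
          (:1 :- (z :⋆ :* z :+ z :* z :⋆) :+ b :* (z :⋆ :* z :+ z :* z :⋆ :+ :1 :* (z :- z :⋆))) :- :1 ⊜
          (:1 :- (z :⋆ :* z :+ z :* z :⋆)) :- (z :⋆ :* z :+ z :* z :⋆) :+
            (b :+ b) :* (z :⋆ :* z :+ z :* z :⋆ :+ (z :- z :⋆))) [])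
        (trans (+-congˡ (*-congʳ 2β)) (solve (z ∷ []) (λ z → [] ,
          (:1 :- (z :⋆ :* z :+ z :* z :⋆)) :- (z :⋆ :* z :+ z :* z :⋆) :+
            :1 :* (z :⋆ :* z :+ z :* z :⋆ :+ (z :- z :⋆)) ⊜ :1 :- (z :⋆ :* z :+ z :* z :⋆) :+ (z :- z :⋆)) [])))

    -- The path conjugates `1# + h` by the rotation. The last two hypotheses place h in the initial
    -- space of z, so that W h W* = z h z* at the end.
    swap : ∀ {h} → IsUnitaryElement (1# + h) → f * h ≈ h * f → z ⋆ * (z * h) ≈ h → h * (z ⋆ * z) ≈ h →
           Path f (1# + h) (1# + z * h * z ⋆)
    swap {h} u fh zzh hzz = path-cong
      (solve (h ∷ []) (λ h → [] , :1 :* (:1 :+ h) :* :1 :⋆ ⊜ :1 :+ h) [])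
      (trans (*-congʳ Ww) (trans (*-assoc _ _ _) (trans (*-congˡ (proj₂ (Path.end-unitary rotation))) (*-identityʳ _))))
      (path-* (path-* rotation (path-const u (solve (f ∷ h ∷ []) (λ f h → (f :* h ⟶ h :* f) ∷ [] ,
        f :* (:1 :+ h) ⊜ (:1 :+ h) :* f) (fh ∷ [])))) (path-⋆ f⋆ rotation))
      where
      Wh : z ⋆ * h ≈ 0#
      Wh = trans (*-congˡ (sym zzh)) (solve (z ∷ h ∷ []) (λ z h → (z :⋆ :* z :⋆ ⟶ :0) ∷ [] ,
        z :⋆ :* (z :⋆ :* (z :* h)) ⊜ :0) (z⋆z⋆ ∷ []))
      hz : h * z ≈ 0#
      hz = trans (*-congʳ (sym hzz)) (solve (z ∷ h ∷ []) (λ z h → (z :* z ⟶ :0) ∷ [] ,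
        h :* (z :⋆ :* z) :* z ⊜ :0) (zz ∷ []))
      Ww : W * (1# + h) ≈ (1# + z * h * z ⋆) * W
      Ww = solve (z ∷ h ∷ []) (λ z h →
        (z :⋆ :* (z :* h) ⟶ h) ∷ (h :* (z :⋆ :* z) ⟶ h) ∷ (z :⋆ :* h ⟶ :0) ∷ (h :* z ⟶ :0) ∷
        (z :* (z :⋆ :* z) ⟶ z) ∷ (z :⋆ :* (z :* z :⋆) ⟶ z :⋆) ∷ (z :* z ⟶ :0) ∷ (z :⋆ :* z :⋆ ⟶ :0) ∷ [] ,
        (:1 :- (z :⋆ :* z :+ z :* z :⋆) :+ (z :- z :⋆)) :* (:1 :+ h) ⊜
        (:1 :+ z :* h :* z :⋆) :* (:1 :- (z :⋆ :* z :+ z :* z :⋆) :+ (z :- z :⋆)))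
        (zzh ∷ hzz ∷ Wh ∷ hz ∷ zz⋆z ∷ z⋆zz⋆ ∷ zz ∷ z⋆z⋆ ∷ [])

  -- Rotation by the partial isometry q p*, which takes the range of p to the orthogonal range of q.
  path-swap : ∀ {f p q a} → f ⋆ ≈ f → f * (q * p ⋆) ≈ q * p ⋆ * f → f * α p a ≈ α p a * f →
              IsIsometry p → IsIsometry q → p ⋆ * q ≈ 0# → IsUnitaryElement a → Path f (α p a) (α q a)
  path-swap {f} {p} {q} {a} f⋆ fz fα pp qq pq u = path-cong refl (+-congˡ
      (solve (p ∷ q ∷ a ∷ []) (λ p q a → (p :⋆ :* p ⟶ :1) ∷ [] ,
        q :* p :⋆ :* (p :* (a :- :1) :* p :⋆) :* (q :* p :⋆) :⋆ ⊜ q :* (a :- :1) :* q :⋆) (pp ∷ [])))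
    (swap (α-unitary pp u) (trans (solve (f ∷ α p a ∷ p * (a - 1#) * p ⋆ ∷ []) (λ f x h → [] ,
        f :* h ⊜ f :* (:1 :+ h) :- f) []) (trans (+-congʳ fα) (solve (f ∷ p * (a - 1#) * p ⋆ ∷ []) (λ f h → [] ,
        (:1 :+ h) :* f :- f ⊜ h :* f) [])))
      (solve (p ∷ q ∷ a ∷ []) (λ p q a → (p :⋆ :* p ⟶ :1) ∷ (q :⋆ :* q ⟶ :1) ∷ [] ,
        (q :* p :⋆) :⋆ :* (q :* p :⋆ :* (p :* (a :- :1) :* p :⋆)) ⊜ p :* (a :- :1) :* p :⋆) (pp ∷ qq ∷ []))
      (solve (p ∷ q ∷ a ∷ []) (λ p q a → (p :⋆ :* p ⟶ :1) ∷ (q :⋆ :* q ⟶ :1) ∷ [] ,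
        p :* (a :- :1) :* p :⋆ :* ((q :* p :⋆) :⋆ :* (q :* p :⋆)) ⊜ p :* (a :- :1) :* p :⋆) (pp ∷ qq ∷ [])))
    where
    open Rotation f (q * p ⋆) f⋆ fz
      (solve (p ∷ q ∷ []) (λ p q → (p :⋆ :* p ⟶ :1) ∷ (q :⋆ :* q ⟶ :1) ∷ [] ,
        q :* p :⋆ :* ((q :* p :⋆) :⋆ :* (q :* p :⋆)) ⊜ q :* p :⋆) (pp ∷ qq ∷ []))
      (solve (p ∷ q ∷ []) (λ p q → (p :⋆ :* q ⟶ :0) ∷ [] , q :* p :⋆ :* (q :* p :⋆) ⊜ :0) (pq ∷ []))

  ¼ : ℝ
  ¼ = ½^ 2

  private
    -- The inverse Cayley transform X = (w - 1)(w + 1)⁻¹ is skew-adjoint. Its bound explains ¼: c₁ =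
    -- (1 + w) / 2 is within ⅛ of 1 and its inverse has norm at most 4, so ‖X‖ ≤ ½ and 1 - τ X stays
    -- within ½ of 1 for all τ in the unit interval.
    module Close (w : Carrier) (u : IsUnitaryElement w) (near : ‖ w - 1# ‖ ℝ.≤ ¼) where

      c₁ : Carrier
      c₁ = ⌜ ½ ⌝ * (1# + w)

      2c₁ : c₁ + c₁ ≈ 1# + w
      2c₁ = ⌜½⌝*-+ _

      ‖1-c₁‖ : ‖ 1# - c₁ ‖ ℝ.≤ half ¼
      ‖1-c₁‖ = ℝ.≤-trans (‖⌜⌝*‖⁺ (1# - w) 0≤½) (ℝ.*-monoʳ-≤ 0≤½ (‖‖-comm near))
        ⟨≈⟩ ⌜½⌝-unique (trans (solve (c₁ ∷ []) (λ c → [] , :1 :- c :+ (:1 :- c) ⊜ :1 :+ :1 :- (c :+ c)) [])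
          (trans (+-congˡ (-‿cong 2c₁)) (solve (w ∷ []) (λ w → [] , :1 :+ :1 :- (:1 :+ w) ⊜ :1 :- w) [])))

      ¼+¼≤1 : half ¼ ℝ.+ half ¼ ℝ.≤ ℝ.1#
      ¼+¼≤1 = ℝ.≤-respˡ-≈ (ℝ.sym (half+half ¼)) (½^-mono {0} {2} ℕ.z≤n)

      open NearInverse (nearInverse c₁ ‖1-c₁‖ ¼+¼≤1) renaming (inverse to G)

      X : Carrier
      X = 1# - G

      c₁⋆ : c₁ ⋆ ≈ w ⋆ * c₁
      c₁⋆ = solveᶜ (⌜ ½ ⌝ ∷ []) (⌜⌝-central ½ ∷ []) (w ∷ []) (λ h w → (h :⋆ ⟶ h) ∷ (w :⋆ :* w ⟶ :1) ∷ [] ,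
        (h :* (:1 :+ w)) :⋆ ⊜ w :⋆ :* (h :* (:1 :+ w))) (⌜⌝-⋆ ½ ∷ proj₁ u ∷ [])

      G⋆ : G ⋆ ≈ G * w
      G⋆ = trans (solve (c₁ ∷ G ∷ w ∷ []) (λ c G w → (G :* c ⟶ :1) ∷ (w :* w :⋆ ⟶ :1) ∷ [] ,
          G :⋆ ⊜ G :* w :* (w :⋆ :* c :* G :⋆)) (inverseˡ ∷ proj₂ u ∷ []))
        (trans (*-congˡ (trans (*-congʳ (sym c₁⋆)) (trans (sym (⋆-* G c₁)) (trans (⋆-cong inverseˡ) 1⋆≈1))))
          (*-identityʳ _))

      X⋆ : X ⋆ ≈ - X
      X⋆ = trans (solve (G ∷ []) (λ G → [] , (:1 :- G) :⋆ ⊜ :1 :- G :⋆) []) (trans (+-congˡ (-‿cong G⋆))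
        (trans (solve (G ∷ w ∷ []) (λ G w → [] , :1 :- G :* w ⊜ :1 :- G :* (:1 :+ w) :+ G) [])
        (trans (+-congʳ (+-congˡ (-‿cong (*-congˡ (sym 2c₁))))) (solve (c₁ ∷ G ∷ []) (λ c G → (G :* c ⟶ :1) ∷ [] ,
          :1 :- G :* (c :+ c) :+ G ⊜ :- (:1 :- G)) (inverseˡ ∷ [])))))

      ‖X‖≤½ : ‖ X ‖ ℝ.≤ ½
      ‖X‖≤½ = ℝ.≤-respʳ-≈ (ℝ.trans (solveᴿ (½ ∷ []) (λ h → [] ,
          h :* (h :* (h :* :1)) :* ((:1 :+ :1) :* (:1 :+ :1)) ⊜ (h :+ h) :* (h :+ h) :* h) [])
          (ℝ.trans (ℝ.*-congʳ (ℝ.*-cong ½+½≈1 ½+½≈1)) (solveᴿ (½ ∷ []) (λ h → [] , :1 :* :1 :* h ⊜ h) [])))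
        ((‖‖-comm ‖1-c₁‖ ⟨*⟩ inverse-norm) ⟨≈⟩ solve (c₁ ∷ G ∷ []) (λ c G → (c :* G ⟶ :1) ∷ [] ,
          (c :- :1) :* G ⊜ :1 :- G) (inverseʳ ∷ []))

      near-inverse : ∀ (t : 𝕀) → NearInverse (1# - ⌜ proj₁ t ⌝ * X) ½
      near-inverse t = nearInverse _ (ℝ.≤-trans (‖⌜⌝*‖⁺ X (proj₁ (proj₂ t)))
        (ℝ.≤-respʳ-≈ (ℝ.*-identityˡ _) (ℝ.*-mono-≤ (proj₁ (proj₂ t)) 0≤½ (proj₂ (proj₂ t)) ‖X‖≤½))
        ⟨≈⟩ solve (⌜ proj₁ t ⌝ * X ∷ []) (λ x → [] , x ⊜ :1 :- (:1 :- x)) []) ½-small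

      module N (t : 𝕀) = NearInverse (near-inverse t)

      inverse-unique : ∀ {d y c} → d * y ≈ 1# → y * c ≈ 1# → d ≈ c
      inverse-unique {d} {y} {c} p q = trans (trans (sym (*-identityʳ d)) (*-congˡ (sym q)))
        (trans (sym (*-assoc d y c)) (trans (*-congʳ p) (*-identityˡ c)))

      end-inverse : (1# - ⌜ ℝ.1# ⌝ * X) * c₁ ≈ 1#
      end-inverse = trans (*-congʳ (+-congˡ (-‿cong (*-congʳ ⌜1⌝)))) (solve (c₁ ∷ G ∷ []) (λ c G → (G :* c ⟶ :1) ∷ [] ,
        (:1 :- :1 :* (:1 :- G)) :* c ⊜ :1) (inverseˡ ∷ []))

      end≈ : N.inverse 1ᴵ ≈ c₁
      end≈ = inverse-unique {N.inverse 1ᴵ} {1# - ⌜ ℝ.1# ⌝ * X} {c₁} (N.inverseˡ 1ᴵ) end-inverse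

      end≈′ : N.inverse 1ᴵ + N.inverse 1ᴵ - 1# ≈ w
      end≈′ = trans (+-congʳ (trans (+-cong end≈ end≈) 2c₁)) (solve (w ∷ []) (λ w → [] , :1 :+ w :- :1 ⊜ w) [])

      path-1-w : Path 1# 1# w
      path-1-w = path-cong refl end≈′
        (Cayley.cayley 1# X X⋆ 1-commutes N.inverse N.inverseˡ N.inverseʳ (2# ℝ.* 2#) N.inverse-norm)

  path-close : ∀ {a b} → IsUnitaryElement a → IsUnitaryElement b → ‖ a - b ‖ ℝ.≤ ¼ → Path 1# b a
  path-close {a} {b} u v p = path-cong (*-identityˡ b)
    (solve (a ∷ b ∷ []) (λ a b → (b :⋆ :* b ⟶ :1) ∷ [] , a :* b :⋆ :* b ⊜ a) (proj₁ v ∷ []))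
    (path-* (Close.path-1-w (a * b ⋆) (unitary-* u (unitary-⋆ v))
      ((p ⟨*1⟩ ⟨⋆⟩ (unitary-norm v)) ⟨≈⟩ solve (a ∷ b ∷ []) (λ a b → (b :* b :⋆ ⟶ :1) ∷ [] ,
        (a :- b) :* b :⋆ ⊜ a :* b :⋆ :- :1) (proj₂ v ∷ []))) (path-const v 1-commutes))

-- Stable homotopy in A and its approximate certificates.

module Stable (em : ∀ {ℓ} → ExcludedMiddle ℓ) (R : CompleteOrderedField)
              {ℓ} (A : Setting.CStarAlgebra em R ℓ) (F : Frames.Frame em R A) where
  open Setting em R
  open Reals em R
  open CStarAlgebra A
  open CStarBasics em R A
  open Paths em R A
  open Frames.Frame F

  -- Homotopy of the unitaries after stabilisation by s; this is equality in K₁.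
  infix 4 _∼_
  _∼_ : Carrier → Carrier → Set ℓ
  a ∼ b = Path 1# (α s a) (α s b)

  private
    1⋆ : 1# ⋆ ≈ 1#
    1⋆ = 1⋆≈1

  path⇒∼ : ∀ {a b} → Path 1# a b → a ∼ b
  path⇒∼ = path-α 1⋆ (*-identityˡ s) s⋆s

  ∼-refl : ∀ {a} → IsUnitaryElement a → a ∼ a
  ∼-refl u = path-const (α-unitary s⋆s u) 1-commutes

  ∼-reflexive : ∀ {a b} → IsUnitaryElement a → a ≈ b → a ∼ b
  ∼-reflexive u p = path-cong refl (α-cong p) (∼-refl u)

  ∼-sym : ∀ {a b} → a ∼ b → b ∼ a
  ∼-sym = path-sym 1⋆

  ∼-trans : ∀ {a b c} → a ∼ b → b ∼ c → a ∼ c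
  ∼-trans = path-trans 1⋆

  ∼-* : ∀ {a b c d} → a ∼ b → c ∼ d → a * c ∼ b * d
  ∼-* p q = path-cong (sym (α-* s⋆s _ _)) (sym (α-* s⋆s _ _)) (path-* p q)

  ∼-⋆ : ∀ {a b} → a ∼ b → a ⋆ ∼ b ⋆
  ∼-⋆ p = path-cong (sym (α-⋆ s _)) (sym (α-⋆ s _)) (path-⋆ 1⋆ p)

  close⇒∼ : ∀ {a b} → IsUnitaryElement a → IsUnitaryElement b → ‖ a - b ‖ ℝ.≤ ¼ → a ∼ b
  close⇒∼ u v p = path⇒∼ (path-close v u (‖‖-comm p))

  -- After stabilisation the copy of a on the range of s p is moved to the range of t, which is
  -- orthogonal to it, and from there to the range of s.
  α-∼ : ∀ {p a} → IsIsometry p → IsUnitaryElement a → α p a ∼ a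
  α-∼ {p} {a} pp u = path-trans 1⋆
    (path-cong (sym (α-α s p a)) refl (path-swap 1⋆ 1-commutes 1-commutes (isometry-* s⋆s pp) t⋆t
      (solve (s ∷ t ∷ p ∷ []) (λ s t p → (s :⋆ :* t ⟶ :0) ∷ [] , (s :* p) :⋆ :* t ⊜ :0) (s⋆t ∷ [])) u))
    (path-swap 1⋆ 1-commutes 1-commutes t⋆t s⋆s t⋆s u)

  -- The product a b is the conjugate of b a by a, and conjugation by a unitary is `α` for an
  -- isometry that happens to be unitary.
  ∼-comm : ∀ {a b} → IsUnitaryElement a → IsUnitaryElement b → a * b ∼ b * a
  ∼-comm {a} {b} u v = path-cong (α-cong (trans (α-conj u (b * a))
      (solve (a ∷ b ∷ []) (λ a b → (a :* a :⋆ ⟶ :1) ∷ [] , a :* (b :* a) :* a :⋆ ⊜ a :* b) (proj₂ u ∷ []))))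
    refl (α-∼ (proj₁ u) (unitary-* v u))

  ∼-cancelʳ : ∀ {a b c} → IsUnitaryElement c → a * c ∼ b * c → a ∼ b
  ∼-cancelʳ {a} {b} {c} u p = path-cong (α-cong (cancel a)) (α-cong (cancel b)) (∼-* p (∼-refl (unitary-⋆ u)))
    where
    cancel : ∀ x → x * c * c ⋆ ≈ x
    cancel x = solve (x ∷ c ∷ []) (λ x c → (c :* c :⋆ ⟶ :1) ∷ [] , x :* c :* c :⋆ ⊜ x) (proj₂ u ∷ [])

  -- Up to the error η, a and b agree modulo a commutator after stabilisation by p.
  Certified : ℝ → Carrier → Carrier → Set ℓ
  Certified η a b = ∃ λ p → ∃₂ λ v d → IsIsometry p × IsUnitaryElement v × IsUnitaryElement d ×
                    ‖ v * α p a * d - α p b * d * v ‖ ℝ.≤ η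

  -- Closeness gives a stable homotopy. Commutativity brings v to the right of both factors on the
  -- left-hand side, and then d v cancels.
  certified⇒∼ : ∀ {a b} → IsUnitaryElement a → IsUnitaryElement b → Certified ¼ a b → a ∼ b
  certified⇒∼ {a} {b} ua ub (p , v , d , pp , uv , ud , close) =
    ∼-trans (∼-sym (α-∼ pp ua)) (∼-trans (∼-cancelʳ (unitary-* ud uv) step₂) (α-∼ pp ub))
    where
    uA = α-unitary pp ua
    uB = α-unitary pp ub
    step₁ : v * (α p a * d) ∼ α p b * (d * v)
    step₁ = path-cong (α-cong (*-assoc _ _ _)) (α-cong (*-assoc _ _ _))
      (close⇒∼ (unitary-* (unitary-* uv uA) ud) (unitary-* (unitary-* uB ud) uv) close)
    step₂ : α p a * (d * v) ∼ α p b * (d * v)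
    step₂ = ∼-trans (path-cong (α-cong (*-assoc _ _ _)) refl (∼-comm (unitary-* uA ud) uv)) step₁

  private
    -- The power of x with exponent 2ᵏ.
    sqpow : ℕ → ℝ → ℝ
    sqpow ℕ.zero    x = x
    sqpow (ℕ.suc k) x = sqpow k (x ℝ.* x)

    sqpow-cong : ∀ k {x y} → x ℝ.≈ y → sqpow k x ℝ.≈ sqpow k y
    sqpow-cong ℕ.zero    p = p
    sqpow-cong (ℕ.suc k) p = sqpow-cong k (ℝ.*-cong p p)

    -- Bernoulli's inequality: each squaring of 1 + c at least doubles c, so a k-fold squared ratio
    -- of at most 2 bounds 2ᵏ c by 1.
    sqpow-ratio : ∀ k {n η c} → ℝ.0# ℝ.< η → ℝ.0# ℝ.≤ c → η ℝ.* (ℝ.1# ℝ.+ c) ℝ.≤ n →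
                  sqpow k n ℝ.≤ 2# ℝ.* sqpow k η → c ℝ.≤ ½^ k
    sqpow-ratio ℕ.zero {n} {η} {c} 0<η 0≤c p q = lin
      (*-monoˡ-≤ (<⇒≤ (⁻¹-pos 0<η)) (ℝ.≤-trans p q))
      (solveᴿ (η ∷ η ℝ.⁻¹ ∷ c ∷ []) (λ e i c → (e :* i ⟶ :1) ∷ [] ,
        c :+ (:1 :+ :1) :* e :* i ⊜ :1 :+ e :* (:1 :+ c) :* i) (ℝ.*-inverseʳ (pos⇒≉0 0<η) ∷ []))
    sqpow-ratio (ℕ.suc k) {n} {η} {c} 0<η 0≤c p q = ℝ.≤-respˡ-≈
      (ℝ.trans (ℝ.*-congˡ (ℝ.refl {c ℝ.+ c})) (ℝ.trans (ℝ.distribˡ ½ c c) (half+half c)))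
      (ℝ.*-monoʳ-≤ 0≤½ (sqpow-ratio k (*-pos 0<η 0<η) (ℝ.≤-respˡ-≈ (ℝ.+-identityˡ _) (ℝ.+-mono-≤ 0≤c 0≤c))
        (lin (ℝ.+-mono-≤ (ℝ.*-mono-≤ 0≤l (ℝ.≤-trans 0≤l p) p p)
          (ℝ.*-nonneg (ℝ.0≤square η) (ℝ.0≤square c)))
          (solveᴿ (η ∷ c ∷ n ∷ []) (λ e c n → [] , e :* e :* (:1 :+ (c :+ c)) :+ (n :* n :+ e :* e :* (c :* c)) ⊜
            n :* n :+ (e :* (:1 :+ c) :* (e :* (:1 :+ c)) :+ :0)) [])) q))
      where
      0≤l : ℝ.0# ℝ.≤ η ℝ.* (ℝ.1# ℝ.+ c)
      0≤l = ℝ.*-nonneg (<⇒≤ 0<η) (<⇒≤ (+-pos 0<1 0≤c))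

    sqpow-≤ : ∀ {n η} → ℝ.0# ℝ.< η → (∀ k → sqpow k n ℝ.≤ 2# ℝ.* sqpow k η) → n ℝ.≤ η
    sqpow-≤ {n} {η} 0<η h with ℝ.total n η
    ... | inj₁ p = p
    ... | inj₂ p = lin c≤ (solveᴿ (η ∷ η ℝ.⁻¹ ∷ n ∷ []) (λ e i n → (e :* i ⟶ :1) ∷ [] ,
            n :+ e :* :0 ⊜ e :+ e :* ((n :- e) :* i)) (inv ∷ []))
      where
      inv = ℝ.*-inverseʳ (pos⇒≉0 0<η)
      c : ℝ
      c = (n ℝ.- η) ℝ.* η ℝ.⁻¹
      0≤c : ℝ.0# ℝ.≤ c
      0≤c = ℝ.*-nonneg (ℝ.x≤y⇒0≤y-x p) (<⇒≤ (⁻¹-pos 0<η))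
      c≤½^ : ∀ k → c ℝ.≤ ½^ k
      c≤½^ k = sqpow-ratio k 0<η 0≤c (ℝ.≤-reflexive (solveᴿ (η ∷ η ℝ.⁻¹ ∷ n ∷ []) (λ e i n → (e :* i ⟶ :1) ∷ [] ,
            e :* (:1 :+ (n :- e) :* i) ⊜ n) (inv ∷ []))) (h k)
      c≤ : η ℝ.* c ℝ.≤ η ℝ.* ℝ.0#
      c≤ = ℝ.*-monoʳ-≤ (<⇒≤ 0<η) (≤-ε λ δ q → ℝ.≤-trans (c≤½^ (proj₁ (½^-small ℝ.1# δ q)))
        (ℝ.≤-trans (≤-resp (ℝ.*-identityʳ _) ℝ.refl (proj₂ (½^-small ℝ.1# δ q))) (ℝ.≤-reflexive (ℝ.sym (ℝ.+-identityˡ δ)))))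

    D : Carrier → Carrier → Carrier
    D x y = s * x * s ⋆ + t * y * t ⋆

    -- Squaring repeatedly turns the crude estimate ‖D x y‖ ≤ ‖x‖ + ‖y‖ into the maximum.
    D-norm : ∀ {x y η} → ℝ.0# ℝ.< η → ‖ x ‖ ℝ.≤ η → ‖ y ‖ ℝ.≤ η → ‖ D x y ‖ ℝ.≤ η
    D-norm 0<η p q = sqpow-≤ 0<η λ k → powers k p q
      where
      powers : ∀ k {x y η} → ‖ x ‖ ℝ.≤ η → ‖ y ‖ ℝ.≤ η → sqpow k ‖ D x y ‖ ℝ.≤ 2# ℝ.* sqpow k η
      powers ℕ.zero {η = η} p q = ℝ.≤-respʳ-≈ (solveᴿ (η ∷ []) (λ e → [] , e :+ e ⊜ (:1 :+ :1) :* e) [])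
        (((isometry-norm s⋆s ⟨1*⟩ p) ⟨*1⟩ ⟨⋆⟩ (isometry-norm s⋆s)) ⟨+⟩
          ((isometry-norm t⋆t ⟨1*⟩ q) ⟨*1⟩ ⟨⋆⟩ (isometry-norm t⋆t)))
      powers (ℕ.suc k) {x} {y} p q = ℝ.≤-respˡ-≈ (sqpow-cong k (ℝ.trans (‖‖-cong DD) (C*-identity (D x y))))
        (powers k (⟨⋆⟩ p ⟨*⟩ p) (⟨⋆⟩ q ⟨*⟩ q))
        where
        DD : D (x ⋆ * x) (y ⋆ * y) ≈ D x y ⋆ * D x y
        DD = solve (s ∷ t ∷ x ∷ y ∷ []) (λ s t x y →
          (s :⋆ :* s ⟶ :1) ∷ (t :⋆ :* t ⟶ :1) ∷ (s :⋆ :* t ⟶ :0) ∷ (t :⋆ :* s ⟶ :0) ∷ [] ,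
          s :* (x :⋆ :* x) :* s :⋆ :+ t :* (y :⋆ :* y) :* t :⋆ ⊜
          (s :* x :* s :⋆ :+ t :* y :* t :⋆) :⋆ :* (s :* x :* s :⋆ :+ t :* y :* t :⋆))
          (s⋆s ∷ t⋆t ∷ s⋆t ∷ t⋆s ∷ [])

  private
    infixr 7 _⊞_ _⊞′_
    -- The direct sum of two unitaries carried out inside A, on the ranges of s and t and with 1 on
    -- the complement `q` of both.
    _⊞_ : Carrier → Carrier → Carrier
    x ⊞ y = 1# + s * (x - 1#) * s ⋆ + t * (y - 1#) * t ⋆

    ⊞-unitary : ∀ {x y} → IsUnitaryElement x → IsUnitaryElement y → IsUnitaryElement (x ⊞ y)
    ⊞-unitary {x} {y} u v = unitary-cong (solve (s ∷ t ∷ x ∷ y ∷ []) (λ s t x y →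
        (s :⋆ :* t ⟶ :0) ∷ [] ,
        (:1 :+ s :* (x :- :1) :* s :⋆) :* (:1 :+ t :* (y :- :1) :* t :⋆) ⊜
        :1 :+ s :* (x :- :1) :* s :⋆ :+ t :* (y :- :1) :* t :⋆) (s⋆t ∷ []))
      (unitary-* (α-unitary s⋆s u) (α-unitary t⋆t v))

    q : Carrier
    q = 1# - s * s ⋆ - t * t ⋆

    -- The direct sums below are rearranged by unitaries that permute the ranges
    -- of words in s and t and the complement q.
    rules : Expr → Expr → Expr → List Rule
    rules s t q = (s :⋆ :* s ⟶ :1) ∷ (t :⋆ :* t ⟶ :1) ∷ (s :⋆ :* t ⟶ :0) ∷ (t :⋆ :* s ⟶ :0) ∷
      (q :⋆ ⟶ q) ∷ (q :* q ⟶ q) ∷ (q :* s ⟶ :0) ∷ (q :* t ⟶ :0) ∷ (s :⋆ :* q ⟶ :0) ∷ (t :⋆ :* q ⟶ :0) ∷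
      (t :* t :⋆ ⟶ :1 :- s :* s :⋆ :- q) ∷ []

    frame-rules : (s t : Expr) → List Rule
    frame-rules s t = (s :⋆ :* s ⟶ :1) ∷ (t :⋆ :* t ⟶ :1) ∷ (s :⋆ :* t ⟶ :0) ∷ (t :⋆ :* s ⟶ :0) ∷ []

    module S = Solver starRing

    holds : ∀ ρ → All (S.Holds (s ∷ t ∷ q ∷ ρ)) (rules (var 0) (var 1) (var 2))
    holds ρ = s⋆s ∷ t⋆t ∷ s⋆t ∷ t⋆s ∷
      solve (s ∷ t ∷ []) (λ s t → [] , (:1 :- s :* s :⋆ :- t :* t :⋆) :⋆ ⊜ :1 :- s :* s :⋆ :- t :* t :⋆) [] ∷
      solve (s ∷ t ∷ []) (λ s t → frame-rules s t , (:1 :- s :* s :⋆ :- t :* t :⋆) :* (:1 :- s :* s :⋆ :- t :* t :⋆) ⊜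
        :1 :- s :* s :⋆ :- t :* t :⋆) fr ∷
      solve (s ∷ t ∷ []) (λ s t → frame-rules s t , (:1 :- s :* s :⋆ :- t :* t :⋆) :* s ⊜ :0) fr ∷
      solve (s ∷ t ∷ []) (λ s t → frame-rules s t , (:1 :- s :* s :⋆ :- t :* t :⋆) :* t ⊜ :0) fr ∷
      solve (s ∷ t ∷ []) (λ s t → frame-rules s t , s :⋆ :* (:1 :- s :* s :⋆ :- t :* t :⋆) ⊜ :0) fr ∷
      solve (s ∷ t ∷ []) (λ s t → frame-rules s t , t :⋆ :* (:1 :- s :* s :⋆ :- t :* t :⋆) ⊜ :0) fr ∷
      solve (s ∷ t ∷ []) (λ s t → [] , t :* t :⋆ ⊜ :1 :- s :* s :⋆ :- (:1 :- s :* s :⋆ :- t :* t :⋆)) [] ∷ []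
      where fr = s⋆s ∷ t⋆t ∷ s⋆t ∷ t⋆s ∷ []

    -- Each term without `q` takes one summand to its new place: `P` re-brackets three summands, `Q`
    -- rearranges four. The terms with `q` match the pieces on which the nested sums are 1; without
    -- them `P` and `Q` would only be partial isometries.
    P Q : Carrier
    P = s * s * s ⋆ + s * t * s ⋆ * t ⋆ + t * t ⋆ * t ⋆ + s * q * t ⋆ + q
    Q = t * s * s ⋆ + s * t * s ⋆ * t ⋆ + s * s * s ⋆ * t ⋆ * t ⋆ + t * t * t ⋆ * t ⋆ * t ⋆ + q +
        s * q * t ⋆ + t * q * t ⋆ * t ⋆

    P′ Q′ : Expr → Expr → Expr → Expr
    P′ s t q = s :* s :* s :⋆ :+ s :* t :* s :⋆ :* t :⋆ :+ t :* t :⋆ :* t :⋆ :+ s :* q :* t :⋆ :+ q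
    Q′ s t q = t :* s :* s :⋆ :+ s :* t :* s :⋆ :* t :⋆ :+ s :* s :* s :⋆ :* t :⋆ :* t :⋆ :+
      t :* t :* t :⋆ :* t :⋆ :* t :⋆ :+ q :+ s :* q :* t :⋆ :+ t :* q :* t :⋆ :* t :⋆

    _⊞′_ : Expr → Expr → Expr
    x ⊞′ y = :1 :+ var 0 :* (x :- :1) :* var 0 :⋆ :+ var 1 :* (y :- :1) :* var 1 :⋆

    P-unitary : IsUnitaryElement P
    P-unitary = solve (s ∷ t ∷ q ∷ []) (λ s t q → rules s t q , P′ s t q :⋆ :* P′ s t q ⊜ :1) (holds []) ,
      solve (s ∷ t ∷ q ∷ []) (λ s t q → rules s t q , P′ s t q :* P′ s t q :⋆ ⊜ :1) (holds [])

    Q-unitary : IsUnitaryElement Q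
    Q-unitary = solve (s ∷ t ∷ q ∷ []) (λ s t q → rules s t q , Q′ s t q :⋆ :* Q′ s t q ⊜ :1) (holds []) ,
      solve (s ∷ t ∷ q ∷ []) (λ s t q → rules s t q , Q′ s t q :* Q′ s t q :⋆ ⊜ :1) (holds [])

    P-conj : ∀ a d e → P * (a ⊞ d ⊞ e) ≈ ((a ⊞ d) ⊞ e) * P
    P-conj a d e = solve (s ∷ t ∷ q ∷ a ∷ d ∷ e ∷ []) (λ s t q a d e → rules s t q ,
      P′ s t q :* (a ⊞′ d ⊞′ e) ⊜ ((a ⊞′ d) ⊞′ e) :* P′ s t q) (holds _)

    Q-conj : ∀ c d b e → Q * (c ⊞ d ⊞ b ⊞ e) ≈ ((b ⊞ d) ⊞ c ⊞ e) * Q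
    Q-conj c d b e = solve (s ∷ t ∷ q ∷ c ∷ d ∷ b ∷ e ∷ []) (λ s t q c d b e → rules s t q ,
      Q′ s t q :* (c ⊞′ d ⊞′ b ⊞′ e) ⊜ ((b ⊞′ d) ⊞′ c ⊞′ e) :* Q′ s t q) (holds _)

    -- Approximate conjugacy after adding a common summand `d`, in which the intermediate points of
    -- a path will be stored.
    Connected : ℝ → Carrier → Carrier → Set ℓ
    Connected η a b = ∃₂ λ v d → IsUnitaryElement v × IsUnitaryElement d × ‖ v * (a ⊞ d) * v ⋆ - (b ⊞ d) ‖ ℝ.≤ η

    connected-close : ∀ {η a b} → ‖ a - b ‖ ℝ.≤ η → Connected η a b
    connected-close {η} {a} {b} p = 1# , 1# , unitary-1 , unitary-1 ,
      (((isometry-norm s⋆s ⟨1*⟩ p) ⟨*1⟩ ⟨⋆⟩ (isometry-norm s⋆s)) ⟨≈⟩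
      solve (s ∷ t ∷ a ∷ b ∷ []) (λ s t a b → [] , s :* (a :- b) :* s :⋆ ⊜
        :1 :* (a ⊞′ :1) :* :1 :⋆ :- (b ⊞′ :1)) [])

    -- Telescoping: a ⊕ d₁ ⊕ b ⊕ d₂ is regrouped as (a ⊕ d₁) ⊕ (b ⊕ d₂), which is close to a
    -- conjugate of (b ⊕ d₁) ⊕ (c ⊕ d₂), and this is regrouped as c ⊕ d₁ ⊕ b ⊕ d₂. So d₁ ⊕ b ⊕ d₂ is
    -- the new common summand. By `D-norm` the two block errors do not add, so η stays the same for
    -- any number of steps.
    connected-trans : ∀ {η a b c} → ℝ.0# ℝ.< η → IsUnitaryElement b →
                      Connected η a b → Connected η b c → Connected η a c
    connected-trans {η} {a} {b} {c} 0<η ub (v₁ , d₁ , uv₁ , ud₁ , p₁) (v₂ , d₂ , uv₂ , ud₂ , p₂) =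
      v , d , unitary-* (unitary-* (unitary-⋆ Q-unitary) uV) P-unitary , ⊞-unitary ud₁ (⊞-unitary ub ud₂) ,
      (((unitary-norm (unitary-⋆ Q-unitary)) ⟨1*⟩ D-norm 0<η p₁ p₂) ⟨*1⟩ unitary-norm Q-unitary ⟨≈⟩ eq)
      where
      V v d : Carrier
      V = v₁ ⊞ v₂
      v = Q ⋆ * V * P
      d = d₁ ⊞ b ⊞ d₂
      uV : IsUnitaryElement V
      uV = ⊞-unitary uv₁ uv₂
      x₁ x₂ y₁ y₂ : Carrier
      x₁ = a ⊞ d₁
      x₂ = b ⊞ d₂
      y₁ = b ⊞ d₁
      y₂ = c ⊞ d₂
      block : V * (x₁ ⊞ x₂) * V ⋆ - (y₁ ⊞ y₂) ≈ D (v₁ * x₁ * v₁ ⋆ - y₁) (v₂ * x₂ * v₂ ⋆ - y₂)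
      block = solve (s ∷ t ∷ v₁ ∷ v₂ ∷ x₁ ∷ x₂ ∷ y₁ ∷ y₂ ∷ []) (λ s t v₁ v₂ x₁ x₂ y₁ y₂ →
        (v₁ :* v₁ :⋆ ⟶ :1) ∷ (v₂ :* v₂ :⋆ ⟶ :1) ∷ frame-rules s t ,
        (v₁ ⊞′ v₂) :* (x₁ ⊞′ x₂) :* (v₁ ⊞′ v₂) :⋆ :- (y₁ ⊞′ y₂) ⊜
        s :* (v₁ :* x₁ :* v₁ :⋆ :- y₁) :* s :⋆ :+ t :* (v₂ :* x₂ :* v₂ :⋆ :- y₂) :* t :⋆)
        (proj₂ uv₁ ∷ proj₂ uv₂ ∷ s⋆s ∷ t⋆t ∷ s⋆t ∷ t⋆s ∷ [])
      X Y X′ Y′ : Carrier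
      X = x₁ ⊞ x₂
      Y = y₁ ⊞ y₂
      X′ = a ⊞ d
      Y′ = c ⊞ d
      eq : Q ⋆ * D (v₁ * x₁ * v₁ ⋆ - y₁) (v₂ * x₂ * v₂ ⋆ - y₂) * Q ≈ v * X′ * v ⋆ - Y′
      eq = trans (*-congʳ (*-congˡ (sym block))) (solve (Q ∷ V ∷ P ∷ X ∷ Y ∷ X′ ∷ Y′ ∷ []) (λ Q V P X Y X′ Y′ →
        (Q :⋆ :* Q ⟶ :1) ∷ (P :* P :⋆ ⟶ :1) ∷ (Y :* Q ⟶ Q :* Y′) ∷ (P :* X′ ⟶ X :* P) ∷ [] ,
        Q :⋆ :* (V :* X :* V :⋆ :- Y) :* Q ⊜ (Q :⋆ :* V :* P) :* X′ :* (Q :⋆ :* V :* P) :⋆ :- Y′)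
        (proj₁ Q-unitary ∷ proj₂ P-unitary ∷ sym (Q-conj c d₁ b d₂) ∷ P-conj a d₁ (b ⊞ d₂) ∷ []))

    -- Cousin's lemma does the subdivision: near each point the path moves by at most η, and
    -- `connected-trans` joins the pieces without loss.
    path⇒connected : ∀ {η a b} → ℝ.0# ℝ.< η → Path 1# a b → Connected η a b
    path⇒connected {η} {a} {b} 0<η P = go (cousin Joined ℝ.0≤1 joined-trans joined-local
        (ℝ.≤-refl , ℝ.0≤1) (ℝ.0≤1 , ℝ.≤-refl))
      where
      open Path P
      -- Quantifying over the proofs of membership in the unit interval gives a relation between
      -- real numbers, as Cousin's lemma expects.
      Joined : ℝ → ℝ → Set ℓ
      Joined x y = ∀ p q → Connected η (path (x , p)) (path (y , q))
      joined-trans : ∀ {x y z} → x ℝ.≤ y → y ℝ.≤ z → Joined x y → Joined y z → Joined x z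
      joined-trans x≤y y≤z f g p r = connected-trans 0<η (unitary _) (f p m) (g m r)
        where m = ℝ.≤-trans (proj₁ p) x≤y , ℝ.≤-trans y≤z (proj₂ r)
      joined-local : ∀ x → ℝ.0# ℝ.≤ x → x ℝ.≤ ℝ.1# → ∃ λ δ → ℝ.0# ℝ.< δ × (∀ c d → ℝ.0# ℝ.≤ c → c ℝ.≤ x →
        x ℝ.≤ d → d ℝ.≤ ℝ.1# → x ℝ.≤ c ℝ.+ δ → d ℝ.≤ x ℝ.+ δ → Joined c d)
      joined-local x 0≤x x≤1 = via (continuous (x , 0≤x , x≤1) (half η) (half-pos 0<η))
        where
        via : (∃ λ δ → ℝ.0# ℝ.< δ × (∀ r → ℝ.Within δ x (proj₁ r) → ‖ path (x , 0≤x , x≤1) - path r ‖ ℝ.≤ half η)) → _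
        via (δ , 0<δ , h) = δ , 0<δ , λ c d _ c≤x x≤d _ x≤c+δ d≤x+δ p q → connected-close
          (ℝ.≤-respʳ-≈ (half+half η) (‖‖-triangle
            (‖‖-comm (h (c , p) (x≤c+δ , ℝ.≤-trans c≤x (proj₁ (Within-refl (<⇒≤ 0<δ))))))
            (h (d , q) (ℝ.≤-trans x≤d (proj₁ (Within-refl (<⇒≤ 0<δ))) , d≤x+δ))))
      go : Connected η (path 0ᴵ) (path 1ᴵ) → Connected η a b
      go (v , d , uv , ud , p) = v , d , uv , ud , p ⟨≈⟩ +-cong (*-congʳ (*-congˡ (⊞-congʳ start))) (-‿cong (⊞-congʳ end))
        where
        ⊞-congʳ : ∀ {x y} → x ≈ y → x ⊞ d ≈ y ⊞ d
        ⊞-congʳ p = +-congʳ (+-congˡ (*-congʳ (*-congˡ (+-congʳ p))))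

  -- The direct sum of `α s a` and d factors as `α (s * s) a` times `α t d`. Multiplying on the
  -- right by v then removes v* from the estimate.
  ∼⇒certified : ∀ {a b} → a ∼ b → ∀ η → ℝ.0# ℝ.< η → Certified η a b
  ∼⇒certified {a} {b} a∼b η 0<η = via (path⇒connected 0<η a∼b)
    where
    via : Connected η (α s a) (α s b) → Certified η a b
    via (v , d , uv , ud , p) = s * s , v , α t d , isometry-* s⋆s s⋆s , uv , α-unitary t⋆t ud ,
      ((p ⟨*1⟩ unitary-norm uv) ⟨≈⟩ solve (s ∷ t ∷ v ∷ a ∷ b ∷ d ∷ []) (λ s t v a b d →
        (v :⋆ :* v ⟶ :1) ∷ frame-rules s t ,
        (v :* ((:1 :+ s :* (a :- :1) :* s :⋆) ⊞′ d) :* v :⋆ :- ((:1 :+ s :* (b :- :1) :* s :⋆) ⊞′ d)) :* v ⊜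
        v :* (:1 :+ s :* s :* (a :- :1) :* (s :* s) :⋆) :* (:1 :+ t :* (d :- :1) :* t :⋆) :-
        (:1 :+ s :* s :* (b :- :1) :* (s :* s) :⋆) :* (:1 :+ t :* (d :- :1) :* t :⋆) :* v)
        (proj₁ uv ∷ s⋆s ∷ t⋆t ∷ s⋆t ∷ t⋆s ∷ []))

-- Representing the classes of K₁ by unitaries of A.

module KOne (em : ∀ {ℓ} → ExcludedMiddle ℓ) (R : CompleteOrderedField)
            {ℓ} (A : Setting.CStarAlgebra em R ℓ) (𝓕 : Frames.Frame em R A) where
  open Setting em R
  open Reals em R
  open CStarAlgebra A hiding (zero)
  open CStarBasics em R A
  open Paths em R A
  open Stable em R A 𝓕
  open Frames.Frame 𝓕
  open Matrices A hiding (K₁)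
  open SemiringSum semiring using (sum; *-distribˡ-sum; *-distribʳ-sum; ∑-comm; sum-replicate-zero) renaming (sum-cong-≋ to sum-cong)

  private
    module K = RawGroup (K₁ A)

    1⋆ : 1# ⋆ ≈ 1#
    1⋆ = 1⋆≈1

  -- The sum of a vector as an opaque operation, so that the summands can be inferred.
  abstract
    ∑ : ∀ {n} → Vector Carrier n → Carrier
    ∑ = sum

    ∑≈sum : ∀ {n} (f : Vector Carrier n) → ∑ f ≈ sum f
    ∑≈sum f = refl

    ∑-cong : ∀ {n} {f g : Vector Carrier n} → (∀ i → f i ≈ g i) → ∑ f ≈ ∑ g
    ∑-cong h = sum-cong h

    *-∑ : ∀ {n} b (f : Vector Carrier n) → b * ∑ f ≈ ∑ (λ i → b * f i)
    *-∑ = *-distribˡ-sum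

    ∑-* : ∀ {n} b (f : Vector Carrier n) → ∑ f * b ≈ ∑ (λ i → f i * b)
    ∑-* = *-distribʳ-sum

    ∑-swap : ∀ {m n} (f : Fin m → Fin n → Carrier) → ∑ (λ i → ∑ (f i)) ≈ ∑ (λ j → ∑ (λ i → f i j))
    ∑-swap = ∑-comm

    ∑-split : ∀ m {n} (f : Vector Carrier (m ℕ.+ n)) → ∑ f ≈ ∑ (λ i → f (i ↑ˡ n)) + ∑ (λ i → f (m ↑ʳ i))
    ∑-split = sum-split

    ∑-zero : ∀ {n} {f : Vector Carrier n} → (∀ i → f i ≈ 0#) → ∑ f ≈ 0#
    ∑-zero {n} h = trans (sum-cong h) (sum-replicate-zero n)

    ∑-one : ∀ (f : Vector Carrier 1) → ∑ f ≈ f zero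
    ∑-one f = +-identityʳ _

    ∑-⋆ : ∀ {n} (f : Vector Carrier n) → ∑ f ⋆ ≈ ∑ (λ i → f i ⋆)
    ∑-⋆ {ℕ.zero}  f = 0⋆≈0
    ∑-⋆ {ℕ.suc n} f = trans (⋆-+ _ _) (+-congˡ (∑-⋆ (f ∘ suc)))

    ∑-norm : ∀ {n η} (f : Vector Carrier n) → (∀ i → ‖ f i ‖ ℝ.≤ η) → ‖ ∑ f ‖ ℝ.≤ ℝ.fromℕ n ℝ.* η
    ∑-norm {ℕ.zero}  f h = ℝ.≤-reflexive (ℝ.trans ‖0‖≈0 (ℝ.sym (ℝ.zeroˡ _)))
    ∑-norm {ℕ.suc n} {η} f h = ℝ.≤-respʳ-≈ (solveᴿ (η ∷ ℝ.fromℕ n ∷ []) (λ e n → [] ,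
      e :+ n :* e ⊜ (:1 :+ n) :* e) []) (h zero ⟨+⟩ ∑-norm (f ∘ suc) (h ∘ suc))

    ∑-neg : ∀ {n} (f g : Vector Carrier n) → ∑ f - ∑ g ≈ ∑ (λ i → f i - g i)
    ∑-neg {ℕ.zero}  f g = -‿inverseʳ 0#
    ∑-neg {ℕ.suc n} f g = trans (solve (f zero ∷ g zero ∷ sum (f ∘ suc) ∷ sum (g ∘ suc) ∷ []) (λ a b c d → [] ,
      (a :+ c) :- (b :+ d) ⊜ (a :- b) :+ (c :- d)) []) (+-congˡ (∑-neg (f ∘ suc) (g ∘ suc)))

    ∑-identityˡ : ∀ {n} (x : Fin n → Carrier) i → ∑ (λ k → 1ᴹ i k * x k) ≈ x i
    ∑-identityˡ = *ᴹ-identityˡ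

    ∑-identityʳ : ∀ {n} (x : Fin n → Carrier) j → ∑ (λ k → x k * 1ᴹ k j) ≈ x j
    ∑-identityʳ x zero    = trans (+-cong (*-identityʳ _) (sum-zeroʳ (x ∘ suc))) (+-identityʳ _)
    ∑-identityʳ x (suc j) = trans (+-cong (zeroʳ _) (∑-identityʳ (x ∘ suc) j)) (+-identityˡ _)

  e : ∀ {n} → Fin n → Carrier
  e zero    = s
  e (suc i) = t * e i

  power : ℕ → Carrier
  power ℕ.zero    = 1#
  power (ℕ.suc n) = t * power n

  col row : ∀ {n} → (Fin n → Carrier) → Carrier
  col x = ∑ λ i → e i * x i
  row x = ∑ λ i → x i * e i ⋆

  -- The sum of all e i x i j (e j)*: the matrices of size n become the corner of A cut out by the
  -- projection `range n`. Adding the complementary projection in `κ` turns unitary matrices into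
  -- unitaries of A.
  Θ : ∀ {n} → Matrix n → Carrier
  Θ x = col λ i → row (x i)

  range : ℕ → Carrier
  range n = ∑ λ (i : Fin n) → e i * e i ⋆

  κ : ∀ {n} → Matrix n → Carrier
  κ {n} x = 1# - range n + Θ x

  private
    col-cong : ∀ {n} {x y : Fin n → Carrier} → (∀ i → x i ≈ y i) → col x ≈ col y
    col-cong h = ∑-cong λ i → *-congˡ (h i)

    row-cong : ∀ {n} {x y : Fin n → Carrier} → (∀ i → x i ≈ y i) → row x ≈ row y
    row-cong h = ∑-cong λ i → *-congʳ (h i)

    orthonormal : ∀ {n} (i j : Fin n) → e i ⋆ * e j ≈ 1ᴹ i j
    orthonormal zero    zero    = s⋆s
    orthonormal zero    (suc j) = trans (sym (*-assoc _ _ _)) (trans (*-congʳ s⋆t) (zeroˡ _))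
    orthonormal (suc i) zero    = solve (t ∷ s ∷ e i ∷ []) (λ t s e → (t :⋆ :* s ⟶ :0) ∷ [] , (t :* e) :⋆ :* s ⊜ :0) (t⋆s ∷ [])
    orthonormal (suc i) (suc j) = trans (solve (t ∷ e i ∷ e j ∷ []) (λ t e f → (t :⋆ :* t ⟶ :1) ∷ [] ,
      (t :* e) :⋆ :* (t :* f) ⊜ e :⋆ :* f) (t⋆t ∷ [])) (orthonormal i j)

    e⋆col : ∀ {n} (x : Fin n → Carrier) i → e i ⋆ * col x ≈ x i
    e⋆col x i = trans (*-∑ _ _) (trans (∑-cong λ k → trans (sym (*-assoc _ _ _)) (*-congʳ (orthonormal i k)))
      (∑-identityˡ x i))

    row-e : ∀ {n} (x : Fin n → Carrier) j → row x * e j ≈ x j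
    row-e x j = trans (∑-* _ _) (trans (∑-cong λ k → trans (*-assoc _ _ _) (*-congˡ (orthonormal k j)))
      (∑-identityʳ x j))

    row-col : ∀ {n} (x y : Fin n → Carrier) → row x * col y ≈ ∑ (λ k → x k * y k)
    row-col x y = trans (∑-* _ _) (∑-cong λ k → trans (*-assoc _ _ _) (*-congˡ (e⋆col y k)))

    col-*ʳ : ∀ {n} (x : Fin n → Carrier) b → col x * b ≈ col (λ i → x i * b)
    col-*ʳ x b = trans (∑-* _ _) (∑-cong λ k → *-assoc _ _ _)

    row-*ˡ : ∀ {n} (x : Fin n → Carrier) b → b * row x ≈ row (λ i → b * x i)
    row-*ˡ x b = trans (*-∑ _ _) (∑-cong λ k → sym (*-assoc _ _ _))

    col-⋆ : ∀ {n} (x : Fin n → Carrier) → col x ⋆ ≈ row (λ i → x i ⋆)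
    col-⋆ x = trans (∑-⋆ _) (∑-cong λ i → ⋆-* _ _)

    row-⋆ : ∀ {n} (x : Fin n → Carrier) → row x ⋆ ≈ col (λ i → x i ⋆)
    row-⋆ x = trans (∑-⋆ _) (∑-cong λ i → trans (⋆-* _ _) (*-congʳ (⋆-involutive _)))

    sum-row : ∀ {m n} (x : Fin m → Carrier) (y : Fin m → Fin n → Carrier) →
              ∑ (λ k → x k * row (y k)) ≈ row (λ j → ∑ (λ k → x k * y k j))
    sum-row x y = trans (∑-cong λ k → row-*ˡ (y k) (x k)) (trans (∑-swap _) (∑-cong λ j → sym (∑-* _ _)))

    row-col-swap : ∀ {m n} (x : Fin m → Fin n → Carrier) →
                   row (λ j → col (λ i → x i j)) ≈ col (λ i → row (x i))
    row-col-swap x = trans (∑-cong λ j → col-*ʳ (λ i → x i j) (e j ⋆)) (trans (∑-swap _)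
      (∑-cong λ i → sym (*-∑ _ _)))

  Θ-cong : ∀ {n} {x y : Matrix n} → x ≈ᴹ y → Θ x ≈ Θ y
  Θ-cong h = col-cong λ i → row-cong (h i)

  private
    Θ-* : ∀ {n} (x y : Matrix n) → Θ (x *ᴹ y) ≈ Θ x * Θ y
    Θ-* x y = sym (trans (col-*ʳ _ _) (col-cong λ i → trans (row-col (x i) _)
      (trans (sum-row (x i) y) (row-cong λ j → ∑≈sum _))))

    Θ-⋆ : ∀ {n} (x : Matrix n) → Θ (x ⋆ᴹ) ≈ Θ x ⋆
    Θ-⋆ x = sym (trans (col-⋆ _) (trans (row-cong λ i → row-⋆ (x i)) (row-col-swap (x ⋆ᴹ))))

    Θ-1 : ∀ n → Θ (1ᴹ {n}) ≈ range n
    Θ-1 n = col-cong λ i → ∑-identityˡ (λ k → e k ⋆) i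

    range-Θ : ∀ {n} (x : Matrix n) → range n * Θ x ≈ Θ x
    range-Θ x = trans (col-*ʳ _ _) (col-cong λ i → e⋆col _ i)

    Θ-range : ∀ {n} (x : Matrix n) → Θ x * range n ≈ Θ x
    Θ-range x = trans (col-*ʳ _ _) (col-cong λ i → row-col (x i) _)

    range-⋆ : ∀ n → range n ⋆ ≈ range n
    range-⋆ n = trans (∑-⋆ _) (∑-cong λ i → trans (⋆-* _ _) (*-congʳ (⋆-involutive _)))

    range-range : ∀ n → range n * range n ≈ range n
    range-range n = trans (*-congˡ (sym (Θ-1 n))) (trans (range-Θ (1ᴹ {n})) (Θ-1 n))

    range-e : ∀ {n} (i : Fin n) → range n * e i ≈ e i
    range-e i = trans (col-*ʳ _ _) (trans (col-cong λ k → orthonormal k i) (∑-identityʳ e i))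

    e-range : ∀ {n} (i : Fin n) → e i ⋆ * range n ≈ e i ⋆
    e-range i = e⋆col (λ k → e k ⋆) i

  κ-cong : ∀ {n} {x y : Matrix n} → x ≈ᴹ y → κ x ≈ κ y
  κ-cong h = +-congˡ (Θ-cong h)

  κ-* : ∀ {n} (x y : Matrix n) → κ (x *ᴹ y) ≈ κ x * κ y
  κ-* {n} x y = trans (+-congˡ (Θ-* x y)) (solve (range n ∷ Θ x ∷ Θ y ∷ []) (λ f x y →
    (f :* f ⟶ f) ∷ (f :* y ⟶ y) ∷ (x :* f ⟶ x) ∷ [] ,
    :1 :- f :+ x :* y ⊜ (:1 :- f :+ x) :* (:1 :- f :+ y)) (range-range n ∷ range-Θ y ∷ Θ-range x ∷ []))

  κ-⋆ : ∀ {n} (x : Matrix n) → κ (x ⋆ᴹ) ≈ κ x ⋆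
  κ-⋆ {n} x = trans (+-congˡ (Θ-⋆ x)) (solve (range n ∷ Θ x ∷ []) (λ f x → (f :⋆ ⟶ f) ∷ [] ,
    :1 :- f :+ x :⋆ ⊜ (:1 :- f :+ x) :⋆) (range-⋆ n ∷ []))

  κ-1 : ∀ n → κ (1ᴹ {n}) ≈ 1#
  κ-1 n = trans (+-congˡ (Θ-1 n)) (solve (range n ∷ []) (λ f → [] , :1 :- f :+ f ⊜ :1) [])

  κ-unitary : ∀ {n} ((u , _) : Unitary n) → IsUnitaryElement (κ u)
  κ-unitary {n} (u , p , q) =
    trans (*-congʳ (sym (κ-⋆ u))) (trans (sym (κ-* _ _)) (trans (κ-cong p) (κ-1 n))) ,
    trans (*-congˡ (sym (κ-⋆ u))) (trans (sym (κ-* _ _)) (trans (κ-cong q) (κ-1 n)))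

  private
    entry : ∀ {n} (x : Matrix n) i j → e i ⋆ * κ x * e j ≈ x i j
    entry {n} x i j = trans (solve (e i ∷ e j ∷ range n ∷ Θ x ∷ []) (λ e e′ f x → (e :⋆ :* f ⟶ e :⋆) ∷ [] ,
        e :⋆ :* (:1 :- f :+ x) :* e′ ⊜ e :⋆ :* x :* e′) (e-range i ∷ []))
      (trans (*-congʳ (e⋆col _ i)) (row-e (x i) j))

    e-norm : ∀ {n} (i : Fin n) → ‖ e i ‖ ℝ.≤ ℝ.1#
    e-norm zero    = isometry-norm s⋆s
    e-norm (suc i) = isometry-norm t⋆t ⟨1*⟩ e-norm i

    κ-near : ∀ {n η} (x y : Matrix n) → (∀ i j → ‖ x i j - y i j ‖ ℝ.≤ η) →
             ‖ κ x - κ y ‖ ℝ.≤ ℝ.fromℕ n ℝ.* (ℝ.fromℕ n ℝ.* η)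
    κ-near {n} x y h = ∑-norm _ (λ i → e-norm i ⟨1*⟩ ∑-norm _ λ j → h i j ⟨*1⟩ ⟨⋆⟩ (e-norm j)) ⟨≈⟩
      sym (trans (solve (range n ∷ Θ x ∷ Θ y ∷ []) (λ f x y → [] , (:1 :- f :+ x) :- (:1 :- f :+ y) ⊜ x :- y) [])
        (trans (∑-neg _ _) (∑-cong λ i → trans (solve (e i ∷ row (x i) ∷ row (y i) ∷ []) (λ e x y → [] ,
            e :* x :- e :* y ⊜ e :* (x :- y)) [])
          (*-congˡ (trans (∑-neg _ _) (∑-cong λ j → solve (e j ∷ x i j ∷ y i j ∷ []) (λ e x y → [] ,
            x :* e :⋆ :- y :* e :⋆ ⊜ (x :- y) :* e :⋆) []))))))

  homotopic⇒path : ∀ {m n} (eq : m ≡ n) (u : Unitary m) (v : Unitary n) →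
                   Homotopic (subst Unitary eq u) v → Path 1# (κ (proj₁ u)) (κ (proj₁ v))
  homotopic⇒path {n = n} ≡.refl u v H = record
    { path = λ t → κ (proj₁ (path t))
    ; unitary = λ t → κ-unitary (path t)
    ; commuting = λ t → 1-commutes
    ; continuous = λ t η p → via t η (shrink (N ℝ.* N) (ℝ.*-nonneg 0≤N 0≤N) η p)
    ; start = κ-cong path-0 ; end = κ-cong path-1 }
    where
    open Homotopic H
    N : ℝ
    N = ℝ.fromℕ n
    0≤N : ℝ.0# ℝ.≤ N
    0≤N = ℝ.fromℕ-nonneg n
    via : ∀ t η → (∃ λ δ → ℝ.0# ℝ.< δ × N ℝ.* N ℝ.* δ ℝ.≤ η) → ∃ λ δ → ℝ.0# ℝ.< δ ×
          (∀ s → ℝ.Within δ (proj₁ t) (proj₁ s) → ‖ κ (proj₁ (path t)) - κ (proj₁ (path s)) ‖ ℝ.≤ η)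
    via t η (δ , p , q) = via′ (continuous t δ p)
      where
      via′ : (∃ λ δ′ → ℝ.0# ℝ.< δ′ × (∀ s → ℝ.Within δ′ (proj₁ t) (proj₁ s) →
             ∀ i j → ‖ proj₁ (path t) i j - proj₁ (path s) i j ‖ ℝ.≤ δ)) → _
      via′ (δ′ , p′ , h) = δ′ , p′ , λ s w → ℝ.≤-trans (κ-near _ _ (h s w)) (ℝ.≤-respˡ-≈ (ℝ.*-assoc _ _ _) q)

  -- The matrix of the e i ⋆ * y * e j is unitary since y commutes with the range projection.
  path⇒homotopic : ∀ {m n} (eq : m ≡ n) (u : Unitary m) (v : Unitary n) →
                   Path (range m) (κ (proj₁ u)) (κ (proj₁ v)) → Homotopic (subst Unitary eq u) v
  path⇒homotopic {n = n} ≡.refl u v P = record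
    { path = λ t → y t , left t , right t
    ; continuous = λ t η p → proj₁ (continuous t η p) , proj₁ (proj₂ (continuous t η p)) , λ s w i j →
        ((⟨⋆⟩ (e-norm i) ⟨1*⟩ proj₂ (proj₂ (continuous t η p)) s w) ⟨*1⟩ e-norm j) ⟨≈⟩
        solve (e i ∷ e j ∷ path t ∷ path s ∷ []) (λ e e′ x y → [] ,
          e :⋆ :* (x :- y) :* e′ ⊜ e :⋆ :* x :* e′ :- e :⋆ :* y :* e′) []
    ; path-0 = λ i j → trans (*-congʳ (*-congˡ start)) (entry (proj₁ u) i j)
    ; path-1 = λ i j → trans (*-congʳ (*-congˡ end)) (entry (proj₁ v) i j) }
    where
    open Path P
    y : 𝕀 → Matrix n
    y t i j = e i ⋆ * path t * e j
    sandwich : ∀ a b (i j : Fin n) → ∑ (λ k → e i ⋆ * a * e k * (e k ⋆ * b * e j)) ≈ e i ⋆ * a * range n * b * e j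
    sandwich a b i j = sym (trans (*-congʳ (*-congʳ (*-∑ _ _))) (trans (*-congʳ (∑-* _ _))
      (trans (∑-* _ _) (∑-cong λ k → solve (e i ∷ e j ∷ e k ∷ a ∷ b ∷ []) (λ e e′ f a b → [] ,
        e :⋆ :* a :* (f :* f :⋆) :* b :* e′ ⊜ e :⋆ :* a :* f :* (f :⋆ :* b :* e′)) []))))
    left : ∀ t i j → sum (λ k → y t k i ⋆ * y t k j) ≈ 1ᴹ i j
    left t i j = trans (sym (∑≈sum _)) (trans (∑-cong λ k → *-congʳ (solve (e k ∷ e i ∷ path t ∷ []) (λ f e x → [] ,
        (f :⋆ :* x :* e) :⋆ ⊜ e :⋆ :* x :⋆ :* f) []))
      (trans (sandwich (path t ⋆) (path t) i j) (trans (solve (e i ∷ e j ∷ range n ∷ path t ∷ []) (λ e e′ f x →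
        (f :* x ⟶ x :* f) ∷ (x :⋆ :* x ⟶ :1) ∷ (f :* e′ ⟶ e′) ∷ [] ,
        e :⋆ :* x :⋆ :* f :* x :* e′ ⊜ e :⋆ :* e′) (commuting t ∷ proj₁ (unitary t) ∷ range-e j ∷ [])) (orthonormal i j))))
    right : ∀ t i j → sum (λ k → y t i k * y t j k ⋆) ≈ 1ᴹ i j
    right t i j = trans (sym (∑≈sum _)) (trans (∑-cong λ k → *-congˡ (solve (e k ∷ e j ∷ path t ∷ []) (λ f e x → [] ,
        (e :⋆ :* x :* f) :⋆ ⊜ f :⋆ :* x :⋆ :* e) []))
      (trans (sandwich (path t) (path t ⋆) i j) (trans (solve (e i ∷ e j ∷ range n ∷ path t ∷ []) (λ e e′ f x →
        (x :* f ⟶ f :* x) ∷ (e :⋆ :* f ⟶ e :⋆) ∷ (x :* x :⋆ ⟶ :1) ∷ [] ,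
        e :⋆ :* x :* f :* x :⋆ :* e′ ⊜ e :⋆ :* e′) (sym (commuting t) ∷ e-range i ∷ proj₂ (unitary t) ∷ [])) (orthonormal i j))))

  private
    power-isometry : ∀ n → IsIsometry (power n)
    power-isometry ℕ.zero    = proj₁ unitary-1
    power-isometry (ℕ.suc n) = isometry-* t⋆t (power-isometry n)

    e-power : ∀ {n} (i : Fin n) → e i ⋆ * power n ≈ 0#
    e-power {ℕ.suc n} zero    = trans (sym (*-assoc _ _ _)) (trans (*-congʳ s⋆t) (zeroˡ _))
    e-power {ℕ.suc n} (suc i) = trans (solve (t ∷ e i ∷ power n ∷ []) (λ t e p → (t :⋆ :* t ⟶ :1) ∷ [] ,
      (t :* e) :⋆ :* (t :* p) ⊜ e :⋆ :* p) (t⋆t ∷ [])) (e-power i)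

    e-↑ˡ : ∀ {m} (i : Fin m) n → e (i ↑ˡ n) ≈ e i
    e-↑ˡ zero    n = refl
    e-↑ˡ (suc i) n = *-congˡ (e-↑ˡ i n)

    e-↑ʳ : ∀ m {n} (i : Fin n) → e (m ↑ʳ i) ≈ power m * e i
    e-↑ʳ ℕ.zero    i = sym (*-identityˡ _)
    e-↑ʳ (ℕ.suc m) i = trans (*-congˡ (e-↑ʳ m i)) (sym (*-assoc _ _ _))

    col-split : ∀ m {n} (x : Fin (m ℕ.+ n) → Carrier) →
                col x ≈ col (λ i → x (i ↑ˡ n)) + power m * col (λ i → x (m ↑ʳ i))
    col-split m {n} x = trans (∑-split m _) (+-cong (∑-cong λ i → *-congʳ (e-↑ˡ i n))
      (trans (∑-cong λ i → trans (*-congʳ (e-↑ʳ m i)) (*-assoc _ _ _)) (sym (*-∑ _ _))))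

    row-split : ∀ m {n} (x : Fin (m ℕ.+ n) → Carrier) →
                row x ≈ row (λ i → x (i ↑ˡ n)) + row (λ i → x (m ↑ʳ i)) * power m ⋆
    row-split m {n} x = trans (∑-split m _) (+-cong (∑-cong λ i → *-congˡ (⋆-cong (e-↑ˡ i n)))
      (trans (∑-cong λ i → trans (*-congˡ (trans (⋆-cong (e-↑ʳ m i)) (⋆-* _ _))) (sym (*-assoc _ _ _)))
        (sym (∑-* _ _))))

    row-zero : ∀ {n} {x : Fin n → Carrier} → (∀ i → x i ≈ 0#) → row x ≈ 0#
    row-zero h = trans (row-cong h) (∑-zero λ i → zeroˡ _)

    Θ-⊕ : ∀ {m n} (u : Matrix m) (v : Matrix n) → Θ (u ⊕ᴹ v) ≈ Θ u + power m * Θ v * power m ⋆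
    Θ-⊕ {m} {n} u v = trans (col-split m _) (+-cong
      (col-cong λ i → trans (row-split m _) (trans (+-cong (row-cong (ll i)) (trans (*-congʳ (row-zero (lr i))) (zeroˡ _)))
        (+-identityʳ _)))
      (trans (*-congˡ (trans (col-cong λ i → trans (row-split m _) (trans (+-cong (row-zero (rl i))
          (*-congʳ (row-cong (rr i)))) (+-identityˡ _))) (sym (col-*ʳ _ _)))) (sym (*-assoc _ _ _))))
      where
      ll : ∀ i j → (u ⊕ᴹ v) (i ↑ˡ n) (j ↑ˡ n) ≈ u i j
      ll i j rewrite Finₚ.splitAt-↑ˡ m i n | Finₚ.splitAt-↑ˡ m j n = refl
      lr : ∀ i j → (u ⊕ᴹ v) (i ↑ˡ n) (m ↑ʳ j) ≈ 0#
      lr i j rewrite Finₚ.splitAt-↑ˡ m i n | Finₚ.splitAt-↑ʳ m n j = refl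
      rl : ∀ i j → (u ⊕ᴹ v) (m ↑ʳ i) (j ↑ˡ n) ≈ 0#
      rl i j rewrite Finₚ.splitAt-↑ʳ m n i | Finₚ.splitAt-↑ˡ m j n = refl
      rr : ∀ i j → (u ⊕ᴹ v) (m ↑ʳ i) (m ↑ʳ j) ≈ v i j
      rr i j rewrite Finₚ.splitAt-↑ʳ m n i | Finₚ.splitAt-↑ʳ m n j = refl

    range-+ : ∀ m n → range (m ℕ.+ n) ≈ range m + power m * range n * power m ⋆
    range-+ m n = trans (sym (Θ-1 (m ℕ.+ n))) (trans (Θ-cong λ i j → sym (⊕ᴹ-1 m {n} i j))
      (trans (Θ-⊕ (1ᴹ {m}) (1ᴹ {n})) (+-cong (Θ-1 m) (*-congʳ (*-congˡ (Θ-1 n))))))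

    row-power : ∀ {n} (x : Fin n → Carrier) → row x * power n ≈ 0#
    row-power {n} x = trans (∑-* _ _) (trans (∑-cong λ i → trans (*-assoc _ _ _) (*-congˡ (e-power i)))
      (∑-zero λ i → zeroʳ _))

    Θ-power : ∀ {n} (x : Matrix n) → Θ x * power n ≈ 0#
    Θ-power x = trans (col-*ʳ _ _) (trans (col-cong λ i → row-power (x i)) (∑-zero λ i → zeroʳ _))

    range-power : ∀ n → range n * power n ≈ 0#
    range-power n = trans (*-congʳ (sym (Θ-1 n))) (Θ-power (1ᴹ {n}))

  -- The second block uses the isometries e (m + i) = tᵐ e i, so it is a copy of `κ v` on the range
  -- of tᵐ.
  κ-⊕ : ∀ {m n} (u : Matrix m) (v : Matrix n) → κ (u ⊕ᴹ v) ≈ κ u * α (power m) (κ v)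
  κ-⊕ {m} {n} u v = trans (+-cong (+-congˡ (-‿cong (range-+ m n))) (Θ-⊕ u v))
    (solve (range m ∷ range n ∷ power m ∷ Θ u ∷ Θ v ∷ []) (λ f g p u v → (f :* p ⟶ :0) ∷ (u :* p ⟶ :0) ∷ [] ,
      :1 :- (f :+ p :* g :* p :⋆) :+ (u :+ p :* v :* p :⋆) ⊜
      (:1 :- f :+ u) :* (:1 :+ p :* (:1 :- g :+ v :- :1) :* p :⋆)) (range-power m ∷ Θ-power u ∷ []))

  -- This makes `κ` indifferent to the identity blocks that the equality of K₁ allows.
  κ-⊕-1 : ∀ {m} (u : Matrix m) k → κ (u ⊕ᴹ 1ᴹ {k}) ≈ κ u
  κ-⊕-1 {m} u k = trans (κ-⊕ u (1ᴹ {k})) (trans (*-congˡ (trans (α-cong (κ-1 k)) (α-1 _))) (*-identityʳ _))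

  κ-⊕-∼ : ∀ {m n} ((u , p) : Unitary m) ((v , q) : Unitary n) → κ (u ⊕ᴹ v) ∼ κ u * κ v
  κ-⊕-∼ {m} u v = path-cong (α-cong (sym (κ-⊕ (proj₁ u) (proj₁ v)))) refl
    (∼-* (∼-refl (κ-unitary u)) (α-∼ (power-isometry m) (κ-unitary v)))

  private
    -- u is moved to the additional corner, which is orthogonal to the others, and from there
    -- to the range of s s.
    shift : ∀ {m} k (u : Unitary m) (f : Carrier) → f ≈ range ((m ℕ.+ ℕ.suc k) ℕ.+ 1) →
            Path f (κ (proj₁ u)) (α (s * s) (κ (proj₁ u)))
    shift {m} k (u , uu) f f≈ = path-cong (κ-⊕-1 u (ℕ.suc k)) (α-cong (κ-⊕-1 u (ℕ.suc k)))
      (path-trans f⋆ (path-cong (solve (x ∷ []) (λ x → [] , :1 :+ (x :- :1) ⊜ x) []) (+-congˡ zhz⋆) first) second)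
      where
      N = m ℕ.+ ℕ.suc k
      F p x h : Carrier
      F = range N
      p = power N
      x = κ (u ⊕ᴹ 1ᴹ {ℕ.suc k})
      h = x - 1#
      -- The partial isometry `z` compresses the whole corner `F` into the single extra corner p s
      -- s* p* of f. This is the room that the (N + 1)-st index provides.
      z : Carrier
      z = p * s * F
      ux : IsUnitaryElement x
      ux = κ-unitary ((u , uu) ⊕ᵁ 1ᵁ (ℕ.suc k))
      F⋆ = range-⋆ N
      FF = range-range N
      Fp = range-power N
      pp = power-isometry N
      f-eq : f ≈ F + p * (s * s ⋆) * p ⋆
      f-eq = trans f≈ (trans (range-+ N 1) (+-congˡ (*-congʳ (*-congˡ (∑-one (λ i → e i * e i ⋆))))))
      p⋆F : p ⋆ * F ≈ 0#
      p⋆F = trans (*-congˡ (sym F⋆)) (trans (sym (⋆-* _ _)) (trans (⋆-cong Fp) 0⋆≈0))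
      -- The successor guarantees that index 0, whose isometry is s, occurs even when the first
      -- summand is 0.
      Fs′ : ∀ M → range (M ℕ.+ ℕ.suc k) * s ≈ s
      Fs′ ℕ.zero    = range-e {ℕ.suc k} zero
      Fs′ (ℕ.suc M) = range-e {ℕ.suc M ℕ.+ ℕ.suc k} zero
      Fs : F * s ≈ s
      Fs = Fs′ m
      s⋆F : s ⋆ * F ≈ s ⋆
      s⋆F = trans (*-congˡ (sym F⋆)) (trans (sym (⋆-* _ _)) (⋆-cong Fs))
      p⋆s : p ⋆ * s ≈ 0#
      p⋆s = trans (*-congˡ (sym Fs)) (trans (sym (*-assoc _ _ _)) (trans (*-congʳ p⋆F) (zeroˡ s)))
      h-eq : h ≈ Θ (u ⊕ᴹ 1ᴹ {ℕ.suc k}) - F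
      h-eq = solve (F ∷ Θ (u ⊕ᴹ 1ᴹ {ℕ.suc k}) ∷ []) (λ f x → [] , :1 :- f :+ x :- :1 ⊜ x :- f) []
      Fh : F * h ≈ h
      Fh = trans (*-congˡ h-eq) (trans (solve (F ∷ Θ (u ⊕ᴹ 1ᴹ {ℕ.suc k}) ∷ []) (λ f x → (f :* f ⟶ f) ∷ (f :* x ⟶ x) ∷ [] ,
        f :* (x :- f) ⊜ x :- f) (FF ∷ range-Θ (u ⊕ᴹ 1ᴹ {ℕ.suc k}) ∷ [])) (sym h-eq))
      hF : h * F ≈ h
      hF = trans (*-congʳ h-eq) (trans (solve (F ∷ Θ (u ⊕ᴹ 1ᴹ {ℕ.suc k}) ∷ []) (λ f x → (f :* f ⟶ f) ∷ (x :* f ⟶ x) ∷ [] ,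
        (x :- f) :* f ⊜ x :- f) (FF ∷ Θ-range (u ⊕ᴹ 1ᴹ {ℕ.suc k}) ∷ [])) (sym h-eq))
      f⋆ : f ⋆ ≈ f
      f⋆ = trans (⋆-cong f-eq) (trans (solve (F ∷ p ∷ s ∷ []) (λ f p s → (f :⋆ ⟶ f) ∷ [] ,
        (f :+ p :* (s :* s :⋆) :* p :⋆) :⋆ ⊜ f :+ p :* (s :* s :⋆) :* p :⋆) (F⋆ ∷ [])) (sym f-eq))
      fz : f * z ≈ z * f
      fz = trans (*-congʳ f-eq) (trans (solve (F ∷ p ∷ s ∷ []) (λ f p s →
          (f :* f ⟶ f) ∷ (f :* p ⟶ :0) ∷ (p :⋆ :* p ⟶ :1) ∷ (s :⋆ :* s ⟶ :1) ∷ [] ,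
          (f :+ p :* (s :* s :⋆) :* p :⋆) :* (p :* s :* f) ⊜ p :* s :* f :* (f :+ p :* (s :* s :⋆) :* p :⋆))
          (FF ∷ Fp ∷ pp ∷ s⋆s ∷ [])) (*-congˡ (sym f-eq)))
      open Rotation f z f⋆ fz
        (solve (F ∷ p ∷ s ∷ []) (λ f p s → (f :⋆ ⟶ f) ∷ (f :* f ⟶ f) ∷ (p :⋆ :* p ⟶ :1) ∷ (s :⋆ :* s ⟶ :1) ∷ [] ,
          p :* s :* f :* ((p :* s :* f) :⋆ :* (p :* s :* f)) ⊜ p :* s :* f) (F⋆ ∷ FF ∷ pp ∷ s⋆s ∷ []))
        (solve (F ∷ p ∷ s ∷ []) (λ f p s → (f :* p ⟶ :0) ∷ [] , p :* s :* f :* (p :* s :* f) ⊜ :0) (Fp ∷ []))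
      p⋆h : p ⋆ * h ≈ 0#
      p⋆h = trans (*-congˡ (sym Fh)) (trans (sym (*-assoc _ _ _)) (trans (*-congʳ p⋆F) (zeroˡ h)))
      hp : h * p ≈ 0#
      hp = trans (*-congʳ (sym hF)) (trans (*-assoc _ _ _) (trans (*-congˡ Fp) (zeroʳ h)))
      fh : f * h ≈ h * f
      fh = trans (*-congʳ f-eq) (trans (solve (F ∷ p ∷ s ∷ h ∷ []) (λ f p s h →
          (f :* h ⟶ h) ∷ (h :* f ⟶ h) ∷ (p :⋆ :* h ⟶ :0) ∷ (h :* p ⟶ :0) ∷ [] ,
          (f :+ p :* (s :* s :⋆) :* p :⋆) :* h ⊜ h :* (f :+ p :* (s :* s :⋆) :* p :⋆)) (Fh ∷ hF ∷ p⋆h ∷ hp ∷ []))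
        (*-congˡ (sym f-eq)))
      first : Path f (1# + h) (1# + z * h * z ⋆)
      first = swap (unitary-cong (solve (x ∷ []) (λ x → [] , x ⊜ :1 :+ (x :- :1)) []) ux) fh
        (solve (F ∷ p ∷ s ∷ h ∷ []) (λ f p s h → (f :⋆ ⟶ f) ∷ (f :* h ⟶ h) ∷ (p :⋆ :* p ⟶ :1) ∷ (s :⋆ :* s ⟶ :1) ∷ [] ,
          (p :* s :* f) :⋆ :* (p :* s :* f :* h) ⊜ h) (F⋆ ∷ Fh ∷ pp ∷ s⋆s ∷ []))
        (solve (F ∷ p ∷ s ∷ h ∷ []) (λ f p s h → (f :⋆ ⟶ f) ∷ (h :* f ⟶ h) ∷ (p :⋆ :* p ⟶ :1) ∷ (s :⋆ :* s ⟶ :1) ∷ [] ,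
          h :* ((p :* s :* f) :⋆ :* (p :* s :* f)) ⊜ h) (F⋆ ∷ hF ∷ pp ∷ s⋆s ∷ []))
      zhz⋆ : z * h * z ⋆ ≈ p * s * h * (p * s) ⋆
      zhz⋆ = solve (F ∷ p ∷ s ∷ h ∷ []) (λ f p s h → (f :⋆ ⟶ f) ∷ (f :* h ⟶ h) ∷ (h :* f ⟶ h) ∷ [] ,
        p :* s :* f :* h :* (p :* s :* f) :⋆ ⊜ p :* s :* h :* (p :* s) :⋆) (F⋆ ∷ Fh ∷ hF ∷ [])
      second : Path f (α (p * s) x) (α (s * s) x)
      second = path-swap f⋆
        (trans (*-congʳ f-eq) (trans (solve (F ∷ p ∷ s ∷ []) (λ f p s →
            (f :* s ⟶ s) ∷ (p :⋆ :* f ⟶ :0) ∷ (p :⋆ :* s ⟶ :0) ∷ (s :⋆ :* s ⟶ :1) ∷ (p :⋆ :* p ⟶ :1) ∷ [] ,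
            (f :+ p :* (s :* s :⋆) :* p :⋆) :* (s :* s :* (p :* s) :⋆) ⊜
            s :* s :* (p :* s) :⋆ :* (f :+ p :* (s :* s :⋆) :* p :⋆)) (Fs ∷ p⋆F ∷ p⋆s ∷ s⋆s ∷ pp ∷ []))
          (*-congˡ (sym f-eq))))
        (trans (*-congʳ f-eq) (trans (solve (F ∷ p ∷ s ∷ x ∷ []) (λ f p s x →
            (f :* p ⟶ :0) ∷ (p :⋆ :* f ⟶ :0) ∷ (s :⋆ :* s ⟶ :1) ∷ (p :⋆ :* p ⟶ :1) ∷ [] ,
            (f :+ p :* (s :* s :⋆) :* p :⋆) :* (:1 :+ p :* s :* (x :- :1) :* (p :* s) :⋆) ⊜
            (:1 :+ p :* s :* (x :- :1) :* (p :* s) :⋆) :* (f :+ p :* (s :* s :⋆) :* p :⋆)) (Fp ∷ p⋆F ∷ s⋆s ∷ pp ∷ []))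
          (*-congˡ (sym f-eq))))
        (isometry-* pp s⋆s) (isometry-* s⋆s s⋆s)
        (solve (p ∷ s ∷ []) (λ p s → (p :⋆ :* s ⟶ :0) ∷ [] , (p :* s) :⋆ :* (s :* s) ⊜ :0) (p⋆s ∷ [])) ux

  -- The given path need not commute with `range n`, so it yields no path of matrices by itself. Put
  -- once more under s it does commute, as f s = s, and `shift` joins both ends to it. Both matrices
  -- are padded to size m + n + 2: one extra index puts s among the isometries even for m = n = 0,
  -- and the other is the free corner of `shift`.
  κ-reflects : ∀ (x y : K.Carrier) → κ (proj₁ (proj₂ x)) ∼ κ (proj₁ (proj₂ y)) → x K.≈ y
  κ-reflects (m , u) (n , v) h = ℕ.suc n ℕ.+ 1 , ℕ.suc m ℕ.+ 1 , eq ,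
    path⇒homotopic eq (u ⊕ᵁ 1ᵁ (ℕ.suc n ℕ.+ 1)) (v ⊕ᵁ 1ᵁ (ℕ.suc m ℕ.+ 1))
      (path-cong (sym (κ-⊕-1 (proj₁ u) (ℕ.suc n ℕ.+ 1))) (sym (κ-⊕-1 (proj₁ v) (ℕ.suc m ℕ.+ 1)))
        (path-trans f⋆ (shift n u f f≈) (path-trans f⋆ middle (path-sym f⋆ (shift m v f f≈′)))))
    where
    f : Carrier
    f = range (m ℕ.+ (ℕ.suc n ℕ.+ 1))
    eq : m ℕ.+ (ℕ.suc n ℕ.+ 1) ≡ n ℕ.+ (ℕ.suc m ℕ.+ 1)
    eq = ≡.trans (≡.sym (ℕₚ.+-assoc m (ℕ.suc n) 1)) (≡.trans (≡.cong (ℕ._+ 1)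
      (≡.trans (ℕₚ.+-suc m n) (≡.trans (≡.cong ℕ.suc (ℕₚ.+-comm m n)) (≡.sym (ℕₚ.+-suc n m)))))
      (ℕₚ.+-assoc n (ℕ.suc m) 1))
    f≈ : f ≈ range ((m ℕ.+ ℕ.suc n) ℕ.+ 1)
    f≈ = reflexive (≡.cong range (≡.sym (ℕₚ.+-assoc m (ℕ.suc n) 1)))
    f≈′ : f ≈ range ((n ℕ.+ ℕ.suc m) ℕ.+ 1)
    f≈′ = reflexive (≡.cong range (≡.trans eq (≡.sym (ℕₚ.+-assoc n (ℕ.suc m) 1))))
    f⋆ : f ⋆ ≈ f
    f⋆ = range-⋆ _
    fs : ∀ m → range (m ℕ.+ (ℕ.suc n ℕ.+ 1)) * s ≈ s
    fs ℕ.zero    = range-e {ℕ.suc n ℕ.+ 1} zero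
    fs (ℕ.suc m) = range-e {ℕ.suc m ℕ.+ (ℕ.suc n ℕ.+ 1)} zero
    middle : Path f (α (s * s) (κ (proj₁ u))) (α (s * s) (κ (proj₁ v)))
    middle = path-cong (α-α s s _) (α-α s s _) (path-α f⋆ (fs m) s⋆s h)

  κ-preserves : ∀ (x y : K.Carrier) → x K.≈ y → κ (proj₁ (proj₂ x)) ∼ κ (proj₁ (proj₂ y))
  κ-preserves (m , u) (n , v) (k , l , eq , H) = path⇒∼ (path-cong (κ-⊕-1 (proj₁ u) k) (κ-⊕-1 (proj₁ v) l)
    (homotopic⇒path eq (u ⊕ᵁ 1ᵁ k) (v ⊕ᵁ 1ᵁ l) H))

  scalarMatrix : ∀ u → IsUnitaryElement u → Unitary 1
  scalarMatrix u (p , q) = (λ _ _ → u) ,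
    (λ { zero zero → trans (+-identityʳ _) p }) , (λ { zero zero → trans (+-identityʳ _) q })

  κ-scalar : ∀ u p → κ (proj₁ (scalarMatrix u p)) ∼ u
  κ-scalar u p = ∼-trans (∼-reflexive (κ-unitary (scalarMatrix u p)) (trans
    (+-cong (+-congˡ (-‿cong (∑-one _))) (trans (∑-one _) (*-congˡ (∑-one _)))) (solve (s ∷ u ∷ []) (λ s u → [] ,
    :1 :- s :* s :⋆ :+ s :* (u :* s :⋆) ⊜ :1 :+ s :* (u :- :1) :* s :⋆) []))) (α-∼ s⋆s p)

  -- Exposes the opaque sums, which the comparison of `κ` in two algebras needs.
  κ-sum : ∀ {n} (x : Matrix n) → κ x ≈ 1# - sum (λ (i : Fin n) → e i * e i ⋆) + sum (λ i → e i * sum (λ j → x i j * e j ⋆))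
  κ-sum {n} x = +-cong (+-congˡ (-‿cong (∑≈sum λ (i : Fin n) → e i * e i ⋆)))
    (trans (∑-cong λ i → *-congˡ (∑≈sum λ j → x i j * e j ⋆)) (∑≈sum λ i → e i * sum (λ j → x i j * e j ⋆)))

-- Values, bounds and moduli of continuity of formulas.

module Formulas (em : ∀ {ℓ} → ExcludedMiddle ℓ) (R : CompleteOrderedField) where
  open Setting em R
  open Reals em R

  addᶠ maxᶠ : ContinuousFunction 2
  addᶠ = record
    { apply = λ x → x zero ℝ.+ x (suc zero)
    ; continuous = λ x η p → half η , half-pos p , λ y h → Within-mono (ℝ.≤-reflexive (half+half η))
        (add (h zero) (h (suc zero))) }
    where
    add : ∀ {δ η a b c d} → ℝ.Within δ a b → ℝ.Within η c d → ℝ.Within (δ ℝ.+ η) (a ℝ.+ c) (b ℝ.+ d)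
    add {δ} {η} {a} {b} {c} {d} (p , p′) (q , q′) =
      ℝ.≤-respʳ-≈ (solveᴿ (b ∷ d ∷ δ ∷ η ∷ []) (λ b d x y → [] , b :+ x :+ (d :+ y) ⊜ b :+ d :+ (x :+ y)) []) (ℝ.+-mono-≤ p q) ,
      ℝ.≤-respʳ-≈ (solveᴿ (a ∷ c ∷ δ ∷ η ∷ []) (λ b d x y → [] , b :+ x :+ (d :+ y) ⊜ b :+ d :+ (x :+ y)) []) (ℝ.+-mono-≤ p′ q′)

  max-≤ : ∀ {x y z} → x ℝ.≤ z → y ℝ.≤ z → x ℝ.⊔ᵣ y ℝ.≤ z
  max-≤ {x} {y} p q with ℝ.total x y
  ... | inj₁ _ = q
  ... | inj₂ _ = p

  max-≥ˡ : ∀ x y → x ℝ.≤ x ℝ.⊔ᵣ y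
  max-≥ˡ x y with ℝ.total x y
  ... | inj₁ p = p
  ... | inj₂ _ = ℝ.≤-refl

  max-≥ʳ : ∀ x y → y ℝ.≤ x ℝ.⊔ᵣ y
  max-≥ʳ x y with ℝ.total x y
  ... | inj₁ _ = ℝ.≤-refl
  ... | inj₂ p = p

  maxᶠ = record
    { apply = λ x → x zero ℝ.⊔ᵣ x (suc zero)
    ; continuous = λ x η p → η , p , λ y h → one x y η h , one y x η (λ i → Within-sym (h i)) }
    where
    one : ∀ (x y : Vector ℝ 2) η → Near η x y → x zero ℝ.⊔ᵣ x (suc zero) ℝ.≤ y zero ℝ.⊔ᵣ y (suc zero) ℝ.+ η
    one x y η h = max-≤ (ℝ.≤-trans (proj₁ (h zero)) (ℝ.+-mono-≤ (max-≥ˡ _ _) ℝ.≤-refl))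
      (ℝ.≤-trans (proj₁ (h (suc zero))) (ℝ.+-mono-≤ (max-≥ʳ _ _) ℝ.≤-refl))

  constᶠ : ℝ → ContinuousFunction 0
  constᶠ r = record { apply = λ _ → r ; continuous = λ x η p → η , p , λ y _ → Within-refl (<⇒≤ p) }

  scaleᶠ : ℝ → ContinuousFunction 1
  scaleᶠ a = record { apply = λ x → a ℝ.* x zero ; continuous = λ x η p → via x η (shrink c 0≤c η p) }
    where
    c : ℝ
    c = proj₁ (upper a (ℝ.- a))
    a≤c : a ℝ.≤ c
    a≤c = proj₁ (proj₂ (upper a (ℝ.- a)))
    -a≤c : ℝ.- a ℝ.≤ c
    -a≤c = proj₂ (proj₂ (upper a (ℝ.- a)))
    0≤c : ℝ.0# ℝ.≤ c
    0≤c with ℝ.total ℝ.0# a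
    ... | inj₁ p = ℝ.≤-trans p a≤c
    ... | inj₂ p = ℝ.≤-trans (lin p (solveᴿ (a ∷ []) (λ a → [] , :0 :+ :0 ⊜ :- a :+ a) [])) -a≤c
    one : ∀ {x y δ} → ℝ.Within δ x y → a ℝ.* x ℝ.≤ a ℝ.* y ℝ.+ c ℝ.* δ
    one {x} {y} {δ} (p , q) with ℝ.total ℝ.0# a
    ... | inj₁ h = lin (ℝ.+-mono-≤ (ℝ.*-monoʳ-≤ h p) (*-monoˡ-≤ 0≤δ a≤c)) (solveᴿ (a ∷ c ∷ x ∷ y ∷ δ ∷ [])
            (λ a c x y d → [] , a :* x :+ (a :* (y :+ d) :+ c :* d) ⊜ a :* y :+ c :* d :+ (a :* x :+ a :* d)) [])
      where
      0≤δ : ℝ.0# ℝ.≤ δ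
      0≤δ = ≤-resp (ℝ.zeroʳ ½) (ℝ.trans (ℝ.distribˡ ½ δ δ) (half+half δ)) (ℝ.*-monoʳ-≤ 0≤½ (lin (ℝ.+-mono-≤ p q)
        (solveᴿ (x ∷ y ∷ δ ∷ []) (λ x y d → [] , :0 :+ (y :+ d :+ (x :+ d)) ⊜ d :+ d :+ (x :+ y)) [])))
    ... | inj₂ h = lin (ℝ.+-mono-≤ (ℝ.*-monoʳ-≤ 0≤-a q) (*-monoˡ-≤ 0≤δ -a≤c)) (solveᴿ (a ∷ c ∷ x ∷ y ∷ δ ∷ [])
            (λ a c x y d → [] , a :* x :+ ((:- a) :* (x :+ d) :+ c :* d) ⊜
              a :* y :+ c :* d :+ ((:- a) :* y :+ (:- a) :* d)) [])
      where
      0≤-a : ℝ.0# ℝ.≤ ℝ.- a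
      0≤-a = lin h (solveᴿ (a ∷ []) (λ a → [] , :0 :+ :0 ⊜ :- a :+ a) [])
      0≤δ : ℝ.0# ℝ.≤ δ
      0≤δ = ≤-resp (ℝ.zeroʳ ½) (ℝ.trans (ℝ.distribˡ ½ δ δ) (half+half δ)) (ℝ.*-monoʳ-≤ 0≤½ (lin (ℝ.+-mono-≤ p q)
        (solveᴿ (x ∷ y ∷ δ ∷ []) (λ x y d → [] , :0 :+ (y :+ d :+ (x :+ d)) ⊜ d :+ d :+ (x :+ y)) [])))
    via : ∀ x η → (∃ λ δ → ℝ.0# ℝ.< δ × c ℝ.* δ ℝ.≤ η) → ∃ λ δ → ℝ.0# ℝ.< δ ×
          (∀ (y : Vector ℝ 1) → (∀ i → ℝ.Within δ (x i) (y i)) → ℝ.Within η (a ℝ.* x zero) (a ℝ.* y zero))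
    via x η (δ , p , q) = δ , p , λ y h → Within-mono q (one (h zero) , one (Within-sym (h zero)))

  module _ {L : Language} where

    infixl 6 _⊕′_
    infixr 7 _⊙′_
    infixl 5 _⊔′_

    _⊕′_ _⊔′_ : ∀ {Γ} → Formula L Γ → Formula L Γ → Formula L Γ
    φ ⊕′ ψ = conn addᶠ (φ Vector.∷ ψ Vector.∷ Vector.[])
    φ ⊔′ ψ = conn maxᶠ (φ Vector.∷ ψ Vector.∷ Vector.[])

    _⊙′_ : ∀ {Γ} → ℝ → Formula L Γ → Formula L Γ
    r ⊙′ φ = conn (scaleᶠ r) (φ Vector.∷ Vector.[])

    const′ : ∀ {Γ} → ℝ → Formula L Γ
    const′ r = conn (constᶠ r) Vector.[]

    -- This is min(1, max(0, φ)), with the minimum expressed by a maximum and two changes of sign.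
    clamp′ : ∀ {Γ} → Formula L Γ → Formula L Γ
    clamp′ φ = (ℝ.- ℝ.1#) ⊙′ (const′ (ℝ.- ℝ.1#) ⊔′ (ℝ.- ℝ.1#) ⊙′ (const′ ℝ.0# ⊔′ φ))

  clamp : ℝ → ℝ
  clamp r = (ℝ.- ℝ.1#) ℝ.* ((ℝ.- ℝ.1#) ℝ.⊔ᵣ ((ℝ.- ℝ.1#) ℝ.* (ℝ.0# ℝ.⊔ᵣ r)))

  clamp-0 : ∀ {r} → r ℝ.≤ ℝ.0# → clamp r ℝ.≈ ℝ.0#
  clamp-0 {r} p = ℝ.trans (ℝ.*-congˡ (ℝ.antisym (max-≤ -1≤0 (ℝ.≤-reflexive 0′)) (ℝ.≤-trans (ℝ.≤-reflexive (ℝ.sym 0′)) (max-≥ʳ _ _))))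
    (ℝ.zeroʳ _)
    where
    0′ : (ℝ.- ℝ.1#) ℝ.* (ℝ.0# ℝ.⊔ᵣ r) ℝ.≈ ℝ.0#
    0′ = ℝ.trans (ℝ.*-congˡ (ℝ.antisym (max-≤ ℝ.≤-refl p) (max-≥ˡ _ _))) (ℝ.zeroʳ _)
    -1≤0 : ℝ.- ℝ.1# ℝ.≤ ℝ.0#
    -1≤0 = lin ℝ.0≤1 (solveᴿ [] ([] , :- :1 :+ :1 ⊜ :0 :+ :0) [])

  clamp-1 : ∀ {r} → ℝ.1# ℝ.≤ r → clamp r ℝ.≈ ℝ.1#
  clamp-1 {r} p = ℝ.trans (ℝ.*-congˡ (ℝ.antisym (max-≤ ℝ.≤-refl (lin p′ (solveᴿ (m ∷ []) (λ m → [] ,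
      (:- :1) :* m :+ m ⊜ :- :1 :+ :1) []))) (max-≥ˡ _ _))) (solveᴿ [] ([] , (:- :1) :* (:- :1) ⊜ :1) [])
    where
    m = ℝ.0# ℝ.⊔ᵣ r
    p′ : ℝ.1# ℝ.≤ m
    p′ = ℝ.≤-trans p (max-≥ʳ _ _)

  -- The value 0 stands for true, so that an infimum is an existential quantifier.
  Truth : ∀ {p} → Set p → ℝ → Set p
  Truth P r = (P → r ℝ.≈ ℝ.0#) × (¬ P → r ℝ.≈ ℝ.1#)

  truth-bounds : ∀ {p} {P : Set p} {r} → Truth P r → ℝ.0# ℝ.≤ r × r ℝ.≤ ℝ.1#
  truth-bounds {P = P} (t , f) with em {P = P}
  ... | yes p = ℝ.≤-reflexive (ℝ.sym (t p)) , ℝ.≤-respˡ-≈ (ℝ.sym (t p)) ℝ.0≤1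
  ... | no ¬p = ℝ.≤-respʳ-≈ (ℝ.sym (f ¬p)) ℝ.0≤1 , ℝ.≤-reflexive (f ¬p)

  truth-reflects : ∀ {p} {P : Set p} {r} → Truth P r → r ℝ.≈ ℝ.0# → P
  truth-reflects {P = P} (t , f) r≈0 with em {P = P}
  ... | yes p = p
  ... | no ¬p = contradiction (ℝ.trans (ℝ.sym (f ¬p)) r≈0) ℝ.1≉0

  truth-⇔ : ∀ {p q} {P : Set p} {Q : Set q} {r} → (P → Q) → (Q → P) → Truth P r → Truth Q r
  truth-⇔ f g (t , u) = (λ q → t (g q)) , λ ¬q → u λ p → ¬q (f p)

  module _ {ℓ} {X : Set ℓ} (f g : X → ℝ) (x₀ : X) {b c η : ℝ} where

    sup-≤ : (∀ x → f x ℝ.≤ b) → (∀ x → g x ℝ.≤ c) → (∀ x → f x ℝ.≤ g x ℝ.+ η) → sup f ℝ.≤ sup g ℝ.+ η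
    sup-≤ p q h = proj₂ (sup-isSup f x₀ b p) _ λ x → ℝ.≤-trans (h x) (ℝ.+-mono-≤ (proj₁ (sup-isSup g x₀ c q) x) ℝ.≤-refl)

    inf-≤ : (∀ x → b ℝ.≤ f x) → (∀ x → c ℝ.≤ g x) → (∀ x → f x ℝ.≤ g x ℝ.+ η) → inf f ℝ.≤ inf g ℝ.+ η
    inf-≤ p q h = lin (proj₂ (inf-isInf g x₀ c q) (inf f ℝ.- η) λ x → lin
        (ℝ.≤-trans (proj₁ (inf-isInf f x₀ b p) x) (h x))
        (solveᴿ (inf f ∷ g x ∷ η ∷ []) (λ i g e → [] , i :- e :+ (g :+ e) ⊜ g :+ i) []))
      (solveᴿ (inf f ∷ inf g ∷ η ∷ []) (λ i g e → [] , i :+ g ⊜ g :+ e :+ (i :- e)) [])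

  inf-attained : ∀ {ℓ} {X : Set ℓ} (f : X → ℝ) (x₀ : X) {b} → (∀ x → b ℝ.≤ f x) →
                 ∀ {c} → inf f ℝ.< c → ∃ λ x → f x ℝ.≤ c
  inf-attained f x₀ {b} h {c} p with em {P = ∃ λ x → f x ℝ.≤ c}
  ... | yes q = q
  ... | no ¬q = contradiction p (≤⇒≯ (proj₂ (inf-isInf f x₀ b h) c λ x → <⇒≤ (≰⇒> λ r → ¬q (x , r))))

  0≤fromℕ : ∀ n → ℝ.0# ℝ.≤ ℝ.fromℕ n
  0≤fromℕ = ℝ.fromℕ-nonneg

  module _ (ℓ : Level) where

    private
      module _ (M : CStarAlgebra ℓ) where
        open CStarAlgebra M using (‖_‖; _-_)

        Dist : CStarAlgebra.Carrier M → CStarAlgebra.Carrier M → ℝ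
        Dist a b = ‖ a - b ‖

      Close : ∀ (M : CStarAlgebra ℓ) {Γ} → ℝ → All (Ball M) Γ → All (Ball M) Γ → Set
      Close M δ []       []       = ⊤
      Close M δ (x ∷ xs) (y ∷ ys) = Dist M (proj₁ x) (proj₁ y) ℝ.≤ δ × Close M δ xs ys

      same : ∀ (M : CStarAlgebra ℓ) a {δ} → ℝ.0# ℝ.≤ δ → Dist M a a ℝ.≤ δ
      same M a = CStarBasics.≈⇒‖-‖≤ em R M (CStarAlgebra.refl M)

      close-refl : ∀ (M : CStarAlgebra ℓ) {Γ δ} → ℝ.0# ℝ.≤ δ → (xs : All (Ball M) Γ) → Close M δ xs xs
      close-refl M p []       = tt
      close-refl M p (x ∷ xs) = same M (proj₁ x) p , close-refl M p xs

      close-mono : ∀ (M : CStarAlgebra ℓ) {Γ δ η} {xs ys : All (Ball M) Γ} → δ ℝ.≤ η → Close M δ xs ys → Close M η xs ys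
      close-mono M {xs = []}    {[]}    _ _       = tt
      close-mono M {xs = _ ∷ _} {_ ∷ _} p (q , r) = ℝ.≤-trans q p , close-mono M p r

      close-lookup : ∀ (M : CStarAlgebra ℓ) {Γ δ n} {xs ys : All (Ball M) Γ} → Close M δ xs ys → (i : n ∈ Γ) →
                     Dist M (proj₁ (lookup xs i)) (proj₁ (lookup ys i)) ℝ.≤ δ
      close-lookup M {xs = _ ∷ _} {_ ∷ _} (p , _) (here ≡.refl) = p
      close-lookup M {xs = _ ∷ _} {_ ∷ _} (_ , p) (there i)     = close-lookup M p i

      ball-0 : ∀ (M : CStarAlgebra ℓ) n → Ball M n
      ball-0 M n = CStarAlgebra.0# M , ℝ.≤-respˡ-≈ (ℝ.sym (CStarAlgebra.‖0‖≈0 M)) (0≤fromℕ n)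

      module Lipschitz (M : CStarAlgebra ℓ) {δ : ℝ} where
        open CStarAlgebra M
        open CStarBasics em R M

        plus-lipschitz : ∀ {a b c d} → ‖ a - c ‖ ℝ.≤ δ → ‖ b - d ‖ ℝ.≤ δ → ‖ (a + b) - (c + d) ‖ ℝ.≤ 2# ℝ.* δ
        plus-lipschitz {a} {b} {c} {d} p q =
          ℝ.≤-respʳ-≈ (solveᴿ (δ ∷ []) (λ d → [] , d :+ d ⊜ (:1 :+ :1) :* d) []) ((p ⟨+⟩ q) ⟨≈⟩
            solve (a ∷ b ∷ c ∷ d ∷ []) (λ a b c d → [] , a :- c :+ (b :- d) ⊜ a :+ b :- (c :+ d)) [])

        times-lipschitz : ∀ {a b c d m n} → ‖ b ‖ ℝ.≤ n → ‖ c ‖ ℝ.≤ m → ‖ a - c ‖ ℝ.≤ δ → ‖ b - d ‖ ℝ.≤ δ →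
                          ‖ a * b - c * d ‖ ℝ.≤ (n ℝ.+ m) ℝ.* δ
        times-lipschitz {a} {b} {c} {d} {m} {n} q′ p′ p q =
          ℝ.≤-respʳ-≈ (solveᴿ (δ ∷ n ∷ m ∷ []) (λ d n m → [] , d :* n :+ m :* d ⊜ (n :+ m) :* d) [])
            (((p ⟨*⟩ q′) ⟨+⟩ (p′ ⟨*⟩ q)) ⟨≈⟩
            solve (a ∷ b ∷ c ∷ d ∷ []) (λ a b c d → [] , (a :- c) :* b :+ c :* (b :- d) ⊜ a :* b :- c :* d) [])

        star-lipschitz : ∀ {a b} → ‖ a - b ‖ ℝ.≤ δ → ‖ a ⋆ - b ⋆ ‖ ℝ.≤ ℝ.1# ℝ.* δ
        star-lipschitz {a} {b} p = ℝ.≤-respʳ-≈ (ℝ.sym (ℝ.*-identityˡ δ))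
          (⟨⋆⟩ p ⟨≈⟩ solve (a ∷ b ∷ []) (λ a b → [] , (a :- b) :⋆ ⊜ a :⋆ :- b :⋆) [])

        scale-lipschitz : ∀ {a b z c} → ℝ.0# ℝ.≤ c → normSq z ℝ.≤ c ℝ.* c → ‖ a - b ‖ ℝ.≤ δ →
                          ‖ (z · a) - (z · b) ‖ ℝ.≤ c ℝ.* δ
        scale-lipschitz {a} {b} {z} {c} 0≤c q≤cc p =
          ℝ.≤-trans (square-cancel (ℝ.*-nonneg 0≤c (‖‖-nonneg _)) (ℝ.≤-respˡ-≈ (ℝ.sym (‖‖-· z (a - b)))
              (≤-resp ℝ.refl (solveᴿ (c ∷ ‖ a - b ‖ ∷ []) (λ c x → [] , c :* c :* (x :* x) ⊜ c :* x :* (c :* x)) [])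
                (*-monoˡ-≤ (ℝ.0≤square _) q≤cc))))
            (ℝ.*-monoʳ-≤ 0≤c p)
          ⟨≈⟩ trans (·-scalar z (a - b)) (trans (solve (z · 1# ∷ a ∷ b ∷ []) (λ z a b → [] , z :* (a :- b) ⊜ z :* a :- z :* b) [])
            (+-cong (sym (·-scalar z a)) (-‿cong (sym (·-scalar z b)))))

      -- The constant is chosen before the algebra. This uniformity is what definability over all
      -- models rests on, and it is kept up to `formula-continuous`.
      fun-lipschitz : ∀ {Δ n} (f : CStarFun Δ n) → ∃ λ c → ℝ.0# ℝ.≤ c ×
        (∀ (M : CStarAlgebra ℓ) δ (xs ys : All (Ball M) Δ) → ℝ.0# ℝ.≤ δ → Close M δ xs ys →
          Dist M (proj₁ (cstarFun M f xs)) (proj₁ (cstarFun M f ys)) ℝ.≤ c ℝ.* δ)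
      fun-lipschitz zero′ = ℝ.0# , ℝ.≤-refl , λ { M δ [] [] p _ → CStarBasics.≈⇒‖-‖≤ em R M (CStarAlgebra.refl M)
        (ℝ.≤-reflexive (ℝ.sym (ℝ.zeroˡ δ))) }
      fun-lipschitz one′ = ℝ.0# , ℝ.≤-refl , λ { M δ [] [] p _ → CStarBasics.≈⇒‖-‖≤ em R M (CStarAlgebra.refl M)
        (ℝ.≤-reflexive (ℝ.sym (ℝ.zeroˡ δ))) }
      fun-lipschitz (plus m n) = 2# , <⇒≤ 0<2 , λ { M δ (_ ∷ _ ∷ []) (_ ∷ _ ∷ []) _ (p , q , _) →
        Lipschitz.plus-lipschitz M p q }
      fun-lipschitz (times m n) = ℝ.fromℕ n ℝ.+ ℝ.fromℕ m , ℝ.≤-respˡ-≈ (ℝ.+-identityˡ _) (ℝ.+-mono-≤ (0≤fromℕ n) (0≤fromℕ m)) ,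
        λ { M δ (_ ∷ (_ , q′) ∷ []) ((_ , p′) ∷ _ ∷ []) _ (p , q , _) → Lipschitz.times-lipschitz M q′ p′ p q }
      fun-lipschitz (star n) = ℝ.1# , ℝ.0≤1 , λ { M δ (_ ∷ []) (_ ∷ []) _ (p , _) → Lipschitz.star-lipschitz M p }
      fun-lipschitz (scale z m n _) = c , 0≤c , λ { M δ (_ ∷ []) (_ ∷ []) _ (p , _) → Lipschitz.scale-lipschitz M 0≤c q≤cc p }
        where
        q c : ℝ
        q = normSq z
        -- Any c with c² at least the squared absolute value of z will do; adding 1 avoids a square
        -- root.
        c = q ℝ.+ ℝ.1#
        0≤q : ℝ.0# ℝ.≤ q
        0≤q = ℝ.≤-respˡ-≈ (ℝ.+-identityˡ ℝ.0#) (ℝ.+-mono-≤ (ℝ.0≤square (proj₁ z)) (ℝ.0≤square (proj₂ z)))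
        0≤c : ℝ.0# ℝ.≤ c
        0≤c = ℝ.≤-respˡ-≈ (ℝ.+-identityˡ ℝ.0#) (ℝ.+-mono-≤ 0≤q ℝ.0≤1)
        q≤cc : q ℝ.≤ c ℝ.* c
        q≤cc = lin (ℝ.+-mono-≤ (ℝ.0≤square q) (ℝ.+-mono-≤ 0≤q ℝ.0≤1)) (solveᴿ (q ∷ []) (λ q → [] ,
          q :+ (q :* q :+ (q :+ :1)) ⊜ (q :+ :1) :* (q :+ :1) :+ (:0 :+ (:0 :+ :0))) [])
      fun-lipschitz (incl _) = ℝ.1# , ℝ.0≤1 , λ { M δ (_ ∷ []) (_ ∷ []) _ (p , _) →
        ℝ.≤-respʳ-≈ (ℝ.sym (ℝ.*-identityˡ δ)) p }

      term-lipschitz : ∀ {Γ n} (u : Term CStarLanguage Γ n) → ∃ λ c → ℝ.0# ℝ.≤ c × (∀ (M : CStarAlgebra ℓ) δ (xs ys : All (Ball M) Γ) →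
        ℝ.0# ℝ.≤ δ → Close M δ xs ys → Dist M (proj₁ (evalTerm (cstarStructure M) u xs)) (proj₁ (evalTerm (cstarStructure M) u ys)) ℝ.≤ c ℝ.* δ)
      terms-lipschitz : ∀ {Γ Δ} (us : All (Term CStarLanguage Γ) Δ) → ∃ λ c → ℝ.0# ℝ.≤ c × (∀ (M : CStarAlgebra ℓ) δ (xs ys : All (Ball M) Γ) →
        ℝ.0# ℝ.≤ δ → Close M δ xs ys → Close M (c ℝ.* δ) (evalTerms (cstarStructure M) us xs) (evalTerms (cstarStructure M) us ys))
      term-lipschitz (var i) = ℝ.1# , ℝ.0≤1 , λ M δ xs ys _ p →
        ℝ.≤-respʳ-≈ (ℝ.sym (ℝ.*-identityˡ δ)) (close-lookup M p i)
      term-lipschitz (app f us) with fun-lipschitz f | terms-lipschitz us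
      ... | c , p , h | d , q , k = c ℝ.* d , ℝ.*-nonneg p q , λ M δ xs ys r s →
            ℝ.≤-respʳ-≈ (ℝ.sym (ℝ.*-assoc c d δ)) (h M (d ℝ.* δ) _ _ (ℝ.*-nonneg q r) (k M δ xs ys r s))
      terms-lipschitz [] = ℝ.0# , ℝ.≤-refl , λ M δ xs ys _ _ → tt
      terms-lipschitz (u ∷ us) with term-lipschitz u | terms-lipschitz us
      ... | c , p , h | d , q , k with upper c d
      ...   | m , l , l′ = m , ℝ.≤-trans p l , λ M δ xs ys r s →
              ℝ.≤-trans (h M δ xs ys r s) (*-monoˡ-≤ r l) , close-mono M (*-monoˡ-≤ r l′) (k M δ xs ys r s)

      max-of : ∀ {n} (f : Fin n → ℝ) → ∃ λ b → ℝ.0# ℝ.≤ b × (∀ i → f i ℝ.≤ b)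
      max-of {ℕ.zero}  f = ℝ.0# , ℝ.≤-refl , λ ()
      max-of {ℕ.suc n} f with max-of (f ∘ suc)
      ... | b , p , h with upper (f zero) b
      ...   | c , l , l′ = c , ℝ.≤-trans p l′ , λ { zero → l ; (suc i) → ℝ.≤-trans (h i) l′ }

      min-of : ∀ {n} (f : Fin n → ℝ) → (∀ i → ℝ.0# ℝ.< f i) → ∃ λ b → ℝ.0# ℝ.< b × (∀ i → b ℝ.≤ f i)
      min-of {ℕ.zero}  f h = ℝ.1# , 0<1 , λ ()
      min-of {ℕ.suc n} f h with min-of (f ∘ suc) (h ∘ suc)
      ... | b , p , k with common (h zero) p
      ...   | c , q , l , l′ = c , q , λ { zero → l ; (suc i) → ℝ.≤-trans l′ (k i) }

    formula-bounded : ∀ {Γ} (φ : Formula CStarLanguage Γ) → ∃ λ b → ℝ.0# ℝ.≤ b ×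
      (∀ (M : CStarAlgebra ℓ) xs → Bound b (eval (cstarStructure M) φ xs))
    formula-bounded (dist′ {n} u v) = b , 0≤b , λ M xs →
        ℝ.≤-trans (lin 0≤b (solveᴿ (b ∷ []) (λ b → [] , :- b :+ b ⊜ :0 :+ :0) [])) (CStarAlgebra.‖‖-nonneg M _) ,
        CStarBasics._⟨-⟩_ em R M (proj₂ (evalTerm (cstarStructure M) u xs)) (proj₂ (evalTerm (cstarStructure M) v xs))
      where
      b : ℝ
      b = ℝ.fromℕ n ℝ.+ ℝ.fromℕ n
      0≤b : ℝ.0# ℝ.≤ b
      0≤b = ℝ.≤-respˡ-≈ (ℝ.+-identityˡ _) (ℝ.+-mono-≤ (0≤fromℕ n) (0≤fromℕ n))
    formula-bounded (conn f φ) = via (max-of λ i → proj₁ (formula-bounded (φ i)))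
      where
      via : (∃ λ b → ℝ.0# ℝ.≤ b × (∀ i → proj₁ (formula-bounded (φ i)) ℝ.≤ b)) → _
      via (b , p , h) = via′ (bounded f b p)
        where
        via′ : (∃ λ c → ℝ.0# ℝ.≤ c × (∀ x → Box b x → Bound c (ContinuousFunction.apply f x))) → _
        via′ (c , q , k) = c , q , λ M xs → k _ λ i → bound-mono (h i) (proj₂ (proj₂ (formula-bounded (φ i))) M xs)
    formula-bounded (sup′ n φ) with formula-bounded φ
    ... | b , p , h = b , p , λ M xs → via M xs (sup-isSup (λ x → eval (cstarStructure M) φ (x ∷ xs)) (ball-0 M n) b λ x → proj₂ (h M (x ∷ xs)))
      where
      via : ∀ (M : CStarAlgebra ℓ) xs → IsSup (λ x → eval (cstarStructure M) φ (x ∷ xs)) (eval (cstarStructure M) (sup′ n φ) xs) → Bound b (eval (cstarStructure M) (sup′ n φ) xs)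
      via M xs (u , v) = ℝ.≤-trans (proj₁ (h M (ball-0 M n ∷ xs))) (u (ball-0 M n)) , v b λ x → proj₂ (h M (x ∷ xs))
    formula-bounded (inf′ n φ) with formula-bounded φ
    ... | b , p , h = b , p , λ M xs → via M xs (inf-isInf (λ x → eval (cstarStructure M) φ (x ∷ xs)) (ball-0 M n) (ℝ.- b) λ x → proj₁ (h M (x ∷ xs)))
      where
      via : ∀ (M : CStarAlgebra ℓ) xs → IsInf (λ x → eval (cstarStructure M) φ (x ∷ xs)) (eval (cstarStructure M) (inf′ n φ) xs) → Bound b (eval (cstarStructure M) (inf′ n φ) xs)
      via M xs (u , v) = v (ℝ.- b) (λ x → proj₁ (h M (x ∷ xs))) , ℝ.≤-trans (u (ball-0 M n)) (proj₂ (h M (ball-0 M n ∷ xs)))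

    private
      -- A connective is merely continuous. As the values of the subformulas lie in a box that does
      -- not depend on the algebra, its modulus can be taken from uniform continuity on that box.
      formula-continuous : ∀ {Γ} (φ : Formula CStarLanguage Γ) η → ℝ.0# ℝ.< η → ∃ λ δ → ℝ.0# ℝ.< δ ×
        (∀ (M : CStarAlgebra ℓ) xs ys → Close M δ xs ys →
          ℝ.Within η (eval (cstarStructure M) φ xs) (eval (cstarStructure M) φ ys))
      formula-continuous (dist′ u v) η p = via (term-lipschitz u) (term-lipschitz v)
        where
        via : (∃ λ c → ℝ.0# ℝ.≤ c × _) → (∃ λ c → ℝ.0# ℝ.≤ c × _) → _
        via (c , q , h) (d , r , k) = via′ (shrink (c ℝ.+ d) (ℝ.≤-respˡ-≈ (ℝ.+-identityˡ _) (ℝ.+-mono-≤ q r)) η p)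
          where
          one : ∀ (M : CStarAlgebra ℓ) δ → ℝ.0# ℝ.≤ δ → ∀ xs ys → Close M δ xs ys → (c ℝ.+ d) ℝ.* δ ℝ.≤ η →
                ℝ.Within η (eval (cstarStructure M) (dist′ u v) xs) (eval (cstarStructure M) (dist′ u v) ys)
          one M δ δ≥0 xs ys cl ≤η = below , above
            where
            open CStarAlgebra M
            open CStarBasics em R M
            a = proj₁ (evalTerm (cstarStructure M) u xs)
            a′ = proj₁ (evalTerm (cstarStructure M) u ys)
            b = proj₁ (evalTerm (cstarStructure M) v xs)
            b′ = proj₁ (evalTerm (cstarStructure M) v ys)
            bound : ∀ z → z ℝ.+ (c ℝ.* δ ℝ.+ d ℝ.* δ) ℝ.≤ z ℝ.+ η
            bound z = ℝ.+-mono-≤ ℝ.≤-refl (ℝ.≤-respˡ-≈ (ℝ.distribʳ δ c d) ≤η)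
            below : ‖ a - b ‖ ℝ.≤ ‖ a′ - b′ ‖ ℝ.+ η
            below = ℝ.≤-trans ((ℝ.≤-refl ⟨+⟩ (h M δ xs ys δ≥0 cl ⟨-⟩ k M δ xs ys δ≥0 cl)) ⟨≈⟩
              solve (a ∷ b ∷ a′ ∷ b′ ∷ []) (λ a b c d → [] , c :- d :+ (a :- c :- (b :- d)) ⊜ a :- b) []) (bound _)
            above : ‖ a′ - b′ ‖ ℝ.≤ ‖ a - b ‖ ℝ.+ η
            above = ℝ.≤-trans ((ℝ.≤-refl ⟨-⟩ (h M δ xs ys δ≥0 cl ⟨-⟩ k M δ xs ys δ≥0 cl)) ⟨≈⟩
              solve (a ∷ b ∷ a′ ∷ b′ ∷ []) (λ a b c d → [] , a :- b :- (a :- c :- (b :- d)) ⊜ c :- d) []) (bound _)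
          via′ : (∃ λ δ → ℝ.0# ℝ.< δ × (c ℝ.+ d) ℝ.* δ ℝ.≤ η) → _
          via′ (δ , s , l) = δ , s , λ M xs ys cl → one M δ (<⇒≤ s) xs ys cl l
      formula-continuous (conn f φ) η p = via (max-of λ i → proj₁ (formula-bounded (φ i)))
        where
        via : (∃ λ b → ℝ.0# ℝ.≤ b × (∀ i → proj₁ (formula-bounded (φ i)) ℝ.≤ b)) → _
        via (b , q , h) = via′ (uniformly-continuous f b q η p)
          where
          via′ : (∃ λ δ → ℝ.0# ℝ.< δ × (∀ x y → Box b x → Near δ x y →
                  ℝ.Within η (ContinuousFunction.apply f x) (ContinuousFunction.apply f y))) → _
          via′ (δ , r , k) = via″ (min-of (λ i → proj₁ (formula-continuous (φ i) δ r)) λ i → proj₁ (proj₂ (formula-continuous (φ i) δ r)))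
            where
            via″ : (∃ λ ε′ → ℝ.0# ℝ.< ε′ × (∀ i → ε′ ℝ.≤ proj₁ (formula-continuous (φ i) δ r))) → _
            via″ (ε′ , s , l) = ε′ , s , λ M xs ys cl → k _ _
              (λ i → bound-mono (h i) (proj₂ (proj₂ (formula-bounded (φ i))) M xs))
              λ i → proj₂ (proj₂ (formula-continuous (φ i) δ r)) M xs ys (close-mono M (l i) cl)
      formula-continuous (sup′ n φ) η p with formula-continuous φ η p | formula-bounded φ
      ... | δ , q , h | b , _ , k = δ , q , λ M xs ys cl →
            sup-≤ _ _ (ball-0 M n) (λ x → proj₂ (k M (x ∷ xs))) (λ x → proj₂ (k M (x ∷ ys)))
              (λ x → proj₁ (h M (x ∷ xs) (x ∷ ys) (same M (proj₁ x) (<⇒≤ q) , cl))) ,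
            sup-≤ _ _ (ball-0 M n) (λ x → proj₂ (k M (x ∷ ys))) (λ x → proj₂ (k M (x ∷ xs)))
              (λ x → proj₂ (h M (x ∷ xs) (x ∷ ys) (same M (proj₁ x) (<⇒≤ q) , cl)))
      formula-continuous (inf′ n φ) η p with formula-continuous φ η p | formula-bounded φ
      ... | δ , q , h | b , _ , k = δ , q , λ M xs ys cl →
            inf-≤ _ _ (ball-0 M n) (λ x → proj₁ (k M (x ∷ xs))) (λ x → proj₁ (k M (x ∷ ys)))
              (λ x → proj₁ (h M (x ∷ xs) (x ∷ ys) (same M (proj₁ x) (<⇒≤ q) , cl))) ,
            inf-≤ _ _ (ball-0 M n) (λ x → proj₁ (k M (x ∷ ys))) (λ x → proj₁ (k M (x ∷ xs)))
              (λ x → proj₂ (h M (x ∷ xs) (x ∷ ys) (same M (proj₁ x) (<⇒≤ q) , cl)))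

    formula-continuous₁ : ∀ {n Γ} (φ : Formula CStarLanguage (n ∷ Γ)) η → ℝ.0# ℝ.< η → ∃ λ δ → ℝ.0# ℝ.< δ ×
      (∀ (M : CStarAlgebra ℓ) (x y : Ball M n) zs → CStarAlgebra.‖_‖ M (CStarAlgebra._-_ M (proj₁ x) (proj₁ y)) ℝ.≤ δ →
        ℝ.Within η (eval (cstarStructure M) φ (x ∷ zs)) (eval (cstarStructure M) φ (y ∷ zs)))
    formula-continuous₁ φ η p with formula-continuous φ η p
    ... | δ , q , h = δ , q , λ M x y zs d → h M (x ∷ zs) (y ∷ zs) (d , close-refl M (<⇒≤ q) zs)

-- Definable sets given by stable relations, and quantification over them.

module Definability (em : ∀ {ℓ} → ExcludedMiddle ℓ) (R : CompleteOrderedField)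
                    {ℓ} (𝓜 : Set (lsuc ℓ)) (alg : 𝓜 → Setting.CStarAlgebra em R ℓ) where
  open Setting em R
  open Reals em R
  open Formulas em R

  baseExpansion : Expansion 𝓜
  baseExpansion = record { language = CStarLanguage ; structure = λ M → cstarStructure (alg M) }

  open Expansion baseExpansion using (Predicate; value; IsDefinable; module Model)

  private
    infixl 6 _-ᵃ_
    norm : ∀ M → CStarAlgebra.Carrier (alg M) → ℝ
    norm M = CStarAlgebra.‖_‖ (alg M)

    _-ᵃ_ : ∀ {M} → CStarAlgebra.Carrier (alg M) → CStarAlgebra.Carrier (alg M) → CStarAlgebra.Carrier (alg M)
    _-ᵃ_ {M} = CStarAlgebra._-_ (alg M)

  -- A subset of the unit ball whose approximate members, in the sense of a formula
  -- measuring the failure of membership, are close to members.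
  record StableSet : Set (lsuc ℓ) where
    field
      In           : ∀ M → Ball (alg M) 1 → Set ℓ
      size         : ∀ M → Ball (alg M) 1 → ℝ
      defect       : ∀ Δ → Formula CStarLanguage (1 ∷ Δ)
      defect-value : ∀ {Δ} M a (y : Model.Env M Δ) → value (defect Δ) M (a ∷ y) ≡ size M a
      size-nonneg  : ∀ M a → ℝ.0# ℝ.≤ size M a
      size-zero    : ∀ M a → In M a → size M a ℝ.≈ ℝ.0#
      zero-size    : ∀ M a → size M a ℝ.≈ ℝ.0# → In M a
      stable       : ∀ η → ℝ.0# ℝ.< η → ∃ λ ζ → ℝ.0# ℝ.< ζ × (∀ M a → size M a ℝ.≤ ζ →
                       ∃ λ b → In M b × norm M (_-ᵃ_ {M} (proj₁ a) (proj₁ b)) ℝ.≤ η)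
      point        : ∀ M → ∃ (In M)

  module _ (Z : StableSet) where
    open StableSet Z

    private
      -- The quantifier over the set becomes one over the ball with penalty K times the defect.
      -- Where the defect is at least ζ, the penalty is at least K ζ = 2 b, which exceeds any gain
      -- since the values lie between -b and b. Where it is at most ζ, there is a member nearby at
      -- which ψ differs by at most η.
      module Quantify {Δ} (ψ : Formula CStarLanguage (1 ∷ Δ)) (η : ℝ) (0<η : ℝ.0# ℝ.< η)
                      (b : ℝ) (0≤b : ℝ.0# ℝ.≤ b) (bound : ∀ (M : CStarAlgebra ℓ) xs → Bound b (eval (cstarStructure M) ψ xs))
                      (δ : ℝ) (near : ∀ (M : CStarAlgebra ℓ) (x y : Ball M 1) zs →
                        CStarAlgebra.‖_‖ M (CStarAlgebra._-_ M (proj₁ x) (proj₁ y)) ℝ.≤ δ →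
                        ℝ.Within η (eval (cstarStructure M) ψ (x ∷ zs)) (eval (cstarStructure M) ψ (y ∷ zs)))
                      (ζ : ℝ) (0<ζ : ℝ.0# ℝ.< ζ) (member : ∀ M a → size M a ℝ.≤ ζ →
                        ∃ λ b → In M b × norm M (_-ᵃ_ {M} (proj₁ a) (proj₁ b)) ℝ.≤ δ) where

        K : ℝ
        K = (b ℝ.+ b) ℝ.* ζ ℝ.⁻¹

        0≤K : ℝ.0# ℝ.≤ K
        0≤K = ℝ.*-nonneg (ℝ.≤-respˡ-≈ (ℝ.+-identityˡ _) (ℝ.+-mono-≤ 0≤b 0≤b)) (<⇒≤ (⁻¹-pos 0<ζ))

        Kζ : K ℝ.* ζ ℝ.≈ b ℝ.+ b
        Kζ = solveᴿ (ζ ∷ ζ ℝ.⁻¹ ∷ b ∷ []) (λ z i b → (z :* i ⟶ :1) ∷ [] , (b :+ b) :* i :* z ⊜ b :+ b)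
          (ℝ.*-inverseʳ (pos⇒≉0 0<ζ) ∷ [])

        supFormula infFormula : Formula CStarLanguage Δ
        supFormula = sup′ 1 (ψ ⊕′ (ℝ.- K) ⊙′ defect Δ)
        infFormula = inf′ 1 (ψ ⊕′ K ⊙′ defect Δ)

        module _ (M : 𝓜) (y : Model.Env M Δ) where
          f : Ball (alg M) 1 → ℝ
          f a = value ψ M (a ∷ y)
          D g h : Ball (alg M) 1 → ℝ
          D a = value (defect Δ) M (a ∷ y)
          g a = f a ℝ.+ (ℝ.- K) ℝ.* D a
          h a = f a ℝ.+ K ℝ.* D a

          fX : ∃ (In M) → ℝ
          fX (a , _) = f a

          D≈ : ∀ a → D a ℝ.≈ size M a
          D≈ a = ℝ.reflexive (defect-value M a y)

          KD : ∀ a → ℝ.0# ℝ.≤ K ℝ.* D a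
          KD a = ℝ.*-nonneg 0≤K (ℝ.≤-respʳ-≈ (ℝ.sym (D≈ a)) (size-nonneg M a))

          KD-large : ∀ a → ζ ℝ.≤ size M a → b ℝ.+ b ℝ.≤ K ℝ.* D a
          KD-large a p = ℝ.≤-respˡ-≈ Kζ (ℝ.*-monoʳ-≤ 0≤K (ℝ.≤-respʳ-≈ (ℝ.sym (D≈ a)) p))

          D-in : ∀ a → In M a → D a ℝ.≈ ℝ.0#
          D-in a m = ℝ.trans (D≈ a) (size-zero M a m)

          f≤b : ∀ a → f a ℝ.≤ b
          f≤b a = proj₂ (bound (alg M) (a ∷ y))
          -b≤f : ∀ a → ℝ.- b ℝ.≤ f a
          -b≤f a = proj₁ (bound (alg M) (a ∷ y))

          g≤b : ∀ a → g a ℝ.≤ b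
          g≤b a = lin (ℝ.+-mono-≤ (f≤b a) (KD a)) (solveᴿ (f a ∷ K ∷ D a ∷ b ∷ []) (λ f K D b → [] ,
            f :+ (:- K) :* D :+ (b :+ K :* D) ⊜ b :+ (f :+ :0)) [])
          -b≤h : ∀ a → ℝ.- b ℝ.≤ h a
          -b≤h a = lin (ℝ.+-mono-≤ (-b≤f a) (KD a)) (solveᴿ (f a ∷ K ∷ D a ∷ b ∷ []) (λ f K D b → [] ,
            :- b :+ (f :+ K :* D) ⊜ f :+ K :* D :+ (:- b :+ :0)) [])

          x₀ : ∃ (In M)
          x₀ = point M

          supX-isSup : IsSup fX (sup fX)
          supX-isSup = sup-isSup fX x₀ b λ (a , _) → f≤b a
          infX-isInf : IsInf fX (inf fX)
          infX-isInf = inf-isInf fX x₀ (ℝ.- b) λ (a , _) → -b≤f a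
          supG-isSup : IsSup g (sup g)
          supG-isSup = sup-isSup g (proj₁ x₀) b g≤b
          infH-isInf : IsInf h (inf h)
          infH-isInf = inf-isInf h (proj₁ x₀) (ℝ.- b) -b≤h

          sup-near : ℝ.Within η (sup fX) (sup g)
          sup-near = ℝ.≤-trans (proj₂ supX-isSup (sup g) λ (a , m) → ℝ.≤-respˡ-≈
              (ℝ.trans (ℝ.+-congˡ (ℝ.trans (ℝ.*-congˡ (D-in a m)) (ℝ.zeroʳ _))) (ℝ.+-identityʳ _)) (proj₁ supG-isSup a))
              (proj₁ (Within-refl (<⇒≤ 0<η))) ,
            proj₂ supG-isSup _ each
            where
            each : ∀ a → g a ℝ.≤ sup fX ℝ.+ η
            each a with em {P = size M a ℝ.≤ ζ}
            ... | no p = lin (ℝ.+-mono-≤ (ℝ.+-mono-≤ (f≤b a) (KD-large a (<⇒≤ (≰⇒> p))))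
                    (ℝ.+-mono-≤ (ℝ.≤-trans (-b≤f (proj₁ x₀)) (proj₁ supX-isSup x₀)) (<⇒≤ 0<η)))
                    (solveᴿ (f a ∷ K ∷ D a ∷ b ∷ sup fX ∷ η ∷ []) (λ f K D b s e → [] ,
                      f :+ (:- K) :* D :+ (b :+ K :* D :+ (s :+ e)) ⊜ s :+ e :+ (f :+ (b :+ b) :+ (:- b :+ :0))) [])
            ... | yes p with member M a p
            ...   | (c , m , d) = lin (ℝ.+-mono-≤ (ℝ.+-mono-≤ (proj₁ (near (alg M) a c y d)) (KD a)) (proj₁ supX-isSup (c , m)))
                      (solveᴿ (f a ∷ K ∷ D a ∷ f c ∷ sup fX ∷ η ∷ []) (λ f K D c s e → [] ,
                        f :+ (:- K) :* D :+ (c :+ e :+ K :* D :+ s) ⊜ s :+ e :+ (f :+ :0 :+ c)) [])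

          inf-near : ℝ.Within η (inf fX) (inf h)
          inf-near = lin (proj₂ infH-isInf (inf fX ℝ.- η) each) (solveᴿ (inf fX ∷ inf h ∷ η ∷ []) (λ i g e → [] ,
              i :+ g ⊜ g :+ e :+ (i :- e)) []) ,
            ℝ.≤-trans (proj₂ infX-isInf (inf h) λ (a , m) → ℝ.≤-respʳ-≈
              (ℝ.trans (ℝ.+-congˡ (ℝ.trans (ℝ.*-congˡ (D-in a m)) (ℝ.zeroʳ _))) (ℝ.+-identityʳ _)) (proj₁ infH-isInf a))
              (proj₁ (Within-refl (<⇒≤ 0<η)))
            where
            each : ∀ a → inf fX ℝ.- η ℝ.≤ h a
            each a with em {P = size M a ℝ.≤ ζ}
            ... | no p = lin (ℝ.+-mono-≤ (ℝ.+-mono-≤ (-b≤f a) (KD-large a (<⇒≤ (≰⇒> p))))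
                    (ℝ.+-mono-≤ (ℝ.≤-trans (proj₁ infX-isInf x₀) (f≤b (proj₁ x₀))) (<⇒≤ 0<η)))
                    (solveᴿ (f a ∷ K ∷ D a ∷ b ∷ inf fX ∷ η ∷ []) (λ f K D b s e → [] ,
                      s :- e :+ (f :+ K :* D :+ (b :+ e)) ⊜ f :+ K :* D :+ (:- b :+ (b :+ b) :+ (s :+ :0))) [])
            ... | yes p with member M a p
            ...   | (c , m , d) = lin (ℝ.+-mono-≤ (ℝ.+-mono-≤ (proj₂ (near (alg M) a c y d)) (KD a)) (proj₁ infX-isInf (c , m)))
                      (solveᴿ (f a ∷ K ∷ D a ∷ f c ∷ inf fX ∷ η ∷ []) (λ f K D c s e → [] ,
                        s :- e :+ (f :+ e :+ K :* D :+ c) ⊜ f :+ K :* D :+ (c :+ :0 :+ s)) [])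

    quantify : ∀ {Δ} (ψ : Formula CStarLanguage (1 ∷ Δ)) η → ℝ.0# ℝ.< η →
      (∃ λ φ → ∀ M (y : Model.Env M Δ) → ℝ.Within η (sup λ ((a , _) : ∃ (In M)) → value ψ M (a ∷ y)) (value φ M y)) ×
      (∃ λ φ → ∀ M (y : Model.Env M Δ) → ℝ.Within η (inf λ ((a , _) : ∃ (In M)) → value ψ M (a ∷ y)) (value φ M y))
    quantify ψ η 0<η with formula-bounded ℓ ψ | formula-continuous₁ ℓ ψ η 0<η
    ... | b , 0≤b , bound | δ , 0<δ , near with stable δ 0<δ
    ...   | ζ , 0<ζ , member = (Q.supFormula , Q.sup-near) , (Q.infFormula , Q.inf-near)
      where module Q = Quantify ψ η 0<η b 0≤b bound δ near ζ 0<ζ member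

    inf-definable-predicate : ∀ {Δ} {P : Predicate (1 ∷ Δ)} → IsDefinable P →
                              IsDefinable λ M y → inf λ ((a , _) : ∃ (In M)) → P M (a ∷ y)
    inf-definable-predicate {Δ} {P} definable η 0<η = via (definable (half η) (half-pos 0<η))
      where
      Near-P : Formula CStarLanguage (1 ∷ Δ) → Set (lsuc ℓ)
      Near-P ψ = ∀ M x → ℝ.Within (half η) (P M x) (value ψ M x)
      module _ (ψ : Formula CStarLanguage (1 ∷ Δ)) (near : Near-P ψ) (M : 𝓜) (y : Model.Env M Δ) where
        b : ℝ
        b = proj₁ (formula-bounded ℓ ψ)
        fP fψ : ∃ (In M) → ℝ
        fP (a , _) = P M (a ∷ y)
        fψ (a , _) = value ψ M (a ∷ y)
        lowerψ : ∀ x → ℝ.- b ℝ.≤ fψ x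
        lowerψ (a , _) = proj₁ (proj₂ (proj₂ (formula-bounded ℓ ψ)) (alg M) (a ∷ y))
        lowerP : ∀ x → ℝ.- b ℝ.- half η ℝ.≤ fP x
        lowerP (a , m) = lin (ℝ.≤-trans (lowerψ (a , m)) (proj₂ (near M (a ∷ y))))
          (solveᴿ (b ∷ half η ∷ P M (a ∷ y) ∷ []) (λ b e p → [] , (:- b :- e) :+ (p :+ e) ⊜ p :+ :- b) [])
        both : ℝ.Within (half η) (inf fP) (inf fψ)
        both = inf-≤ fP fψ (point M) lowerP lowerψ (λ (a , _) → proj₁ (near M (a ∷ y))) ,
               inf-≤ fψ fP (point M) lowerψ lowerP (λ (a , _) → proj₂ (near M (a ∷ y)))
      via : ∃ Near-P → ∃ λ φ → ∀ M y → ℝ.Within η (inf λ ((a , _) : ∃ (In M)) → P M (a ∷ y)) (value φ M y)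
      via (ψ , near) = via′ (proj₂ (quantify ψ (half η) (half-pos 0<η)))
        where
        via′ : (∃ λ φ → ∀ M y → ℝ.Within (half η) (inf λ ((a , _) : ∃ (In M)) → value ψ M (a ∷ y)) (value φ M y)) →
               ∃ λ φ → ∀ M y → ℝ.Within η (inf λ ((a , _) : ∃ (In M)) → P M (a ∷ y)) (value φ M y)
        via′ (φ , near′) = φ , λ M y → Within-half (both ψ near M y) (near′ M y)

    definableSet : DefinableSet 𝓜 baseExpansion (1 ∷ [])
    definableSet = record
      { Member = λ M x → In M (All.head x)
      ; nonempty = λ M → (proj₁ (point M) ∷ []) , proj₂ (point M)
      ; closed = λ { M (x ∷ []) h → zero-size M x (nonneg-ε (size-nonneg M x) λ η p → limit M x h η p) }
      ; sup-definable = λ ψ η p → proj₁ (proj₁ (quantify ψ η p)) , λ M y → Within-resp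
          (antisym-sup ψ M y) ℝ.refl (proj₂ (proj₁ (quantify ψ η p)) M y)
      ; inf-definable = λ ψ η p → proj₁ (proj₂ (quantify ψ η p)) , λ M y → Within-resp
          (antisym-inf ψ M y) ℝ.refl (proj₂ (proj₂ (quantify ψ η p)) M y)
      }
      where
      Member : ∀ M → Model.Env M (1 ∷ []) → Set ℓ
      Member M x = In M (All.head x)

      limit : ∀ M x → (∀ η → ℝ.0# ℝ.< η → ∃ λ z → Member M z × Model.distEnv M (x ∷ []) z ℝ.≤ η) →
              ∀ η → ℝ.0# ℝ.< η → size M x ℝ.≤ η
      limit M x h η p with formula-continuous₁ ℓ (defect []) η p
      ... | δ , 0<δ , near with h δ 0<δ
      ...   | (z ∷ []) , m , d = ℝ.≤-trans (≤-resp (ℝ.reflexive (defect-value M x [])) (ℝ.+-congʳ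
                (ℝ.trans (ℝ.reflexive (defect-value M z [])) (size-zero M z m)))
                (proj₁ (near (alg M) x z [] (ℝ.≤-trans (max-≥ˡ _ _) d)))) (ℝ.≤-reflexive (ℝ.+-identityˡ η))

      module _ {Δ} (ψ : Formula CStarLanguage (1 ∷ Δ)) (M : 𝓜) (y : Model.Env M Δ) where
        fX : ∃ (In M) → ℝ
        fX (a , _) = value ψ M (a ∷ y)
        fY : ∃ (Member M) → ℝ
        fY (x , _) = value ψ M (Allₚ.++⁺ x y)
        x₀ : ∃ (In M)
        x₀ = point M
        y₀ : ∃ (Member M)
        y₀ = (proj₁ x₀ ∷ []) , proj₂ x₀
        b : ℝ
        b = proj₁ (formula-bounded ℓ ψ)
        bound : ∀ xs → Bound b (value ψ M xs)
        bound = proj₂ (proj₂ (formula-bounded ℓ ψ)) (alg M)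

        antisym-sup : sup fX ℝ.≈ sup fY
        antisym-sup = ℝ.antisym
          (proj₂ (sup-isSup fX x₀ b λ x → proj₂ (bound _)) _ λ (a , m) →
            proj₁ (sup-isSup fY y₀ b λ x → proj₂ (bound _)) ((a ∷ []) , m))
          (proj₂ (sup-isSup fY y₀ b λ x → proj₂ (bound _)) _ λ { ((a ∷ []) , m) →
            proj₁ (sup-isSup fX x₀ b λ x → proj₂ (bound _)) (a , m) })

        antisym-inf : inf fX ℝ.≈ inf fY
        antisym-inf = ℝ.antisym
          (proj₂ (inf-isInf fY y₀ (ℝ.- b) λ x → proj₁ (bound _)) _ λ { ((a ∷ []) , m) →
            proj₁ (inf-isInf fX x₀ (ℝ.- b) λ x → proj₁ (bound _)) (a , m) })
          (proj₂ (inf-isInf fX x₀ (ℝ.- b) λ x → proj₁ (bound _)) _ λ (a , m) →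
            proj₁ (inf-isInf fY y₀ (ℝ.- b) λ x → proj₁ (bound _)) ((a ∷ []) , m))

  definable-formula : ∀ {Δ} (φ : Formula CStarLanguage Δ) → IsDefinable (value φ)
  definable-formula φ η p = φ , λ M y → Within-refl (<⇒≤ p)

  -- An approximation φ within ¼ is at most ¼ where the predicate is 0 and at least ¾ where it is at
  -- least 1; clamping 2 φ - ½ then gives exactly 0 or 1. The gap is required only at the point
  -- considered, because terms are unitary at some environments only.
  exact : ∀ {Δ p} {P : Predicate Δ} → IsDefinable P → (T : ∀ M → Model.Env M Δ → Set p) →
          ∃ λ φ → ∀ M y → (T M y → P M y ℝ.≈ ℝ.0#) × (¬ T M y → ℝ.1# ℝ.≤ P M y) → Truth (T M y) (value φ M y)
  exact {P = P} definable T with definable (half ½) (half-pos 0<½)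
  ... | φ , near = clamp′ (const′ (ℝ.- ½) ⊕′ 2# ⊙′ φ) , λ M y (t , f) →
        (λ x → clamp-0 (lin (ℝ.+-mono-≤ (v≤ M y (t x)) (v≤ M y (t x))) (solve½ (value φ M y)))) ,
        (λ x → clamp-1 (lin (ℝ.+-mono-≤ (≤v M y (f x)) (≤v M y (f x))) (solve½′ (value φ M y))))
    where
    q : ℝ
    q = half ½
    v≤ : ∀ M y → P M y ℝ.≈ ℝ.0# → value φ M y ℝ.≤ q
    v≤ M y p = ℝ.≤-trans (proj₂ (near M y)) (ℝ.≤-reflexive (ℝ.trans (ℝ.+-congʳ p) (ℝ.+-identityˡ _)))
    ≤v : ∀ M y → ℝ.1# ℝ.≤ P M y → ℝ.1# ℝ.≤ value φ M y ℝ.+ q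
    ≤v M y p = ℝ.≤-trans p (proj₁ (near M y))
    solve½ : ∀ v → ℝ.- ½ ℝ.+ 2# ℝ.* v ℝ.+ (q ℝ.+ q) ℝ.≈ ℝ.0# ℝ.+ (v ℝ.+ v)
    solve½ v = ℝ.trans (ℝ.+-congˡ (half+half ½)) (solveᴿ (½ ∷ v ∷ []) (λ h v → [] ,
      :- h :+ (:1 :+ :1) :* v :+ h ⊜ :0 :+ (v :+ v)) [])
    solve½′ : ∀ v → ℝ.1# ℝ.+ (v ℝ.+ q ℝ.+ (v ℝ.+ q)) ℝ.≈ ℝ.- ½ ℝ.+ 2# ℝ.* v ℝ.+ (ℝ.1# ℝ.+ ℝ.1#)
    solve½′ v = ℝ.trans (solveᴿ (q ∷ v ∷ []) (λ q v → [] , :1 :+ (v :+ q :+ (v :+ q)) ⊜ :1 :+ (v :+ v :+ (q :+ q))) [])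
      (ℝ.trans (ℝ.+-congˡ (ℝ.+-congˡ (half+half ½))) (ℝ.trans (solveᴿ (½ ∷ v ∷ []) (λ h v → [] ,
        :1 :+ (v :+ v :+ h) ⊜ :- h :+ (:1 :+ :1) :* v :+ (:1 :+ (h :+ h))) []) (ℝ.+-congˡ (ℝ.+-congˡ ½+½≈1))))

  -- An infimum of values 0 and 1 is itself 0 or 1, so `exact` turns the approximable infimum into a
  -- formula.
  exists-formula : ∀ (Z : StableSet) {Δ p} (φ : Formula CStarLanguage (1 ∷ Δ)) (T : ∀ M → Model.Env M (1 ∷ Δ) → Set p) →
    ∃ λ φ′ → ∀ M y → (∀ a → StableSet.In Z M a → Truth (T M (a ∷ y)) (value φ M (a ∷ y))) →
      Truth (∃ λ a → StableSet.In Z M a × T M (a ∷ y)) (value φ′ M y)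
  exists-formula Z φ T = via (exact (inf-definable-predicate Z (definable-formula φ)) λ M y → ∃ λ a → In M a × T M (a ∷ y))
    where
    open StableSet Z
    via : (∃ λ φ′ → ∀ M y → _ → Truth (∃ λ a → In M a × T M (a ∷ y)) (value φ′ M y)) → _
    via (φ′ , h) = φ′ , λ M y k → h M y
      ( (λ (a , m , t) → ℝ.antisym (ℝ.≤-respʳ-≈ (proj₁ (k a m) t) (proj₁ (isInf M y k) (a , m)))
          (proj₂ (isInf M y k) ℝ.0# λ (b , n) → proj₁ (truth-bounds (k b n))))
      , (λ ¬e → proj₂ (isInf M y k) ℝ.1# λ (b , n) → ℝ.≤-reflexive (ℝ.sym (proj₂ (k b n) λ t → ¬e (b , n , t)))) )
      where
      isInf : ∀ M y → (∀ a → In M a → Truth (T M (a ∷ y)) (value φ M (a ∷ y))) →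
              IsInf (λ ((a , _) : ∃ (In M)) → value φ M (a ∷ y)) (inf λ ((a , _) : ∃ (In M)) → value φ M (a ∷ y))
      isInf M y k = inf-isInf _ (point M) ℝ.0# λ (b , n) → proj₁ (truth-bounds (k b n))

-- Correcting approximate isometries, unitaries and frames.

module UnitBall (em : ∀ {ℓ} → ExcludedMiddle ℓ) (R : CompleteOrderedField)
                {ℓ} (A : Setting.CStarAlgebra em R ℓ) where
  open Setting em R
  open Reals em R
  open CStarAlgebra A
  open CStarBasics em R A
  open NewtonIteration em R A
  open Paths em R A using (unitary-norm)
  open Frames em R A using (Frame)

  unit : ∀ a → ‖ a ‖ ℝ.≤ ℝ.1# → Ball A 1
  unit a p = a , ℝ.≤-respʳ-≈ (ℝ.sym ℝ.fromℕ-1) p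

  unit-norm : ∀ (a : Ball A 1) → ‖ proj₁ a ‖ ℝ.≤ ℝ.1#
  unit-norm (a , p) = ℝ.≤-respʳ-≈ ℝ.fromℕ-1 p

  private
    move : ∀ {a g ζ η} → ‖ a ‖ ℝ.≤ ℝ.1# → ‖ g - 1# ‖ ℝ.≤ ζ ℝ.+ ζ → ζ ℝ.≤ half η → ‖ a - a * g ‖ ℝ.≤ η
    move {a} {g} {ζ} {η} p q r = ℝ.≤-trans ((p ⟨1*⟩ ‖‖-comm q) ⟨≈⟩ solve (a ∷ g ∷ []) (λ a g → [] ,
      a :* (:1 :- g) ⊜ a :- a :* g) []) (ℝ.≤-respʳ-≈ (half+half η) (ℝ.+-mono-≤ r r))

    2ζ≤1 : ∀ {ζ} → ζ ℝ.≤ ½ → ζ ℝ.+ ζ ℝ.≤ ℝ.1#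
    2ζ≤1 p = ℝ.≤-respʳ-≈ ½+½≈1 (ℝ.+-mono-≤ p p)

  near-isometry : ∀ {ζ η} (a : Ball A 1) → ζ ℝ.≤ half η → ζ ℝ.≤ ½ → ‖ proj₁ a ⋆ * proj₁ a - 1# ‖ ℝ.≤ ζ →
                  ∃ λ (b : Ball A 1) → IsIsometry (proj₁ b) × ‖ proj₁ a - proj₁ b ‖ ℝ.≤ η
  near-isometry a p q r = via (polar-isometry (proj₁ a) (‖‖-comm r) (2ζ≤1 q))
    where
    via : (∃ λ g → IsIsometry (proj₁ a * g) × ‖ g - 1# ‖ ℝ.≤ _) → _
    via (g , h , k) = unit (proj₁ a * g) (isometry-norm h) , h , move (unit-norm a) k p

  near-unitary : ∀ {ζ η} (a : Ball A 1) → ζ ℝ.≤ half η → ζ ℝ.≤ ½ → ‖ proj₁ a ⋆ * proj₁ a - 1# ‖ ℝ.≤ ζ →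
                 ‖ proj₁ a * proj₁ a ⋆ - 1# ‖ ℝ.≤ ζ →
                 ∃ λ (b : Ball A 1) → IsUnitaryElement (proj₁ b) × ‖ proj₁ a - proj₁ b ‖ ℝ.≤ η
  near-unitary a p q r r′ = via (polar-unitary (proj₁ a) (‖‖-comm r) (‖‖-comm r′) (2ζ≤1 q))
    where
    via : (∃ λ g → IsUnitaryElement (proj₁ a * g) × ‖ g - 1# ‖ ℝ.≤ _) → _
    via (g , h , k) = unit (proj₁ a * g) (unitary-norm h) , h , move (unit-norm a) k p

  -- First s is corrected, then the part of t orthogonal to its range.
  near-frame : ∀ {s t} → ‖ t ‖ ℝ.≤ ℝ.1# → ‖ s ⋆ * s - 1# ‖ ℝ.≤ half ½ → ‖ t ⋆ * t - 1# ‖ ℝ.≤ half ½ →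
               ‖ s ⋆ * t ‖ ℝ.≤ half ½ → Frame
  near-frame {s} {t} ‖t‖ p q r = via (polar-isometry s (‖‖-comm p) ¼+¼≤1)
    where
    ¼+¼≤1 : half ½ ℝ.+ half ½ ℝ.≤ ℝ.1#
    ¼+¼≤1 = ℝ.≤-respˡ-≈ (ℝ.sym (half+half ½)) ½≤1
    via : (∃ λ g → IsIsometry (s * g) × ‖ g - 1# ‖ ℝ.≤ half ½ ℝ.+ half ½) → Frame
    via (g , isom , near) = via′ (polar-isometry t₁ bound ½-small)
      where
      s′ t₁ : Carrier
      s′ = s * g
      t₁ = t - s′ * (s′ ⋆ * t)
      ‖g‖≤2 : ‖ g ‖ ℝ.≤ 2#
      ‖g‖≤2 = ‖‖-near (ℝ.≤-trans near ¼+¼≤1) ‖1‖≤1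
      small : ‖ s′ ⋆ * t ‖ ℝ.≤ ½
      small = ℝ.≤-respʳ-≈ (ℝ.trans (solveᴿ (½ ∷ []) (λ h → [] , (:1 :+ :1) :* (h :* h) ⊜ h :* h :+ h :* h) []) (half+half ½))
        ((⟨⋆⟩ ‖g‖≤2 ⟨*⟩ r) ⟨≈⟩ solve (s ∷ g ∷ t ∷ []) (λ s g t → [] , g :⋆ :* (s :⋆ :* t) ⊜ (s :* g) :⋆ :* t) [])
      -- Because s′ is an isometry, 1 - t₁* t₁ = (1 - t* t) + (s′* t)* (s′* t), of norm at most ¼ +
      -- ½ · ½.
      bound : ‖ 1# - t₁ ⋆ * t₁ ‖ ℝ.≤ ½
      bound = ℝ.≤-respʳ-≈ (half+half ½) ((‖‖-comm q ⟨+⟩ (⟨⋆⟩ small ⟨*⟩ small)) ⟨≈⟩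
        solve (s′ ∷ t ∷ []) (λ s t → (s :⋆ :* s ⟶ :1) ∷ [] , :1 :- t :⋆ :* t :+ (s :⋆ :* t) :⋆ :* (s :⋆ :* t) ⊜
          :1 :- (t :- s :* (s :⋆ :* t)) :⋆ :* (t :- s :* (s :⋆ :* t))) (isom ∷ []))
      via′ : (∃ λ h → IsIsometry (t₁ * h) × _) → Frame
      via′ (h , isom′ , _) = record { s = s′ ; t = t₁ * h ; s⋆s = isom ; t⋆t = isom′ ; s⋆t =
        solve (s′ ∷ t ∷ h ∷ []) (λ s t h → (s :⋆ :* s ⟶ :1) ∷ [] , s :⋆ :* ((t :- s :* (s :⋆ :* t)) :* h) ⊜ :0) (isom ∷ []) }

-- Terms over the unit ball and weakening.

module Terms (em : ∀ {ℓ} → ExcludedMiddle ℓ) (R : CompleteOrderedField) where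
  open Setting em R

  infixl 7 _∙ᵗ_
  infix  8 _⋆ᵗ

  _∙ᵗ_ : ∀ {Γ} → Term CStarLanguage Γ 1 → Term CStarLanguage Γ 1 → Term CStarLanguage Γ 1
  x ∙ᵗ y = app (times 1 1) (x ∷ y ∷ [])

  _⋆ᵗ : ∀ {Γ} → Term CStarLanguage Γ 1 → Term CStarLanguage Γ 1
  x ⋆ᵗ = app (star 1) (x ∷ [])

  1ᵗ 0ᵗ : ∀ {Γ} → Term CStarLanguage Γ 1
  1ᵗ = app one′ []
  0ᵗ = app (incl ℕ.z≤n) (app zero′ [] ∷ [])

  sum₃ : ∀ {Γ} → (x y z : Term CStarLanguage Γ 1) → Term CStarLanguage Γ 3
  sum₃ x y z = app (plus 2 1) (app (plus 1 1) (x ∷ y ∷ []) ∷ z ∷ [])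

  x₀ᵗ : ∀ {Γ} → Term CStarLanguage (1 ∷ Γ) 1
  x₀ᵗ = var (here ≡.refl)

  module _ {L : Language} where
    open Language L

    weaken  : ∀ {Γ t s} → Term L Γ s → Term L (t ∷ Γ) s
    weakens : ∀ {Γ t Δ} → All (Term L Γ) Δ → All (Term L (t ∷ Γ)) Δ
    weaken (var i)    = var (there i)
    weaken (app f us) = app f (weakens us)
    weakens []       = []
    weakens (u ∷ us) = weaken u ∷ weakens us

    module _ {ℓ} (𝓐 : Structure L ℓ) where
      open Structure 𝓐

      weaken-value  : ∀ {Γ t s} (u : Term L Γ s) {x : Dom t} {ρ} →
                      evalTerm 𝓐 (weaken {t = t} u) (x ∷ ρ) ≡ evalTerm 𝓐 u ρ
      weakens-value : ∀ {Γ t Δ} (us : All (Term L Γ) Δ) {x : Dom t} {ρ} →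
                      evalTerms 𝓐 (weakens {t = t} us) (x ∷ ρ) ≡ evalTerms 𝓐 us ρ
      weaken-value          (var i)    = ≡.refl
      weaken-value  {t = t} (app f us) = ≡.cong (fun f) (weakens-value {t = t} us)
      weakens-value         []         = ≡.refl
      weakens-value {t = t} (u ∷ us)   = ≡.cong₂ _∷_ (weaken-value {t = t} u) (weakens-value {t = t} us)

-- Frames in all models of the theory.

module FrameTransfer (em : ∀ {ℓ} → ExcludedMiddle ℓ) (R : CompleteOrderedField) where
  open Setting em R
  open Reals em R
  open Formulas em R
  open Terms em R

  private
    matrix : Formula CStarLanguage (1 ∷ 1 ∷ [])
    matrix = dist′ (s ⋆ᵗ ∙ᵗ s) 1ᵗ ⊔′ (dist′ (t ⋆ᵗ ∙ᵗ t) 1ᵗ ⊔′ dist′ (s ⋆ᵗ ∙ᵗ t) 0ᵗ)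
      where
      s t : Term CStarLanguage (1 ∷ 1 ∷ []) 1
      s = var (there (here ≡.refl))
      t = x₀ᵗ

    sentence : Formula CStarLanguage []
    sentence = inf′ 1 (inf′ 1 matrix)

    module Semantics {ℓ} (A : CStarAlgebra ℓ) where
      open CStarAlgebra A
      open CStarBasics em R A
      open UnitBall em R A
      open Frames em R A using (Frame)

      m : Ball A 1 → Ball A 1 → ℝ
      m s t = eval (cstarStructure A) matrix (t ∷ s ∷ [])

      m≥0 : ∀ s t → ℝ.0# ℝ.≤ m s t
      m≥0 s t = ℝ.≤-trans (‖‖-nonneg _) (max-≥ˡ _ _)

      i : Ball A 1 → ℝ
      i s = inf (m s)

      one : Ball A 1
      one = unit 1# ‖1‖≤1

      m-isInf : ∀ s → IsInf (m s) (i s)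
      m-isInf s = inf-isInf (m s) one ℝ.0# (m≥0 s)

      i≥0 : ∀ s → ℝ.0# ℝ.≤ i s
      i≥0 s = proj₂ (m-isInf s) ℝ.0# (m≥0 s)

      i-isInf : IsInf i (inf i)
      i-isInf = inf-isInf i one ℝ.0# i≥0

      value : Frame → inf i ℝ.≈ ℝ.0#
      value F = ℝ.antisym (ℝ.≤-trans (proj₁ i-isInf s′) (ℝ.≤-trans (proj₁ (m-isInf s′) t′)
          (max-≤ (≈⇒‖-‖≤ s⋆s ℝ.≤-refl) (max-≤ (≈⇒‖-‖≤ t⋆t ℝ.≤-refl) (≈⇒‖-‖≤ s⋆t ℝ.≤-refl)))))
        (proj₂ i-isInf ℝ.0# i≥0)
        where
        open Frames.Frame F
        s′ t′ : Ball A 1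
        s′ = unit s (isometry-norm s⋆s)
        t′ = unit t (isometry-norm t⋆t)

      realise : inf i ℝ.≈ ℝ.0# → Frame
      -- The infima are approached and perhaps not attained, so the outer one is realised up to
      -- `half q` and the inner one up to the larger `q`.
      realise p = via (inf-attained i one i≥0 {half q} (≤-<-trans (ℝ.≤-reflexive p) (half-pos 0<q)))
        where
        q : ℝ
        q = half ½
        0<q : ℝ.0# ℝ.< q
        0<q = half-pos 0<½
        half-q<q : half q ℝ.< q
        half-q<q = half≤ (<⇒≤ 0<q) , λ e → pos⇒≉0 (half-pos 0<q) (ℝ.trans
          (solveᴿ (half q ∷ []) (λ h → [] , h ⊜ (h :+ h) :- h) []) (ℝ.trans (ℝ.+-congʳ (half+half q))
            (ℝ.trans (ℝ.+-congʳ (ℝ.sym e)) (ℝ.-‿inverseʳ _))))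
        via : (∃ λ s → i s ℝ.≤ half q) → Frame
        via (s , h) = via′ (inf-attained (m s) one (m≥0 s) {q} (≤-<-trans h half-q<q))
          where
          via′ : (∃ λ t → m s t ℝ.≤ q) → Frame
          via′ (t , k) = near-frame (unit-norm t) (ℝ.≤-trans (max-≥ˡ _ _) k)
            (ℝ.≤-trans (max-≥ˡ _ _) (ℝ.≤-trans (max-≥ʳ _ _) k))
            (ℝ.≤-trans (max-≥ʳ _ _) (ℝ.≤-trans (max-≥ʳ _ _) k) ⟨≈⟩
              solve (proj₁ s ⋆ * proj₁ t ∷ []) (λ x → [] , x :- :0 ⊜ x) [])

  abstract
    -- The infimum of the defect of a pair (s, t) is 0 in A, hence in M by elementary equivalence. A
    -- pair with small defect in M is then corrected to a frame.
    frame-transfer : ∀ {ℓ} (A M : CStarAlgebra ℓ) → (∀ (φ : Formula CStarLanguage []) →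
      eval (cstarStructure M) φ [] ℝ.≈ eval (cstarStructure A) φ []) → Frames.Frame em R A → Frames.Frame em R M
    frame-transfer A M h F = Semantics.realise M (ℝ.trans (h sentence) (Semantics.value A F))

-- Stable homotopy as a formula with values 0 and 1.

module EquivalenceFormula (em : ∀ {ℓ} → ExcludedMiddle ℓ) (R : CompleteOrderedField)
                   {ℓ} (𝓜 : Set (lsuc ℓ)) (alg : 𝓜 → Setting.CStarAlgebra em R ℓ)
                   (frame : ∀ M → Frames.Frame em R (alg M)) where
  open Setting em R
  open Reals em R
  open Formulas em R
  open Terms em R
  open Definability em R 𝓜 alg public
  open Expansion baseExpansion using (Predicate; value; IsDefinable; module Model)

  module Alg (M : 𝓜) where
    open CStarAlgebra (alg M) public
    open CStarBasics em R (alg M) public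
    open UnitBall em R (alg M) public
    open Stable em R (alg M) (frame M) public
    open Paths em R (alg M) public

    left-defect right-defect : Ball (alg M) 1 → ℝ
    left-defect a  = ‖ proj₁ a ⋆ * proj₁ a - 1# ‖
    right-defect a = ‖ proj₁ a * proj₁ a ⋆ - 1# ‖

  private
    two : ∀ {η} → ℝ.0# ℝ.< η → ∃ λ ζ → ℝ.0# ℝ.< ζ × ζ ℝ.≤ half η × ζ ℝ.≤ ½
    two p = common (half-pos p) 0<½

  isometries : StableSet
  isometries = record
    { In = λ M a → Alg.IsIsometry M (proj₁ a)
    ; size = λ M a → Alg.left-defect M a
    ; defect = λ Δ → dist′ (x₀ᵗ ⋆ᵗ ∙ᵗ x₀ᵗ) 1ᵗ
    ; defect-value = λ M a y → ≡.refl
    ; size-nonneg = λ M a → Alg.‖‖-nonneg M _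
    ; size-zero = λ M a p → ℝ.antisym (Alg.≈⇒‖-‖≤ M p ℝ.≤-refl) (Alg.‖‖-nonneg M _)
    ; zero-size = λ M a p → Alg.≈-small M λ η q → ℝ.≤-trans (ℝ.≤-reflexive p) (<⇒≤ q)
    ; stable = λ η p → proj₁ (two p) , proj₁ (proj₂ (two p)) , λ M a → Alg.near-isometry M a
        (proj₁ (proj₂ (proj₂ (two p)))) (proj₂ (proj₂ (proj₂ (two p))))
    ; point = λ M → Alg.unit M (Alg.1# M) (Alg.‖1‖≤1 M) , proj₁ (Alg.unitary-1 M)
    }

  unitaries : StableSet
  unitaries = record
    { In = λ M a → Alg.IsUnitaryElement M (proj₁ a)
    ; size = λ M a → Alg.left-defect M a ℝ.⊔ᵣ Alg.right-defect M a
    ; defect = λ Δ → dist′ (x₀ᵗ ⋆ᵗ ∙ᵗ x₀ᵗ) 1ᵗ ⊔′ dist′ (x₀ᵗ ∙ᵗ x₀ᵗ ⋆ᵗ) 1ᵗ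
    ; defect-value = λ M a y → ≡.refl
    ; size-nonneg = λ M a → ℝ.≤-trans (Alg.‖‖-nonneg M _) (max-≥ˡ _ _)
    ; size-zero = λ M a (p , q) → ℝ.antisym (max-≤ (Alg.≈⇒‖-‖≤ M p ℝ.≤-refl) (Alg.≈⇒‖-‖≤ M q ℝ.≤-refl))
        (ℝ.≤-trans (Alg.‖‖-nonneg M _) (max-≥ˡ _ _))
    ; zero-size = λ M a p →
        Alg.≈-small M (λ η q → ℝ.≤-trans (max-≥ˡ _ _) (ℝ.≤-trans (ℝ.≤-reflexive p) (<⇒≤ q))) ,
        Alg.≈-small M (λ η q → ℝ.≤-trans (max-≥ʳ _ _) (ℝ.≤-trans (ℝ.≤-reflexive p) (<⇒≤ q)))
    ; stable = λ η p → proj₁ (two p) , proj₁ (proj₂ (two p)) , λ M a h → Alg.near-unitary M a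
        (proj₁ (proj₂ (proj₂ (two p)))) (proj₂ (proj₂ (proj₂ (two p))))
        (ℝ.≤-trans (max-≥ˡ _ _) h) (ℝ.≤-trans (max-≥ʳ _ _) h)
    ; point = λ M → Alg.unit M (Alg.1# M) (Alg.‖1‖≤1 M) , Alg.unitary-1 M
    }

  module I = StableSet isometries
  module U = StableSet unitaries

  private
    module Certificate {Γ} (a₀ b₀ : Term CStarLanguage Γ 1) where

      -- The certificate inequality, multiplied out so that no subtraction occurs.
      certificate : Formula CStarLanguage (1 ∷ 1 ∷ 1 ∷ Γ)
      certificate = (2# ℝ.* 2#) ⊙′ dist′
        (sum₃ (v ∙ᵗ d) (v ∙ᵗ p ∙ᵗ a ∙ᵗ p ⋆ᵗ ∙ᵗ d) (p ∙ᵗ p ⋆ᵗ ∙ᵗ d ∙ᵗ v))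
        (sum₃ (d ∙ᵗ v) (p ∙ᵗ b ∙ᵗ p ⋆ᵗ ∙ᵗ d ∙ᵗ v) (v ∙ᵗ p ∙ᵗ p ⋆ᵗ ∙ᵗ d))
        where
        d v p a b : Term CStarLanguage (1 ∷ 1 ∷ 1 ∷ Γ) 1
        d = var (here ≡.refl)
        v = var (there (here ≡.refl))
        p = var (there (there (here ≡.refl)))
        a = weaken (weaken (weaken a₀))
        b = weaken (weaken (weaken b₀))

      P₀ : Predicate (1 ∷ 1 ∷ 1 ∷ Γ)
      P₀ = value certificate

      P₁ : Predicate (1 ∷ 1 ∷ Γ)
      P₁ M y = inf λ ((d , _) : ∃ (U.In M)) → P₀ M (d ∷ y)

      P₂ : Predicate (1 ∷ Γ)
      P₂ M y = inf λ ((v , _) : ∃ (U.In M)) → P₁ M (v ∷ y)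

      P₃ : Predicate Γ
      P₃ M y = inf λ ((p , _) : ∃ (I.In M)) → P₂ M (p ∷ y)

      P₃-definable : IsDefinable P₃
      P₃-definable = inf-definable-predicate isometries {P = P₂} (inf-definable-predicate unitaries {P = P₁}
        (inf-definable-predicate unitaries {P = P₀} (definable-formula certificate)))

      module Value (M : 𝓜) (E : Model.Env M Γ) where
        open Alg M

        a b : Carrier
        a = proj₁ (evalTerm (cstarStructure (alg M)) a₀ E)
        b = proj₁ (evalTerm (cstarStructure (alg M)) b₀ E)

        error : ∀ d v p → Carrier
        error d v p = v * α p a * d - α p b * d * v

        weaken³-value : ∀ (u : Term CStarLanguage Γ 1) (d v p : Ball (alg M) 1) →
          evalTerm (cstarStructure (alg M)) (weaken {t = 1} (weaken {t = 1} (weaken {t = 1} u))) (d ∷ v ∷ p ∷ E) ≡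
          evalTerm (cstarStructure (alg M)) u E
        weaken³-value u d v p = ≡.trans (weaken-value (cstarStructure (alg M)) {t = 1} (weaken (weaken u)))
          (≡.trans (weaken-value (cstarStructure (alg M)) {t = 1} (weaken u)) (weaken-value (cstarStructure (alg M)) {t = 1} u))

        P₀-value : ∀ d v p → P₀ M (d ∷ v ∷ p ∷ E) ℝ.≈ 2# ℝ.* 2# ℝ.* ‖ error (proj₁ d) (proj₁ v) (proj₁ p) ‖
        P₀-value d′ v′ p′ = ℝ.*-congˡ (‖‖-cong (trans (solve (d ∷ v ∷ p ∷ a′ ∷ b′ ∷ []) (λ d v p a b → [] ,
          v :* d :+ v :* p :* a :* p :⋆ :* d :+ p :* p :⋆ :* d :* v :-
            (d :* v :+ p :* b :* p :⋆ :* d :* v :+ v :* p :* p :⋆ :* d) ⊜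
          v :* (:1 :+ p :* (a :- :1) :* p :⋆) :* d :- (:1 :+ p :* (b :- :1) :* p :⋆) :* d :* v) [])
          (+-cong (*-congʳ (*-congˡ (α-cong (reflexive (≡.cong proj₁ (weaken³-value a₀ d′ v′ p′))))))
            (-‿cong (*-congʳ (*-congʳ (α-cong (reflexive (≡.cong proj₁ (weaken³-value b₀ d′ v′ p′))))))))))
          where
          d v p a′ b′ : Carrier
          d = proj₁ d′
          v = proj₁ v′
          p = proj₁ p′
          a′ = proj₁ (evalTerm (cstarStructure (alg M)) (weaken (weaken (weaken a₀))) (d′ ∷ v′ ∷ p′ ∷ E))
          b′ = proj₁ (evalTerm (cstarStructure (alg M)) (weaken (weaken (weaken b₀))) (d′ ∷ v′ ∷ p′ ∷ E))

        0≤4 : ℝ.0# ℝ.≤ 2# ℝ.* 2#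
        0≤4 = ℝ.*-nonneg (<⇒≤ 0<2) (<⇒≤ 0<2)

        P₀≥0 : ∀ y → ℝ.0# ℝ.≤ P₀ M y
        P₀≥0 y = ℝ.*-nonneg 0≤4 (‖‖-nonneg _)

        isInf₁ : ∀ y → IsInf (λ ((d , _) : ∃ (U.In M)) → P₀ M (d ∷ y)) (P₁ M y)
        isInf₁ y = inf-isInf _ (U.point M) ℝ.0# λ (d , _) → P₀≥0 (d ∷ y)
        P₁≥0 : ∀ y → ℝ.0# ℝ.≤ P₁ M y
        P₁≥0 y = proj₂ (isInf₁ y) ℝ.0# λ (d , _) → P₀≥0 (d ∷ y)
        isInf₂ : ∀ y → IsInf (λ ((v , _) : ∃ (U.In M)) → P₁ M (v ∷ y)) (P₂ M y)
        isInf₂ y = inf-isInf _ (U.point M) ℝ.0# λ (v , _) → P₁≥0 (v ∷ y)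
        P₂≥0 : ∀ y → ℝ.0# ℝ.≤ P₂ M y
        P₂≥0 y = proj₂ (isInf₂ y) ℝ.0# λ (v , _) → P₁≥0 (v ∷ y)
        isInf₃ : ∀ y → IsInf (λ ((p , _) : ∃ (I.In M)) → P₂ M (p ∷ y)) (P₃ M y)
        isInf₃ y = inf-isInf _ (I.point M) ℝ.0# λ (p , _) → P₂≥0 (p ∷ y)
        P₃≥0 : ℝ.0# ℝ.≤ P₃ M E
        P₃≥0 = proj₂ (isInf₃ E) ℝ.0# λ (p , _) → P₂≥0 (p ∷ E)

        P₃≤P₀ : ∀ d v p → U.In M d → U.In M v → I.In M p → P₃ M E ℝ.≤ P₀ M (d ∷ v ∷ p ∷ E)
        P₃≤P₀ d v p ud uv ip = ℝ.≤-trans (proj₁ (isInf₃ E) (p , ip)) (ℝ.≤-trans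
          (proj₁ (isInf₂ (p ∷ E)) (v , uv)) (proj₁ (isInf₁ (v ∷ p ∷ E)) (d , ud)))

        equivalent : a ∼ b → P₃ M E ℝ.≈ ℝ.0#
        equivalent a∼b = nonneg-ε P₃≥0 λ η q → via η (shrink (2# ℝ.* 2#) 0≤4 η q)
          where
          via : ∀ η → (∃ λ δ → ℝ.0# ℝ.< δ × 2# ℝ.* 2# ℝ.* δ ℝ.≤ η) → P₃ M E ℝ.≤ η
          via η (δ , 0<δ , l) = via′ (∼⇒certified a∼b δ 0<δ)
            where
            via′ : Certified δ (a) (b) → P₃ M E ℝ.≤ η
            via′ (p , v , d , ip , uv , ud , bound) = ℝ.≤-trans (P₃≤P₀ d′ v′ p′ ud uv ip)
              (ℝ.≤-trans (ℝ.≤-reflexive (P₀-value d′ v′ p′)) (ℝ.≤-trans (ℝ.*-monoʳ-≤ 0≤4 bound) l))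
              where
              d′ v′ p′ : Ball (alg M) 1
              d′ = unit d (unitary-norm ud)
              v′ = unit v (unitary-norm uv)
              p′ = unit p (isometry-norm ip)

        module _ (ua : IsUnitaryElement (a)) (ub : IsUnitaryElement (b)) where

          -- An error of at most ¼ would certify equivalence. The factor 4 in the certificate moves
          -- this threshold to 1, the gap that `exact` asks for.
          inequivalent : ¬ a ∼ b → ℝ.1# ℝ.≤ P₃ M E
          inequivalent ¬a∼b = proj₂ (isInf₃ E) _ λ (p , ip) → proj₂ (isInf₂ (p ∷ E)) _ λ (v , uv) →
            proj₂ (isInf₁ (v ∷ p ∷ E)) _ λ (d , ud) → each d v p ud uv ip
            where
            4¼ : 2# ℝ.* 2# ℝ.* ¼ ℝ.≈ ℝ.1#
            4¼ = ℝ.trans (solveᴿ (½ ∷ []) (λ h → [] ,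
              (:1 :+ :1) :* (:1 :+ :1) :* (h :* (h :* :1)) ⊜ (h :+ h) :* (h :+ h)) [])
              (ℝ.trans (ℝ.*-cong ½+½≈1 ½+½≈1) (ℝ.*-identityˡ _))
            each : ∀ d v p → U.In M d → U.In M v → I.In M p → ℝ.1# ℝ.≤ P₀ M (d ∷ v ∷ p ∷ E)
            each d v p ud uv ip = ℝ.≤-respʳ-≈ (ℝ.sym (P₀-value d v p)) (ℝ.≤-respˡ-≈ 4¼ (ℝ.*-monoʳ-≤ 0≤4
              (<⇒≤ (≰⇒> λ small → ¬a∼b (certified⇒∼ ua ub (proj₁ p , proj₁ v , proj₁ d , ip , uv , ud , small))))))

  module _ {Γ} (a₀ b₀ : Term CStarLanguage Γ 1) where
    open Certificate a₀ b₀

    private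
      Equivalent : ∀ M → Model.Env M Γ → Set ℓ
      Equivalent M y = Alg._∼_ M (Value.a M y) (Value.b M y)

    IsEquivalenceFormula : Formula CStarLanguage Γ → Set (lsuc ℓ)
    IsEquivalenceFormula φ = ∀ M y →
      Alg.IsUnitaryElement M (proj₁ (evalTerm (cstarStructure (alg M)) a₀ y)) →
      Alg.IsUnitaryElement M (proj₁ (evalTerm (cstarStructure (alg M)) b₀ y)) →
      Truth (Alg._∼_ M (proj₁ (evalTerm (cstarStructure (alg M)) a₀ y)) (proj₁ (evalTerm (cstarStructure (alg M)) b₀ y)))
        (value φ M y)

    abstract
      ∼-formula : ∃ IsEquivalenceFormula
      ∼-formula = via (exact {P = P₃} P₃-definable Equivalent)
        where
        via : (∃ λ φ → ∀ M y → (Equivalent M y → P₃ M y ℝ.≈ ℝ.0#) × (¬ Equivalent M y → ℝ.1# ℝ.≤ P₃ M y) →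
               Truth (Equivalent M y) (value φ M y)) → ∃ IsEquivalenceFormula
        via (φ , h) = φ , λ M y ua ub → h M y (Value.equivalent M y , Value.inequivalent M y ua ub)

-- Formulas of an expansion read in a further expansion.

module Translation (em : ∀ {ℓ} → ExcludedMiddle ℓ) (R : CompleteOrderedField)
                   {ℓ} (𝓜 : Set (lsuc ℓ)) (E : Setting.Expansion em R 𝓜)
                   {J : Set} (new : J → Setting.NewSort em R 𝓜 E) where
  open Setting em R
  open Reals em R
  open Terms em R using (weaken; weaken-value)

  private
    L L′ : Language
    L  = Expansion.language E
    L′ = Expansion.language (extend 𝓜 E new)

    module Old = Expansion E
    module New = Expansion (extend 𝓜 E new)

    Substitution : List Old.Sort → List New.Sort → Set
    Substitution Γ Γ′ = ∀ {s} → s ∈ Γ → Term L′ Γ′ (inj₁ s)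

    lift-substitution : ∀ {Γ Γ′ t} → Substitution Γ Γ′ → Substitution (t ∷ Γ) (inj₁ t ∷ Γ′)
    lift-substitution σ (here ≡.refl) = var (here ≡.refl)
    lift-substitution σ (there i)     = weaken (σ i)

    term  : ∀ {Γ Γ′ s} → Substitution Γ Γ′ → Term L Γ s → Term L′ Γ′ (inj₁ s)
    terms : ∀ {Γ Γ′ Δ} → Substitution Γ Γ′ → All (Term L Γ) Δ → All (Term L′ Γ′) (List.map inj₁ Δ)
    term σ (var i)    = σ i
    term σ (app f us) = app (old f) (terms σ us)
    terms σ []       = []
    terms σ (u ∷ us) = term σ u ∷ terms σ us

  -- A variable of an old sort may be replaced by any new term of that sort. This is how a formula
  -- about elements of the ball is applied to the coordinates of elements of a definable set.
  translate : ∀ {Γ Γ′} → Substitution Γ Γ′ → Formula L Γ → Formula L′ Γ′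
  translate σ (dist′ u v) = dist′ (term σ u) (term σ v)
  translate σ (conn f φ)  = conn f λ i → translate σ (φ i)
  translate σ (sup′ s φ)  = sup′ (inj₁ s) (translate (lift-substitution σ) φ)
  translate σ (inf′ s φ)  = inf′ (inj₁ s) (translate (lift-substitution σ) φ)

  module _ (M : 𝓜) where

    Agree : ∀ {Γ Γ′} → Substitution Γ Γ′ → Old.Model.Env M Γ → New.Model.Env M Γ′ → Set ℓ
    Agree σ ρ ρ′ = ∀ {s} (i : s ∈ _) → evalTerm (New.structure M) (σ {s} i) ρ′ ≡ lookup ρ i

    private
      lift-agree : ∀ {Γ Γ′ t} (σ : Substitution Γ Γ′) {ρ ρ′} {x : Old.Model.Dom M t} → Agree σ ρ ρ′ →
                   Agree (lift-substitution σ) (x ∷ ρ) (x ∷ ρ′)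
      lift-agree         σ h (here ≡.refl) = ≡.refl
      lift-agree {t = t} σ h (there i)     = ≡.trans (weaken-value (New.structure M) {t = inj₁ t} (σ i)) (h i)

      term-value  : ∀ {Γ Γ′ s} (σ : Substitution Γ Γ′) {ρ ρ′} → Agree σ ρ ρ′ → (u : Term L Γ s) →
                    evalTerm (New.structure M) (term σ u) ρ′ ≡ evalTerm (Old.structure M) u ρ
      terms-value : ∀ {Γ Γ′ Δ} (σ : Substitution Γ Γ′) {ρ ρ′} → Agree σ ρ ρ′ → (us : All (Term L Γ) Δ) →
                    Allₚ.map⁻ (evalTerms (New.structure M) (terms σ us) ρ′) ≡ evalTerms (Old.structure M) us ρ
      term-value σ h (var i)    = h i
      term-value σ h (app f us) = ≡.cong (Old.Model.fun M f) (terms-value σ h us)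
      terms-value σ h []       = ≡.refl
      terms-value σ h (u ∷ us) = ≡.cong₂ _∷_ (term-value σ h u) (terms-value σ h us)

    translate-value : ∀ {Γ Γ′} (σ : Substitution Γ Γ′) {ρ ρ′} → Agree σ ρ ρ′ → (φ : Formula L Γ) →
                      eval (New.structure M) (translate σ φ) ρ′ ℝ.≈ eval (Old.structure M) φ ρ
    translate-value σ h (dist′ u v) = ℝ.reflexive (≡.cong₂ (Old.Model.dist M) (term-value σ h u) (term-value σ h v))
    translate-value σ h (conn f φ)  = apply-cong f λ i → translate-value σ h (φ i)
    translate-value σ h (sup′ s φ)  = sup-cong λ x → translate-value (lift-substitution σ) (lift-agree σ h) φ
    translate-value σ h (inf′ s φ)  = inf-cong λ x → translate-value (lift-substitution σ) (lift-agree σ h) φ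

-- The sort of unitaries and its quotient by stable homotopy.

module UnitarySort (em : ∀ {ℓ} → ExcludedMiddle ℓ) (R : CompleteOrderedField)
                   {ℓ} (𝓜 : Set (lsuc ℓ)) (alg : 𝓜 → Setting.CStarAlgebra em R ℓ)
                   (frame : ∀ M → Frames.Frame em R (alg M)) where
  open Setting em R
  open Reals em R
  open Formulas em R
  open EquivalenceFormula em R 𝓜 alg frame

  E₁ : Expansion 𝓜
  E₁ = extend 𝓜 baseExpansion {⊤} λ _ → subset (1 ∷ []) (definableSet unitaries)

  module E₁ = Expansion E₁

  unitarySort : E₁.Sort
  unitarySort = inj₂ tt

  ball : ∀ {M} → E₁.Model.Dom M unitarySort → Ball (alg M) 1
  ball (x , _) = lookup x (here ≡.refl)

  ball-unitary : ∀ {M} (x : E₁.Model.Dom M unitarySort) → U.In M (ball {M} x)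
  ball-unitary ((_ ∷ []) , u) = u

  element : ∀ {M} → E₁.Model.Dom M unitarySort → Alg.Carrier M
  element {M} x = proj₁ (ball {M} x)

  fromUnitary : ∀ M u → Alg.IsUnitaryElement M u → E₁.Model.Dom M unitarySort
  fromUnitary M u p = (Alg.unit M u (Alg.unitary-norm M p) ∷ []) , p

  private
    φ∼ : Formula CStarLanguage (1 ∷ 1 ∷ [])
    φ∼ = proj₁ (∼-formula (var (here ≡.refl)) (var (there (here ≡.refl))))

    value∼ : ∀ M → (x y : E₁.Model.Dom M unitarySort) → ℝ
    value∼ M x y = eval (cstarStructure (alg M)) φ∼ (ball {M} x ∷ ball {M} y ∷ [])

    truth∼ : ∀ M x y → Truth (Alg._∼_ M (element {M} x) (element {M} y)) (value∼ M x y)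
    truth∼ M x y = proj₂ (∼-formula (var (here ≡.refl)) (var (there (here ≡.refl)))) M
      (ball {M} x ∷ ball {M} y ∷ []) (ball-unitary {M} x) (ball-unitary {M} y)

  δ∼ : ∀ M → (x y : E₁.Model.Env M (unitarySort ∷ [])) → ℝ
  δ∼ M x y = value∼ M (lookup x (here ≡.refl)) (lookup y (here ≡.refl))

  δ∼-truth : ∀ M x y → Truth (Alg._∼_ M (element {M} (lookup x (here ≡.refl))) (element {M} (lookup y (here ≡.refl)))) (δ∼ M x y)
  δ∼-truth M x y = truth∼ M (lookup x (here ≡.refl)) (lookup y (here ≡.refl))

  private
    module T = Translation em R 𝓜 baseExpansion {⊤} (λ _ → subset (1 ∷ []) (definableSet unitaries))

    σ : ∀ {s} → s ∈ (1 ∷ 1 ∷ []) → Term E₁.language (unitarySort ∷ unitarySort ∷ []) (inj₁ s)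
    σ (here ≡.refl)         = app (from tt (here ≡.refl)) (var (here ≡.refl) ∷ [])
    σ (there (here ≡.refl)) = app (from tt (here ≡.refl)) (var (there (here ≡.refl)) ∷ [])

    σ-agree : ∀ M (x y : E₁.Model.Dom M unitarySort) → T.Agree M σ (ball {M} x ∷ ball {M} y ∷ []) (x ∷ y ∷ [])
    σ-agree M x y (here ≡.refl)         = ≡.refl
    σ-agree M x y (there (here ≡.refl)) = ≡.refl

  classPseudometric : DefinablePseudometric 𝓜 E₁ (unitarySort ∷ [])
  classPseudometric = record
    { δ = δ∼
    ; nonneg = λ M x y → proj₁ (truth-bounds (δ∼-truth M x y))
    ; reflexive = λ M x → proj₁ (δ∼-truth M x x) (Alg.∼-refl M (ball-unitary {M} (lookup x (here ≡.refl))))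
    ; symmetric = symmetric
    ; triangle = triangle
    ; definable = λ η p → T.translate σ φ∼ , λ { M (x ∷ y ∷ []) → Within-reflexive (<⇒≤ p)
        (ℝ.sym (T.translate-value M σ (σ-agree M x y) φ∼)) }
    }
    where
    symmetric : ∀ M x y → δ∼ M x y ℝ.≈ δ∼ M y x
    symmetric M x y with em {P = Alg._∼_ M (element {M} (lookup x (here ≡.refl))) (element {M} (lookup y (here ≡.refl)))}
    ... | yes p = ℝ.trans (proj₁ (δ∼-truth M x y) p) (ℝ.sym (proj₁ (δ∼-truth M y x) (Alg.∼-sym M p)))
    ... | no ¬p = ℝ.trans (proj₂ (δ∼-truth M x y) ¬p) (ℝ.sym (proj₂ (δ∼-truth M y x) λ q → ¬p (Alg.∼-sym M q)))
    triangle : ∀ M x y z → δ∼ M x z ℝ.≤ δ∼ M x y ℝ.+ δ∼ M y z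
    triangle M x y z with em {P = Alg._∼_ M (element {M} (lookup x (here ≡.refl))) (element {M} (lookup y (here ≡.refl)))}
                        | em {P = Alg._∼_ M (element {M} (lookup y (here ≡.refl))) (element {M} (lookup z (here ≡.refl)))}
    ... | yes p | yes q = ℝ.≤-respˡ-≈ (ℝ.sym (proj₁ (δ∼-truth M x z) (Alg.∼-trans M p q)))
          (ℝ.≤-respˡ-≈ (ℝ.+-identityˡ _) (ℝ.+-mono-≤ (proj₁ (truth-bounds (δ∼-truth M x y))) (proj₁ (truth-bounds (δ∼-truth M y z)))))
    ... | no ¬p | _ = ℝ.≤-trans (proj₂ (truth-bounds (δ∼-truth M x z))) (≤-resp (ℝ.+-identityʳ _)
          (ℝ.+-congʳ (ℝ.sym (proj₂ (δ∼-truth M x y) ¬p))) (ℝ.+-mono-≤ ℝ.≤-refl (proj₁ (truth-bounds (δ∼-truth M y z)))))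
    ... | yes _ | no ¬q = ℝ.≤-trans (proj₂ (truth-bounds (δ∼-truth M x z))) (≤-resp (ℝ.+-identityˡ _)
          (ℝ.+-congˡ (ℝ.sym (proj₂ (δ∼-truth M y z) ¬q))) (ℝ.+-mono-≤ (proj₁ (truth-bounds (δ∼-truth M x y))) ℝ.≤-refl))

  E₂ : Expansion 𝓜
  E₂ = extend 𝓜 E₁ {⊤} λ _ → quotient (unitarySort ∷ []) classPseudometric

  module E₂ = Expansion E₂

  classSort : E₂.Sort
  classSort = inj₂ tt

  private
    V : E₂.Sort
    V = inj₁ unitarySort

  -- Nothing is chosen here: the elements of a quotient sort are the representatives themselves, and
  -- only the metric identifies them.
  representative : ∀ {M} → E₂.Model.Dom M classSort → E₁.Model.Dom M unitarySort
  representative x = lookup x (here ≡.refl)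

  class : ∀ {M} → E₂.Model.Dom M classSort → Alg.Carrier M
  class {M} x = element {M} (representative {M} x)

  class-unitary : ∀ {M} x → Alg.IsUnitaryElement M (class {M} x)
  class-unitary {M} x = ball-unitary {M} (representative {M} x)

  classOf : ∀ M u → Alg.IsUnitaryElement M u → E₂.Model.Dom M classSort
  classOf M u p = fromUnitary M u p ∷ []

  ballTerm : ∀ {Γ} → Term E₂.language Γ V → Term E₂.language Γ (inj₁ (inj₁ 1))
  ballTerm u = app (old (from tt (here ≡.refl))) (u ∷ [])

  private
    1ₛ : E₂.Sort
    1ₛ = inj₁ (inj₁ 1)

  productTerm : ∀ {Γ} → Term E₂.language (V ∷ V ∷ V ∷ Γ) 1ₛ
  productTerm = app (old (old (times 1 1))) (ballTerm (var (there (there (here ≡.refl)))) ∷ ballTerm (var (there (here ≡.refl))) ∷ [])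

  unitTerm : ∀ {Γ} → Term E₂.language (V ∷ V ∷ V ∷ Γ) 1ₛ
  unitTerm = app (old (old one′)) []

  adjointTerm : ∀ {Γ} → Term E₂.language (V ∷ V ∷ V ∷ Γ) 1ₛ
  adjointTerm = app (old (old (star 1))) (ballTerm (var (there (there (here ≡.refl)))) ∷ [])

  module _ {M Γ} (w v u : E₂.Model.Dom M V) (ρ : E₂.Model.Env M Γ) where
    open Alg M

    productTerm-value : proj₁ (evalTerm (E₂.structure M) (productTerm {Γ}) (w ∷ v ∷ u ∷ ρ)) ≈ element {M} u * element {M} v
    productTerm-value = refl

    unitTerm-value : proj₁ (evalTerm (E₂.structure M) (unitTerm {Γ}) (w ∷ v ∷ u ∷ ρ)) ≈ 1#
    unitTerm-value = refl

    adjointTerm-value : proj₁ (evalTerm (E₂.structure M) (adjointTerm {Γ}) (w ∷ v ∷ u ∷ ρ)) ≈ element {M} u ⋆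
    adjointTerm-value = refl

  private
    quotientTerm : ∀ {Γ} → Term E₂.language Γ V → Term E₂.language Γ classSort
    quotientTerm u = app (to tt ≡.refl) (u ∷ [])

  private
    max₄ : ℝ → ℝ → ℝ → ℝ → ℝ
    max₄ a b c d = a ℝ.⊔ᵣ (b ℝ.⊔ᵣ (c ℝ.⊔ᵣ d))

    max₄-≤ : ∀ {a b c d r} → a ℝ.≤ r → b ℝ.≤ r → c ℝ.≤ r → d ℝ.≤ r → max₄ a b c d ℝ.≤ r
    max₄-≤ p q r s = max-≤ p (max-≤ q (max-≤ r s))

    max₄-≥₁ : ∀ a b c d → a ℝ.≤ max₄ a b c d
    max₄-≥₁ a b c d = max-≥ˡ a _
    max₄-≥₂ : ∀ a b c d → b ℝ.≤ max₄ a b c d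
    max₄-≥₂ a b c d = ℝ.≤-trans (max-≥ˡ b _) (max-≥ʳ a _)
    max₄-≥₃ : ∀ a b c d → c ℝ.≤ max₄ a b c d
    max₄-≥₃ a b c d = ℝ.≤-trans (max-≥ˡ c d) (ℝ.≤-trans (max-≥ʳ b _) (max-≥ʳ a _))
    max₄-≥₄ : ∀ a b c d → d ℝ.≤ max₄ a b c d
    max₄-≥₄ a b c d = ℝ.≤-trans (max-≥ʳ c d) (ℝ.≤-trans (max-≥ʳ b _) (max-≥ʳ a _))

  -- u, v, w run through representatives of the classes i, j, k; it suffices that τ(u, v)
  -- and w are close, since close unitaries are homotopic.
  module Graph {Γ} (i j k : classSort ∈ Γ) (τ : Term E₂.language (V ∷ V ∷ V ∷ Γ) (inj₁ (inj₁ 1))) where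

    private
      w v u : Term E₂.language (V ∷ V ∷ V ∷ Γ) V
      w = var (here ≡.refl)
      v = var (there (here ≡.refl))
      u = var (there (there (here ≡.refl)))

      x y z : Term E₂.language (V ∷ V ∷ V ∷ Γ) classSort
      x = var (there (there (there i)))
      y = var (there (there (there j)))
      z = var (there (there (there k)))

      matrix : Formula E₂.language (V ∷ V ∷ V ∷ Γ)
      matrix = dist′ (quotientTerm u) x ⊔′ (dist′ (quotientTerm v) y ⊔′ (dist′ (quotientTerm w) z ⊔′
               (2# ℝ.* 2#) ⊙′ dist′ τ (ballTerm w)))

    -- The infimum is 0 if the relation holds and at least 1 otherwise, but it may exceed 1;
    -- clamping makes it the discrete distance.
    graph : Formula E₂.language Γ
    graph = clamp′ (inf′ V (inf′ V (inf′ V matrix)))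

    module _ (M : 𝓜) (op : Alg.Carrier M → Alg.Carrier M → Alg.Carrier M)
             (op-unitary : ∀ {a b} → Alg.IsUnitaryElement M a → Alg.IsUnitaryElement M b → Alg.IsUnitaryElement M (op a b))
             (op-∼ : ∀ {a b c d} → Alg._∼_ M a c → Alg._∼_ M b d → Alg._∼_ M (op a b) (op c d))
             (τ-value : ∀ (w v u : E₂.Model.Dom M V) ρ → Alg._≈_ M
               (proj₁ (evalTerm (E₂.structure M) τ (w ∷ v ∷ u ∷ ρ))) (op (element {M} u) (element {M} v)))
             (ρ : E₂.Model.Env M Γ) where
      open Alg M

      private
        a b c : Carrier
        a = class {M} (lookup ρ i)
        b = class {M} (lookup ρ j)
        c = class {M} (lookup ρ k)

        Unitaries : Set ℓ
        Unitaries = E₂.Model.Dom M V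

        e : Unitaries → Carrier
        e = element {M}

        e-unitary : ∀ x → IsUnitaryElement (e x)
        e-unitary = ball-unitary {M}

        X Y Z : Unitaries
        X = representative {M} (lookup ρ i)
        Y = representative {M} (lookup ρ j)
        Z = representative {M} (lookup ρ k)

        D₄ : Unitaries → Unitaries → Unitaries → ℝ
        D₄ u v w = 2# ℝ.* 2# ℝ.* ‖ proj₁ (evalTerm (E₂.structure M) τ (w ∷ v ∷ u ∷ ρ)) - e w ‖

        f₀ : Unitaries → Unitaries → Unitaries → ℝ
        f₀ u v w = max₄ (value∼ M u X) (value∼ M v Y) (value∼ M w Z) (D₄ u v w)

        0≤4 : ℝ.0# ℝ.≤ 2# ℝ.* 2#
        0≤4 = ℝ.*-nonneg (<⇒≤ 0<2) (<⇒≤ 0<2)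

        f₀≥0 : ∀ u v w → ℝ.0# ℝ.≤ f₀ u v w
        f₀≥0 u v w = ℝ.≤-trans (proj₁ (truth-bounds (truth∼ M u X)))
          (max₄-≥₁ (value∼ M u X) (value∼ M v Y) (value∼ M w Z) (D₄ u v w))

        one : Unitaries
        one = fromUnitary M 1# unitary-1

        f₁ : Unitaries → Unitaries → ℝ
        f₁ u v = inf (f₀ u v)
        f₂ : Unitaries → ℝ
        f₂ u = inf (f₁ u)

        isInf₁ : ∀ u v → IsInf (f₀ u v) (f₁ u v)
        isInf₁ u v = inf-isInf (f₀ u v) one ℝ.0# (f₀≥0 u v)
        f₁≥0 : ∀ u v → ℝ.0# ℝ.≤ f₁ u v
        f₁≥0 u v = proj₂ (isInf₁ u v) ℝ.0# (f₀≥0 u v)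
        isInf₂ : ∀ u → IsInf (f₁ u) (f₂ u)
        isInf₂ u = inf-isInf (f₁ u) one ℝ.0# (f₁≥0 u)
        f₂≥0 : ∀ u → ℝ.0# ℝ.≤ f₂ u
        f₂≥0 u = proj₂ (isInf₂ u) ℝ.0# (f₁≥0 u)
        isInf₃ : IsInf f₂ (inf f₂)
        isInf₃ = inf-isInf f₂ one ℝ.0# f₂≥0

        zero-dist : ∀ x y → e x ∼ e y → value∼ M x y ℝ.≤ ℝ.0#
        zero-dist x y p = ℝ.≤-reflexive (proj₁ (truth∼ M x y) p)

        value-true : op a b ∼ c → inf f₂ ℝ.≤ ℝ.0#
        value-true h = ℝ.≤-trans (proj₁ isInf₃ X) (ℝ.≤-trans (proj₁ (isInf₂ X) Y) (ℝ.≤-trans (proj₁ (isInf₁ X Y) W) bound))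
          where
          W : Unitaries
          W = fromUnitary M (op a b) (op-unitary (e-unitary X) (e-unitary Y))
          last : D₄ X Y W ℝ.≤ ℝ.0#
          last = ℝ.≤-trans (ℝ.*-monoʳ-≤ 0≤4 (≈⇒‖-‖≤ (τ-value W Y X ρ) ℝ.≤-refl)) (ℝ.≤-reflexive (ℝ.zeroʳ _))
          bound : f₀ X Y W ℝ.≤ ℝ.0#
          bound = max₄-≤ (zero-dist X X (∼-refl (e-unitary X))) (zero-dist Y Y (∼-refl (e-unitary Y))) (zero-dist W Z h) last

        4¼ : 2# ℝ.* 2# ℝ.* ¼ ℝ.≈ ℝ.1#
        4¼ = ℝ.trans (solveᴿ (½ ∷ []) (λ h → [] ,
          (:1 :+ :1) :* (:1 :+ :1) :* (h :* (h :* :1)) ⊜ (h :+ h) :* (h :+ h)) [])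
          (ℝ.trans (ℝ.*-cong ½+½≈1 ½+½≈1) (ℝ.*-identityˡ _))

        far : ∀ x y → ¬ e x ∼ e y → ℝ.1# ℝ.≤ value∼ M x y
        far x y p = ℝ.≤-reflexive (ℝ.sym (proj₂ (truth∼ M x y) p))

        module _ (¬h : ¬ op a b ∼ c) (u v w : Unitaries) where
          near : e u ∼ a → e v ∼ b → e w ∼ c → ℝ.1# ℝ.≤ D₄ u v w
          near p q r = ℝ.≤-respˡ-≈ 4¼ (ℝ.*-monoʳ-≤ 0≤4 (<⇒≤ (≰⇒> λ small → ¬h
            (∼-trans (∼-sym (op-∼ p q)) (∼-trans (close⇒∼ (op-unitary (e-unitary u) (e-unitary v)) (e-unitary w)
              (small ⟨≈⟩ +-congʳ (τ-value w v u ρ))) r)))))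

          cases : Dec (e u ∼ a) → Dec (e v ∼ b) → Dec (e w ∼ c) → ℝ.1# ℝ.≤ f₀ u v w
          cases (no ¬p) _ _ = ℝ.≤-trans (far u X ¬p) (max₄-≥₁ (value∼ M u X) (value∼ M v Y) (value∼ M w Z) (D₄ u v w))
          cases (yes _) (no ¬p) _ = ℝ.≤-trans (far v Y ¬p) (max₄-≥₂ (value∼ M u X) (value∼ M v Y) (value∼ M w Z) (D₄ u v w))
          cases (yes _) (yes _) (no ¬p) = ℝ.≤-trans (far w Z ¬p) (max₄-≥₃ (value∼ M u X) (value∼ M v Y) (value∼ M w Z) (D₄ u v w))
          cases (yes p) (yes q) (yes r) = ℝ.≤-trans (near p q r) (max₄-≥₄ (value∼ M u X) (value∼ M v Y) (value∼ M w Z) (D₄ u v w))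

        value-false : ¬ op a b ∼ c → ℝ.1# ℝ.≤ inf f₂
        value-false ¬h = proj₂ isInf₃ ℝ.1# λ u → proj₂ (isInf₂ u) ℝ.1# λ v → proj₂ (isInf₁ u v) ℝ.1# λ w → cases ¬h u v w em em em

      private
        matrix-value : ∀ u v w → E₂.value matrix M (w ∷ v ∷ u ∷ ρ) ≡ f₀ u v w
        matrix-value u v w = ≡.refl

        graph-value : E₂.value (inf′ V (inf′ V (inf′ V matrix))) M ρ ℝ.≈ inf f₂
        graph-value = inf-cong λ u → inf-cong λ v → inf-cong λ w → ℝ.reflexive (matrix-value u v w)

        r : ℝ
        r = E₂.value (inf′ V (inf′ V (inf′ V matrix))) M ρ

        r-truth : Truth (op a b ∼ c) (clamp r)
        r-truth = (λ h → clamp-0 {r} (ℝ.≤-respˡ-≈ (ℝ.sym graph-value) (value-true h))) ,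
                  λ ¬h → clamp-1 {r} (ℝ.≤-respʳ-≈ (ℝ.sym graph-value) (value-false ¬h))

      graph-truth : Truth (op a b ∼ c) (E₂.value graph M ρ)
      graph-truth = r-truth

-- The group operations on the sort of classes.

module ClassGroup (em : ∀ {ℓ} → ExcludedMiddle ℓ) (R : CompleteOrderedField)
                  {ℓ} (𝓜 : Set (lsuc ℓ)) (alg : 𝓜 → Setting.CStarAlgebra em R ℓ)
                  (frame : ∀ M → Frames.Frame em R (alg M)) (M : 𝓜) where
  open Setting em R
  open Formulas em R
  open UnitarySort em R 𝓜 alg frame
  open EquivalenceFormula em R 𝓜 alg frame using (module Alg)
  open KOne em R (alg M) (frame M) using (κ; κ-unitary; κ-scalar; κ-reflects; κ-preserves; κ-⊕-∼; κ-⋆; κ-1; scalarMatrix)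
  open Alg M using (Carrier; _≈_; _*_; _⋆; 1#; IsUnitaryElement; unitary-*; unitary-⋆; unitary-1; _∼_; ∼-refl; ∼-trans;
                    ∼-sym; ∼-*; ∼-⋆; ∼-reflexive)

  private
    module G = RawGroup (K₁ (alg M))

  Class : Set ℓ
  Class = E₂.Model.Dom M classSort

  toGroup : Class → G.Carrier
  toGroup x = 1 , scalarMatrix (class {M} x) (class-unitary {M} x)

  k : G.Carrier → Carrier
  k (_ , u) = κ (proj₁ u)

  k-unitary : ∀ g → IsUnitaryElement (k g)
  k-unitary (_ , u) = κ-unitary u

  k-toGroup : ∀ x → k (toGroup x) ∼ class {M} x
  k-toGroup x = κ-scalar (class {M} x) (class-unitary {M} x)

  discrete : ∀ {g h a b r} → k g ∼ a → k h ∼ b → Truth (a ∼ b) r → Truth (g G.≈ h) r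
  discrete {g} {h} p q = truth-⇔ (λ a∼b → κ-reflects g h (∼-trans p (∼-trans a∼b (∼-sym q))))
    (λ g≈h → ∼-trans (∼-sym p) (∼-trans (κ-preserves g h g≈h) q))

  -- The unitary `k g` of A, taken as a matrix of size 1, lies in the class g, since `κ` sends it
  -- back to `k g` up to stable homotopy.
  surjective : ∀ g → ∃ λ x → toGroup x G.≈ g
  surjective g = x , κ-reflects (toGroup x) g (k-toGroup x)
    where
    x : Class
    x = classOf M (k g) (k-unitary g)

  0ᵥ : ∀ {Γ} → classSort ∈ (classSort ∷ Γ)
  0ᵥ = here ≡.refl

  -- One construction serves all three operations: nullary and unary ones are read as binary by
  -- repeating a variable.
  module ∙-Graph = Graph {classSort ∷ classSort ∷ classSort ∷ []} 0ᵥ (there 0ᵥ) (there (there 0ᵥ)) productTerm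
  module ε-Graph = Graph {classSort ∷ []} 0ᵥ 0ᵥ 0ᵥ unitTerm
  module ⁻¹-Graph = Graph {classSort ∷ classSort ∷ []} 0ᵥ 0ᵥ (there 0ᵥ) adjointTerm

  c : Class → Carrier
  c x = class {M} x

  ∙-class : ∀ x y → k (toGroup x G.∙ toGroup y) ∼ c x * c y
  ∙-class x y = ∼-trans {k (toGroup x G.∙ toGroup y)} {k (toGroup x) * k (toGroup y)} {c x * c y}
    (κ-⊕-∼ (proj₂ (toGroup x)) (proj₂ (toGroup y)))
    (∼-* {k (toGroup x)} {c x} {k (toGroup y)} {c y} (k-toGroup x) (k-toGroup y))

  ε-class : k G.ε ∼ 1#
  ε-class = ∼-reflexive {k G.ε} {1#} (k-unitary G.ε) (κ-1 0)

  ⁻¹-class : ∀ x → k (toGroup x G.⁻¹) ∼ c x ⋆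
  ⁻¹-class x = ∼-trans {k (toGroup x G.⁻¹)} {k (toGroup x) ⋆} {c x ⋆}
    (∼-reflexive {k (toGroup x G.⁻¹)} {k (toGroup x) ⋆} (k-unitary (toGroup x G.⁻¹)) (κ-⋆ (proj₁ (proj₂ (toGroup x)))))
    (∼-⋆ {k (toGroup x)} {c x} (k-toGroup x))

  isometric : ∀ x y → Truth (toGroup x G.≈ toGroup y) (δ∼ M x y)
  isometric x y = discrete {toGroup x} {toGroup y} {c x} {c y} {δ∼ M x y} (k-toGroup x) (k-toGroup y) (δ∼-truth M x y)

  ∙-value : (x y z : Class) → ℝ
  ∙-value x y z = E₂.value ∙-Graph.graph M (x ∷ y ∷ z ∷ [])

  ∙-truth : ∀ x y z → Truth (c x * c y ∼ c z) (∙-value x y z)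
  ∙-truth x y z = ∙-Graph.graph-truth M _*_ (λ {a} {b} → unitary-* {a} {b}) (λ {a} {b} {c} {d} → ∼-* {a} {c} {b} {d})
    (productTerm-value {M}) (x ∷ y ∷ z ∷ [])

  ∙-isGraph : ∀ x y z → Truth ((toGroup x G.∙ toGroup y) G.≈ toGroup z) (∙-value x y z)
  ∙-isGraph x y z = discrete {toGroup x G.∙ toGroup y} {toGroup z} {c x * c y} {c z} {∙-value x y z}
    (∙-class x y) (k-toGroup z) (∙-truth x y z)

  ε-value : Class → ℝ
  ε-value z = E₂.value ε-Graph.graph M (z ∷ [])

  ε-truth : ∀ z → Truth (1# ∼ c z) (ε-value z)
  ε-truth z = ε-Graph.graph-truth M (λ _ _ → 1#) (λ _ _ → unitary-1) (λ _ _ → ∼-refl {1#} unitary-1) (unitTerm-value {M}) (z ∷ [])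

  ε-isGraph : ∀ z → Truth (G.ε G.≈ toGroup z) (ε-value z)
  ε-isGraph z = discrete {G.ε} {toGroup z} {1#} {c z} {ε-value z} ε-class (k-toGroup z) (ε-truth z)

  ⁻¹-value : (x z : Class) → ℝ
  ⁻¹-value x z = E₂.value ⁻¹-Graph.graph M (x ∷ z ∷ [])

  ⁻¹-truth : ∀ x z → Truth (c x ⋆ ∼ c z) (⁻¹-value x z)
  ⁻¹-truth x z = ⁻¹-Graph.graph-truth M (λ a _ → a ⋆) (λ {a} p _ → unitary-⋆ {a} p) (λ {a} {_} {c} p _ → ∼-⋆ {a} {c} p)
    (adjointTerm-value {M}) (x ∷ z ∷ [])

  ⁻¹-isGraph : ∀ x z → Truth ((toGroup x G.⁻¹) G.≈ toGroup z) (⁻¹-value x z)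
  ⁻¹-isGraph x z = discrete {toGroup x G.⁻¹} {toGroup z} {c x ⋆} {c z} {⁻¹-value x z}
    (⁻¹-class x) (k-toGroup z) (⁻¹-truth x z)

-- K₁ as an imaginary sort.

module KOneImaginary (em : ∀ {ℓ} → ExcludedMiddle ℓ) (R : CompleteOrderedField)
                     {ℓ} (A : Setting.CStarAlgebra em R ℓ) (𝓕 : Frames.Frame em R A) where
  open Setting em R
  open Reals em R

  private
    frame : ∀ (M : Models A) → Frames.Frame em R (proj₁ M)
    frame (M , h) = FrameTransfer.frame-transfer em R A M h 𝓕

  open UnitarySort em R (Models A) proj₁ frame
  open ClassGroup em R (Models A) proj₁ frame (itself A)

  private
    value-definable : ∀ {Γ} (φ : Formula E₂.language Γ) → E₂.IsDefinable (E₂.value φ)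
    value-definable φ η p = φ , λ M x → Within-refl (<⇒≤ p)

  abstract
    K₁-inEq : InEq A (K₁ A)
    K₁-inEq = record
      { expansion = E₂
      ; imaginary = step (step base _) _
      ; sort = classSort
      ; toGroup = toGroup
      ; surjective = surjective
      ; isometric = isometric
      ; ∙-graph = E₂.value ∙-Graph.graph
      ; ∙-definable = value-definable ∙-Graph.graph
      ; ∙-isGraph = ∙-isGraph
      ; ε-graph = E₂.value ε-Graph.graph
      ; ε-definable = value-definable ε-Graph.graph
      ; ε-isGraph = ε-isGraph
      ; ⁻¹-graph = E₂.value ⁻¹-Graph.graph
      ; ⁻¹-definable = value-definable ⁻¹-Graph.graph
      ; ⁻¹-isGraph = ⁻¹-isGraph
      }

-- Translation of first-order group formulas.

module GroupFormulas (em : ∀ {ℓ} → ExcludedMiddle ℓ) (R : CompleteOrderedField) (ℓ : Level) where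
  open Setting em R
  open Reals em R
  open Formulas em R
  open Terms em R

  -- Ranging over all algebras with a chosen frame yields one formula that can be evaluated both in
  -- A and in B, each with its own frame.
  Framed : Set (lsuc ℓ)
  Framed = Σ (CStarAlgebra ℓ) (Frames.Frame em R)

  open EquivalenceFormula em R Framed proj₁ proj₂
  open Expansion baseExpansion using (value; module Model)

  private
    module K (M : Framed) = KOne em R (proj₁ M) (proj₂ M)
    module G (M : Framed) = RawGroup (K₁ (proj₁ M))

  Γ : ℕ → List ℕ
  Γ n = List.replicate n 1

  index : ∀ {n} → Fin n → 1 ∈ Γ n
  index zero    = here ≡.refl
  index (suc i) = there (index i)

  k : ∀ M → G.Carrier M → Alg.Carrier M
  k M (_ , u) = K.κ M (proj₁ u)

  -- The unitaries in `e` represent the classes in `ρ`. Truth of a translated formula is claimed for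
  -- every such choice, so quantifiers over classes can become quantifiers over unitaries.
  Related : ∀ M {n} → (Fin n → G.Carrier M) → Model.Env M (Γ n) → Set ℓ
  Related M ρ e = ∀ i → U.In M (lookup e (index i)) × Alg._∼_ M (k M (ρ i)) (proj₁ (lookup e (index i)))

  private
    term : ∀ {n} → GroupTerm n → Term CStarLanguage (Γ n) 1
    term (var i) = var (index i)
    term (s ∙ t) = term s ∙ᵗ term t
    term ε       = 1ᵗ
    term (t ⁻¹)  = term t ⋆ᵗ

    module _ (M : Framed) where
      open Alg M
      module KM = K M
      module GM = G M

      Represents : GM.Carrier → Ball (proj₁ M) 1 → Set ℓ
      Represents g a = IsUnitaryElement (proj₁ a) × k M g ∼ proj₁ a

      term-represents : ∀ {n} (t : GroupTerm n) {ρ e} → Related M ρ e →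
                        Represents (⟦_⟧ᵍ (K₁ (proj₁ M)) t ρ) (evalTerm (cstarStructure (proj₁ M)) (term t) e)
      term-represents (var i) h = h i
      term-represents (s ∙ t) {ρ} h with term-represents s h | term-represents t h
      ... | u , p | v , q = unitary-* u v , ∼-trans (KM.κ-⊕-∼ (proj₂ (⟦_⟧ᵍ (K₁ (proj₁ M)) s ρ)) (proj₂ (⟦_⟧ᵍ (K₁ (proj₁ M)) t ρ))) (∼-* p q)
      term-represents ε h = unitary-1 , ∼-reflexive (KM.κ-unitary (proj₂ GM.ε)) (KM.κ-1 0)
      term-represents (t ⁻¹) {ρ} h with term-represents t h
      ... | u , p = unitary-⋆ u , ∼-trans (∼-reflexive (KM.κ-unitary (proj₂ (⟦_⟧ᵍ (K₁ (proj₁ M)) t ρ GM.⁻¹)))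
                      (KM.κ-⋆ (proj₁ (proj₂ (⟦_⟧ᵍ (K₁ (proj₁ M)) t ρ))))) (∼-⋆ p)

    Relation : ℕ → Set (lsuc ℓ)
    Relation n = ∀ M → (Fin n → G.Carrier M) → Set ℓ

    Expressible : ∀ n → Relation n → Set (lsuc ℓ)
    Expressible n S = ∃ λ (φ : Formula CStarLanguage (Γ n)) → ∀ M ρ e → Related M ρ e → Truth (S M ρ) (value φ M e)

    expressible-⇔ : ∀ {n} {S T : Relation n} → (∀ M ρ → S M ρ → T M ρ) → (∀ M ρ → T M ρ → S M ρ) →
                    Expressible n S → Expressible n T
    expressible-⇔ f g (φ , h) = φ , λ M ρ e r → truth-⇔ (f M ρ) (g M ρ) (h M ρ e r)

    expressible-⊥ : ∀ {n} → Expressible n (λ M ρ → Lift ℓ ⊥)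
    expressible-⊥ = const′ ℝ.1# , λ M ρ e _ → (λ ()) , λ _ → ℝ.refl

    truth-⇒ : ∀ {P Q : Set ℓ} {r s} → Truth P r → Truth Q s → Truth (P → Q) (clamp (s ℝ.+ (ℝ.- ℝ.1#) ℝ.* r))
    truth-⇒ {P} {Q} {r} {s} p q = (λ f → clamp-0 (holds f)) , λ ¬f → clamp-1 (fails ¬f)
      where
      difference : ∀ {a b} → r ℝ.≈ a → s ℝ.≤ b → s ℝ.+ (ℝ.- ℝ.1#) ℝ.* r ℝ.≤ b ℝ.+ (ℝ.- ℝ.1#) ℝ.* a
      difference h l = ℝ.+-mono-≤ l (ℝ.≤-reflexive (ℝ.*-congˡ h))
      holds : (P → Q) → s ℝ.+ (ℝ.- ℝ.1#) ℝ.* r ℝ.≤ ℝ.0#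
      holds f with em {P = P}
      ... | yes x = ℝ.≤-trans (difference (proj₁ p x) (ℝ.≤-reflexive (proj₁ q (f x))))
                      (ℝ.≤-reflexive (solveᴿ [] ([] , :0 :+ (:- :1) :* :0 ⊜ :0) []))
      ... | no ¬x = ℝ.≤-trans (difference (proj₂ p ¬x) (proj₂ (truth-bounds q)))
                      (ℝ.≤-reflexive (solveᴿ [] ([] , :1 :+ (:- :1) :* :1 ⊜ :0) []))
      fails : ¬ (P → Q) → ℝ.1# ℝ.≤ s ℝ.+ (ℝ.- ℝ.1#) ℝ.* r
      fails ¬f with em {P = P} | em {P = Q}
      ... | _     | yes y = contradiction (λ _ → y) ¬f
      ... | no ¬x | _     = contradiction (λ x → contradiction x ¬x) ¬f
      ... | yes x | no ¬y = ℝ.≤-reflexive (ℝ.sym (ℝ.trans (ℝ.+-cong (proj₂ q ¬y) (ℝ.*-congˡ (proj₁ p x)))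
                              (solveᴿ [] ([] , :1 :+ (:- :1) :* :0 ⊜ :1) [])))

    expressible-⇒ : ∀ {n} {S T : Relation n} → Expressible n S → Expressible n T → Expressible n (λ M ρ → S M ρ → T M ρ)
    expressible-⇒ (φ , h) (ψ , k) = clamp′ (ψ ⊕′ (ℝ.- ℝ.1#) ⊙′ φ) , λ M ρ e r → truth-⇒ (h M ρ e r) (k M ρ e r)

    expressible-¬ : ∀ {n} {S : Relation n} → Expressible n S → Expressible n (λ M ρ → S M ρ → Lift ℓ ⊥)
    expressible-¬ x = expressible-⇒ x expressible-⊥

    -- Every class has a representing unitary and every unitary represents a class, so the
    -- quantifier over the group becomes one over the definable set of unitaries.
    expressible-∃ : ∀ {n} {S : Relation (ℕ.suc n)} → Expressible (ℕ.suc n) S →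
                    Expressible n (λ M ρ → ∃ λ x → S M (x Vector.∷ ρ))
    expressible-∃ {n} {S} (φ , h) = via (exists-formula unitaries φ Holds)
      where
      -- `exists-formula` needs a property of the environment alone, so the represented classes are
      -- quantified away. Any two choices agree, because the value of φ at `e` decides S for both.
      Holds : ∀ M → Model.Env M (Γ (ℕ.suc n)) → Set ℓ
      Holds M e = ∃ λ ρ → Related M ρ e × S M ρ
      extend-related : ∀ M {ρ : Fin n → G.Carrier M} {e} x a → U.In M a → Alg._∼_ M (k M x) (proj₁ a) → Related M ρ e →
                       Related M (x Vector.∷ ρ) (a ∷ e)
      extend-related M x a u p r zero    = u , p
      extend-related M x a u p r (suc i) = r i
      represented : ∀ M a → U.In M a → ∃ λ x → Alg._∼_ M (k M x) (proj₁ a)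
      represented M a u = (1 , K.scalarMatrix M (proj₁ a) u) , K.κ-scalar M (proj₁ a) u
      truth-holds : ∀ M ρ e → Related M ρ e → Truth (Holds M e) (value φ M e)
      truth-holds M ρ e r = truth-⇔ (λ s → ρ , r , s)
        (λ (ρ′ , r′ , s) → truth-reflects (h M ρ e r) (proj₁ (h M ρ′ e r′) s)) (h M ρ e r)
      via : (∃ λ φ′ → ∀ M y → (∀ a → U.In M a → Truth (Holds M (a ∷ y)) (value φ M (a ∷ y))) →
             Truth (∃ λ a → U.In M a × Holds M (a ∷ y)) (value φ′ M y)) → Expressible n (λ M ρ → ∃ λ x → S M (x Vector.∷ ρ))
      via (φ′ , t) = φ′ , λ M ρ e r → truth-⇔ (to-group M ρ e r) (from-group M ρ e r)
            (t M e λ a u → truth-holds M (proj₁ (represented M a u) Vector.∷ ρ) (a ∷ e)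
              (extend-related M (proj₁ (represented M a u)) a u (proj₂ (represented M a u)) r))
        where
        to-group : ∀ M ρ e → Related M ρ e → (∃ λ a → U.In M a × Holds M (a ∷ e)) → ∃ λ x → S M (x Vector.∷ ρ)
        to-group M ρ e r (a , u , s) = x , truth-reflects (h M (x Vector.∷ ρ) (a ∷ e) r′)
            (proj₁ (truth-holds M (x Vector.∷ ρ) (a ∷ e) r′) s)
          where
          x : G.Carrier M
          x = proj₁ (represented M a u)
          r′ : Related M (x Vector.∷ ρ) (a ∷ e)
          r′ = extend-related M x a u (proj₂ (represented M a u)) r
        from-group : ∀ M ρ e → Related M ρ e → (∃ λ x → S M (x Vector.∷ ρ)) → ∃ λ a → U.In M a × Holds M (a ∷ e)
        from-group M ρ e r (x , s) = a , u , (x Vector.∷ ρ) , extend-related M x a u (Alg.∼-refl M u) r , s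
          where
          u : Alg.IsUnitaryElement M (k M x)
          u = K.κ-unitary M (proj₂ x)
          a : Ball (proj₁ M) 1
          a = Alg.unit M (k M x) (Alg.unitary-norm M u)

  private
    SatisfiedBy : ∀ {n} → GroupFormula n → Relation n
    SatisfiedBy φ M ρ = Satisfies (K₁ (proj₁ M)) φ ρ

    ¬¬-elim : ∀ {P : Set ℓ} → ((P → Lift ℓ ⊥) → Lift ℓ ⊥) → P
    ¬¬-elim {P} f with em {P = P}
    ... | yes p = p
    ... | no ¬p = ⊥-elim (lower (f λ p → contradiction p ¬p))

    absurd : ∀ {p} {P : Set p} → Lift ℓ ⊥ → P
    absurd ()

  -- By excluded middle the remaining connectives and ∀ reduce to ⊥, ⇒ and ∃, where the values 0 and
  -- 1 are easy to compute.
  expressible : ∀ {n} (φ : GroupFormula n) → Expressible n (SatisfiedBy φ)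
  expressible (s ≐ t) = proj₁ f , λ M ρ e r → truth-⇔
      (λ p → lift (K.κ-reflects M (⟦_⟧ᵍ (K₁ (proj₁ M)) s ρ) (⟦_⟧ᵍ (K₁ (proj₁ M)) t ρ) (Alg.∼-trans M (proj₂ (term-represents M s r)) (Alg.∼-trans M p
        (Alg.∼-sym M (proj₂ (term-represents M t r)))))))
      (λ (lift p) → Alg.∼-trans M (Alg.∼-sym M (proj₂ (term-represents M s r))) (Alg.∼-trans M
        (K.κ-preserves M (⟦_⟧ᵍ (K₁ (proj₁ M)) s ρ) (⟦_⟧ᵍ (K₁ (proj₁ M)) t ρ) p) (proj₂ (term-represents M t r))))
      (proj₂ f M e (proj₁ (term-represents M s {ρ} {e} r)) (proj₁ (term-represents M t {ρ} {e} r)))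
    where
    f : ∃ (IsEquivalenceFormula (term s) (term t))
    f = ∼-formula (term s) (term t)
  expressible ⊥′      = expressible-⊥
  expressible (φ ∧ ψ) = expressible-⇔ {T = SatisfiedBy (φ ∧ ψ)}
    (λ M ρ f → ¬¬-elim (λ g → f λ p q → g (p , q))) (λ M ρ (p , q) f → f p q)
    (expressible-¬ (expressible-⇒ (expressible φ) (expressible-¬ (expressible ψ))))
  expressible (φ ∨ ψ) = expressible-⇔ {T = SatisfiedBy (φ ∨ ψ)}
    (λ M ρ f → ¬¬-elim (λ g → g (inj₂ (f λ p → g (inj₁ p))))) (λ { M ρ (inj₁ p) f → absurd (f p) ; M ρ (inj₂ q) f → q })
    (expressible-⇒ (expressible-¬ (expressible φ)) (expressible ψ))
  expressible (φ ⇒ ψ) = expressible-⇒ (expressible φ) (expressible ψ)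
  expressible (∀′ φ)  = expressible-⇔ {T = SatisfiedBy (∀′ φ)}
    (λ M ρ f x → ¬¬-elim (λ g → f (x , g))) (λ M ρ f (x , g) → g (f x))
    (expressible-¬ (expressible-∃ (expressible-¬ (expressible φ))))
  expressible (∃′ φ)  = expressible-∃ (expressible φ)

-- Elementarity of the induced map on K₁.

module ElementarySubgroup (em : ∀ {ℓ} → ExcludedMiddle ℓ) (R : CompleteOrderedField)
                          {ℓ} (A B : Setting.CStarAlgebra em R ℓ) (ι : Setting.Embedding em R A B)
                          (elementary : Setting.IsElementary em R ι) (𝓕 : Frames.Frame em R A) where
  open Setting em R
  open Formulas em R
  open GroupFormulas em R ℓ
  open Embedding ι

  private
    module A = CStarAlgebra A
    module B = CStarAlgebra B
    module F = Frames.Frame 𝓕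
    module ∑ᴬ = SemiringSum A.semiring
    module ∑ᴮ = SemiringSum B.semiring

    -- Giving B the image of the frame of A makes `κ` commute with the embedding, so representing
    -- unitaries in A are sent to representing unitaries in B.
    image : Frames.Frame em R B
    image = record
      { s = ⟦ F.s ⟧ ; t = ⟦ F.t ⟧
      ; s⋆s = relation F.s⋆s 1#-homo ; t⋆t = relation F.t⋆t 1#-homo ; s⋆t = relation F.s⋆t 0#-homo }
      where
      relation : ∀ {a b c d} → (a A.⋆ A.* b) A.≈ c → ⟦ c ⟧ B.≈ d → (⟦ a ⟧ B.⋆ B.* ⟦ b ⟧) B.≈ d
      relation p q = B.trans (B.*-congʳ (B.sym (⋆-homo _))) (B.trans (B.sym (*-homo _ _)) (B.trans (⟦⟧-cong p) q))

    module KA = KOne em R A 𝓕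
    module KB = KOne em R B image

    sum-homo : ∀ {n} (f : Vector A.Carrier n) (g : Vector B.Carrier n) → (∀ i → ⟦ f i ⟧ B.≈ g i) →
               ⟦ ∑ᴬ.sum f ⟧ B.≈ ∑ᴮ.sum g
    sum-homo {ℕ.zero}  f g h = 0#-homo
    sum-homo {ℕ.suc n} f g h = B.trans (+-homo _ _) (B.+-cong (h zero) (sum-homo (f ∘ suc) (g ∘ suc) (h ∘ suc)))

    e-homo : ∀ {n} (i : Fin n) → ⟦ KA.e i ⟧ B.≈ KB.e i
    e-homo zero    = B.refl
    e-homo (suc i) = B.trans (*-homo _ _) (B.*-congˡ (e-homo i))

    e⋆-homo : ∀ {n} (i : Fin n) → ⟦ KA.e i A.⋆ ⟧ B.≈ KB.e i B.⋆
    e⋆-homo i = B.trans (⋆-homo _) (B.⋆-cong (e-homo i))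

    range-homo : ∀ n → ⟦ ∑ᴬ.sum (λ (i : Fin n) → KA.e i A.* KA.e i A.⋆) ⟧ B.≈ ∑ᴮ.sum (λ (i : Fin n) → KB.e i B.* KB.e i B.⋆)
    range-homo n = sum-homo (λ (i : Fin n) → KA.e i A.* KA.e i A.⋆) (λ i → KB.e i B.* KB.e i B.⋆) λ i →
      B.trans (*-homo _ _) (B.*-cong (e-homo i) (e⋆-homo i))

    κ-homo : ∀ {n} (x : Fin n → Fin n → A.Carrier) → ⟦ KA.κ x ⟧ B.≈ KB.κ (λ i j → ⟦ x i j ⟧)
    κ-homo {n} x = B.trans (⟦⟧-cong (KA.κ-sum x)) (B.trans (B.trans (+-homo _ _) (B.+-cong
        (B.trans (+-homo _ _) (B.+-cong 1#-homo (B.trans (-‿homo _) (B.-‿cong (range-homo n)))))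
        (sum-homo (λ i → KA.e i A.* rowA i) (λ i → KB.e i B.* rowB i) λ i →
          B.trans (*-homo _ _) (B.*-cong (e-homo i) (row-homo i)))))
      (B.sym (KB.κ-sum λ i j → ⟦ x i j ⟧)))
      where
      rowA : Fin n → A.Carrier
      rowA i = ∑ᴬ.sum λ j → x i j A.* KA.e j A.⋆
      rowB : Fin n → B.Carrier
      rowB i = ∑ᴮ.sum λ j → ⟦ x i j ⟧ B.* KB.e j B.⋆
      row-homo : ∀ i → ⟦ rowA i ⟧ B.≈ rowB i
      row-homo i = sum-homo (λ j → x i j A.* KA.e j A.⋆) (λ j → ⟦ x i j ⟧ B.* KB.e j B.⋆) λ j →
        B.trans (*-homo _ _) (B.*-congˡ (e⋆-homo j))

    𝓐 𝓑 : Framed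
    𝓐 = A , 𝓕
    𝓑 = B , image

    module UA = UnitBall em R A
    module PA = Paths em R A
    module PB = Paths em R B
    module SA = Stable em R A 𝓕
    module SB = Stable em R B image

    point : RawGroup.Carrier (K₁ A) → Ball A 1
    point (_ , u) = UA.unit (KA.κ (proj₁ u)) (PA.unitary-norm (KA.κ-unitary u))

    env : ∀ {n} → (Fin n → RawGroup.Carrier (K₁ A)) → All (Ball A) (Γ n)
    env {ℕ.zero}  ρ = []
    env {ℕ.suc n} ρ = point (ρ zero) ∷ env (ρ ∘ suc)

    env-related : ∀ {n} (ρ : Fin n → RawGroup.Carrier (K₁ A)) → Related 𝓐 ρ (env ρ)
    env-related ρ zero    = KA.κ-unitary (proj₂ (ρ zero)) , SA.∼-refl (KA.κ-unitary (proj₂ (ρ zero)))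
    env-related ρ (suc i) = env-related (ρ ∘ suc) i

    image-related : ∀ {n} (ρ : Fin n → RawGroup.Carrier (K₁ A)) →
                    Related 𝓑 (K₁-map ι ∘ ρ) (All.map (λ {m} → Ball-map ι {m}) (env ρ))
    image-related ρ zero    = PB.unitary-cong (B.sym (κ-homo _)) unitary , SB.∼-reflexive unitary (B.sym (κ-homo _))
      where
      unitary = KB.κ-unitary (proj₂ (K₁-map ι (ρ zero)))
    image-related ρ (suc i) = image-related (ρ ∘ suc) i

  abstract
    K₁-elementary : IsElementaryGroupEmbedding (K₁ A) (K₁ B) (K₁-map ι)
    K₁-elementary {n} φ ρ = mk⇔
      (λ s → truth-reflects truthB (ℝ.trans (ℝ.sym same) (proj₁ truthA s)))
      (λ s → truth-reflects truthA (ℝ.trans same (proj₁ truthB s)))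
      where
      image-env : All (Ball B) (Γ n)
      image-env = All.map (λ {m} → Ball-map ι {m}) (env ρ)
      truthA : Truth (Satisfies (K₁ A) φ ρ) (eval (cstarStructure A) (proj₁ (expressible φ)) (env ρ))
      truthA = proj₂ (expressible φ) 𝓐 ρ (env ρ) (env-related ρ)
      truthB : Truth (Satisfies (K₁ B) φ (K₁-map ι ∘ ρ)) (eval (cstarStructure B) (proj₁ (expressible φ)) image-env)
      truthB = proj₂ (expressible φ) 𝓑 (K₁-map ι ∘ ρ) image-env (image-related ρ)
      same : eval (cstarStructure A) (proj₁ (expressible φ)) (env ρ) ℝ.≈
             eval (cstarStructure B) (proj₁ (expressible φ)) image-env
      same = elementary (proj₁ (expressible φ)) (env ρ)

proposition3p12p2 : (em : ∀ {ℓ} → ExcludedMiddle ℓ) (R : CompleteOrderedField) →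
    let open Setting em R in
    ∀ {ℓ} (A : CStarAlgebra ℓ) → PurelyInfiniteSimple A →
    InEq A (K₁ A) ×
    (∀ (B : CStarAlgebra ℓ) (ι : Embedding A B) → IsElementary ι →
    IsElementaryGroupEmbedding (K₁ A) (K₁ B) (K₁-map ι))
proposition3p12p2 em R A pis =
  KOneImaginary.K₁-inEq em R A 𝓕 , λ B ι elementary → ElementarySubgroup.K₁-elementary em R A B ι elementary 𝓕
  where
  𝓕 : Frames.Frame em R A
  𝓕 = Frames.frame em R A pis
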